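{- Let $\Gamma$ be a Shilla distance-regular graph with $b(\Gamma)=2$. Then $\Gamma$ is one of the following graphs: (i) the Odd graph with valency $4$; (ii) a generalized hexagon of order $(2,2)$; (iii) the Hamming graph $H(3,3)$; (iv) the Doro graph with intersection array $\{10,6,4;1,2,5\}$; (v) the Johnson graph $J(9,3)$.
   Context: A connected graph $\Gamma$ of diameter $D$ is distance-regular if there are integers $b_i,c_i$ ($0\le i\le D$) such that for any two vertices $x,y$ at distance $i$, exactly $c_i$ neighbours of $y$ are at distance $i-1$ from $x$ and exactly $b_i$ neighbours of $y$ are at distance $i+1$ from $x$. Then $\Gamma$ is regular of valency $k=b_0$, and $a_i:=k-b_i-c_i$. The intersection array is $\{b_0,b_1,\dots,b_{D-1};c_1,\dots,c_D\}$. The eigenvalues of $\Gamma$ are those of its adjacency matrix; $\Gamma$ has exactly $D+1$ distinct eigenvalues $k=\theta_0>\theta_1>\dots>\theta_D$. A Shilla distance-regular graph is a distance-regular graph of diameter $3$ whose second largest eigenvalue satisfies $\theta_1=a_3$. For such graphs $k=(a_3-a_1)a_3$, and one defines $b(\Gamma):=a_3-a_1=k/a_3$. -}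

module Defs where

open import Algebra.Bundles using (CommutativeMonoid; CommutativeSemigroup)
open import Algebra.Properties.CommutativeSemigroup using (interchange)
open import Data.Bool using (if_then_else_)
open import Data.Empty using (⊥)
open import Data.Fin using (Fin; zero; suc; toℕ; #_)
open import Data.Fin.Properties as Fin using (any?)
open import Data.Fin.Subset using (Subset; _∈_; _∩_; ∣_∣)
open import Data.Fin.Subset.Properties using (∩-comm; ∩-idem)
open import Data.Integer as ℤ using (ℤ; +_)
open import Data.Nat as ℕ using (ℕ; zero; suc; _%_)
import Data.Nat.Properties as ℕ
open import Data.Product using (Σ; Σ-syntax; ∃-syntax; _×_; _,_)
open import Data.Rational as ℚ using (ℚ; 0ℚ; 1ℚ; ½; 1/_)
import Data.Rational.Properties as ℚ
open import Data.Sum using (_⊎_; inj₁; inj₂)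
open import Data.Vec using (Vec; []; _∷_; zip; count)
open import Data.Vec.Functional using (foldr)
open import Function.Base using (const)
open import Function.Bundles using (_↔_; _⇔_; module Inverse)
open import Function.Definitions using (Injective)
open import Level using (0ℓ)
open import Relation.Binary.PropositionalEquality
  using (_≡_; _≢_; refl; sym; trans; cong; cong₂; subst)
open import Relation.Nullary using (¬_; Dec; yes; no; does; contradiction)
open import Relation.Nullary.Decidable using (¬?; _×-dec_)

IsCauchy : (ℕ → ℚ) → Set
IsCauchy x = ∀ ε → 0ℚ ℚ.< ε →
  ∃[ N ] (∀ m n → N ℕ.≤ m → N ℕ.≤ n → ℚ.∣ x m ℚ.- x n ∣ ℚ.< ε)

record ℝ : Set where
  constructor mkℝ
  field
    seq    : ℕ → ℚ
    cauchy : IsCauchy seq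

open ℝ public

infix 4 _≃_ _<_ _≤_
infixl 6 _+_
infixl 7 _*_

_≃_ : ℝ → ℝ → Set
x ≃ y = ∀ ε → 0ℚ ℚ.< ε →
  ∃[ N ] (∀ n → N ℕ.≤ n → ℚ.∣ seq x n ℚ.- seq y n ∣ ℚ.< ε)

_<_ : ℝ → ℝ → Set
x < y = ∃[ ε ] 0ℚ ℚ.< ε ×
  ∃[ N ] (∀ n → N ℕ.≤ n → seq x n ℚ.+ ε ℚ.< seq y n)

_≤_ : ℝ → ℝ → Set
x ≤ y = ¬ (y < x)

fromℚ : ℚ → ℝ
fromℚ q = mkℝ (const q) λ ε ε>0 → 0 , λ _ _ _ _ →
  subst (ℚ._< ε) (sym (cong ℚ.∣_∣ (ℚ.+-inverseʳ q))) ε>0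

fromℤ : ℤ → ℝ
fromℤ z = fromℚ (z ℚ./ 1)

0ℝ 1ℝ : ℝ
0ℝ = fromℚ 0ℚ
1ℝ = fromℚ 1ℚ

private abstract
  +-commutativeSemigroup : CommutativeSemigroup 0ℓ 0ℓ
  +-commutativeSemigroup = CommutativeMonoid.commutativeSemigroup ℚ.+-0-commutativeMonoid

  ½ε>0 : ∀ {ε} → 0ℚ ℚ.< ε → 0ℚ ℚ.< ½ ℚ.* ε
  ½ε>0 {ε} ε>0 = subst (ℚ._< ½ ℚ.* ε) (ℚ.*-zeroʳ ½) (ℚ.*-monoʳ-<-pos ½ ε>0)

  halves : ∀ ε → ½ ℚ.* ε ℚ.+ ½ ℚ.* ε ≡ ε
  halves ε = trans (sym (ℚ.*-distribʳ-+ ε ½ ½)) (ℚ.*-identityˡ ε)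

  cancel : ∀ a b → a ≡ (a ℚ.- b) ℚ.+ b
  cancel a b = sym (trans (ℚ.+-assoc a (ℚ.- b) b)
    (trans (cong (a ℚ.+_) (ℚ.+-inverseˡ b)) (ℚ.+-identityʳ a)))

  *-distribˡ-− : ∀ a b c → a ℚ.* (b ℚ.- c) ≡ a ℚ.* b ℚ.- a ℚ.* c
  *-distribˡ-− a b c = trans (ℚ.*-distribˡ-+ a b (ℚ.- c))
    (cong (a ℚ.* b ℚ.+_) (sym (ℚ.neg-distribʳ-* a c)))

  +-cauchy : ∀ {x y} → IsCauchy x → IsCauchy y → IsCauchy (λ n → x n ℚ.+ y n)
  +-cauchy {x} {y} cx cy ε ε>0
    with cx (½ ℚ.* ε) (½ε>0 ε>0) | cy (½ ℚ.* ε) (½ε>0 ε>0)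
  ... | M , p | N , q = M ℕ.⊔ N , λ m n hm hn → begin-strict
    ℚ.∣ (x m ℚ.+ y m) ℚ.- (x n ℚ.+ y n) ∣
      ≡⟨ cong ℚ.∣_∣ (rearrange (x m) (y m) (x n) (y n)) ⟩
    ℚ.∣ (x m ℚ.- x n) ℚ.+ (y m ℚ.- y n) ∣
      ≤⟨ ℚ.∣p+q∣≤∣p∣+∣q∣ (x m ℚ.- x n) (y m ℚ.- y n) ⟩
    ℚ.∣ x m ℚ.- x n ∣ ℚ.+ ℚ.∣ y m ℚ.- y n ∣
      <⟨ ℚ.+-mono-< (p m n (ℕ.m⊔n≤o⇒m≤o M N hm) (ℕ.m⊔n≤o⇒m≤o M N hn))
                    (q m n (ℕ.m⊔n≤o⇒n≤o M N hm) (ℕ.m⊔n≤o⇒n≤o M N hn)) ⟩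
    ½ ℚ.* ε ℚ.+ ½ ℚ.* ε
      ≡⟨ halves ε ⟩
    ε ∎
    where
    open ℚ.≤-Reasoning
    rearrange : ∀ a b c d → (a ℚ.+ b) ℚ.- (c ℚ.+ d) ≡ (a ℚ.- c) ℚ.+ (b ℚ.- d)
    rearrange a b c d = trans (cong (a ℚ.+ b ℚ.+_) (ℚ.neg-distrib-+ c d))
                              (interchange +-commutativeSemigroup a b (ℚ.- c) (ℚ.- d))

  EventuallyBounded : (ℕ → ℚ) → Set
  EventuallyBounded x = ∃[ B ] 0ℚ ℚ.< B × ∃[ N ] (∀ n → N ℕ.≤ n → ℚ.∣ x n ∣ ℚ.≤ B)

  cauchy⇒bounded : ∀ {x} → IsCauchy x → EventuallyBounded x
  cauchy⇒bounded {x} cx with cx 1ℚ (ℚ.positive⁻¹ 1ℚ)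
  ... | N , p = 1ℚ ℚ.+ ℚ.∣ x N ∣
    , ℚ.+-mono-<-≤ (ℚ.positive⁻¹ 1ℚ) (ℚ.0≤∣p∣ (x N))
    , N , λ n hn → begin
    ℚ.∣ x n ∣                          ≡⟨ cong ℚ.∣_∣ (cancel (x n) (x N)) ⟩
    ℚ.∣ (x n ℚ.- x N) ℚ.+ x N ∣        ≤⟨ ℚ.∣p+q∣≤∣p∣+∣q∣ (x n ℚ.- x N) (x N) ⟩
    ℚ.∣ x n ℚ.- x N ∣ ℚ.+ ℚ.∣ x N ∣    ≤⟨ ℚ.+-monoˡ-≤ ℚ.∣ x N ∣ (ℚ.<⇒≤ (p n N hn ℕ.≤-refl)) ⟩
    1ℚ ℚ.+ ℚ.∣ x N ∣                   ∎
    where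
    open ℚ.≤-Reasoning
  scaled : ∀ {B ε} → 0ℚ ℚ.< B → 0ℚ ℚ.< ε → ∃[ δ ] 0ℚ ℚ.< δ × B ℚ.* δ ≡ ε
  scaled {B} {ε} B>0 ε>0 = 1/ B ℚ.* ε
    , subst (ℚ._< 1/ B ℚ.* ε) (ℚ.*-zeroʳ (1/ B))
        (ℚ.*-monoʳ-<-pos (1/ B) {{ℚ.1/pos⇒pos B}} ε>0)
    , trans (sym (ℚ.*-assoc B (1/ B) ε))
        (trans (cong (ℚ._* ε) (ℚ.*-inverseʳ B)) (ℚ.*-identityˡ ε))
    where instance
      B-pos : ℚ.Positive B
      B-pos = ℚ.positive B>0
      B-nonZero : ℚ.NonZero B
      B-nonZero = ℚ.pos⇒nonZero B

  product-< : ∀ {B δ} p q → 0ℚ ℚ.< B → ℚ.∣ p ∣ ℚ.≤ B → ℚ.∣ q ∣ ℚ.< δ →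
              ℚ.∣ p ℚ.* q ∣ ℚ.< B ℚ.* δ
  product-< {B} {δ} p q B>0 p≤B q<δ = begin-strict
    ℚ.∣ p ℚ.* q ∣        ≡⟨ ℚ.∣p*q∣≡∣p∣*∣q∣ p q ⟩
    ℚ.∣ p ∣ ℚ.* ℚ.∣ q ∣  ≤⟨ ℚ.*-monoʳ-≤-nonNeg ℚ.∣ q ∣ {{ℚ.∣-∣-nonNeg q}} p≤B ⟩
    B ℚ.* ℚ.∣ q ∣        <⟨ ℚ.*-monoʳ-<-pos B {{ℚ.positive B>0}} q<δ ⟩
    B ℚ.* δ              ∎
    where open ℚ.≤-Reasoning

  *-cauchy : ∀ {x y} → IsCauchy x → IsCauchy y → IsCauchy (λ n → x n ℚ.* y n)
  *-cauchy {x} {y} cx cy ε ε>0 =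
    let A , A>0 , K , bx = cauchy⇒bounded {x} cx
        B , B>0 , L , by = cauchy⇒bounded {y} cy
        α , α>0 , Aα = scaled A>0 (½ε>0 ε>0)
        β , β>0 , Bβ = scaled B>0 (½ε>0 ε>0)
        M , p = cx β β>0
        N , q = cy α α>0
    in (K ℕ.⊔ L) ℕ.⊔ (M ℕ.⊔ N) , λ m n hm hn →
    let hm₁ = ℕ.m⊔n≤o⇒m≤o (K ℕ.⊔ L) (M ℕ.⊔ N) hm
        hm₂ = ℕ.m⊔n≤o⇒n≤o (K ℕ.⊔ L) (M ℕ.⊔ N) hm
        hn₁ = ℕ.m⊔n≤o⇒m≤o (K ℕ.⊔ L) (M ℕ.⊔ N) hn
        hn₂ = ℕ.m⊔n≤o⇒n≤o (K ℕ.⊔ L) (M ℕ.⊔ N) hn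
    in begin-strict
    ℚ.∣ x m ℚ.* y m ℚ.- x n ℚ.* y n ∣
      ≡⟨ cong ℚ.∣_∣ (rearrange (x m) (y m) (x n) (y n)) ⟩
    ℚ.∣ x m ℚ.* (y m ℚ.- y n) ℚ.+ y n ℚ.* (x m ℚ.- x n) ∣
      ≤⟨ ℚ.∣p+q∣≤∣p∣+∣q∣ (x m ℚ.* (y m ℚ.- y n)) (y n ℚ.* (x m ℚ.- x n)) ⟩
    ℚ.∣ x m ℚ.* (y m ℚ.- y n) ∣ ℚ.+ ℚ.∣ y n ℚ.* (x m ℚ.- x n) ∣
      <⟨ ℚ.+-mono-<
           (product-< (x m) (y m ℚ.- y n) A>0 (bx m (ℕ.m⊔n≤o⇒m≤o K L hm₁))
             (q m n (ℕ.m⊔n≤o⇒n≤o M N hm₂) (ℕ.m⊔n≤o⇒n≤o M N hn₂)))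
           (product-< (y n) (x m ℚ.- x n) B>0 (by n (ℕ.m⊔n≤o⇒n≤o K L hn₁))
             (p m n (ℕ.m⊔n≤o⇒m≤o M N hm₂) (ℕ.m⊔n≤o⇒m≤o M N hn₂))) ⟩
    A ℚ.* α ℚ.+ B ℚ.* β
      ≡⟨ cong₂ ℚ._+_ Aα Bβ ⟩
    ½ ℚ.* ε ℚ.+ ½ ℚ.* ε
      ≡⟨ halves ε ⟩
    ε ∎
    where
    open ℚ.≤-Reasoning
    rearrange : ∀ a b c d →
      a ℚ.* b ℚ.- c ℚ.* d ≡ a ℚ.* (b ℚ.- d) ℚ.+ d ℚ.* (a ℚ.- c)
    rearrange a b c d = sym (begin-equality
      a ℚ.* (b ℚ.- d) ℚ.+ d ℚ.* (a ℚ.- c)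
        ≡⟨ cong₂ ℚ._+_ (*-distribˡ-− a b d) (*-distribˡ-− d a c) ⟩
      (a ℚ.* b ℚ.- a ℚ.* d) ℚ.+ (d ℚ.* a ℚ.- d ℚ.* c)
        ≡⟨ cong₂ (λ p q → (a ℚ.* b ℚ.- a ℚ.* d) ℚ.+ (p ℚ.- q)) (ℚ.*-comm d a) (ℚ.*-comm d c) ⟩
      (a ℚ.* b ℚ.- a ℚ.* d) ℚ.+ (a ℚ.* d ℚ.- c ℚ.* d)
        ≡⟨ ℚ.+-assoc (a ℚ.* b ℚ.- a ℚ.* d) (a ℚ.* d) (ℚ.- (c ℚ.* d)) ⟨
      (a ℚ.* b ℚ.- a ℚ.* d) ℚ.+ a ℚ.* d ℚ.- c ℚ.* d
        ≡⟨ cong (ℚ._- c ℚ.* d) (cancel (a ℚ.* b) (a ℚ.* d)) ⟨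
      a ℚ.* b ℚ.- c ℚ.* d ∎)

_+_ : ℝ → ℝ → ℝ
x + y = mkℝ (λ n → seq x n ℚ.+ seq y n) (+-cauchy {seq x} {seq y} (cauchy x) (cauchy y))

_*_ : ℝ → ℝ → ℝ
x * y = mkℝ (λ n → seq x n ℚ.* seq y n) (*-cauchy {seq x} {seq y} (cauchy x) (cauchy y))

∑ : ∀ {n} → (Fin n → ℝ) → ℝ
∑ = foldr _+_ 0ℝ

Matrix : ℕ → Set
Matrix n = Fin n → Fin n → ℝ

IsEigenvalue : ∀ {n} → Matrix n → ℝ → Set
IsEigenvalue {n} A θ = Σ[ v ∈ (Fin n → ℝ) ]
  (∃[ i ] (v i < 0ℝ ⊎ 0ℝ < v i)) ×
  (∀ i → ∑ (λ j → A i j * v j) ≃ θ * v i)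

IsLargestEigenvalue : ∀ {n} → Matrix n → ℝ → Set
IsLargestEigenvalue A θ = IsEigenvalue A θ × (∀ μ → IsEigenvalue A μ → μ ≤ θ)

-- Second largest among the distinct eigenvalues: multiplicities are ignored.
IsSecondLargestEigenvalue : ∀ {n} → Matrix n → ℝ → Set
IsSecondLargestEigenvalue A θ₁ = ∃[ θ₀ ]
  IsLargestEigenvalue A θ₀ ×
  θ₁ < θ₀ ×
  IsEigenvalue A θ₁ ×
  (∀ μ → IsEigenvalue A μ → μ < θ₀ → μ ≤ θ₁)

record Graph (V : Set) : Set₁ where
  infix 4 _∼_ _∼?_
  field
    _∼_      : V → V → Set
    _∼?_     : ∀ x y → Dec (x ∼ y)
    ∼-sym    : ∀ {x y} → x ∼ y → y ∼ x
    ∼-irrefl : ∀ {x} → ¬ (x ∼ x)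

record _≅_ {V W : Set} (Γ : Graph V) (Δ : Graph W) : Set where
  private
    module Γ = Graph Γ
    module Δ = Graph Δ
  field
    vertices  : V ↔ W
    adjacency : ∀ x y → x Γ.∼ y ⇔ Inverse.to vertices x Δ.∼ Inverse.to vertices y

HasSize : ∀ {n} → (Fin n → Set) → ℕ → Set
HasSize {n} P c = Σ[ S ∈ Subset n ] ∣ S ∣ ≡ c × (∀ x → x ∈ S ⇔ P x)

module _ {V : Set} (Γ : Graph V) where
  open Graph Γ

  data Walk : V → V → ℕ → Set where
    []  : ∀ {x} → Walk x x 0
    _∷_ : ∀ {x y z n} → x ∼ y → Walk y z n → Walk x z (suc n)

  Distance : V → V → ℕ → Set
  Distance x y d = Walk x y d × (∀ e → e ℕ.< d → ¬ Walk x y e)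

  -- Every distance exists (is finite), so this includes connectedness.
  HasDiameter : ℕ → Set
  HasDiameter D =
    (∀ x y → ∃[ d ] d ℕ.≤ D × Distance x y d) ×
    (∃[ x ] ∃[ y ] Distance x y D)

  record Cycle (m : ℕ) : Set where
    field
      3≤m       : 3 ℕ.≤ m
      vertex    : Fin m → V
      injective : Injective _≡_ _≡_ vertex
      step      : ∀ i j → suc (toℕ i) ≡ toℕ j → vertex i ∼ vertex j
      close     : ∀ i j → suc (toℕ i) ≡ m → toℕ j ≡ 0 → vertex i ∼ vertex j

  HasGirth : ℕ → Set
  HasGirth g = Cycle g × (∀ m → m ℕ.< g → ¬ Cycle m)

adjacencyMatrix : ∀ {n} → Graph (Fin n) → Matrix n
adjacencyMatrix Γ x y = if does (x ∼? y) then 1ℝ else 0ℝ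
  where open Graph Γ

record DistanceRegular {n} (Γ : Graph (Fin n)) (D : ℕ) : Set where
  open Graph Γ
  field
    diameter : HasDiameter Γ D
    b c      : Fin (suc D) → ℕ
    -- At i = 0 and i = D the sets counted by c and b are empty, so the
    -- conventions c₀ = 0 and b_D = 0 are consequences.
    c-count  : ∀ x y i → Distance Γ x y (toℕ i) →
      HasSize (λ z → y ∼ z × ∃[ d ] suc d ≡ toℕ i × Distance Γ x z d) (c i)
    b-count  : ∀ x y i → Distance Γ x y (toℕ i) →
      HasSize (λ z → y ∼ z × Distance Γ x z (suc (toℕ i))) (b i)

  valency : ℕ
  valency = b zero

  a : Fin (suc D) → ℤ
  a i = + valency ℤ.- + b i ℤ.- + c i

record Shilla {n} (Γ : Graph (Fin n)) : Set where
  field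
    distanceRegular : DistanceRegular Γ 3

  open DistanceRegular distanceRegular public

  field
    θ₁≡a₃ : IsSecondLargestEigenvalue (adjacencyMatrix Γ) (fromℤ (a (# 3)))

  bΓ : ℤ
  bΓ = a (# 3) ℤ.- a (# 1)

record IncidenceStructure (p l : ℕ) : Set₁ where
  infix 4 _I_ _I?_
  field
    _I_  : Fin p → Fin l → Set
    _I?_ : ∀ x L → Dec (x I L)

module _ {p l} (S : IncidenceStructure p l) where
  open IncidenceStructure S

  private
    Inc : Fin p ⊎ Fin l → Fin p ⊎ Fin l → Set
    Inc (inj₁ x) (inj₂ L) = x I L
    Inc (inj₂ L) (inj₁ x) = x I L
    Inc (inj₁ _) (inj₁ _) = ⊥
    Inc (inj₂ _) (inj₂ _) = ⊥

    Inc? : ∀ u v → Dec (Inc u v)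
    Inc? (inj₁ x) (inj₂ L) = x I? L
    Inc? (inj₂ L) (inj₁ x) = x I? L
    Inc? (inj₁ _) (inj₁ _) = no λ ()
    Inc? (inj₂ _) (inj₂ _) = no λ ()

    Inc-sym : ∀ u v → Inc u v → Inc v u
    Inc-sym (inj₁ _) (inj₂ _) i = i
    Inc-sym (inj₂ _) (inj₁ _) i = i

    Inc-irrefl : ∀ u → ¬ Inc u u
    Inc-irrefl (inj₁ _) ()
    Inc-irrefl (inj₂ _) ()

  incidenceGraph : Graph (Fin p ⊎ Fin l)
  incidenceGraph = record
    { _∼_      = Inc
    ; _∼?_     = Inc?
    ; ∼-sym    = λ {u} {v} → Inc-sym u v
    ; ∼-irrefl = λ {u} → Inc-irrefl u
    }

  collinearityGraph : Graph (Fin p)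
  collinearityGraph = record
    { _∼_      = λ x y → x ≢ y × ∃[ L ] (x I L × y I L)
    ; _∼?_     = λ x y → ¬? (x Fin.≟ y) ×-dec any? (λ L → (x I? L) ×-dec (y I? L))
    ; ∼-sym    = λ { (x≢y , L , xL , yL) → (λ y≡x → x≢y (sym y≡x)) , L , yL , xL }
    ; ∼-irrefl = λ { (x≢x , _) → x≢x refl }
    }

  record GeneralizedHexagon (s t : ℕ) : Set where
    field
      diameter   : HasDiameter incidenceGraph 6
      girth      : HasGirth incidenceGraph 12
      line-size  : ∀ L → HasSize (λ x → x I L) (suc s)
      point-size : ∀ x → HasSize (λ L → x I L) (suc t)

-- Generalized hexagons are taken in Tits' sense (incidence graph of diameter 6
-- and girth 12); as a graph, one is identified with its collinearity graph.
IsGeneralizedHexagon : ∀ {n} → Graph (Fin n) → ℕ → ℕ → Set₁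
IsGeneralizedHexagon Γ s t = ∃[ p ] ∃[ l ] Σ[ S ∈ IncidenceStructure p l ]
  GeneralizedHexagon S s t × Γ ≅ collinearityGraph S

KSubset : ℕ → ℕ → Set
KSubset n k = Σ[ S ∈ Subset n ] ∣ S ∣ ≡ k

-- k-subsets of an n-set, adjacent when they meet in exactly i elements.
intersectionGraph : ∀ n k i → i ℕ.< k → Graph (KSubset n k)
intersectionGraph n k i i<k = record
  { _∼_      = λ (S , _) (T , _) → ∣ S ∩ T ∣ ≡ i
  ; _∼?_     = λ (S , _) (T , _) → ∣ S ∩ T ∣ ℕ.≟ i
  ; ∼-sym    = λ {(S , _)} {(T , _)} e → trans (cong ∣_∣ (∩-comm T S)) e
  ; ∼-irrefl = λ {(S , ∣S∣≡k)} e →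
      ℕ.<⇒≢ i<k (trans (sym e) (trans (cong ∣_∣ (∩-idem S)) ∣S∣≡k))
  }

johnsonGraph : ∀ n k .{{_ : ℕ.NonZero k}} → Graph (KSubset n k)
johnsonGraph n (suc k) = intersectionGraph n (suc k) k ℕ.≤-refl

-- The Odd graph of valency k.
oddGraph : ∀ k .{{_ : ℕ.NonZero (k ℕ.∸ 1)}} → Graph (KSubset (2 ℕ.* k ℕ.∸ 1) (k ℕ.∸ 1))
oddGraph k = intersectionGraph (2 ℕ.* k ℕ.∸ 1) (k ℕ.∸ 1) 0 (ℕ.>-nonZero⁻¹ (k ℕ.∸ 1))

hammingDistance : ∀ {d q} → Vec (Fin q) d → Vec (Fin q) d → ℕ
hammingDistance x y = count (λ (s , t) → ¬? (s Fin.≟ t)) (zip x y)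

private
  hammingDistance-sym : ∀ {d q} (x y : Vec (Fin q) d) →
    hammingDistance x y ≡ hammingDistance y x
  hammingDistance-sym []      []      = refl
  hammingDistance-sym (s ∷ x) (t ∷ y) with s Fin.≟ t | t Fin.≟ s
  ... | yes _   | yes _   = hammingDistance-sym x y
  ... | no  _   | no  _   = cong suc (hammingDistance-sym x y)
  ... | yes s≡t | no  t≢s = contradiction (sym s≡t) t≢s
  ... | no  s≢t | yes t≡s = contradiction (sym t≡s) s≢t

  hammingDistance-self : ∀ {d q} (x : Vec (Fin q) d) → hammingDistance x x ≡ 0
  hammingDistance-self []      = refl
  hammingDistance-self (s ∷ x) with s Fin.≟ s
  ... | yes _   = hammingDistance-self x
  ... | no  s≢s = contradiction refl s≢s

hammingGraph : ∀ d q → Graph (Vec (Fin q) d)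
hammingGraph d q = record
  { _∼_      = λ x y → hammingDistance x y ≡ 1
  ; _∼?_     = λ x y → hammingDistance x y ℕ.≟ 1
  ; ∼-sym    = λ {x} {y} e → trans (hammingDistance-sym y x) e
  ; ∼-irrefl = λ {x} e → ℕ.0≢1+n (trans (sym (hammingDistance-self x)) e)
  }

-- The Doro graph with intersection array {10,6,4;1,2,5}, in its realization
-- by PΩ₄⁻(5) ≅ PSL₂(25): its 65 vertices are the points x of PG(3,5) for which
-- B(x,x) is a nonzero square, adjacent when orthogonal. The quadric is
-- elliptic since the discriminant 2 of B is a non-square in F₅.

B : Vec (Fin 5) 4 → Vec (Fin 5) 4 → ℕ
B (x₁ ∷ x₂ ∷ x₃ ∷ x₄ ∷ []) (y₁ ∷ y₂ ∷ y₃ ∷ y₄ ∷ []) =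
  (toℕ x₁ ℕ.* toℕ y₁ ℕ.+ toℕ x₂ ℕ.* toℕ y₂ ℕ.+
   toℕ x₃ ℕ.* toℕ y₃ ℕ.+ 2 ℕ.* (toℕ x₄ ℕ.* toℕ y₄)) % 5

leading : ∀ {n} → Vec (Fin 5) n → ℕ
leading []          = 0
leading (zero  ∷ x) = leading x
leading (suc i ∷ x) = suc (toℕ i)

-- Projective points are represented by vectors with leading coordinate 1;
-- the nonzero squares q of F₅ are those with q² = 1.
DoroVertex : Set
DoroVertex = Σ[ x ∈ Vec (Fin 5) 4 ] leading x ≡ 1 × (B x x ℕ.* B x x) % 5 ≡ 1

private
  B-sym : ∀ x y → B x y ≡ B y x
  B-sym (x₁ ∷ x₂ ∷ x₃ ∷ x₄ ∷ []) (y₁ ∷ y₂ ∷ y₃ ∷ y₄ ∷ [])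
    rewrite ℕ.*-comm (toℕ x₁) (toℕ y₁) | ℕ.*-comm (toℕ x₂) (toℕ y₂)
          | ℕ.*-comm (toℕ x₃) (toℕ y₃) | ℕ.*-comm (toℕ x₄) (toℕ y₄) = refl

doroGraph : Graph DoroVertex
doroGraph = record
  { _∼_      = λ (x , _) (y , _) → B x y ≡ 0
  ; _∼?_     = λ (x , _) (y , _) → B x y ℕ.≟ 0
  ; ∼-sym    = λ {(x , _)} {(y , _)} e → trans (B-sym y x) e
  ; ∼-irrefl = λ {(x , _ , sq)} e →
      ℕ.0≢1+n (trans (cong (λ q → (q ℕ.* q) % 5) (sym e)) sq)
  }

{-# OPTIONS --safe #-}

-- Write a = a₃, b = b₂ and c = c₂.  As a₃ is an eigenvalue, k = 2a and all other intersection numbers are functions of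
-- a, b, c.  Counting c k₂ and k₃, a claw in a local graph, the least eigenvalue of the local graphs averaged against
-- the Bose-Mesner algebra, and the integrality of the multiplicity of θ₁ leave six triples (a, b, c), one of which
-- contradicts its own intersection numbers.
--
-- For the other five, the vertices are represented by vectors of an eigenspace: inner products are functions of the
-- distance, so short integral combinations of vertices can be recognised by their norms, and null ones give linear
-- relations between distances.  In this way the vertices of the Odd, Hamming and Johnson graphs become sums of "points"
-- whose inner products are those of the expected subsets or words, and lines of a hexagon are null triangles.  For
-- the Doro graph, the distances between 21 suitably chosen vertices, which span the 13-dimensional eigenspace of
-- θ₁ = 5, are forced by Bessel's inequality; every other vertex is determined by its distances to them.

module Submission where

open import Defs
  using (Graph; Shilla; _≅_; KSubset; IsGeneralizedHexagon; oddGraph; hammingGraph; doroGraph; johnsonGraph)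
open import Data.Bool using (Bool; true; false; if_then_else_)
open import Function.Bundles using (_⇔_; mk⇔)
open import Relation.Nullary.Decidable using (toWitness; _×-dec_; _→-dec_; _⊎-dec_; ¬?)
import Data.Fin.Properties as Fin
import Data.Integer.Properties as ℤ
import Data.Nat.Properties as ℕ
open import Data.Empty using (⊥; ⊥-elim)
open import Data.Fin as Fin using (Fin; zero; suc; toℕ; fromℕ<)
open import Data.Fin.Patterns
open import Data.Integer as ℤ using (ℤ; +_; -[1+_]; 0ℤ; 1ℤ; _+_; _*_; -_; _-_; _≤_; _<_; +≤+; +<+; -≤+; -<+)
open import Data.Integer.Tactic.RingSolver using (solve-∀)
open import Data.List using (List; []; _∷_; _++_)
open import Data.Nat as ℕ using (ℕ; zero; suc; z≤n; s≤s)
open import Data.Product using (Σ-syntax; ∃; ∃-syntax; _×_; _,_; proj₁; proj₂)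
open import Data.Sum using (_⊎_; inj₁; inj₂)
open import Function.Base using (_∘_)
open import Relation.Binary.PropositionalEquality
  using (_≡_; _≢_; refl; sym; trans; cong; cong₂; subst; subst₂; module ≡-Reasoning)
open import Relation.Nullary using (¬_; Dec; yes; no; does; contradiction)

-- The reals are Cauchy sequences, with no exact eigenvectors and no decidable order, so beyond the
-- quadratic equation for a₃ all linear algebra is done over ℤ. An eigenfunction `u` of the
-- tridiagonal operator `T` gives the matrix G = (u(d x y)) with G² = κG. This single identity
-- provides positivity (κ times the form is a sum of squares), projections, and multiplicities (tr G
-- is a multiple of κ). Sums over all vertices of products of two functions of the distance follow
-- from the intersection numbers, so what remains are polynomial identities and decision tables on a
-- few distances. The obstacle in the surviving cases is that the intersection numbers do not
-- visibly determine the graph. Apart from the hexagon, where only the axioms are to be verified,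
-- each identification fixes a small configuration whose mutual distances are forced, expresses
-- every vertex by it, and confines the coordinates to a finite set by null vectors or by Bessel's
-- inequality. Only injectivity has to be shown then, because the orders agree.

-- Integer sums and traces of scaled projections

module IntegerSums where
  import Algebra.Properties.Semiring.Sum

  open Algebra.Properties.Semiring.Sum ℤ.+-*-semiring public
    using (sum; sum-cong-≗; sum-remove; ∑-distrib-+; ∑-comm; *-distribˡ-sum; *-distribʳ-sum)

  square-nonneg : ∀ x → 0ℤ ≤ x * x
  square-nonneg (+ zero)    = ℤ.≤-refl
  square-nonneg (+ (suc n)) = +≤+ z≤n
  square-nonneg (-[1+ n ])  = +≤+ z≤n

  square≡0 : ∀ x → x * x ≡ 0ℤ → x ≡ 0ℤ
  square≡0 x eq with ℤ.i*j≡0⇒i≡0∨j≡0 x eq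
  ... | inj₁ e = e
  ... | inj₂ e = e

  *-nonneg : ∀ {x y} → 0ℤ ≤ x → 0ℤ ≤ y → 0ℤ ≤ x * y
  *-nonneg {+ m} {+ n} _ _ = subst (0ℤ ≤_) (ℤ.pos-* m n) (+≤+ z≤n)

  *-positive : ∀ {x y} → 0ℤ < x → 0ℤ < y → 0ℤ < x * y
  *-positive {+ suc m} {+ suc n} _ _ = +<+ (s≤s z≤n)
  *-positive {+ suc m} {+ zero} _ (+<+ ())
  *-positive {+ zero} (+<+ ()) _

  ≤⇒0≤- : ∀ {x y} → x ≤ y → 0ℤ ≤ y - x
  ≤⇒0≤- = ℤ.i≤j⇒0≤j-i

  0≤-⇒≤ : ∀ {x y} → 0ℤ ≤ y - x → x ≤ y
  0≤-⇒≤ = ℤ.0≤i-j⇒j≤i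

  cancel-positive-≤ : ∀ {c x} → 0ℤ < c → 0ℤ ≤ c * x → 0ℤ ≤ x
  cancel-positive-≤ {c} {+ n} _ _ = +≤+ z≤n
  cancel-positive-≤ {+ suc c} { -[1+ n ]} _ ()
  cancel-positive-≤ {+ zero} { -[1+ n ]} (+<+ ()) _

  cancel-positive-≡ : ∀ {c x y} → 0ℤ < c → c * x ≡ c * y → x ≡ y
  cancel-positive-≡ {c} {x} {y} c>0 e = ℤ.*-cancelˡ-≡ c x y {{ℤ.>-nonZero c>0}} e

  cancel-+ : ∀ c {x y} → x + c ≡ y + c → x ≡ y
  cancel-+ c {x} {y} e = trans (shape x c) (trans (cong (_- c) e) (sym (shape y c)))
    where
    shape : ∀ x c → x ≡ x + c - c
    shape = solve-∀

  sum-nonneg : ∀ {n} (f : Fin n → ℤ) → (∀ i → 0ℤ ≤ f i) → 0ℤ ≤ sum f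
  sum-nonneg {zero}  f p = ℤ.≤-refl
  sum-nonneg {suc n} f p = ℤ.+-mono-≤ (p zero) (sum-nonneg (f ∘ suc) (p ∘ suc))

  sum-mono : ∀ {n} (f g : Fin n → ℤ) → (∀ i → f i ≤ g i) → sum f ≤ sum g
  sum-mono {zero}  f g p = ℤ.≤-refl
  sum-mono {suc n} f g p = ℤ.+-mono-≤ (p zero) (sum-mono (f ∘ suc) (g ∘ suc) (p ∘ suc))

  private
    +-zero-nonneg : ∀ {x y} → 0ℤ ≤ x → 0ℤ ≤ y → x + y ≡ 0ℤ → x ≡ 0ℤ × y ≡ 0ℤ
    +-zero-nonneg {+ zero} {+ zero} _ _ _ = refl , refl
    +-zero-nonneg {+ zero} {+ suc n} _ _ ()
    +-zero-nonneg {+ suc m} {+ n} _ _ ()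

  sum-nonneg-zero : ∀ {n} (f : Fin n → ℤ) → (∀ i → 0ℤ ≤ f i) → sum f ≡ 0ℤ → ∀ i → f i ≡ 0ℤ
  sum-nonneg-zero {suc n} f p e zero =
    proj₁ (+-zero-nonneg (p zero) (sum-nonneg (f ∘ suc) (p ∘ suc)) e)
  sum-nonneg-zero {suc n} f p e (suc i) = sum-nonneg-zero (f ∘ suc) (p ∘ suc)
    (proj₂ (+-zero-nonneg (p zero) (sum-nonneg (f ∘ suc) (p ∘ suc)) e)) i

  sum-zero : ∀ {n} (f : Fin n → ℤ) → (∀ i → f i ≡ 0ℤ) → sum f ≡ 0ℤ
  sum-zero {zero}  f p = refl
  sum-zero {suc n} f p = cong₂ _+_ (p zero) (sum-zero (f ∘ suc) (p ∘ suc))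

  sum-positive : ∀ {n} (f : Fin n → ℤ) → 0ℤ < sum f → ∃[ i ] 0ℤ < f i
  sum-positive {n} f pos with Fin.any? (λ i → 0ℤ ℤ.<? f i)
  ... | yes p = p
  ... | no ¬p = contradiction pos (ℤ.≤⇒≯ (subst (sum f ≤_) (sum-zero {n} _ (λ _ → refl))
    (sum-mono f (λ _ → 0ℤ) (λ i → ℤ.≮⇒≥ (λ q → ¬p (i , q))))))

  sum-const : ∀ n c → sum {n} (λ _ → c) ≡ + n * c
  sum-const zero    c = refl
  sum-const (suc n) c = trans (cong (_+_ c) (sum-const n c)) (shape (+ n) c)
    where
    shape : ∀ n c → c + n * c ≡ (1ℤ + n) * c
    shape = solve-∀

  sum-1 : ∀ n → sum {n} (λ _ → 1ℤ) ≡ + n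
  sum-1 n = trans (sum-const n 1ℤ) (ℤ.*-identityʳ (+ n))

  -- Linear combinations of summands are kept as lists, so that exchanging them with `sum` costs one
  -- pointwise ring identity. The final `0ℤ` in these identities is the empty list.
  Combination : Set → Set
  Combination A = List (ℤ × (A → ℤ))

  infix 8 _⟦_⟧
  _⟦_⟧ : ∀ {A : Set} → Combination A → A → ℤ
  [] ⟦ i ⟧ = 0ℤ
  ((c , f) ∷ L) ⟦ i ⟧ = c * f i + L ⟦ i ⟧

  sums : ∀ {n} → Combination (Fin n) → ℤ
  sums [] = 0ℤ
  sums ((c , f) ∷ L) = c * sum f + sums L

  sum-linear : ∀ {n} (L : Combination (Fin n)) → sum (L ⟦_⟧) ≡ sums L
  sum-linear {n} [] = sum-zero {n} _ (λ _ → refl)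
  sum-linear ((c , f) ∷ L) = trans (∑-distrib-+ (λ i → c * f i) (L ⟦_⟧))
    (cong₂ _+_ (sym (*-distribˡ-sum c f)) (sum-linear L))

  sum-combination : ∀ {n} {f : Fin n → ℤ} (L : Combination (Fin n)) →
    (∀ i → f i ≡ L ⟦ i ⟧) → sum f ≡ sums L
  sum-combination L p = trans (sum-cong-≗ p) (sum-linear L)

  -- Eliminating one index of a symmetric matrix with G² = κG lowers its trace by κ or 0 (up to scaling).
  trace-divisible : ∀ n κ → 0ℤ < κ → (G : Fin n → Fin n → ℤ) → (∀ i j → G i j ≡ G j i) →
    (∀ i j → sum (λ k → G i k * G k j) ≡ κ * G i j) → ∃[ m ] sum (λ i → G i i) ≡ κ * m
  trace-divisible zero κ κ>0 G symm idem = 0ℤ , sym (ℤ.*-zeroʳ κ)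
  trace-divisible (suc n) κ κ>0 G symm idem with G 0F 0F ℤ.≟ 0ℤ
  ... | yes p≡0 = let m , e = IH in m , trans (cong₂ _+_ p≡0 e) (ℤ.+-identityˡ (κ * m))
    where
    row : ∀ k → G 0F k ≡ 0ℤ
    row k = square≡0 _ (trans (cong (G 0F k *_) (symm 0F k))
      (sum-nonneg-zero (λ k → G 0F k * G k 0F)
        (λ k → subst (λ x → 0ℤ ≤ G 0F k * x) (symm 0F k) (square-nonneg (G 0F k)))
        (trans (idem 0F 0F) (trans (cong (κ *_) p≡0) (ℤ.*-zeroʳ κ))) k))
    IH = trace-divisible n κ κ>0 (λ i j → G (suc i) (suc j)) (λ i j → symm (suc i) (suc j))
      (λ i j → trans (sym (trans (cong (_+ rest i j) (trans (cong (G (suc i) 0F *_) (row (suc j)))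
        (ℤ.*-zeroʳ (G (suc i) 0F)))) (ℤ.+-identityˡ (rest i j)))) (idem (suc i) (suc j)))
      where rest = λ i j → sum (λ k → G (suc i) (suc k) * G (suc k) (suc j))
  ... | no p≢0 = let m , e = IH in m + 1ℤ , cancel-positive-≡ p>0 (goal m e)
    where
    p = G 0F 0F
    p>0 : 0ℤ < p
    p>0 = ℤ.≤∧≢⇒< (cancel-positive-≤ κ>0 (subst (0ℤ ≤_) (idem 0F 0F)
      (sum-nonneg _ (λ k → subst (λ x → 0ℤ ≤ G 0F k * x) (symm 0F k) (square-nonneg (G 0F k))))))
      (λ e → p≢0 (sym e))
    -- Schur complement of the pivot `p`: its first row and column vanish, H² = κpH and tr H = p tr
    -- G - κp. The induction hypothesis with κp in place of κ gives tr G after cancelling `p`.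
    H : Fin (suc n) → Fin (suc n) → ℤ
    H i j = p * G i j - G i 0F * G 0F j
    H-sym : ∀ i j → H i j ≡ H j i
    H-sym i j = cong₂ (λ x y → p * x - y) (symm i j)
      (trans (ℤ.*-comm (G i 0F) (G 0F j)) (cong₂ _*_ (symm 0F j) (symm i 0F)))
    expand : ∀ p x y z u v w →
      (p * x - y * u) * (p * z - w * v) ≡
      (p * p) * (x * z) + (- (p * v) * (x * w) + (- (p * y) * (u * z) + ((y * v) * (u * w) + 0ℤ)))
    expand = solve-∀
    collect : ∀ p κ x y v →
      (p * p) * (κ * x) + (- (p * v) * (κ * y) + (- (p * y) * (κ * v) + ((y * v) * (κ * p) + 0ℤ)))
      ≡ (κ * p) * (p * x - y * v)
    collect = solve-∀
    H-idem : ∀ i j → sum (λ k → H i k * H k j) ≡ (κ * p) * H i j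
    H-idem i j = trans (sum-combination
        ((p * p , λ k → G i k * G k j) ∷ (- (p * G 0F j) , λ k → G i k * G k 0F) ∷
         (- (p * G i 0F) , λ k → G 0F k * G k j) ∷ (G i 0F * G 0F j , λ k → G 0F k * G k 0F) ∷ [])
        (λ k → expand p (G i k) (G i 0F) (G k j) (G 0F k) (G 0F j) (G k 0F)))
      (trans (cong₂ (λ a b → p * p * a + b) (idem i j)
        (cong₂ (λ a b → - (p * G 0F j) * a + b) (idem i 0F)
          (cong₂ (λ a b → - (p * G i 0F) * a + (G i 0F * G 0F j * b + 0ℤ)) (idem 0F j) (idem 0F 0F))))
       (collect p κ (G i j) (G i 0F) (G 0F j)))
    cancel : ∀ p x → p * x - x * p ≡ 0ℤ
    cancel = solve-∀
    H-0 : ∀ i → H i 0F ≡ 0ℤ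
    H-0 i = cancel p (G i 0F)
    H-trace : sum (λ i → H i i) ≡ p * sum (λ i → G i i) + (- 1ℤ * (κ * p) + 0ℤ)
    H-trace = trans (sum-combination
        ((p , λ i → G i i) ∷ (- 1ℤ , λ i → G 0F i * G i 0F) ∷ [])
        (λ i → shape p (G i i) (G i 0F) (G 0F i)))
      (cong (λ a → p * sum (λ i → G i i) + (- 1ℤ * a + 0ℤ)) (idem 0F 0F))
      where
      shape : ∀ p x y z → p * x - y * z ≡ p * x + (- 1ℤ * (z * y) + 0ℤ)
      shape = solve-∀
    IH = trace-divisible n (κ * p) (*-positive κ>0 p>0) (λ i j → H (suc i) (suc j))
      (λ i j → H-sym (suc i) (suc j))
      (λ i j → trans (sym (trans (cong (_+ rest i j) (cong (_* H 0F (suc j)) (H-0 (suc i))))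
        (ℤ.+-identityˡ (rest i j)))) (H-idem (suc i) (suc j)))
      where rest = λ i j → sum (λ k → H (suc i) (suc k) * H (suc k) (suc j))
    goal : ∀ m → sum (λ i → H (suc i) (suc i)) ≡ κ * p * m → p * sum (λ i → G i i) ≡ p * (κ * (m + 1ℤ))
    goal m e = final p κ m _ _ (trans (sym (ℤ.+-identityˡ _)) (trans (cong (_+ sum (λ i → H (suc i) (suc i))) (sym (H-0 0F))) H-trace)) e
      where
      rearr : ∀ p κ m t → p * t ≡ (p * t + (- 1ℤ * (κ * p) + 0ℤ)) + κ * p
      rearr = solve-∀
      rearr′ : ∀ p κ m → κ * p * m + κ * p ≡ p * (κ * (m + 1ℤ))
      rearr′ = solve-∀
      final : ∀ p κ m t s → s ≡ p * t + (- 1ℤ * (κ * p) + 0ℤ) → s ≡ κ * p * m → p * t ≡ p * (κ * (m + 1ℤ))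
      final p κ m t s e₁ e₂ = trans (rearr p κ m t)
        (trans (cong (_+ κ * p) (trans (sym e₁) e₂)) (rearr′ p κ m))

-- From distance-regularity to a metric with intersection numbers

module DistanceSchemes where
  open IntegerSums
  import Data.Fin.Subset.Properties as Subset
  open import Data.Fin.Subset using (Subset; inside; outside; _∈_; ∣_∣)
  open import Data.Vec using ([]; _∷_; here; there)
  open import Defs hiding (_≃_; _<_; _≤_; _+_; _*_; ∑)
  open import Function.Bundles using (module Equivalence)

  δ : ∀ {m} → Fin m → Fin m → ℤ
  δ zero    zero    = 1ℤ
  δ (suc i) (suc j) = δ i j
  δ zero    (suc j) = 0ℤ
  δ (suc i) zero    = 0ℤ

  δ-refl : ∀ {m} (i : Fin m) → δ i i ≡ 1ℤ
  δ-refl zero    = refl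
  δ-refl (suc i) = δ-refl i

  δ-≢ : ∀ {m} {i j : Fin m} → i ≢ j → δ i j ≡ 0ℤ
  δ-≢ {i = zero}  {zero}  p = contradiction refl p
  δ-≢ {i = zero}  {suc j} p = refl
  δ-≢ {i = suc i} {zero}  p = refl
  δ-≢ {i = suc i} {suc j} p = δ-≢ (p ∘ cong suc)

  sum-δ : ∀ {n} (x : Fin n) (f : Fin n → ℤ) → sum (λ z → δ x z * f z) ≡ f x
  sum-δ {suc n} zero f = trans (cong₂ _+_ (ℤ.*-identityˡ (f 0F)) (sum-zero {n} _ (λ _ → refl))) (ℤ.+-identityʳ (f 0F))
  sum-δ {suc n} (suc x) f = trans (ℤ.+-identityˡ _) (sum-δ x (f ∘ suc))

  record Parameters : Set where
    field k a₁ b₁ c₂ a₂ b₂ c₃ a₃ : ℤ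

  module _ (π : Parameters) where
    open Parameters π

    -- The action of the adjacency matrix on functions of the distance.
    T : (Fin 4 → ℤ) → Fin 4 → ℤ
    T f 0F = k * f 1F
    T f 1F = f 0F + a₁ * f 1F + b₁ * f 2F
    T f 2F = c₂ * f 1F + a₂ * f 2F + b₂ * f 3F
    T f 3F = c₃ * f 2F + a₃ * f 3F

  -- `neighbours` holds for arbitrary functions of the distance, so it encodes all intersection
  -- numbers at once, and sums over neighbours are iterated by iterating `T`.
  record Scheme (n : ℕ) (π : Parameters) : Set where
    field
      d         : Fin n → Fin n → Fin 4
      d-refl    : ∀ x → d x x ≡ 0F
      d-zero    : ∀ {x y} → d x y ≡ 0F → x ≡ y
      d-sym     : ∀ x y → d x y ≡ d y x
      d-tri     : ∀ x y z → toℕ (d x z) ℕ.≤ toℕ (d x y) ℕ.+ toℕ (d y z)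
      neighbours : ∀ (f : Fin 4 → ℤ) x y → sum (λ z → δ 1F (d y z) * f (d x z)) ≡ T π f (d x y)
      far       : ∃[ x ] ∃[ y ] d x y ≡ 3F

  indicator : ∀ {n} → Subset n → Fin n → ℤ
  indicator (s ∷ S) zero    = if s then 1ℤ else 0ℤ
  indicator (_ ∷ S) (suc x) = indicator S x

  indicator-∈ : ∀ {n} {S : Subset n} {x} → x ∈ S → indicator S x ≡ 1ℤ
  indicator-∈ here      = refl
  indicator-∈ {S = _ ∷ S} (there p) = indicator-∈ {S = S} p

  indicator-∉ : ∀ {n} {S : Subset n} {x} → ¬ x ∈ S → indicator S x ≡ 0ℤ
  indicator-∉ {S = inside  ∷ S} {zero}  p = contradiction here p
  indicator-∉ {S = outside ∷ S} {zero}  p = refl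
  indicator-∉ {S = _ ∷ S}       {suc x} p = indicator-∉ {S = S} (p ∘ there)

  sum-indicator : ∀ {n} (S : Subset n) → sum (indicator S) ≡ + ∣ S ∣
  sum-indicator []            = refl
  sum-indicator (inside  ∷ S) = cong (_+_ 1ℤ) (sum-indicator S)
  sum-indicator (outside ∷ S) = trans (ℤ.+-identityˡ _) (sum-indicator S)

  HasSize⇒sum : ∀ {n} {P : Fin n → Set} {c} → HasSize P c → (f : Fin n → ℤ) →
    (∀ x → P x → f x ≡ 1ℤ) → (∀ x → ¬ P x → f x ≡ 0ℤ) → sum f ≡ + c
  HasSize⇒sum (S , refl , iff) f on off = trans (sum-cong-≗ pointwise) (sum-indicator S)
    where
    pointwise : ∀ x → f x ≡ indicator S x
    pointwise x with x Subset.∈? S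
    ... | yes x∈S = trans (on x (Equivalence.to (iff x) x∈S)) (sym (indicator-∈ x∈S))
    ... | no  x∉S = trans (off x (x∉S ∘ Equivalence.from (iff x))) (sym (indicator-∉ x∉S))

  module _ {V : Set} (Γ : Graph V) where
    open Graph Γ

    append : ∀ {x y z m m′} → Walk Γ x y m → Walk Γ y z m′ → Walk Γ x z (m ℕ.+ m′)
    append []      w′ = w′
    append (e ∷ w) w′ = e ∷ append w w′

    snoc : ∀ {x y z m} → Walk Γ x y m → y ∼ z → Walk Γ x z (suc m)
    snoc []      e′ = e′ ∷ []
    snoc (e ∷ w) e′ = e ∷ snoc w e′

    reverse : ∀ {x y m} → Walk Γ x y m → Walk Γ y x m
    reverse []      = []
    reverse (e ∷ w) = snoc (reverse w) (∼-sym e)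

    Distance-≤ : ∀ {x y m m′} → Distance Γ x y m → Walk Γ x y m′ → m ℕ.≤ m′
    Distance-≤ {m = m} {m′} (_ , min) w = ℕ.≮⇒≥ (λ m′<m → min m′ m′<m w)

    Distance-unique : ∀ {x y m m′} → Distance Γ x y m → Distance Γ x y m′ → m ≡ m′
    Distance-unique D D′ = ℕ.≤-antisym (Distance-≤ D (proj₁ D′)) (Distance-≤ D′ (proj₁ D))

    Distance-sym : ∀ {x y m} → Distance Γ x y m → Distance Γ y x m
    Distance-sym (w , min) = reverse w , λ e e<m w′ → min e e<m (reverse w′)

    Distance-0 : ∀ x → Distance Γ x x 0
    Distance-0 x = [] , λ _ ()

    ∼⇒Distance-1 : ∀ {x y} → x ∼ y → Distance Γ x y 1
    ∼⇒Distance-1 x∼y = x∼y ∷ [] , λ { zero _ [] → ∼-irrefl x∼y ; (suc e) (s≤s ()) }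

    Distance-1⇒∼ : ∀ {x y} → Distance Γ x y 1 → x ∼ y
    Distance-1⇒∼ (e ∷ [] , _) = e

  module DistanceScheme {n} {Γ : Graph (Fin n)} (Γ-DR : DistanceRegular Γ 3) where
    open Graph Γ
    open DistanceRegular Γ-DR renaming (a to a′)

    d : Fin n → Fin n → Fin 4
    d x y = fromℕ< (s≤s (proj₁ (proj₂ (proj₁ diameter x y))))

    d-Distance : ∀ x y → Distance Γ x y (toℕ (d x y))
    d-Distance x y = subst (Distance Γ x y) (sym (Fin.toℕ-fromℕ< _)) (proj₂ (proj₂ (proj₁ diameter x y)))

    Distance⇒d : ∀ {x y} i → Distance Γ x y (toℕ i) → d x y ≡ i
    Distance⇒d i D = Fin.toℕ-injective (Distance-unique Γ (d-Distance _ _) D)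

    d⇒Distance : ∀ {x y i} → d x y ≡ i → Distance Γ x y (toℕ i)
    d⇒Distance refl = d-Distance _ _

    d-refl : ∀ x → d x x ≡ 0F
    d-refl x = Distance⇒d 0F (Distance-0 Γ x)

    d-zero : ∀ {x y} → d x y ≡ 0F → x ≡ y
    d-zero {x} {y} e with d⇒Distance {x} {y} e
    ... | [] , _ = refl

    d-sym : ∀ x y → d x y ≡ d y x
    d-sym x y = Distance⇒d _ (Distance-sym Γ (d-Distance y x))

    d-tri : ∀ x y z → toℕ (d x z) ℕ.≤ toℕ (d x y) ℕ.+ toℕ (d y z)
    d-tri x y z = Distance-≤ Γ (d-Distance x z) (append Γ (proj₁ (d-Distance x y)) (proj₁ (d-Distance y z)))

    ∼⇒d : ∀ {x y} → x ∼ y → d x y ≡ 1F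
    ∼⇒d = Distance⇒d 1F ∘ ∼⇒Distance-1 Γ

    d⇒∼ : ∀ {x y} → d x y ≡ 1F → x ∼ y
    d⇒∼ e = Distance-1⇒∼ Γ (d⇒Distance e)

    far : ∃[ x ] ∃[ y ] d x y ≡ 3F
    far = let x , y , D = proj₂ diameter in x , y , Distance⇒d 3F D

    -- The tail of a geodesic of length 3 is again geodesic. The three pairs later witness that b₂,
    -- c₂ and c₃ are nonzero.
    step-far : ∃[ x ] ∃[ z ] ∃[ y ] d x z ≡ 1F × d z y ≡ 2F × d x y ≡ 3F
    step-far with far
    ... | x , y , e with d⇒Distance {x} {y} e
    ...   | _∷_ {y = z} x∼z (z∼u ∷ u∼y ∷ []) , min =
      x , z , y , ∼⇒d x∼z , Distance⇒d 2F (z∼u ∷ u∼y ∷ [] ,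
        λ m m<2 w → min (suc m) (s≤s m<2) (x∼z ∷ w)) , e

    N : Fin 4 → Fin n → Fin n → ℤ
    N j x y = sum (λ z → δ 1F (d y z) * δ j (d x z))

    product-on : ∀ {x y z j} → d y z ≡ 1F → d x z ≡ j → δ 1F (d y z) * δ j (d x z) ≡ 1ℤ
    product-on {x} {y} {z} {j} p q rewrite p | q | δ-refl j = refl

    product-off : ∀ {x y z j} → ¬ (d y z ≡ 1F × d x z ≡ j) → δ 1F (d y z) * δ j (d x z) ≡ 0ℤ
    product-off {x} {y} {z} {j} ¬p with d y z Fin.≟ 1F | d x z Fin.≟ j
    ... | no p  | _     = cong (_* δ j (d x z)) (δ-≢ (p ∘ sym))
    ... | yes p | no q  = trans (cong (δ 1F (d y z) *_) (δ-≢ (q ∘ sym))) (ℤ.*-zeroʳ (δ 1F (d y z)))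
    ... | yes p | yes q = contradiction (p , q) ¬p

    N-size : ∀ {x y j m} {P : Fin n → Set} → HasSize P m →
      (∀ z → P z → d y z ≡ 1F × d x z ≡ j) → (∀ z → d y z ≡ 1F → d x z ≡ j → P z) → N j x y ≡ + m
    N-size size to from = HasSize⇒sum size _
      (λ z Pz → product-on (proj₁ (to z Pz)) (proj₂ (to z Pz)))
      (λ z ¬Pz → product-off (λ (p , q) → ¬Pz (from z p q)))

    N-zero : ∀ {x y j} → (∀ z → d y z ≡ 1F → d x z ≢ j) → N j x y ≡ 0ℤ
    N-zero none = sum-zero _ (λ z → product-off (λ (p , q) → none z p q))

    N-b : ∀ x y i j → toℕ j ≡ suc (toℕ i) → d x y ≡ i → N j x y ≡ + b i
    N-b x y i j eq e = N-size (b-count x y i (d⇒Distance e))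
      (λ z (y∼z , D) → ∼⇒d y∼z , Distance⇒d j (subst (Distance Γ x z) (sym eq) D))
      (λ z p q → d⇒∼ p , subst (Distance Γ x z) eq (d⇒Distance q))

    N-c : ∀ x y i j → toℕ i ≡ suc (toℕ j) → d x y ≡ i → N j x y ≡ + c i
    N-c x y i j eq e = N-size (c-count x y i (d⇒Distance e))
      (λ z (y∼z , m , m≡ , D) → ∼⇒d y∼z ,
        Distance⇒d j (subst (Distance Γ x z) (ℕ.suc-injective (trans m≡ eq)) D))
      (λ z p q → d⇒∼ p , toℕ j , sym eq , d⇒Distance q)

    degree : ∀ y → sum (λ z → δ 1F (d y z)) ≡ + valency
    degree y = HasSize⇒sum (b-count y y 0F (d⇒Distance (d-refl y))) _
      (λ z (y∼z , _) → cong (δ 1F) (∼⇒d y∼z))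
      (λ z ¬p → δ-≢ (λ e → ¬p (d⇒∼ (sym e) , d⇒Distance (sym e))))

    split : ∀ (f : Fin 4 → ℤ) x y → sum (λ z → δ 1F (d y z) * f (d x z)) ≡
      f 0F * N 0F x y + (f 1F * N 1F x y + (f 2F * N 2F x y + (f 3F * N 3F x y + 0ℤ)))
    split f x y = sum-combination
      ((f 0F , λ z → δ 1F (d y z) * δ 0F (d x z)) ∷ (f 1F , λ z → δ 1F (d y z) * δ 1F (d x z)) ∷
       (f 2F , λ z → δ 1F (d y z) * δ 2F (d x z)) ∷ (f 3F , λ z → δ 1F (d y z) * δ 3F (d x z)) ∷ [])
      (λ z → pointwise (δ 1F (d y z)) (d x z))
      where
      s₀ : ∀ m p q r s → m * p ≡ p * (m * 1ℤ) + (q * (m * 0ℤ) + (r * (m * 0ℤ) + (s * (m * 0ℤ) + 0ℤ)))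
      s₀ = solve-∀
      s₁ : ∀ m p q r s → m * q ≡ p * (m * 0ℤ) + (q * (m * 1ℤ) + (r * (m * 0ℤ) + (s * (m * 0ℤ) + 0ℤ)))
      s₁ = solve-∀
      s₂ : ∀ m p q r s → m * r ≡ p * (m * 0ℤ) + (q * (m * 0ℤ) + (r * (m * 1ℤ) + (s * (m * 0ℤ) + 0ℤ)))
      s₂ = solve-∀
      s₃ : ∀ m p q r s → m * s ≡ p * (m * 0ℤ) + (q * (m * 0ℤ) + (r * (m * 0ℤ) + (s * (m * 1ℤ) + 0ℤ)))
      s₃ = solve-∀
      pointwise : ∀ m j → m * f j ≡
        f 0F * (m * δ 0F j) + (f 1F * (m * δ 1F j) + (f 2F * (m * δ 2F j) + (f 3F * (m * δ 3F j) + 0ℤ)))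
      pointwise m 0F = s₀ m (f 0F) (f 1F) (f 2F) (f 3F)
      pointwise m 1F = s₁ m (f 0F) (f 1F) (f 2F) (f 3F)
      pointwise m 2F = s₂ m (f 0F) (f 1F) (f 2F) (f 3F)
      pointwise m 3F = s₃ m (f 0F) (f 1F) (f 2F) (f 3F)

    N-total : ∀ x y → N 0F x y + (N 1F x y + (N 2F x y + N 3F x y)) ≡ + valency
    N-total x y = trans (shape (N 0F x y) (N 1F x y) (N 2F x y) (N 3F x y)) (trans (sym (split (λ _ → 1ℤ) x y))
      (trans (sum-cong-≗ (λ z → ℤ.*-identityʳ (δ 1F (d y z)))) (degree y)))
      where
      shape : ∀ p q r s → p + (q + (r + s)) ≡ 1ℤ * p + (1ℤ * q + (1ℤ * r + (1ℤ * s + 0ℤ)))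
      shape = solve-∀

    c-1 : c 1F ≡ 1
    c-1 with step-far
    ... | x , z , y , xz , _ = ℤ.+-injective (trans (sym (N-c x z 1F 0F refl xz))
      (trans (sum-cong-≗ pointwise) (sum-δ x (λ _ → 1ℤ))))
      where
      pointwise : ∀ u → δ 1F (d z u) * δ 0F (d x u) ≡ δ x u * 1ℤ
      pointwise u with x Fin.≟ u
      ... | yes refl rewrite d-sym z x | xz | d-refl x | δ-refl x = refl
      ... | no x≢u = trans (product-off (λ (_ , e) → x≢u (d-zero e))) (cong (_* 1ℤ) (sym (δ-≢ x≢u)))

    π : Parameters
    π = record
      { k = + valency ; a₁ = a′ 1F ; b₁ = + b 1F ; c₂ = + c 2F
      ; a₂ = a′ 2F ; b₂ = + b 2F ; c₃ = + c 3F ; a₃ = + valency - + c 3F }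

    private
      far-off : ∀ {x y z i j} → d x y ≡ i → d y z ≡ 1F → d x z ≡ j → toℕ j ℕ.≤ toℕ i ℕ.+ 1
      far-off {x} {y} {z} refl p refl = subst (λ e → toℕ (d x z) ℕ.≤ toℕ (d x y) ℕ.+ toℕ e) p (d-tri x y z)

      near-off : ∀ {x y z i j} → d x y ≡ i → d y z ≡ 1F → d x z ≡ j → toℕ i ℕ.≤ toℕ j ℕ.+ 1
      near-off {x} {y} {z} refl p refl =
        subst (λ e → toℕ (d x y) ℕ.≤ toℕ (d x z) ℕ.+ toℕ e) (trans (d-sym z y) p) (d-tri x z y)

      module _ (f : Fin 4 → ℤ) {x y : Fin n} where
        tuple : ∀ {p q r s} → N 0F x y ≡ p → N 1F x y ≡ q → N 2F x y ≡ r → N 3F x y ≡ s →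
          sum (λ z → δ 1F (d y z) * f (d x z)) ≡ f 0F * p + (f 1F * q + (f 2F * r + (f 3F * s + 0ℤ)))
        tuple refl refl refl refl = split f x y

    -- By the triangle inequality a neighbour of y lies at distance i - 1, i or i + 1 from x. The
    -- outer two counts are c and b, and for i > 0 the middle one is what the degree leaves over.
    neighbours : ∀ (f : Fin 4 → ℤ) x y → sum (λ z → δ 1F (d y z) * f (d x z)) ≡ T π f (d x y)
    neighbours f x y = go (d x y) refl
      where
      total = N-total x y
      go : ∀ i → d x y ≡ i → sum (λ z → δ 1F (d y z) * f (d x z)) ≡ T π f i
      go 0F e = trans (tuple f n₀ (N-b x y 0F 1F refl e) n₂ n₃) (shape (f 0F) (f 1F) (f 2F) (f 3F) (+ valency))
        where
        n₀ = N-zero {x} {y} {0F} (λ z p q → case-zero z p q)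
          where
          case-zero : ∀ z → d y z ≡ 1F → d x z ≡ 0F → ⊥
          case-zero z p q with d-zero e | d-zero q
          ... | refl | refl = contradiction (trans (sym p) (d-refl x)) λ ()
        n₂ = N-zero {x} {y} {2F} (λ z p q → contradiction (far-off e p q) λ { (s≤s ()) })
        n₃ = N-zero {x} {y} {3F} (λ z p q → contradiction (far-off e p q) λ { (s≤s ()) })
        shape : ∀ p q r s m → p * 0ℤ + (q * m + (r * 0ℤ + (s * 0ℤ + 0ℤ))) ≡ m * q
        shape = solve-∀
      go 1F e = trans (tuple f n₀ n₁ n₂ n₃) (shape (f 0F) (f 1F) (f 2F) (f 3F) (+ valency) (+ b 1F) (+ c 1F) (cong +_ c-1))
        where
        n₀ = N-c x y 1F 0F refl e
        n₂ = N-b x y 1F 2F refl e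
        n₃ = N-zero {x} {y} {3F} (λ z p q → contradiction (far-off e p q) λ { (s≤s (s≤s ())) })
        isolate : ∀ p q r s m → p + (q + (r + s)) ≡ m → p ≡ + c 1F → r ≡ + b 1F → s ≡ 0ℤ → q ≡ m - + b 1F - + c 1F
        isolate p q r s m refl refl refl refl = shape′ (+ c 1F) q (+ b 1F)
          where
          shape′ : ∀ p q r → q ≡ p + (q + (r + 0ℤ)) - r - p
          shape′ = solve-∀
        n₁ = isolate (N 0F x y) (N 1F x y) (N 2F x y) (N 3F x y) (+ valency) total n₀ n₂ n₃
        shape : ∀ p q r s m u v → v ≡ 1ℤ → p * v + (q * (m - u - v) + (r * u + (s * 0ℤ + 0ℤ))) ≡ p + (m - u - v) * q + u * r
        shape p q r s m u v refl = shape′ p q r s m u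
          where
          shape′ : ∀ p q r s m u → p * 1ℤ + (q * (m - u - 1ℤ) + (r * u + (s * 0ℤ + 0ℤ))) ≡ p + (m - u - 1ℤ) * q + u * r
          shape′ = solve-∀
      go 2F e = trans (tuple f n₀ n₁ n₂ n₃) (shape (f 0F) (f 1F) (f 2F) (f 3F) (+ valency) (+ b 2F) (+ c 2F))
        where
        n₀ = N-zero {x} {y} {0F} (λ z p q → contradiction (near-off e p q) λ { (s≤s ()) })
        n₁ = N-c x y 2F 1F refl e
        n₃ = N-b x y 2F 3F refl e
        isolate : ∀ p q r s m → p + (q + (r + s)) ≡ m → p ≡ 0ℤ → q ≡ + c 2F → s ≡ + b 2F → r ≡ m - + b 2F - + c 2F
        isolate p q r s m refl refl refl refl = shape′ (+ c 2F) r (+ b 2F)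
          where
          shape′ : ∀ q r s → r ≡ 0ℤ + (q + (r + s)) - s - q
          shape′ = solve-∀
        n₂ = isolate (N 0F x y) (N 1F x y) (N 2F x y) (N 3F x y) (+ valency) total n₀ n₁ n₃
        shape : ∀ p q r s m u v → p * 0ℤ + (q * v + (r * (m - u - v) + (s * u + 0ℤ))) ≡ v * q + (m - u - v) * r + u * s
        shape = solve-∀
      go 3F e = trans (tuple f n₀ n₁ n₂ n₃) (shape (f 0F) (f 1F) (f 2F) (f 3F) (+ valency) (+ c 3F))
        where
        n₀ = N-zero {x} {y} {0F} (λ z p q → contradiction (near-off e p q) λ { (s≤s ()) })
        n₁ = N-zero {x} {y} {1F} (λ z p q → contradiction (near-off e p q) λ { (s≤s (s≤s ())) })
        n₂ = N-c x y 3F 2F refl e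
        isolate : ∀ p q r s m → p + (q + (r + s)) ≡ m → p ≡ 0ℤ → q ≡ 0ℤ → r ≡ + c 3F → s ≡ m - + c 3F
        isolate p q r s m refl refl refl refl = shape′ (+ c 3F) s
          where
          shape′ : ∀ r s → s ≡ 0ℤ + (0ℤ + (r + s)) - r
          shape′ = solve-∀
        n₃ = isolate (N 0F x y) (N 1F x y) (N 2F x y) (N 3F x y) (+ valency) total n₀ n₁ n₂
        shape : ∀ p q r s m v → p * 0ℤ + (q * 0ℤ + (r * v + (s * (m - v) + 0ℤ))) ≡ v * r + (m - v) * s
        shape = solve-∀

    b-3 : b 3F ≡ 0
    b-3 with far
    ... | x , y , e = sym (ℤ.+-injective (trans (sym (sum-zero {n} _ (λ _ → refl)))
      (HasSize⇒sum (b-count x y 3F (d⇒Distance e)) (λ _ → 0ℤ)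
        (λ z (_ , D) → contradiction (Fin.toℕ<n (d x z)) (ℕ.<-irrefl (Distance-unique Γ (d-Distance x z) D)))
        (λ _ _ → refl))))

    scheme : Scheme n π
    scheme = record
      { d = d ; d-refl = d-refl ; d-zero = d-zero ; d-sym = d-sym ; d-tri = d-tri
      ; neighbours = neighbours ; far = far }

-- Integral vectors approximating a real eigenvector

module ApproximateEigenvectors where
  open IntegerSums
  open DistanceSchemes
  import Data.Rational.Properties as ℚ
  import Data.Rational.Unnormalised.Properties as ℚᵘ
  open import Data.Rational as ℚ using (ℚ; 0ℚ; 1ℚ; toℚᵘ)
  open import Data.Rational.Unnormalised as ℚᵘ using (mkℚᵘ; *≡*; *<*)
  open import Defs hiding (_≃_; _<_; _≤_; _+_; _*_)

  abstract
    ι : ℤ → ℚ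
    ι z = z ℚ./ 1

    ι-def : ∀ z → z ℚ./ 1 ≡ ι z
    ι-def z = refl

    ι-0 : ι 0ℤ ≡ 0ℚ
    ι-0 = refl

    ιᵘ : ∀ z → toℚᵘ (ι z) ℚᵘ.≃ mkℚᵘ z 0
    ιᵘ z = ℚ.toℚᵘ-fromℚᵘ (mkℚᵘ z 0)

    ι-+ : ∀ a b → ι (a + b) ≡ ι a ℚ.+ ι b
    ι-+ a b = ℚ.toℚᵘ-injective (ℚᵘ.≃-trans (ιᵘ (a + b)) (ℚᵘ.≃-sym (ℚᵘ.≃-trans (ℚ.toℚᵘ-homo-+ (ι a) (ι b))
      (ℚᵘ.≃-trans (ℚᵘ.+-cong (ιᵘ a) (ιᵘ b)) (*≡* (shape a b))))))
      where
      shape : ∀ a b → (a * 1ℤ + b * 1ℤ) * 1ℤ ≡ (a + b) * 1ℤ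
      shape = solve-∀

    ι-* : ∀ a b → ι (a * b) ≡ ι a ℚ.* ι b
    ι-* a b = ℚ.toℚᵘ-injective (ℚᵘ.≃-trans (ιᵘ (a * b)) (ℚᵘ.≃-sym (ℚᵘ.≃-trans (ℚ.toℚᵘ-homo-* (ι a) (ι b))
      (ℚᵘ.≃-trans (ℚᵘ.*-cong (ιᵘ a) (ιᵘ b)) (*≡* refl)))))

    ι-neg : ∀ a → ι (- a) ≡ ℚ.- ι a
    ι-neg a = ℚ.toℚᵘ-injective (ℚᵘ.≃-trans (ιᵘ (- a)) (ℚᵘ.≃-sym (ℚᵘ.≃-trans (ℚ.toℚᵘ-homo‿- (ι a))
      (ℚᵘ.-‿cong (ιᵘ a)))))

    ι-<⁻ : ∀ {a b} → ι a ℚ.< ι b → a < b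
    ι-<⁻ {a} {b} p = subst₂ _<_ (ℤ.*-identityʳ a) (ℤ.*-identityʳ b)
      (ℚᵘ.drop-*<* (ℚᵘ.<-respˡ-≃ (ιᵘ a) (ℚᵘ.<-respʳ-≃ (ιᵘ b) (ℚ.toℚᵘ-mono-< p))))

    ι-pos : ∀ m → 0ℚ ℚ.< ι (+ suc m)
    ι-pos m = ℚ.toℚᵘ-cancel-< (ℚᵘ.<-respʳ-≃ (ℚᵘ.≃-sym (ιᵘ (+ suc m))) (*<* (+<+ (s≤s z≤n))))

    ι-denominator : ∀ q → ι (ℚ.↧ q) ℚ.* q ≡ ι (ℚ.↥ q)
    ι-denominator q = ℚ.toℚᵘ-injective (ℚᵘ.≃-trans (ℚ.toℚᵘ-homo-* (ι (ℚ.↧ q)) q)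
      (ℚᵘ.≃-trans (ℚᵘ.*-cong (ιᵘ (ℚ.↧ q)) (ℚᵘ.≃-refl {toℚᵘ q}))
      (ℚᵘ.≃-trans (lemma q) (ℚᵘ.≃-sym (ιᵘ (ℚ.↥ q))))))
      where
      lemma : ∀ q → mkℚᵘ (ℚ.↧ q) 0 ℚᵘ.* toℚᵘ q ℚᵘ.≃ mkℚᵘ (ℚ.↥ q) 0
      lemma (ℚ.mkℚ m e _) = *≡* (shape (+ suc e) m (cong (λ e → + suc e) (ℕ.+-identityʳ e)))
        where
        shape : ∀ e m {e′} → e′ ≡ e → e * m * 1ℤ ≡ m * e′
        shape e m refl = shape′ e m
          where
          shape′ : ∀ e m → e * m * 1ℤ ≡ m * e
          shape′ = solve-∀

    1/suc : ℕ → ℚ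
    1/suc m = 1ℤ ℚ./ suc m

    reciprocal : ∀ m → ι (+ suc m) ℚ.* (1/suc m) ≡ 1ℚ
    reciprocal m = ℚ.toℚᵘ-injective (ℚᵘ.≃-trans (ℚ.toℚᵘ-homo-* (ι (+ suc m)) (1/suc m))
      (ℚᵘ.≃-trans (ℚᵘ.*-cong (ιᵘ (+ suc m)) (ℚ.toℚᵘ-fromℚᵘ (mkℚᵘ 1ℤ m)))
        (*≡* (shape (+ suc m) (cong (λ e → + suc e) (ℕ.+-identityʳ m))))))
      where
      shape : ∀ e {e′} → e′ ≡ e → e * 1ℤ * 1ℤ ≡ 1ℤ * e′
      shape e refl = shape′ e
        where
        shape′ : ∀ e → e * 1ℤ * 1ℤ ≡ 1ℤ * e
        shape′ = solve-∀

    reciprocal-pos : ∀ m → 0ℚ ℚ.< 1/suc m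
    reciprocal-pos m = ℚ.toℚᵘ-cancel-< (ℚᵘ.<-respʳ-≃ (ℚᵘ.≃-sym (ℚ.toℚᵘ-fromℚᵘ (mkℚᵘ 1ℤ m))) (*<* (+<+ (s≤s z≤n))))

  clear-denominators : ∀ {n} (q : Fin n → ℚ) →
    ∃[ N ] Σ[ v ∈ (Fin n → ℤ) ] ∀ i → ι (v i) ≡ ι (+ suc N) ℚ.* q i
  clear-denominators {zero}  q = 0 , (λ ()) , λ ()
  clear-denominators {suc n} q with q 0F in eq | clear-denominators (q ∘ suc)
  -- `suc (N + e * suc N)` computes to `suc e * suc N`, so the common multiple is the product of all
  -- denominators.
  ... | ℚ.mkℚ m e _ | N , v , p = N ℕ.+ e ℕ.* suc N , v′ , p′
    where
    v′ : Fin (suc n) → ℤ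
    v′ zero    = + suc N * m
    v′ (suc i) = + suc e * v i
    p′ : ∀ i → ι (v′ i) ≡ ι (+ suc e * + suc N) ℚ.* q i
    p′ zero = trans (ι-* (+ suc N) m) (trans (cong (ι (+ suc N) ℚ.*_) (sym (ι-denominator (ℚ.mkℚ m e _))))
      (trans (sym (ℚ.*-assoc (ι (+ suc N)) (ι (+ suc e)) _)) (trans (cong₂ ℚ._*_
        (trans (sym (ι-* (+ suc N) (+ suc e))) (cong ι (ℤ.*-comm (+ suc N) (+ suc e)))) (sym eq)) refl)))
    p′ (suc i) = trans (ι-* (+ suc e) (v i)) (trans (cong (ι (+ suc e) ℚ.*_) (p i))
      (trans (sym (ℚ.*-assoc (ι (+ suc e)) (ι (+ suc N)) (q (suc i))))
        (cong (ℚ._* q (suc i)) (sym (ι-* (+ suc e) (+ suc N))))))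

  p≤∣p∣ : ∀ p → p ℚ.≤ ℚ.∣ p ∣
  p≤∣p∣ p with ℚ.≤-total 0ℚ p
  ... | inj₁ 0≤p = ℚ.≤-reflexive (sym (ℚ.0≤p⇒∣p∣≡p 0≤p))
  ... | inj₂ p≤0 = ℚ.≤-trans p≤0 (ℚ.0≤∣p∣ p)

  private
    maximum : ∀ {n} (f : Fin n → ℕ) → ∃[ M ] ∀ i → f i ℕ.≤ M
    maximum {zero}  f = 0 , λ ()
    maximum {suc n} f with maximum (f ∘ suc)
    ... | M , p = f 0F ℕ.⊔ M , λ { zero → ℕ.m≤m⊔n (f 0F) M ; (suc i) → ℕ.≤-trans (p i) (ℕ.m≤n⊔m (f 0F) M) }

    ∑-seq : ∀ {n} (f : Fin n → ℝ) (g : Fin n → ℤ) M (c : ℚ) →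
      (∀ j → ι (g j) ≡ c ℚ.* seq (f j) M) → ι (sum g) ≡ c ℚ.* seq (∑ f) M
    ∑-seq {zero}  f g M c p = trans ι-0 (sym (ℚ.*-zeroʳ c))
    ∑-seq {suc n} f g M c p = trans (ι-+ (g 0F) (sum (g ∘ suc)))
      (trans (cong₂ ℚ._+_ (p 0F) (∑-seq (f ∘ suc) (g ∘ suc) M c (p ∘ suc)))
        (sym (ℚ.*-distribˡ-+ c (seq (f 0F) M) (seq (∑ (f ∘ suc)) M))))

    ι-combination : ∀ {a θ w c s q} → ι a ≡ c ℚ.* s → ι w ≡ c ℚ.* q →
      ι (a - θ * w) ≡ c ℚ.* (s ℚ.- (θ ℚ./ 1) ℚ.* q)
    ι-combination {a} {θ} {w} {c} {s} {q} e₁ e₂ = begin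
      ι (a - θ * w)                              ≡⟨ ι-+ a (- (θ * w)) ⟩
      ι a ℚ.+ ι (- (θ * w))                      ≡⟨ cong₂ ℚ._+_ e₁ (ι-neg (θ * w)) ⟩
      c ℚ.* s ℚ.- ι (θ * w)                      ≡⟨ cong (λ e → c ℚ.* s ℚ.- e) (trans (ι-* θ w) (cong (ι θ ℚ.*_) e₂)) ⟩
      c ℚ.* s ℚ.- ι θ ℚ.* (c ℚ.* q)              ≡⟨ cong (λ e → c ℚ.* s ℚ.- e) (swap (ι θ) c q) ⟩
      c ℚ.* s ℚ.- c ℚ.* (ι θ ℚ.* q)              ≡⟨ cong (c ℚ.* s ℚ.+_) (ℚ.neg-distribʳ-* c (ι θ ℚ.* q)) ⟩
      c ℚ.* s ℚ.+ c ℚ.* (ℚ.- (ι θ ℚ.* q))        ≡⟨ ℚ.*-distribˡ-+ c s (ℚ.- (ι θ ℚ.* q)) ⟨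
      c ℚ.* (s ℚ.- ι θ ℚ.* q)                    ≡⟨ cong (λ e → c ℚ.* (s ℚ.- e ℚ.* q)) (ι-def θ) ⟨
      c ℚ.* (s ℚ.- (θ ℚ./ 1) ℚ.* q)              ∎
      where
      open ≡-Reasoning
      swap : ∀ a b c → a ℚ.* (b ℚ.* c) ≡ b ℚ.* (a ℚ.* c)
      swap a b c = trans (sym (ℚ.*-assoc a b c)) (trans (cong (ℚ._* c) (ℚ.*-comm a b)) (ℚ.*-assoc b a c))

    scaled-bound : ∀ m N ε₀ g r → ι r ≡ ι (+ suc N) ℚ.* g → ℚ.∣ g ∣ ℚ.< ε₀ ℚ.* 1/suc m →
      ι (+ suc m * r) ℚ.< ι (+ suc N) ℚ.* ε₀ × ι (- (+ suc m * r)) ℚ.< ι (+ suc N) ℚ.* ε₀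
    scaled-bound m N ε₀ g r e small =
        subst (ℚ._< c ℚ.* ε₀) (sym pos-form) (scale-< g (ℚ.≤-<-trans (p≤∣p∣ g) small))
      , subst (ℚ._< c ℚ.* ε₀) (sym neg-form) (scale-< (ℚ.- g) (ℚ.≤-<-trans
          (subst (ℚ.- g ℚ.≤_) (ℚ.∣-p∣≡∣p∣ g) (p≤∣p∣ (ℚ.- g))) small))
      where
      open ≡-Reasoning
      c = ι (+ suc N)
      l = ι (+ suc m)
      scaled-ε : l ℚ.* (c ℚ.* (ε₀ ℚ.* 1/suc m)) ≡ c ℚ.* ε₀
      scaled-ε = begin
        l ℚ.* (c ℚ.* (ε₀ ℚ.* 1/suc m))   ≡⟨ ℚ.*-assoc l c (ε₀ ℚ.* 1/suc m) ⟨
        l ℚ.* c ℚ.* (ε₀ ℚ.* 1/suc m)     ≡⟨ cong₂ ℚ._*_ (ℚ.*-comm l c) (ℚ.*-comm ε₀ (1/suc m)) ⟩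
        c ℚ.* l ℚ.* (1/suc m ℚ.* ε₀)     ≡⟨ ℚ.*-assoc c l (1/suc m ℚ.* ε₀) ⟩
        c ℚ.* (l ℚ.* (1/suc m ℚ.* ε₀))   ≡⟨ cong (c ℚ.*_) (ℚ.*-assoc l (1/suc m) ε₀) ⟨
        c ℚ.* (l ℚ.* 1/suc m ℚ.* ε₀)     ≡⟨ cong (λ e → c ℚ.* (e ℚ.* ε₀)) (reciprocal m) ⟩
        c ℚ.* (1ℚ ℚ.* ε₀)                ≡⟨ cong (c ℚ.*_) (ℚ.*-identityˡ ε₀) ⟩
        c ℚ.* ε₀                         ∎
      scale-< : ∀ p → p ℚ.< ε₀ ℚ.* 1/suc m → l ℚ.* (c ℚ.* p) ℚ.< c ℚ.* ε₀
      scale-< p p<ε = subst (l ℚ.* (c ℚ.* p) ℚ.<_) scaled-ε (ℚ.*-monoʳ-<-pos l {{ℚ.positive (ι-pos m)}}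
        (ℚ.*-monoʳ-<-pos c {{ℚ.positive (ι-pos N)}} p<ε))
      pos-form : ι (+ suc m * r) ≡ l ℚ.* (c ℚ.* g)
      pos-form = trans (ι-* (+ suc m) r) (cong (l ℚ.*_) e)
      neg-form : ι (- (+ suc m * r)) ≡ l ℚ.* (c ℚ.* (ℚ.- g))
      neg-form = begin
        ι (- (+ suc m * r))       ≡⟨ ι-neg (+ suc m * r) ⟩
        ℚ.- ι (+ suc m * r)       ≡⟨ cong ℚ.-_ pos-form ⟩
        ℚ.- (l ℚ.* (c ℚ.* g))     ≡⟨ ℚ.neg-distribʳ-* l (c ℚ.* g) ⟩
        l ℚ.* (ℚ.- (c ℚ.* g))     ≡⟨ cong (l ℚ.*_) (ℚ.neg-distribʳ-* c g) ⟩
        l ℚ.* (c ℚ.* (ℚ.- g))     ∎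

  module _ {n} (Γ : Graph (Fin n)) {π : Parameters} (S : Scheme n π) where
    open Graph Γ
    open Scheme S

    residual : ℤ → (Fin n → ℤ) → Fin n → ℤ
    residual θ v i = sum (λ j → δ 1F (d i j) * v j) - θ * v i

    -- An eigenvector is only given up to arbitrary precision, so it is replaced by integral vectors with
    -- arbitrarily small relative residual.
    ApproximateEigenvalue : ℤ → Set
    ApproximateEigenvalue θ = ∃[ x ] ∀ m → Σ[ v ∈ (Fin n → ℤ) ] ∃[ s ]
      (s ≡ v x ⊎ s ≡ - v x) × 0ℤ < s × (∀ i → + suc m * residual θ v i < s × - (+ suc m * residual θ v i) < s)

    -- All Cauchy sequences are frozen at one index M, beyond which the entry at x is bounded away
    -- from 0 by ε₀ and every residual is below ε₀/(m + 1). Clearing denominators multiplies the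
    -- entry and the residuals by the same factor, so their ratio survives.
    approximate : (∀ x y → x ∼ y → d x y ≡ 1F) → (∀ x y → d x y ≡ 1F → x ∼ y) →
      ∀ {θ} → IsEigenvalue (adjacencyMatrix Γ) (fromℤ θ) → ApproximateEigenvalue θ
    approximate ∼⇒d d⇒∼ {θ} (v , (x , nonzero) , eig) = x , λ m → approx m nonzero
      where
      entry : ∀ i j M (c : ℚ) (w : ℤ) → ι w ≡ c ℚ.* seq (v j) M →
        ι (δ 1F (d i j) * w) ≡ c ℚ.* (seq (adjacencyMatrix Γ i j) M ℚ.* seq (v j) M)
      entry i j M c w e with i ∼? j
      ... | yes i∼j rewrite ∼⇒d i j i∼j = trans (cong ι (ℤ.*-identityˡ w)) (trans e (cong (c ℚ.*_) (sym (ℚ.*-identityˡ _))))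
      ... | no ¬i∼j rewrite δ-≢ {i = 1F} {d i j} (λ e → ¬i∼j (d⇒∼ i j (sym e))) =
        trans (cong ι (ℤ.*-zeroˡ w)) (trans ι-0
        (sym (trans (cong (c ℚ.*_) (ℚ.*-zeroˡ (seq (v j) M))) (ℚ.*-zeroʳ c))))

      sample : ∀ m ε₀ → 0ℚ ℚ.< ε₀ → (N₀ : ℕ) →
        ∃[ M ] N₀ ℕ.≤ M × ∃[ N ] Σ[ w ∈ (Fin n → ℤ) ]
          (∀ i → ι (w i) ≡ ι (+ suc N) ℚ.* seq (v i) M) ×
          (∀ i → ι (+ suc m * residual θ w i) ℚ.< ι (+ suc N) ℚ.* ε₀ ×
                 ι (- (+ suc m * residual θ w i)) ℚ.< ι (+ suc N) ℚ.* ε₀)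
      sample m ε₀ ε₀>0 N₀ = M , ℕ.m≤m⊔n N₀ (proj₁ Nmax) , N , w , wp , bound
        where
        r = 1/suc m
        ε = ε₀ ℚ.* r
        ε>0 : 0ℚ ℚ.< ε
        ε>0 = subst (ℚ._< ε) (ℚ.*-zeroʳ ε₀) (ℚ.*-monoʳ-<-pos ε₀ {{ℚ.positive ε₀>0}} (reciprocal-pos m))
        Nmax = maximum (λ i → proj₁ (eig i ε ε>0))
        M = N₀ ℕ.⊔ proj₁ Nmax
        cleared = clear-denominators (λ i → seq (v i) M)
        N = proj₁ cleared
        w = proj₁ (proj₂ cleared)
        wp = proj₂ (proj₂ cleared)
        c = ι (+ suc N)
        gap : Fin n → ℚ
        gap i = seq (∑ (λ j → adjacencyMatrix Γ i j Defs.* v j)) M ℚ.- (θ ℚ./ 1) ℚ.* seq (v i) M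
        small : ∀ i → ℚ.∣ gap i ∣ ℚ.< ε
        small i = proj₂ (eig i ε ε>0) M (ℕ.≤-trans (proj₂ Nmax i) (ℕ.m≤n⊔m N₀ (proj₁ Nmax)))
        residual-gap : ∀ i → ι (residual θ w i) ≡ c ℚ.* gap i
        residual-gap i = ι-combination {sum (λ j → δ 1F (d i j) * w j)} {θ} {w i} {c}
          {seq (∑ (λ j → adjacencyMatrix Γ i j Defs.* v j)) M} {seq (v i) M}
          (∑-seq (λ j → adjacencyMatrix Γ i j Defs.* v j) (λ j → δ 1F (d i j) * w j) M c
            (λ j → entry i j M c (w j) (wp j))) (wp i)
        bound : ∀ i → ι (+ suc m * residual θ w i) ℚ.< c ℚ.* ε₀ × ι (- (+ suc m * residual θ w i)) ℚ.< c ℚ.* ε₀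
        bound i = scaled-bound m N ε₀ (gap i) (residual θ w i) (residual-gap i) (small i)

      Approximation : ℕ → Set
      Approximation m = Σ[ w ∈ (Fin n → ℤ) ] ∃[ s ] (s ≡ w x ⊎ s ≡ - w x) × 0ℤ < s ×
        (∀ i → + suc m * residual θ w i < s × - (+ suc m * residual θ w i) < s)

      conclude : ∀ m N ε₀ (w : Fin n → ℤ) s → 0ℚ ℚ.< ε₀ → s ≡ w x ⊎ s ≡ - w x →
        ι (+ suc N) ℚ.* ε₀ ℚ.< ι s →
        (∀ i → ι (+ suc m * residual θ w i) ℚ.< ι (+ suc N) ℚ.* ε₀ ×
               ι (- (+ suc m * residual θ w i)) ℚ.< ι (+ suc N) ℚ.* ε₀) → Approximation m
      conclude m N ε₀ w s ε₀>0 sign big bound = w , s , sign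
        , ι-<⁻ (subst (ℚ._< ι s) (sym ι-0) (ℚ.<-trans pos big))
        , λ i → ι-<⁻ (ℚ.<-trans (proj₁ (bound i)) big) , ι-<⁻ (ℚ.<-trans (proj₂ (bound i)) big)
        where
        pos : 0ℚ ℚ.< ι (+ suc N) ℚ.* ε₀
        pos = subst (ℚ._< ι (+ suc N) ℚ.* ε₀) (ℚ.*-zeroʳ (ι (+ suc N)))
          (ℚ.*-monoʳ-<-pos (ι (+ suc N)) {{ℚ.positive (ι-pos N)}} ε₀>0)

      approx : ∀ m → v x Defs.< 0ℝ ⊎ 0ℝ Defs.< v x → Approximation m
      approx m (inj₂ (ε₀ , ε₀>0 , N₀ , lower)) =
        let M , N₀≤M , N , w , wp , bound = sample m ε₀ ε₀>0 N₀
        in conclude m N ε₀ w (w x) ε₀>0 (inj₁ refl)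
          (subst (ι (+ suc N) ℚ.* ε₀ ℚ.<_) (sym (wp x)) (ℚ.*-monoʳ-<-pos (ι (+ suc N)) {{ℚ.positive (ι-pos N)}}
            (subst (ℚ._< seq (v x) M) (ℚ.+-identityˡ ε₀) (lower M N₀≤M)))) bound
      approx m (inj₁ (ε₀ , ε₀>0 , N₀ , upper)) =
        let M , N₀≤M , N , w , wp , bound = sample m ε₀ ε₀>0 N₀
        in conclude m N ε₀ w (- w x) ε₀>0 (inj₂ refl)
          (subst (ι (+ suc N) ℚ.* ε₀ ℚ.<_)
            (trans (sym (ℚ.neg-distribʳ-* (ι (+ suc N)) (seq (v x) M))) (trans (cong ℚ.-_ (sym (wp x))) (sym (ι-neg (w x)))))
            (ℚ.*-monoʳ-<-pos (ι (+ suc N)) {{ℚ.positive (ι-pos N)}} (below (seq (v x) M) ε₀ (upper M N₀≤M)))) bound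
        where
        below : ∀ p ε → p ℚ.+ ε ℚ.< 0ℚ → ε ℚ.< ℚ.- p
        below p ε lt = subst₂ ℚ._<_ (trans (sym (ℚ.+-assoc (ℚ.- p) p ε))
            (trans (cong (ℚ._+ ε) (ℚ.+-inverseˡ p)) (ℚ.+-identityˡ ε))) (ℚ.+-identityʳ (ℚ.- p))
          (ℚ.+-monoʳ-< (ℚ.- p) lt)

-- The quadratic equation satisfied by a₃

module IntegralEigenvalues where
  open IntegerSums
  open DistanceSchemes
  open ApproximateEigenvectors
  open import Data.Nat.Tactic.RingSolver renaming (solve-∀ to ℕ-solve-∀)

  private
    abs-bound : ∀ {x s} → x < s → - x < s → ℤ.∣ x ∣ ℕ.≤ ℤ.∣ s ∣
    abs-bound {+ zero}   {s}      _       _       = z≤n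
    abs-bound {+ suc m}  {+ s}    (+<+ p) _       = ℕ.<⇒≤ p
    abs-bound { -[1+ m ]} {+ s}   _       (+<+ p) = ℕ.<⇒≤ p

  module _ {n} (Γ : Graph (Fin n)) {π : Parameters} (S : Scheme n π) where
    open Scheme S
    open Parameters π

    private
     module Bound (x : Fin n) (m : ℕ) (v : Fin n → ℤ) (s : ℤ) (sign : s ≡ v x ⊎ s ≡ - v x) (s>0 : 0ℤ < s)
        (small : ∀ i → + suc m * residual Γ S a₃ v i < s × - (+ suc m * residual Γ S a₃ v i) < s) where
      X = b₂ * (k + a₁ * a₃ - a₃ * a₃)
      C₁ = ℤ.∣ b₂ ∣
      C₀ = ℤ.∣ b₂ * (a₁ - a₃) ∣
      C₃ = ℤ.∣ c₂ ∣
      W = ℤ.∣ s ∣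
      r = residual Γ S a₃ v

      average : (Fin 4 → ℤ) → (Fin n → ℤ) → ℤ
      average f g = sum (λ y → f (d x y) * g y)

      -- Averaging over the spheres about x turns the eigenvalue equation on n vertices into a
      -- tridiagonal system of order 4 for `ω`, with `ρ` as the error term.
      ρ ω : Fin 4 → ℤ
      ρ j = average (δ j) r
      ω j = average (δ j) v

      average-r : ∀ j → ρ j ≡ average (T π (δ j)) v - a₃ * ω j
      average-r j = trans (sum-combination
          ((1ℤ , λ y → δ j (d x y) * sum (λ z → δ 1F (d y z) * v z)) ∷ (- a₃ , λ y → δ j (d x y) * v y) ∷ [])
          (λ y → shape (δ j (d x y)) (sum (λ z → δ 1F (d y z) * v z)) a₃ (v y)))
        (trans (cong (λ e → 1ℤ * e + (- a₃ * ω j + 0ℤ)) exchange) (shape′ (average (T π (δ j)) v) a₃ (ω j)))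
        where
        shape : ∀ p q a t → p * (q - a * t) ≡ 1ℤ * (p * q) + (- a * (p * t) + 0ℤ)
        shape = solve-∀
        shape′ : ∀ q a t → 1ℤ * q + (- a * t + 0ℤ) ≡ q - a * t
        shape′ = solve-∀
        exchange : sum (λ y → δ j (d x y) * sum (λ z → δ 1F (d y z) * v z)) ≡ average (T π (δ j)) v
        exchange = trans (sum-cong-≗ (λ y → trans (*-distribˡ-sum (δ j (d x y)) (λ z → δ 1F (d y z) * v z))
            (sum-cong-≗ (λ z → trans (cong (λ e → δ j (d x y) * (δ 1F e * v z)) (d-sym y z))
              (shape″ (δ j (d x y)) (δ 1F (d z y)) (v z))))))
          (trans (∑-comm (λ y z → δ 1F (d z y) * δ j (d x y) * v z))
            (sum-cong-≗ (λ z → trans (sym (*-distribʳ-sum (v z) (λ y → δ 1F (d z y) * δ j (d x y))))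
              (cong (_* v z) (neighbours (δ j) x z)))))
          where
          shape″ : ∀ p q t → p * (q * t) ≡ q * p * t
          shape″ = solve-∀

      ω₀ : ω 0F ≡ v x
      ω₀ = trans (sum-cong-≗ pointwise) (sum-δ x v)
        where
        pointwise : ∀ y → δ 0F (d x y) * v y ≡ δ x y * v y
        pointwise y with x Fin.≟ y
        ... | yes refl rewrite d-refl x | δ-refl x = refl
        ... | no x≢y = cong (_* v y) (trans (δ-≢ (λ e → x≢y (d-zero (sym e)))) (sym (δ-≢ x≢y)))

      T-average : ∀ j f → (∀ i → T π (δ j) i ≡ f i) → average (T π (δ j)) v ≡ average f v
      T-average j f p = sum-cong-≗ (λ y → cong (_* v y) (p (d x y)))

      row₀ : average (T π (δ 0F)) v ≡ ω 1F
      row₀ = T-average 0F (δ 1F) λ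
        { 0F → e₁ k ; 1F → e₂ a₁ b₁ ; 2F → e₃ c₂ a₂ b₂ ; 3F → e₄ c₃ a₃ }
        where
        e₁ : ∀ p → p * 0ℤ ≡ 0ℤ
        e₁ = solve-∀
        e₂ : ∀ p q → 1ℤ + p * 0ℤ + q * 0ℤ ≡ 1ℤ
        e₂ = solve-∀
        e₃ : ∀ p q r → p * 0ℤ + q * 0ℤ + r * 0ℤ ≡ 0ℤ
        e₃ = solve-∀
        e₄ : ∀ p q → p * 0ℤ + q * 0ℤ ≡ 0ℤ
        e₄ = solve-∀

      row₁ : average (T π (δ 1F)) v ≡ k * ω 0F + (a₁ * ω 1F + (c₂ * ω 2F + 0ℤ))
      row₁ = sum-combination ((k , λ y → δ 0F (d x y) * v y) ∷ (a₁ , λ y → δ 1F (d x y) * v y) ∷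
        (c₂ , λ y → δ 2F (d x y) * v y) ∷ []) (λ y → pointwise (d x y) (v y))
        where
        e₁ : ∀ k a c t → k * 1ℤ * t ≡ k * (1ℤ * t) + (a * (0ℤ * t) + (c * (0ℤ * t) + 0ℤ))
        e₁ = solve-∀
        e₂ : ∀ k a c b t → (0ℤ + a * 1ℤ + b * 0ℤ) * t ≡ k * (0ℤ * t) + (a * (1ℤ * t) + (c * (0ℤ * t) + 0ℤ))
        e₂ = solve-∀
        e₃ : ∀ k a c p q t → (c * 1ℤ + p * 0ℤ + q * 0ℤ) * t ≡ k * (0ℤ * t) + (a * (0ℤ * t) + (c * (1ℤ * t) + 0ℤ))
        e₃ = solve-∀
        e₄ : ∀ k a c p q t → (p * 0ℤ + q * 0ℤ) * t ≡ k * (0ℤ * t) + (a * (0ℤ * t) + (c * (0ℤ * t) + 0ℤ))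
        e₄ = solve-∀
        pointwise : ∀ i t → T π (δ 1F) i * t ≡ k * (δ 0F i * t) + (a₁ * (δ 1F i * t) + (c₂ * (δ 2F i * t) + 0ℤ))
        pointwise 0F t = e₁ k a₁ c₂ t
        pointwise 1F t = e₂ k a₁ c₂ b₁ t
        pointwise 2F t = e₃ k a₁ c₂ a₂ b₂ t
        pointwise 3F t = e₄ k a₁ c₂ c₃ a₃ t

      row₃ : average (T π (δ 3F)) v ≡ b₂ * ω 2F + (a₃ * ω 3F + 0ℤ)
      row₃ = sum-combination ((b₂ , λ y → δ 2F (d x y) * v y) ∷ (a₃ , λ y → δ 3F (d x y) * v y) ∷ [])
        (λ y → pointwise (d x y) (v y))
        where
        e₁ : ∀ b a k t → k * 0ℤ * t ≡ b * (0ℤ * t) + (a * (0ℤ * t) + 0ℤ)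
        e₁ = solve-∀
        e₂ : ∀ b a p q t → (0ℤ + p * 0ℤ + q * 0ℤ) * t ≡ b * (0ℤ * t) + (a * (0ℤ * t) + 0ℤ)
        e₂ = solve-∀
        e₃ : ∀ b a p q t → (p * 0ℤ + q * 0ℤ + b * 1ℤ) * t ≡ b * (1ℤ * t) + (a * (0ℤ * t) + 0ℤ)
        e₃ = solve-∀
        e₄ : ∀ b a p t → (p * 0ℤ + a * 1ℤ) * t ≡ b * (0ℤ * t) + (a * (1ℤ * t) + 0ℤ)
        e₄ = solve-∀
        pointwise : ∀ i t → T π (δ 3F) i * t ≡ b₂ * (δ 2F i * t) + (a₃ * (δ 3F i * t) + 0ℤ)
        pointwise 0F t = e₁ b₂ a₃ k t
        pointwise 1F t = e₂ b₂ a₃ a₁ b₁ t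
        pointwise 2F t = e₃ b₂ a₃ c₂ a₂ t
        pointwise 3F t = e₄ b₂ a₃ c₃ t

      -- The eigenvalue equals the last diagonal entry a₃, so the last equation is ρ₃ = b₂ω₂. This
      -- eliminates ω₂, the first equation eliminates ω₁, and a multiple of ω₀ = v x is left.
      R = b₂ * ρ 1F + - (b₂ * (a₁ - a₃)) * ρ 0F + - c₂ * ρ 3F

      X-R : X * v x ≡ R
      X-R = trans (cong (X *_) (sym ω₀)) (sym (combine (ω 0F) (ω 1F) (ω 2F) (ω 3F)
        (trans (average-r 0F) (cong (λ e → e - a₃ * ω 0F) row₀))
        (trans (average-r 1F) (cong (λ e → e - a₃ * ω 1F) row₁))
        (trans (average-r 3F) (cong (λ e → e - a₃ * ω 3F) row₃))))
        where
        combine : ∀ w₀ w₁ w₂ w₃ {r₀ r₁ r₃} → r₀ ≡ w₁ - a₃ * w₀ →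
          r₁ ≡ k * w₀ + (a₁ * w₁ + (c₂ * w₂ + 0ℤ)) - a₃ * w₁ →
          r₃ ≡ b₂ * w₂ + (a₃ * w₃ + 0ℤ) - a₃ * w₃ →
          b₂ * r₁ + - (b₂ * (a₁ - a₃)) * r₀ + - c₂ * r₃ ≡ X * w₀
        combine w₀ w₁ w₂ w₃ refl refl refl = shape k a₁ a₃ b₂ c₂ w₀ w₁ w₂ w₃
          where
          shape : ∀ k p q b c w₀ w₁ w₂ w₃ →
            b * (k * w₀ + (p * w₁ + (c * w₂ + 0ℤ)) - q * w₁) + - (b * (p - q)) * (w₁ - q * w₀)
              + - c * (b * w₂ + (q * w₃ + 0ℤ) - q * w₃) ≡ b * (k + p * q - q * q) * w₀
          shape = solve-∀

      ∣v∣ : ℤ.∣ v x ∣ ≡ W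
      ∣v∣ = from sign
        where
        from : s ≡ v x ⊎ s ≡ - v x → ℤ.∣ v x ∣ ≡ ℤ.∣ s ∣
        from (inj₁ e) = cong ℤ.∣_∣ (sym e)
        from (inj₂ e) = sym (trans (cong ℤ.∣_∣ e) (ℤ.∣-i∣≡∣i∣ (v x)))

      r-bound : ∀ y → suc m ℕ.* ℤ.∣ r y ∣ ℕ.≤ W
      r-bound y = subst (ℕ._≤ W) (ℤ.abs-* (+ suc m) (r y))
        (abs-bound (proj₁ (small y)) (proj₂ (small y)))

      sum-bound : ∀ {l} (g : Fin l → ℤ) → (∀ y → suc m ℕ.* ℤ.∣ g y ∣ ℕ.≤ W) → suc m ℕ.* ℤ.∣ sum g ∣ ℕ.≤ l ℕ.* W
      sum-bound {zero}  g p = ℕ.≤-reflexive (ℕ.*-zeroʳ (suc m))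
      sum-bound {suc l} g p = begin
        suc m ℕ.* ℤ.∣ g 0F + sum (g ∘ suc) ∣              ≤⟨ ℕ.*-monoʳ-≤ (suc m) (ℤ.∣i+j∣≤∣i∣+∣j∣ (g 0F) (sum (g ∘ suc))) ⟩
        suc m ℕ.* (ℤ.∣ g 0F ∣ ℕ.+ ℤ.∣ sum (g ∘ suc) ∣)     ≡⟨ ℕ.*-distribˡ-+ (suc m) ℤ.∣ g 0F ∣ ℤ.∣ sum (g ∘ suc) ∣ ⟩
        suc m ℕ.* ℤ.∣ g 0F ∣ ℕ.+ suc m ℕ.* ℤ.∣ sum (g ∘ suc) ∣ ≤⟨ ℕ.+-mono-≤ (p 0F) (sum-bound (g ∘ suc) (p ∘ suc)) ⟩
        W ℕ.+ l ℕ.* W ∎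
        where open ℕ.≤-Reasoning

      ρ-bound : ∀ j → suc m ℕ.* ℤ.∣ ρ j ∣ ℕ.≤ n ℕ.* W
      ρ-bound j = sum-bound (λ y → δ j (d x y) * r y) (λ y → ℕ.≤-trans
        (ℕ.*-monoʳ-≤ (suc m) (δ-bound j (d x y) (r y))) (r-bound y))
        where
        δ-bound : ∀ (j i : Fin 4) t → ℤ.∣ δ j i * t ∣ ℕ.≤ ℤ.∣ t ∣
        δ-bound j i t with j Fin.≟ i
        ... | yes refl rewrite δ-refl j = ℕ.≤-reflexive (cong ℤ.∣_∣ (ℤ.*-identityˡ t))
        ... | no j≢i rewrite δ-≢ j≢i = subst (ℕ._≤ ℤ.∣ t ∣) (sym (cong ℤ.∣_∣ (ℤ.*-zeroˡ t))) z≤n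

      R-bound : suc m ℕ.* ℤ.∣ R ∣ ℕ.≤ (C₁ ℕ.+ C₀ ℕ.+ C₃) ℕ.* (n ℕ.* W)
      R-bound = begin
        suc m ℕ.* ℤ.∣ R ∣
          ≤⟨ ℕ.*-monoʳ-≤ (suc m) (ℕ.≤-trans (ℤ.∣i+j∣≤∣i∣+∣j∣ (b₂ * ρ 1F + - (b₂ * (a₁ - a₃)) * ρ 0F) (- c₂ * ρ 3F))
               (ℕ.+-monoˡ-≤ ℤ.∣ - c₂ * ρ 3F ∣ (ℤ.∣i+j∣≤∣i∣+∣j∣ (b₂ * ρ 1F) (- (b₂ * (a₁ - a₃)) * ρ 0F)))) ⟩
        suc m ℕ.* (ℤ.∣ b₂ * ρ 1F ∣ ℕ.+ ℤ.∣ - (b₂ * (a₁ - a₃)) * ρ 0F ∣ ℕ.+ ℤ.∣ - c₂ * ρ 3F ∣)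
          ≡⟨ cong (suc m ℕ.*_) (cong₂ ℕ._+_ (cong₂ ℕ._+_ (ℤ.abs-* b₂ (ρ 1F))
               (trans (ℤ.abs-* (- (b₂ * (a₁ - a₃))) (ρ 0F)) (cong (ℕ._* ℤ.∣ ρ 0F ∣) (ℤ.∣-i∣≡∣i∣ (b₂ * (a₁ - a₃))))))
               (trans (ℤ.abs-* (- c₂) (ρ 3F)) (cong (ℕ._* ℤ.∣ ρ 3F ∣) (ℤ.∣-i∣≡∣i∣ c₂)))) ⟩
        suc m ℕ.* (C₁ ℕ.* ℤ.∣ ρ 1F ∣ ℕ.+ C₀ ℕ.* ℤ.∣ ρ 0F ∣ ℕ.+ C₃ ℕ.* ℤ.∣ ρ 3F ∣)
          ≡⟨ distribute (suc m) C₁ C₀ C₃ ℤ.∣ ρ 1F ∣ ℤ.∣ ρ 0F ∣ ℤ.∣ ρ 3F ∣ ⟩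
        C₁ ℕ.* (suc m ℕ.* ℤ.∣ ρ 1F ∣) ℕ.+ C₀ ℕ.* (suc m ℕ.* ℤ.∣ ρ 0F ∣) ℕ.+ C₃ ℕ.* (suc m ℕ.* ℤ.∣ ρ 3F ∣)
          ≤⟨ ℕ.+-mono-≤ (ℕ.+-mono-≤ (ℕ.*-monoʳ-≤ C₁ (ρ-bound 1F)) (ℕ.*-monoʳ-≤ C₀ (ρ-bound 0F))) (ℕ.*-monoʳ-≤ C₃ (ρ-bound 3F)) ⟩
        C₁ ℕ.* (n ℕ.* W) ℕ.+ C₀ ℕ.* (n ℕ.* W) ℕ.+ C₃ ℕ.* (n ℕ.* W)
          ≡⟨ collect C₁ C₀ C₃ (n ℕ.* W) ⟩
        (C₁ ℕ.+ C₀ ℕ.+ C₃) ℕ.* (n ℕ.* W) ∎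
        where
        open ℕ.≤-Reasoning
        distribute : ∀ m p q r x y z → m ℕ.* (p ℕ.* x ℕ.+ q ℕ.* y ℕ.+ r ℕ.* z) ≡
          p ℕ.* (m ℕ.* x) ℕ.+ q ℕ.* (m ℕ.* y) ℕ.+ r ℕ.* (m ℕ.* z)
        distribute = ℕ-solve-∀
        collect : ∀ p q r w → p ℕ.* w ℕ.+ q ℕ.* w ℕ.+ r ℕ.* w ≡ (p ℕ.+ q ℕ.+ r) ℕ.* w
        collect = ℕ-solve-∀

      W-nonZero : ℕ.NonZero W
      W-nonZero = nz s s>0
        where
        nz : ∀ s → 0ℤ < s → ℕ.NonZero ℤ.∣ s ∣
        nz (+ suc s) _ = _
        nz (+ zero) (+<+ ())

      X-bound : suc m ℕ.* ℤ.∣ X ∣ ℕ.≤ (C₁ ℕ.+ C₀ ℕ.+ C₃) ℕ.* n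
      X-bound = ℕ.*-cancelʳ-≤ (suc m ℕ.* ℤ.∣ X ∣) ((C₁ ℕ.+ C₀ ℕ.+ C₃) ℕ.* n) W {{W-nonZero}} (begin
        suc m ℕ.* ℤ.∣ X ∣ ℕ.* W     ≡⟨ ℕ.*-assoc (suc m) ℤ.∣ X ∣ W ⟩
        suc m ℕ.* (ℤ.∣ X ∣ ℕ.* W)   ≡⟨ cong (λ w → suc m ℕ.* (ℤ.∣ X ∣ ℕ.* w)) (sym ∣v∣) ⟩
        suc m ℕ.* (ℤ.∣ X ∣ ℕ.* ℤ.∣ v x ∣) ≡⟨ cong (suc m ℕ.*_) (trans (sym (ℤ.abs-* X (v x))) (cong ℤ.∣_∣ X-R)) ⟩
        suc m ℕ.* ℤ.∣ R ∣           ≤⟨ R-bound ⟩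
        (C₁ ℕ.+ C₀ ℕ.+ C₃) ℕ.* (n ℕ.* W)             ≡⟨ ℕ.*-assoc (C₁ ℕ.+ C₀ ℕ.+ C₃) n W ⟨
        (C₁ ℕ.+ C₀ ℕ.+ C₃) ℕ.* n ℕ.* W                     ∎)
        where open ℕ.≤-Reasoning

     squeeze : ∀ m X → suc m ℕ.* ℤ.∣ X ∣ ℕ.≤ m → X ≡ 0ℤ
     squeeze m X p = go ℤ.∣ X ∣ refl p
       where
       go : ∀ t → ℤ.∣ X ∣ ≡ t → suc m ℕ.* t ℕ.≤ m → X ≡ 0ℤ
       go zero    eq _ = ℤ.∣i∣≡0⇒i≡0 eq
       go (suc t) eq p = contradiction (ℕ.≤-trans (ℕ.m≤m*n (suc m) (suc t)) p) (ℕ.<-irrefl refl)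

    -- Both sides of the estimate scale with |v x|, so (m + 1)|b₂(k + a₁a₃ - a₃²)| is bounded
    -- independently of m and of the approximating vector. Taking m equal to that bound forces the
    -- integer to vanish.
    approximate-eigenvalue⇒quadratic : b₂ ≢ 0ℤ → ApproximateEigenvalue Γ S a₃ → k + a₁ * a₃ - a₃ * a₃ ≡ 0ℤ
    approximate-eigenvalue⇒quadratic b₂≢0 (x , approx) = conclude (ℤ.i*j≡0⇒i≡0∨j≡0 b₂ X≡0)
      where
      m = (ℤ.∣ b₂ ∣ ℕ.+ ℤ.∣ b₂ * (a₁ - a₃) ∣ ℕ.+ ℤ.∣ c₂ ∣) ℕ.* n
      X≡0 : b₂ * (k + a₁ * a₃ - a₃ * a₃) ≡ 0ℤ
      X≡0 = let v , s , sign , s>0 , small = approx m in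
        squeeze m _ (Bound.X-bound x m v s sign s>0 small)
      conclude : b₂ ≡ 0ℤ ⊎ k + a₁ * a₃ - a₃ * a₃ ≡ 0ℤ → k + a₁ * a₃ - a₃ * a₃ ≡ 0ℤ
      conclude (inj₁ b₂≡0) = contradiction b₂≡0 b₂≢0
      conclude (inj₂ e)    = e

-- The Bose-Mesner algebra and forms on combinations of vertices

module BoseMesnerAlgebra where
  open IntegerSums
  open DistanceSchemes

  module BoseMesner {n : ℕ} {π : Parameters} (S : Scheme n π) where
    open Parameters π
    open Scheme S

    sphere : Fin 4 → (Fin 4 → ℤ) → Fin n → Fin n → ℤ
    sphere i g x y = sum (λ z → δ i (d x z) * g (d y z))

    -- The actions of c₂A₂ and c₂c₃A₃, from the three-term recurrences for AA₁ and AA₂; keeping the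
    -- factors avoids division.
    S₂ S₃ : (Fin 4 → ℤ) → Fin 4 → ℤ
    S₂ g i = T π (T π g) i - a₁ * T π g i - k * g i
    S₃ g i = T π (S₂ g) i - a₂ * S₂ g i - c₂ * b₁ * T π g i

    δ0-d : ∀ x z → δ 0F (d x z) ≡ δ x z
    δ0-d x z with x Fin.≟ z
    ... | yes refl rewrite d-refl x = sym (δ-refl x)
    ... | no x≢z = trans (δ-≢ (λ e → x≢z (d-zero (sym e)))) (sym (δ-≢ x≢z))

    sphere-0 : ∀ g x y → sphere 0F g x y ≡ g (d y x)
    sphere-0 g x y = trans (sum-cong-≗ (λ z → cong (_* g (d y z)) (δ0-d x z))) (sum-δ x (λ z → g (d y z)))

    sphere-1 : ∀ g x y → sphere 1F g x y ≡ T π g (d y x)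
    sphere-1 g x y = neighbours g y x

    private
      swap : ∀ (h f : Fin n → Fin n → ℤ) (g : Fin n → ℤ) x →
        sum (λ u → h x u * sum (λ z → f u z * g z)) ≡ sum (λ z → sum (λ u → h x u * f u z) * g z)
      swap h f g x = trans (sum-cong-≗ (λ u → trans (*-distribˡ-sum (h x u) (λ z → f u z * g z))
          (sum-cong-≗ (λ z → sym (ℤ.*-assoc (h x u) (f u z) (g z))))))
        (trans (∑-comm (λ u z → h x u * f u z * g z))
          (sum-cong-≗ (λ z → sym (*-distribʳ-sum (g z) (λ u → h x u * f u z)))))

    step : ∀ (f g : Fin 4 → ℤ) x y →
      sum (λ u → δ 1F (d x u) * sum (λ z → f (d u z) * g (d y z))) ≡ sum (λ z → T π f (d x z) * g (d y z))
    step f g x y = trans (swap (λ x u → δ 1F (d x u)) (λ u z → f (d u z)) (λ z → g (d y z)) x)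
      (sum-cong-≗ (λ z → cong (_* g (d y z)) (trans (sum-cong-≗ (λ u → cong (λ e → δ 1F (d x u) * f e) (d-sym u z)))
        (trans (neighbours f z x) (cong (T π f) (d-sym z x))))))

    sphere-2 : ∀ g x y → c₂ * sphere 2F g x y ≡ S₂ g (d y x)
    sphere-2 g x y = final (T π (T π g) (d y x)) (sphere 0F g x y) (sphere 1F g x y) (sphere 2F g x y)
      (trans (sym lhs) rhs) (sphere-0 g x y) (sphere-1 g x y)
      where
      lhs : sum (λ u → δ 1F (d x u) * sphere 1F g u y) ≡ T π (T π g) (d y x)
      lhs = trans (sum-cong-≗ (λ u → cong (δ 1F (d x u) *_) (sphere-1 g u y))) (neighbours (T π g) y x)
      T-δ1 : ∀ i m → T π (δ 1F) i * m ≡ k * (δ 0F i * m) + (a₁ * (δ 1F i * m) + (c₂ * (δ 2F i * m) + 0ℤ))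
      T-δ1 0F m = shape k a₁ c₂ m
        where
        shape : ∀ k a c m → k * 1ℤ * m ≡ k * (1ℤ * m) + (a * (0ℤ * m) + (c * (0ℤ * m) + 0ℤ))
        shape = solve-∀
      T-δ1 1F m = shape k a₁ c₂ b₁ m
        where
        shape : ∀ k a c b m → (0ℤ + a * 1ℤ + b * 0ℤ) * m ≡ k * (0ℤ * m) + (a * (1ℤ * m) + (c * (0ℤ * m) + 0ℤ))
        shape = solve-∀
      T-δ1 2F m = shape k a₁ c₂ a₂ b₂ m
        where
        shape : ∀ k a c p q m → (c * 1ℤ + p * 0ℤ + q * 0ℤ) * m ≡ k * (0ℤ * m) + (a * (0ℤ * m) + (c * (1ℤ * m) + 0ℤ))
        shape = solve-∀
      T-δ1 3F m = shape k a₁ c₂ c₃ a₃ m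
        where
        shape : ∀ k a c p q m → (p * 0ℤ + q * 0ℤ) * m ≡ k * (0ℤ * m) + (a * (0ℤ * m) + (c * (0ℤ * m) + 0ℤ))
        shape = solve-∀
      rhs : sum (λ u → δ 1F (d x u) * sphere 1F g u y) ≡
        k * sphere 0F g x y + (a₁ * sphere 1F g x y + (c₂ * sphere 2F g x y + 0ℤ))
      rhs = trans (step (δ 1F) g x y) (sum-combination
        ((k , λ z → δ 0F (d x z) * g (d y z)) ∷ (a₁ , λ z → δ 1F (d x z) * g (d y z)) ∷
         (c₂ , λ z → δ 2F (d x z) * g (d y z)) ∷ []) (λ z → T-δ1 (d x z) (g (d y z))))
      final : ∀ t p q r → t ≡ k * p + (a₁ * q + (c₂ * r + 0ℤ)) → p ≡ g (d y x) → q ≡ T π g (d y x) →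
        c₂ * r ≡ t - a₁ * T π g (d y x) - k * g (d y x)
      final t p q r refl refl refl = shape k a₁ c₂ p q r
        where
        shape : ∀ k a c p q r → c * r ≡ k * p + (a * q + (c * r + 0ℤ)) - a * q - k * p
        shape = solve-∀

    sphere-3 : ∀ g x y → c₂ * c₃ * sphere 3F g x y ≡ S₃ g (d y x)
    sphere-3 g x y = final (T π (S₂ g) (d y x)) (sphere 1F g x y) (sphere 2F g x y) (sphere 3F g x y)
      (trans (sym lhs) (cong (c₂ *_) rhs)) (sphere-1 g x y) (sphere-2 g x y)
      where
      lhs : c₂ * sum (λ u → δ 1F (d x u) * sphere 2F g u y) ≡ T π (S₂ g) (d y x)
      lhs = trans (*-distribˡ-sum c₂ (λ u → δ 1F (d x u) * sphere 2F g u y))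
        (trans (sum-cong-≗ (λ u → trans (shape c₂ (δ 1F (d x u)) (sphere 2F g u y))
          (cong (δ 1F (d x u) *_) (sphere-2 g u y)))) (neighbours (S₂ g) y x))
        where
        shape : ∀ c p q → c * (p * q) ≡ p * (c * q)
        shape = solve-∀
      T-δ2 : ∀ i m → T π (δ 2F) i * m ≡ b₁ * (δ 1F i * m) + (a₂ * (δ 2F i * m) + (c₃ * (δ 3F i * m) + 0ℤ))
      T-δ2 0F m = shape k b₁ a₂ c₃ m
        where
        shape : ∀ k b a c m → k * 0ℤ * m ≡ b * (0ℤ * m) + (a * (0ℤ * m) + (c * (0ℤ * m) + 0ℤ))
        shape = solve-∀
      T-δ2 1F m = shape a₁ b₁ a₂ c₃ m
        where
        shape : ∀ p b a c m → (0ℤ + p * 0ℤ + b * 1ℤ) * m ≡ b * (1ℤ * m) + (a * (0ℤ * m) + (c * (0ℤ * m) + 0ℤ))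
        shape = solve-∀
      T-δ2 2F m = shape c₂ b₂ b₁ a₂ c₃ m
        where
        shape : ∀ p q b a c m → (p * 0ℤ + a * 1ℤ + q * 0ℤ) * m ≡ b * (0ℤ * m) + (a * (1ℤ * m) + (c * (0ℤ * m) + 0ℤ))
        shape = solve-∀
      T-δ2 3F m = shape a₃ b₁ a₂ c₃ m
        where
        shape : ∀ q b a c m → (c * 1ℤ + q * 0ℤ) * m ≡ b * (0ℤ * m) + (a * (0ℤ * m) + (c * (1ℤ * m) + 0ℤ))
        shape = solve-∀
      rhs : sum (λ u → δ 1F (d x u) * sphere 2F g u y) ≡
        b₁ * sphere 1F g x y + (a₂ * sphere 2F g x y + (c₃ * sphere 3F g x y + 0ℤ))
      rhs = trans (step (δ 2F) g x y) (sum-combination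
        ((b₁ , λ z → δ 1F (d x z) * g (d y z)) ∷ (a₂ , λ z → δ 2F (d x z) * g (d y z)) ∷
         (c₃ , λ z → δ 3F (d x z) * g (d y z)) ∷ []) (λ z → T-δ2 (d x z) (g (d y z))))
      final : ∀ t p q r → t ≡ c₂ * (b₁ * p + (a₂ * q + (c₃ * r + 0ℤ))) → p ≡ T π g (d y x) →
        c₂ * q ≡ S₂ g (d y x) → c₂ * c₃ * r ≡ t - a₂ * S₂ g (d y x) - c₂ * b₁ * T π g (d y x)
      final t p q r refl refl e = subst (λ s → c₂ * c₃ * r ≡ c₂ * (b₁ * p + (a₂ * q + (c₃ * r + 0ℤ))) - a₂ * s - c₂ * b₁ * p)
        e (shape b₁ a₂ c₃ c₂ p q r)
        where
        shape : ∀ b a c c₂ p q r → c₂ * c * r ≡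
          c₂ * (b * p + (a * q + (c * r + 0ℤ))) - a * (c₂ * q) - c₂ * b * p
        shape = solve-∀

    spheres : ∀ (f g : Fin 4 → ℤ) x y → sum (λ z → f (d x z) * g (d y z)) ≡
      f 0F * sphere 0F g x y + (f 1F * sphere 1F g x y + (f 2F * sphere 2F g x y + (f 3F * sphere 3F g x y + 0ℤ)))
    spheres f g x y = sum-combination
      ((f 0F , λ z → δ 0F (d x z) * g (d y z)) ∷ (f 1F , λ z → δ 1F (d x z) * g (d y z)) ∷
       (f 2F , λ z → δ 2F (d x z) * g (d y z)) ∷ (f 3F , λ z → δ 3F (d x z) * g (d y z)) ∷ [])
      (λ z → pointwise (d x z) (g (d y z)))
      where
      s₀ : ∀ m p q r s → p * m ≡ p * (1ℤ * m) + (q * (0ℤ * m) + (r * (0ℤ * m) + (s * (0ℤ * m) + 0ℤ)))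
      s₀ = solve-∀
      s₁ : ∀ m p q r s → q * m ≡ p * (0ℤ * m) + (q * (1ℤ * m) + (r * (0ℤ * m) + (s * (0ℤ * m) + 0ℤ)))
      s₁ = solve-∀
      s₂ : ∀ m p q r s → r * m ≡ p * (0ℤ * m) + (q * (0ℤ * m) + (r * (1ℤ * m) + (s * (0ℤ * m) + 0ℤ)))
      s₂ = solve-∀
      s₃ : ∀ m p q r s → s * m ≡ p * (0ℤ * m) + (q * (0ℤ * m) + (r * (0ℤ * m) + (s * (1ℤ * m) + 0ℤ)))
      s₃ = solve-∀
      pointwise : ∀ j m → f j * m ≡
        f 0F * (δ 0F j * m) + (f 1F * (δ 1F j * m) + (f 2F * (δ 2F j * m) + (f 3F * (δ 3F j * m) + 0ℤ)))
      pointwise 0F m = s₀ m (f 0F) (f 1F) (f 2F) (f 3F)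
      pointwise 1F m = s₁ m (f 0F) (f 1F) (f 2F) (f 3F)
      pointwise 2F m = s₂ m (f 0F) (f 1F) (f 2F) (f 3F)
      pointwise 3F m = s₃ m (f 0F) (f 1F) (f 2F) (f 3F)

    -- c₂c₃ times the product of Σ fᵢAᵢ and Σ gᵢAᵢ in the Bose-Mesner algebra, as a function of the
    -- distance.
    convolution : (f g : Fin 4 → ℤ) → Fin 4 → ℤ
    convolution f g i = c₂ * c₃ * f 0F * g i + c₂ * c₃ * f 1F * T π g i + c₃ * f 2F * S₂ g i + f 3F * S₃ g i

    product : ∀ (f g : Fin 4 → ℤ) x y →
      c₂ * c₃ * sum (λ z → f (d x z) * g (d y z)) ≡ convolution f g (d x y)
    product f g x y = subst (λ i → c₂ * c₃ * sum (λ z → f (d x z) * g (d y z)) ≡ convolution f g i) (d-sym y x)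
      (final (f 0F) (f 1F) (f 2F) (f 3F) (spheres f g x y) (sphere-0 g x y) (sphere-1 g x y) (sphere-2 g x y) (sphere-3 g x y))
      where
      i = d y x
      final : ∀ f₀ f₁ f₂ f₃ {m p₀ p₁ p₂ p₃} → m ≡ f₀ * p₀ + (f₁ * p₁ + (f₂ * p₂ + (f₃ * p₃ + 0ℤ))) →
        p₀ ≡ g i → p₁ ≡ T π g i → c₂ * p₂ ≡ S₂ g i → c₂ * c₃ * p₃ ≡ S₃ g i →
        c₂ * c₃ * m ≡ c₂ * c₃ * f₀ * g i + c₂ * c₃ * f₁ * T π g i + c₃ * f₂ * S₂ g i + f₃ * S₃ g i
      final f₀ f₁ f₂ f₃ {m} {p₀} {p₁} {p₂} {p₃} refl refl refl e₂ e₃ =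
        trans (shape c₂ c₃ f₀ f₁ f₂ f₃ p₀ p₁ p₂ p₃)
          (cong₂ (λ s t → c₂ * c₃ * f₀ * p₀ + c₂ * c₃ * f₁ * p₁ + c₃ * f₂ * s + f₃ * t) e₂ e₃)
        where
        shape : ∀ c c′ f₀ f₁ f₂ f₃ p₀ p₁ p₂ p₃ →
          c * c′ * (f₀ * p₀ + (f₁ * p₁ + (f₂ * p₂ + (f₃ * p₃ + 0ℤ)))) ≡
          c * c′ * f₀ * p₀ + c * c′ * f₁ * p₁ + c′ * f₂ * (c * p₂) + f₃ * (c * c′ * p₃)
        shape = solve-∀

  -- Formal integer combinations of points, with the bilinear form given by a function of the distance.
  module Form {n : ℕ} {π : Parameters} (S : Scheme n π) (u : Fin 4 → ℤ) where
    open Scheme S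

    Vect : Set
    Vect = List (ℤ × Fin n)

    infix 8 _·_
    _·_ : Vect → Fin n → ℤ
    [] · z = 0ℤ
    ((m , x) ∷ v) · z = m * u (d x z) + v · z

    infix 8 _●_
    _●_ : Vect → Vect → ℤ
    v ● [] = 0ℤ
    v ● ((m , y) ∷ w) = m * v · y + v ● w

    scale : ℤ → Vect → Vect
    scale c []            = []
    scale c ((m , x) ∷ v) = (c * m , x) ∷ scale c v

    scale-· : ∀ c v z → scale c v · z ≡ c * v · z
    scale-· c []            z = sym (ℤ.*-zeroʳ c)
    scale-· c ((m , x) ∷ v) z = trans (cong (_+_ (c * m * u (d x z))) (scale-· c v z)) (shape c m (u (d x z)) (v · z))
      where
      shape : ∀ c m p q → c * m * p + c * q ≡ c * (m * p + q)
      shape = solve-∀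

    ++-· : ∀ v w z → (v ++ w) · z ≡ v · z + w · z
    ++-· []            w z = sym (ℤ.+-identityˡ (w · z))
    ++-· ((m , x) ∷ v) w z = trans (cong (_+_ (m * u (d x z))) (++-· v w z)) (sym (ℤ.+-assoc (m * u (d x z)) (v · z) (w · z)))

    ●-scale : ∀ v c w → v ● scale c w ≡ c * v ● w
    ●-scale v c []            = sym (ℤ.*-zeroʳ c)
    ●-scale v c ((m , y) ∷ w) = trans (cong (_+_ (c * m * v · y)) (●-scale v c w)) (shape c m (v · y) (v ● w))
      where
      shape : ∀ c m p q → c * m * p + c * q ≡ c * (m * p + q)
      shape = solve-∀

    ●-++ : ∀ v w w′ → v ● (w ++ w′) ≡ v ● w + v ● w′
    ●-++ v []            w′ = sym (ℤ.+-identityˡ (v ● w′))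
    ●-++ v ((m , y) ∷ w) w′ = trans (cong (_+_ (m * v · y)) (●-++ v w w′)) (sym (ℤ.+-assoc (m * v · y) (v ● w) (v ● w′)))

    module Positive (κ : ℤ) (κ>0 : 0ℤ < κ)
      (idem : ∀ x y → sum (λ z → u (d x z) * u (d y z)) ≡ κ * u (d x y)) where

      -- Idempotence up to κ makes κ times the form the standard inner product of the vectors of
      -- values on all vertices. Symmetry, nonnegativity and the vanishing of null combinations are
      -- read off from this.
      pairing : ∀ v w → sum (λ z → v · z * w · z) ≡ κ * (v ● w)
      pairing v [] = trans (sum-zero {n} _ (λ z → ℤ.*-zeroʳ (v · z))) (sym (ℤ.*-zeroʳ κ))
      pairing v ((m , y) ∷ w) = trans (sum-combination
          ((m , λ z → v · z * u (d y z)) ∷ (1ℤ , λ z → v · z * w · z) ∷ [])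
          (λ z → shape m (v · z) (u (d y z)) (w · z)))
        (trans (cong₂ (λ s t → m * s + (1ℤ * t + 0ℤ)) (point v) (pairing v w)) (shape′ m κ (v · y) (v ● w)))
        where
        shape : ∀ m p q r → p * (m * q + r) ≡ m * (p * q) + (1ℤ * (p * r) + 0ℤ)
        shape = solve-∀
        shape′ : ∀ m κ p q → m * (κ * p) + (1ℤ * (κ * q) + 0ℤ) ≡ κ * (m * p + q)
        shape′ = solve-∀
        point : ∀ v → sum (λ z → v · z * u (d y z)) ≡ κ * v · y
        point [] = trans (sum-zero {n} _ (λ z → ℤ.*-zeroˡ (u (d y z)))) (sym (ℤ.*-zeroʳ κ))
        point ((m , x) ∷ v) = trans (sum-combination
            ((m , λ z → u (d x z) * u (d y z)) ∷ (1ℤ , λ z → v · z * u (d y z)) ∷ [])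
            (λ z → shape″ m (u (d x z)) (v · z) (u (d y z))))
          (trans (cong₂ (λ s t → m * s + (1ℤ * t + 0ℤ)) (idem x y) (point v)) (shape′ m κ (u (d x y)) (v · y)))
          where
          shape″ : ∀ m p q r → (m * p + q) * r ≡ m * (p * r) + (1ℤ * (q * r) + 0ℤ)
          shape″ = solve-∀

      ●-sym : ∀ v w → v ● w ≡ w ● v
      ●-sym v w = cancel-positive-≡ κ>0 (trans (sym (pairing v w))
        (trans (sum-cong-≗ (λ z → ℤ.*-comm (v · z) (w · z))) (pairing w v)))

      nonneg : ∀ v → 0ℤ ≤ v ● v
      nonneg v = cancel-positive-≤ κ>0 (subst (0ℤ ≤_) (pairing v v)
        (sum-nonneg _ (λ z → square-nonneg (v · z))))

      null : ∀ v → v ● v ≡ 0ℤ → ∀ z → v · z ≡ 0ℤ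
      null v e z = square≡0 _ (sum-nonneg-zero (λ z → v · z * v · z) (λ z → square-nonneg (v · z))
        (trans (pairing v v) (trans (cong (κ *_) e) (ℤ.*-zeroʳ κ))) z)

-- Parameters for b = 2: divisibility, multiplicity and claws

module ParameterBounds where
  open IntegerSums
  open DistanceSchemes
  open BoseMesnerAlgebra
  open import Relation.Nullary.Decidable using (True)

  Triangle : Fin 4 → Fin 4 → Fin 4 → Set
  Triangle i j k = toℕ i ℕ.≤ toℕ j ℕ.+ toℕ k × toℕ j ℕ.≤ toℕ i ℕ.+ toℕ k × toℕ k ℕ.≤ toℕ i ℕ.+ toℕ j

  Triangle? : ∀ i j k → Dec (Triangle i j k)
  Triangle? i j k = (toℕ i ℕ.≤? toℕ j ℕ.+ toℕ k) ×-dec (toℕ j ℕ.≤? toℕ i ℕ.+ toℕ k) ×-dec (toℕ k ℕ.≤? toℕ i ℕ.+ toℕ j)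

  module _ {P : Fin 4 → Fin 4 → Set} (P? : ∀ p q → Dec (P p q)) where
    finite₂ : {True (Fin.all? λ p → Fin.all? λ q → P? p q)} → ∀ p q → P p q
    finite₂ {t} p q = toWitness t p q

  module _ {P : Fin 4 → Fin 4 → Fin 4 → Set} (P? : ∀ p q r → Dec (P p q r)) where
    finite₃ : {True (Fin.all? λ p → Fin.all? λ q → Fin.all? λ r → P? p q r)} → ∀ p q r → P p q r
    finite₃ {t} p q r = toWitness t p q r

  module _ {P : Fin 4 → Fin 4 → Fin 4 → Fin 4 → Set} (P? : ∀ p q r s → Dec (P p q r s)) where
    finite₄ : {True (Fin.all? λ p → Fin.all? λ q → Fin.all? λ r → Fin.all? λ s → P? p q r s)} →
      ∀ p q r s → P p q r s
    finite₄ {t} p q r s = toWitness t p q r s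

  module Metric {n : ℕ} {π : Parameters} (S : Scheme n π) where
    open Scheme S

    triangle : ∀ x y z → Triangle (d x y) (d x z) (d y z)
    triangle x y z =
        subst (λ i → toℕ (d x y) ℕ.≤ toℕ (d x z) ℕ.+ toℕ i) (d-sym z y) (d-tri x z y)
      , d-tri x y z
      , subst (λ i → toℕ (d y z) ℕ.≤ toℕ i ℕ.+ toℕ (d x z)) (d-sym y x) (d-tri y x z)

    triangle-at : ∀ {x y i} → d x y ≡ i → ∀ z → Triangle i (d x z) (d y z)
    triangle-at {x} {y} refl z = triangle x y z

  δδ-positive : ∀ {m m′} (i p : Fin m) (j q : Fin m′) → 0ℤ < δ i p * δ j q → p ≡ i × q ≡ j
  δδ-positive i p j q pos with i Fin.≟ p | j Fin.≟ q
  ... | yes e | yes e′ = sym e , sym e′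
  ... | no ne | _ rewrite δ-≢ ne = contradiction (subst (0ℤ <_) (ℤ.*-zeroˡ (δ j q)) pos) (ℤ.<-irrefl refl)
  ... | yes e | no ne rewrite δ-≢ ne = contradiction (subst (0ℤ <_) (ℤ.*-zeroʳ (δ i p)) pos) (ℤ.<-irrefl refl)

  module Existence {n : ℕ} {π : Parameters} (S : Scheme n π) where
    open Scheme S

    exists₂ : ∀ i j x y → 0ℤ < sum (λ z → δ i (d x z) * δ j (d y z)) → ∃[ z ] d x z ≡ i × d y z ≡ j
    exists₂ i j x y pos =
      let z , q = sum-positive (λ z → δ i (d x z) * δ j (d y z)) pos
      in z , δδ-positive i (d x z) j (d y z) q

    exists₃ : ∀ i j l x y w → 0ℤ < sum (λ z → δ i (d x z) * (δ j (d y z) * δ l (d w z))) →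
      ∃[ z ] d x z ≡ i × d y z ≡ j × d w z ≡ l
    exists₃ i j l x y w pos =
      let z , q = sum-positive (λ z → δ i (d x z) * (δ j (d y z) * δ l (d w z))) pos
      in z , split (d x z) (d y z) (d w z) q
      where
      split : ∀ p q r → 0ℤ < δ i p * (δ j q * δ l r) → p ≡ i × q ≡ j × r ≡ l
      split p q r pos with i Fin.≟ p
      ... | no ne rewrite δ-≢ ne = contradiction (subst (0ℤ <_) (ℤ.*-zeroˡ (δ j q * δ l r)) pos) (ℤ.<-irrefl refl)
      ... | yes refl = refl , δδ-positive j q l r
        (subst (0ℤ <_) (trans (cong (_* (δ j q * δ l r)) (δ-refl p)) (ℤ.*-identityˡ (δ j q * δ l r))) pos)

  -- With a₃ = a, the value b(Γ) = 2 gives a₁ = a - 2 and k = 2a; then b₁ = k - a₁ - 1 and c₃ = k -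
  -- a₃.
  shilla : ℤ → ℤ → ℤ → Parameters
  shilla a b c = record
    { k = + 2 * a ; a₁ = a - + 2 ; b₁ = a + 1ℤ ; c₂ = c
    ; a₂ = + 2 * a - b - c ; b₂ = b ; c₃ = a ; a₃ = a }

  module Eigenfunction {n : ℕ} {π : Parameters} (S : Scheme n π) (g : Fin 4 → ℤ) (θ : ℤ)
    (eigen : ∀ i → T π g i ≡ θ * g i) where
    open Parameters π
    open Scheme S
    open BoseMesner S

    -- Eigenvalues of c₂A₂ and c₂c₃A₃ on the eigenspace of θ. Convolution with an eigenfunction
    -- becomes multiplication by a scalar, which keeps the identities with symbolic parameters
    -- small.
    m₂ m₃ : ℤ
    m₂ = θ * θ - a₁ * θ - k
    m₃ = θ * m₂ - a₂ * m₂ - c₂ * b₁ * θ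

    private
      T-scale : ∀ (f : Fin 4 → ℤ) μ → (∀ i → f i ≡ μ * g i) → ∀ i → T π f i ≡ μ * (θ * g i)
      T-scale f μ p i = trans (go i) (cong (μ *_) (eigen i))
        where
        go : ∀ i → T π f i ≡ μ * T π g i
        go 0F rewrite p 1F = shape k μ (g 1F)
          where
          shape : ∀ k μ x → k * (μ * x) ≡ μ * (k * x)
          shape = solve-∀
        go 1F rewrite p 0F | p 1F | p 2F = shape a₁ b₁ μ (g 0F) (g 1F) (g 2F)
          where
          shape : ∀ p q μ x y z → μ * x + p * (μ * y) + q * (μ * z) ≡ μ * (x + p * y + q * z)
          shape = solve-∀
        go 2F rewrite p 1F | p 2F | p 3F = shape c₂ a₂ b₂ μ (g 1F) (g 2F) (g 3F)
          where
          shape : ∀ o p q μ x y z → o * (μ * x) + p * (μ * y) + q * (μ * z) ≡ μ * (o * x + p * y + q * z)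
          shape = solve-∀
        go 3F rewrite p 2F | p 3F = shape c₃ a₃ μ (g 2F) (g 3F)
          where
          shape : ∀ p q μ x y → p * (μ * x) + q * (μ * y) ≡ μ * (p * x + q * y)
          shape = solve-∀

    S₂-eigen : ∀ i → S₂ g i ≡ m₂ * g i
    S₂-eigen i = trans (cong₂ (λ s t → s - a₁ * t - k * g i) (T-scale (T π g) θ eigen i) (eigen i))
      (shape θ a₁ k (g i))
      where
      shape : ∀ θ a k x → θ * (θ * x) - a * (θ * x) - k * x ≡ (θ * θ - a * θ - k) * x
      shape = solve-∀

    S₃-eigen : ∀ i → S₃ g i ≡ m₃ * g i
    S₃-eigen i = trans (cong₂ (λ s t → s - t - c₂ * b₁ * T π g i) (T-scale (S₂ g) m₂ S₂-eigen i) (cong (a₂ *_) (S₂-eigen i)))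
      (trans (cong (λ t → m₂ * (θ * g i) - a₂ * (m₂ * g i) - c₂ * b₁ * t) (eigen i)) (shape θ m₂ a₂ (c₂ * b₁) (g i)))
      where
      shape : ∀ θ m a c x → m * (θ * x) - a * (m * x) - c * (θ * x) ≡ (θ * m - a * m - c * θ) * x
      shape = solve-∀

    product-eigen : ∀ (f : Fin 4 → ℤ) x y → c₂ * c₃ * sum (λ z → f (d x z) * g (d y z)) ≡
      (c₂ * c₃ * f 0F + c₂ * c₃ * f 1F * θ + c₃ * f 2F * m₂ + f 3F * m₃) * g (d x y)
    product-eigen f x y = trans (product f g x y) (convolution-eigen (d x y))
      where
      convolution-eigen : ∀ i → convolution f g i ≡
        (c₂ * c₃ * f 0F + c₂ * c₃ * f 1F * θ + c₃ * f 2F * m₂ + f 3F * m₃) * g i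
      convolution-eigen i = combine (c₂ * c₃ * f 0F) (c₂ * c₃ * f 1F) (c₃ * f 2F) (f 3F) (eigen i) (S₂-eigen i) (S₃-eigen i)
        where
        combine : ∀ p q r s {t₁ t₂ t₃} → t₁ ≡ θ * g i → t₂ ≡ m₂ * g i → t₃ ≡ m₃ * g i →
          p * g i + q * t₁ + r * t₂ + s * t₃ ≡ (p + q * θ + r * m₂ + s * m₃) * g i
        combine p q r s refl refl refl = shape p q r s θ m₂ m₃ (g i)
         where
         shape : ∀ p q r s θ m m′ x → p * x + q * (θ * x) + r * (m * x) + s * (m′ * x) ≡ (p + q * θ + r * m + s * m′) * x
         shape = solve-∀

  module Arithmetic {n : ℕ} (a b c : ℤ) (a>0 : 0ℤ < a) (b>0 : 0ℤ < b) (c>0 : 0ℤ < c) (S : Scheme n (shilla a b c)) where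
    open Scheme S
    open BoseMesner S
    open Metric S
    open Existence S

    π : Parameters
    π = shilla a b c

    distance-2 : ∃[ x ] ∃[ y ] d x y ≡ 2F
    distance-2 =
      let x , y , xy = far
          z , _ , xz = exists₂ 1F 2F y x (subst (0ℤ <_) (sym (trans (neighbours (δ 2F) x y)
            (trans (cong (T π (δ 2F)) xy) (shape a)))) a>0)
      in x , z , xz
      where
      shape : ∀ a → a * 1ℤ + a * 0ℤ ≡ a
      shape = solve-∀

    distance-1 : ∃[ x ] ∃[ y ] d x y ≡ 1F
    distance-1 =
      let x , y , xy = distance-2
          z , _ , xz = exists₂ 1F 1F y x (subst (0ℤ <_) (sym (trans (neighbours (δ 1F) x y)
            (trans (cong (T π (δ 1F)) xy) (shape a b c)))) c>0)
      in x , z , xz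
      where
      shape : ∀ a b c → c * 1ℤ + (+ 2 * a - b - c) * 0ℤ + b * 0ℤ ≡ c
      shape = solve-∀

    k₂ : Fin n → ℤ
    k₂ x = sphere 2F (λ _ → 1ℤ) x x

    k₂-eq : ∀ x → c * k₂ x ≡ + 2 * a * (a + 1ℤ)
    k₂-eq x = trans (sphere-2 (λ _ → 1ℤ) x x) (trans (cong (S₂ (λ _ → 1ℤ)) (d-refl x)) (shape a))
      where
      shape : ∀ a → + 2 * a * (1ℤ + (a - + 2) * 1ℤ + (a + 1ℤ) * 1ℤ) - (a - + 2) * (+ 2 * a * 1ℤ) - + 2 * a * 1ℤ ≡ + 2 * a * (a + 1ℤ)
      shape = solve-∀

    -- b is a combination of multiples of c: here c p¹₃₃ = (a + 1)b, c k₂ = 2a(a + 1), c p³₂₂ = a(2a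
    -- - b - c + 2), and ca itself. Integrality of these intersection numbers gives the quotient.
    c∣b : ∀ x → ∃[ t ] b ≡ c * t
    c∣b x = p′ - k₂ x + a + p , trans (shape a b c) (trans
        (cong₂ (λ s r → s - + 2 * a * (a + 1ℤ) + c * a + r) (sym e′) (sym e))
        (trans (cong (λ s → c * p′ - s + c * a + c * p) (sym (k₂-eq x))) (shape′ c p′ (k₂ x) a p)))
      where
      p = sphere 2F (δ 2F) (proj₁ (proj₂ far)) (proj₁ far)
      e : c * p ≡ a * (+ 2 * a - b - c + + 2)
      e = trans (sphere-2 (δ 2F) (proj₁ (proj₂ far)) (proj₁ far)) (trans (cong (S₂ (δ 2F)) (proj₂ (proj₂ far))) (shape₁ a b c))
        where
        shape₁ : ∀ a b c → (a * (c * 0ℤ + (+ 2 * a - b - c) * 1ℤ + b * 0ℤ) + a * (a * 1ℤ + a * 0ℤ)) - (a - + 2) * (a * 1ℤ + a * 0ℤ) - + 2 * a * 0ℤ ≡ a * (+ 2 * a - b - c + + 2)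
        shape₁ = solve-∀
      p′ = sphere 3F (δ 3F) (proj₁ (proj₂ distance-1)) (proj₁ distance-1)
      e′ : c * p′ ≡ (a + 1ℤ) * b
      e′ = cancel-positive-≡ a>0 (trans (shape₃ a c p′) (trans (sphere-3 (δ 3F) (proj₁ (proj₂ distance-1)) (proj₁ distance-1))
        (trans (cong (S₃ (δ 3F)) (proj₂ (proj₂ distance-1))) (shape₂ a b c))))
        where
        shape₃ : ∀ a c p → a * (c * p) ≡ c * a * p
        shape₃ = solve-∀
        shape₂ : ∀ a b c → (((+ 2 * a * (0ℤ + (a - + 2) * 0ℤ + (a + 1ℤ) * 0ℤ)) - (a - + 2) * (+ 2 * a * 0ℤ) - + 2 * a * 0ℤ) + (a - + 2) * (((+ 2 * a * 0ℤ) + (a - + 2) * (0ℤ + (a - + 2) * 0ℤ + (a + 1ℤ) * 0ℤ) + (a + 1ℤ) * (c * 0ℤ + (+ 2 * a - b - c) * 0ℤ + b * 1ℤ)) - (a - + 2) * (0ℤ + (a - + 2) * 0ℤ + (a + 1ℤ) * 0ℤ) - + 2 * a * 0ℤ) + (a + 1ℤ) * ((c * (0ℤ + (a - + 2) * 0ℤ + (a + 1ℤ) * 0ℤ) + (+ 2 * a - b - c) * (c * 0ℤ + (+ 2 * a - b - c) * 0ℤ + b * 1ℤ) + b * (a * 0ℤ + a * 1ℤ)) - (a - + 2) * (c * 0ℤ + (+ 2 * a - b - c) * 0ℤ + b * 1ℤ) - + 2 * a * 0ℤ)) - (+ 2 * a - b - c) * (((+ 2 * a * 0ℤ) + (a -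 + 2) * (0ℤ + (a - + 2) * 0ℤ + (a + 1ℤ) * 0ℤ) + (a + 1ℤ) * (c * 0ℤ + (+ 2 * a - b - c) * 0ℤ + b * 1ℤ)) - (a - + 2) * (0ℤ + (a - + 2) * 0ℤ + (a + 1ℤ) * 0ℤ) - + 2 * a * 0ℤ) - c * (a + 1ℤ) * (0ℤ + (a - + 2) * 0ℤ + (a + 1ℤ) * 0ℤ) ≡ a * ((a + 1ℤ) * b)
        shape₂ = solve-∀
      shape : ∀ a b c → b ≡ (a + 1ℤ) * b - + 2 * a * (a + 1ℤ) + c * a + a * (+ 2 * a - b - c + + 2)
      shape = solve-∀
      shape′ : ∀ c p k a q → c * p - c * k + c * a + c * q ≡ c * (p - k + a + q)
      shape′ = solve-∀

    module Ratio (t : ℤ) (b≡ct : b ≡ c * t) where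
      k₃ : Fin n → ℤ
      k₃ x = sphere 3F (λ _ → 1ℤ) x x

      k₃-eq : ∀ x → k₃ x ≡ + 2 * (a + 1ℤ) * t
      k₃-eq x = cancel-positive-≡ (*-positive c>0 a>0) (trans (sphere-3 (λ _ → 1ℤ) x x)
        (trans (cong (S₃ (λ _ → 1ℤ)) (d-refl x)) (shape a b c t b≡ct)))
        where
        row : ∀ i → T π (λ _ → 1ℤ) i ≡ + 2 * a
        row 0F = r a
          where
          r : ∀ a → + 2 * a * 1ℤ ≡ + 2 * a
          r = solve-∀
        row 1F = r a
          where
          r : ∀ a → 1ℤ + (a - + 2) * 1ℤ + (a + 1ℤ) * 1ℤ ≡ + 2 * a
          r = solve-∀
        row 2F = r a b c
          where
          r : ∀ a b c → c * 1ℤ + (+ 2 * a - b - c) * 1ℤ + b * 1ℤ ≡ + 2 * a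
          r = solve-∀
        row 3F = r a
          where
          r : ∀ a → a * 1ℤ + a * 1ℤ ≡ + 2 * a
          r = solve-∀
        module E = Eigenfunction S (λ _ → 1ℤ) (+ 2 * a) (λ i → trans (row i) (sym (ℤ.*-identityʳ (+ 2 * a))))
        shape : ∀ a′ b′ c′ t → b ≡ c * t → S₃ (λ _ → 1ℤ) 0F ≡ c * a * (+ 2 * (a + 1ℤ) * t)
        shape _ _ _ t e = trans (E.S₃-eigen 0F) (trans (s a b c) (trans (cong (λ b → + 2 * a * (a + 1ℤ) * b) e) (s′ a c t)))
          where
          s : ∀ a b c → (+ 2 * a * (+ 2 * a * (+ 2 * a) - (a - + 2) * (+ 2 * a) - + 2 * a) -
            (+ 2 * a - b - c) * (+ 2 * a * (+ 2 * a) - (a - + 2) * (+ 2 * a) - + 2 * a) - c * (a + 1ℤ) * (+ 2 * a)) * 1ℤ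
            ≡ + 2 * a * (a + 1ℤ) * b
          s = solve-∀
          s′ : ∀ a c t → + 2 * a * (a + 1ℤ) * (c * t) ≡ c * a * (+ 2 * (a + 1ℤ) * t)
          s′ = solve-∀

      order : ∀ x → + n ≡ 1ℤ + + 2 * a + k₂ x + + 2 * (a + 1ℤ) * t
      order x = trans (sym (sum-1 n)) (trans (spheres (λ _ → 1ℤ) (λ _ → 1ℤ) x x)
        (final (sphere-0 (λ _ → 1ℤ) x x) (trans (sphere-1 (λ _ → 1ℤ) x x) (cong (T π (λ _ → 1ℤ)) (d-refl x))) (k₃-eq x)))
        where
        final : ∀ {p q r s} → p ≡ 1ℤ → q ≡ + 2 * a * 1ℤ → s ≡ + 2 * (a + 1ℤ) * t →
          1ℤ * p + (1ℤ * q + (1ℤ * r + (1ℤ * s + 0ℤ))) ≡ 1ℤ + + 2 * a + r + + 2 * (a + 1ℤ) * t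
        final {r = r} refl refl refl = shape a t r
          where
          shape : ∀ a t r → 1ℤ * 1ℤ + (1ℤ * (+ 2 * a * 1ℤ) + (1ℤ * r + (1ℤ * (+ 2 * (a + 1ℤ) * t) + 0ℤ))) ≡ 1ℤ + + 2 * a + r + + 2 * (a + 1ℤ) * t
          shape = solve-∀

    -- The Gram matrix, up to scaling, of the projection onto the eigenspace of θ₁ = a.
    u : Fin 4 → ℤ
    u 0F = + 2 * b
    u 1F = b
    u 2F = 0ℤ
    u 3F = - c

    κ : ℤ
    κ = (a + + 2) * b + (a + 1ℤ) * c

    κ>0 : 0ℤ < κ
    κ>0 = ℤ.+-mono-< (*-positive (ℤ.+-mono-< a>0 (+<+ (s≤s z≤n))) b>0) (*-positive (ℤ.+-mono-< a>0 (+<+ (s≤s z≤n))) c>0)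

    u-eigen : ∀ i → T π u i ≡ a * u i
    u-eigen 0F = s a b
      where
      s : ∀ a b → + 2 * a * b ≡ a * (+ 2 * b)
      s = solve-∀
    u-eigen 1F = s a b
      where
      s : ∀ a b → + 2 * b + (a - + 2) * b + (a + 1ℤ) * 0ℤ ≡ a * b
      s = solve-∀
    u-eigen 2F = s a b c
      where
      s : ∀ a b c → c * b + (+ 2 * a - b - c) * 0ℤ + b * (- c) ≡ a * 0ℤ
      s = solve-∀
    u-eigen 3F = s a c
      where
      s : ∀ a c → a * 0ℤ + a * (- c) ≡ a * (- c)
      s = solve-∀

    u-idem : ∀ x y → sum (λ z → u (d x z) * u (d y z)) ≡ κ * u (d x y)
    u-idem x y = cancel-positive-≡ (*-positive c>0 a>0) (trans (E.product-eigen u x y) (shape a b c (u (d x y))))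
      where
      module E = Eigenfunction S u a u-eigen
      shape : ∀ a b c v → (c * a * (+ 2 * b) + c * a * b * a + a * 0ℤ * (a * a - (a - + 2) * a - + 2 * a) +
        (- c) * (a * (a * a - (a - + 2) * a - + 2 * a) - (+ 2 * a - b - c) * (a * a - (a - + 2) * a - + 2 * a) - c * (a + 1ℤ) * a)) * v
        ≡ c * a * (((a + + 2) * b + (a + 1ℤ) * c) * v)
      shape = solve-∀

    -- `m` is the multiplicity of θ₁: the projection G/κ has trace 2bn/κ.
    trace : ∃[ m ] + n * (+ 2 * b) ≡ κ * m
    trace =
      let m , e = trace-divisible n κ κ>0 (λ x y → u (d x y)) (λ x y → cong u (d-sym x y))
            (λ x y → trans (sum-cong-≗ (λ z → cong (λ i → u (d x z) * u i) (d-sym z y))) (u-idem x y))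
      in m , trans (sym diagonal) e
      where
      diagonal : sum (λ x → u (d x x)) ≡ + n * (+ 2 * b)
      diagonal = trans (sum-cong-≗ (λ x → cong u (d-refl x))) (sum-const n (+ 2 * b))

    non-neighbours : ∀ {x y} → d x y ≡ 1F → sum (λ z → δ 1F (d x z) * δ 2F (d y z)) ≡ a + 1ℤ
    non-neighbours {x} {y} e = trans (neighbours (δ 2F) y x) (trans (cong (T π (δ 2F)) (trans (d-sym y x) e)) (s a))
      where
      s : ∀ a → 0ℤ + (a - + 2) * 0ℤ + (a + 1ℤ) * 1ℤ ≡ a + 1ℤ
      s = solve-∀

    -- Two sets of a + 1 elements among the 2a neighbours of x share at least two. Hence a
    -- 3-coclique in a local graph can be chosen greedily.
    common-non-neighbours : ∀ {x y₁ y₂} → d x y₁ ≡ 1F → d x y₂ ≡ 1F →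
      + 2 ≤ sum (λ z → δ 1F (d x z) * (δ 2F (d y₁ z) * δ 2F (d y₂ z)))
    common-non-neighbours {x} {y₁} {y₂} xy₁ xy₂ =
      subst (_≤ sum (λ z → δ 1F (d x z) * (δ 2F (d y₁ z) * δ 2F (d y₂ z)))) total
        (sum-mono (λ z → δ 1F (d x z) * (δ 2F (d y₁ z) + δ 2F (d y₂ z) - 1ℤ))
          (λ z → δ 1F (d x z) * (δ 2F (d y₁ z) * δ 2F (d y₂ z))) (λ z → pointwise (d x z) (d y₁ z) (d y₂ z)))
      where
      pointwise : ∀ p q r → δ 1F p * (δ 2F q + δ 2F r - 1ℤ) ≤ δ 1F p * (δ 2F q * δ 2F r)
      pointwise = finite₃ (λ p q r → δ 1F p * (δ 2F q + δ 2F r - 1ℤ) ℤ.≤? δ 1F p * (δ 2F q * δ 2F r))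
      total : sum (λ z → δ 1F (d x z) * (δ 2F (d y₁ z) + δ 2F (d y₂ z) - 1ℤ)) ≡ + 2
      total = trans (sum-combination
          ((1ℤ , λ z → δ 1F (d x z) * δ 2F (d y₁ z)) ∷ (1ℤ , λ z → δ 1F (d x z) * δ 2F (d y₂ z)) ∷
           (- 1ℤ , λ z → δ 1F (d x z) * 1ℤ) ∷ [])
          (λ z → s (δ 1F (d x z)) (δ 2F (d y₁ z)) (δ 2F (d y₂ z))))
        (trans (cong₂ (λ p q → 1ℤ * p + q) (non-neighbours xy₁) (cong₂ (λ p q → 1ℤ * p + (- 1ℤ * q + 0ℤ)) (non-neighbours xy₂)
          (trans (neighbours (λ _ → 1ℤ) x x) (cong (T π (λ _ → 1ℤ)) (d-refl x))))) (s′ a))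
        where
        s : ∀ m p q → m * (p + q - 1ℤ) ≡ 1ℤ * (m * p) + (1ℤ * (m * q) + (- 1ℤ * (m * 1ℤ) + 0ℤ))
        s = solve-∀
        s′ : ∀ a → 1ℤ * (a + 1ℤ) + (1ℤ * (a + 1ℤ) + (- 1ℤ * (+ 2 * a * 1ℤ) + 0ℤ)) ≡ + 2
        s′ = solve-∀

    Coclique : Fin n → Fin n → Fin n → Fin n → Set
    Coclique x y₁ y₂ y₃ = d x y₁ ≡ 1F × d x y₂ ≡ 1F × d x y₃ ≡ 1F ×
      d y₁ y₂ ≡ 2F × d y₁ y₃ ≡ 2F × d y₂ y₃ ≡ 2F

    coclique : ∃[ x ] ∃[ y₁ ] ∃[ y₂ ] ∃[ y₃ ] Coclique x y₁ y₂ y₃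
    coclique =
      let x , y₁ , xy₁ = distance-1
          y₂ , xy₂ , y₁y₂ = exists₂ 1F 2F x y₁
            (subst (0ℤ <_) (sym (non-neighbours xy₁)) (ℤ.+-mono-< a>0 (+<+ (s≤s z≤n))))
          y₃ , xy₃ , y₁y₃ , y₂y₃ = exists₃ 1F 2F 2F x y₁ y₂
            (ℤ.<-≤-trans (+<+ {n = 2} (s≤s z≤n)) (common-non-neighbours xy₁ xy₂))
      in x , y₁ , y₂ , y₃ , xy₁ , xy₂ , xy₃ , y₁y₂ , y₁y₃ , y₂y₃

    -- Inclusion-exclusion for the closed neighbourhoods of a 3-coclique in a local graph.
    claw : a ≤ + 3 * c
    claw = let x , y₁ , y₂ , y₃ , e = coclique in inclusion-exclusion x y₁ y₂ y₃ e
     where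
     inclusion-exclusion : ∀ x y₁ y₂ y₃ → Coclique x y₁ y₂ y₃ → a ≤ + 3 * c
     inclusion-exclusion x y₁ y₂ y₃ (xy₁ , xy₂ , xy₃ , y₁y₂ , y₁y₃ , y₂y₃) =
      0≤-⇒≤ (subst (0ℤ ≤_) (final a c) (≤⇒0≤- (ℤ.≤-trans lower upper)))
      where
      h : Fin 4 → ℤ
      h i = δ 0F i + δ 1F i
      f : Fin n → ℤ
      f z = δ 1F (d x z) * (h (d y₁ z) + h (d y₂ z) + h (d y₃ z)
        - h (d y₁ z) * h (d y₂ z) - h (d y₁ z) * h (d y₃ z) - h (d y₂ z) * h (d y₃ z))
      upper : sum f ≤ + 2 * a * 1ℤ
      upper = subst (sum f ≤_) (trans (neighbours (λ _ → 1ℤ) x x) (cong (T π (λ _ → 1ℤ)) (d-refl x)))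
        (sum-mono f (λ z → δ 1F (d x z) * 1ℤ) (λ z → pointwise (d x z) (d y₁ z) (d y₂ z) (d y₃ z)))
        where
        pointwise : ∀ p q r s → δ 1F p * (h q + h r + h s - h q * h r - h q * h s - h r * h s) ≤ δ 1F p * 1ℤ
        pointwise = finite₄ (λ p q r s → δ 1F p * (h q + h r + h s - h q * h r - h q * h s - h r * h s) ℤ.≤? δ 1F p * 1ℤ)
      g : Fin n → ℤ
      g z = δ 1F (d x z) * h (d y₁ z) + δ 1F (d x z) * h (d y₂ z) + δ 1F (d x z) * h (d y₃ z)
        - (δ 1F (d y₁ z) * δ 1F (d y₂ z) - δ 0F (d x z))
        - (δ 1F (d y₁ z) * δ 1F (d y₃ z) - δ 0F (d x z))
        - (δ 1F (d y₂ z) * δ 1F (d y₃ z) - δ 0F (d x z))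
      -- The closed neighbourhoods of nonadjacent y and y′ inside the local graph of x meet only in
      -- common neighbours of y and y′ other than x, of which there are c - 1.
      pair : ∀ p q r → Triangle 1F p q → Triangle 1F p r → Triangle 2F q r →
        δ 1F p * (h q * h r) ≤ δ 1F q * δ 1F r - δ 0F p
      pair = finite₃ (λ p q r → Triangle? 1F p q →-dec Triangle? 1F p r →-dec Triangle? 2F q r →-dec
        (δ 1F p * (h q * h r) ℤ.≤? δ 1F q * δ 1F r - δ 0F p))
      g≤f : ∀ z → g z ≤ f z
      g≤f z = 0≤-⇒≤ (subst (0ℤ ≤_) (s (δ 1F (d x z)) (h (d y₁ z)) (h (d y₂ z)) (h (d y₃ z))
          (δ 1F (d y₁ z) * δ 1F (d y₂ z) - δ 0F (d x z)) (δ 1F (d y₁ z) * δ 1F (d y₃ z) - δ 0F (d x z)) (δ 1F (d y₂ z) * δ 1F (d y₃ z) - δ 0F (d x z)))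
        (ℤ.+-mono-≤ (ℤ.+-mono-≤
          (≤⇒0≤- (pair (d x z) (d y₁ z) (d y₂ z) (triangle-at xy₁ z) (triangle-at xy₂ z) (triangle-at y₁y₂ z)))
          (≤⇒0≤- (pair (d x z) (d y₁ z) (d y₃ z) (triangle-at xy₁ z) (triangle-at xy₃ z) (triangle-at y₁y₃ z))))
          (≤⇒0≤- (pair (d x z) (d y₂ z) (d y₃ z) (triangle-at xy₂ z) (triangle-at xy₃ z) (triangle-at y₂y₃ z)))))
        where
        s : ∀ m p q r u v w → (u - m * (p * q)) + (v - m * (p * r)) + (w - m * (q * r)) ≡
          m * (p + q + r - p * q - p * r - q * r) - (m * p + m * q + m * r - u - v - w)
        s = solve-∀
      near : ∀ {y} → d x y ≡ 1F → sum (λ z → δ 1F (d x z) * h (d y z)) ≡ a - 1ℤ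
      near {y} e = trans (neighbours h y x) (trans (cong (T π h) (trans (d-sym y x) e)) (s a))
        where
        s : ∀ a → 1ℤ + 0ℤ + (a - + 2) * (0ℤ + 1ℤ) + (a + 1ℤ) * (0ℤ + 0ℤ) ≡ a - 1ℤ
        s = solve-∀
      common : ∀ {y y′} → d y y′ ≡ 2F → sum (λ z → δ 1F (d y z) * δ 1F (d y′ z)) ≡ c
      common {y} {y′} e = trans (neighbours (δ 1F) y′ y) (trans (cong (T π (δ 1F)) (trans (d-sym y′ y) e)) (s a b c))
        where
        s : ∀ a b c → c * 1ℤ + (+ 2 * a - b - c) * 0ℤ + b * 0ℤ ≡ c
        s = solve-∀
      self : sum (λ z → δ 0F (d x z)) ≡ 1ℤ
      self = trans (sum-cong-≗ (λ z → sym (ℤ.*-identityʳ (δ 0F (d x z))))) (sphere-0 (λ _ → 1ℤ) x x)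
      total : sum g ≡ + 3 * (a - 1ℤ) - + 3 * (c - 1ℤ)
      total = trans (sum-combination
          ((1ℤ , λ z → δ 1F (d x z) * h (d y₁ z)) ∷ (1ℤ , λ z → δ 1F (d x z) * h (d y₂ z)) ∷
           (1ℤ , λ z → δ 1F (d x z) * h (d y₃ z)) ∷ (- 1ℤ , λ z → δ 1F (d y₁ z) * δ 1F (d y₂ z)) ∷
           (- 1ℤ , λ z → δ 1F (d y₁ z) * δ 1F (d y₃ z)) ∷ (- 1ℤ , λ z → δ 1F (d y₂ z) * δ 1F (d y₃ z)) ∷
           (+ 3 , λ z → δ 0F (d x z)) ∷ [])
          (λ z → s (δ 1F (d x z) * h (d y₁ z)) (δ 1F (d x z) * h (d y₂ z)) (δ 1F (d x z) * h (d y₃ z))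
            (δ 1F (d y₁ z) * δ 1F (d y₂ z)) (δ 1F (d y₁ z) * δ 1F (d y₃ z)) (δ 1F (d y₂ z) * δ 1F (d y₃ z)) (δ 0F (d x z))))
        (final′ (near xy₁) (near xy₂) (near xy₃) (common y₁y₂) (common y₁y₃) (common y₂y₃) self)
        where
        s : ∀ p q r u v w o → p + q + r - (u - o) - (v - o) - (w - o) ≡
          1ℤ * p + (1ℤ * q + (1ℤ * r + (- 1ℤ * u + (- 1ℤ * v + (- 1ℤ * w + (+ 3 * o + 0ℤ))))))
        s = solve-∀
        final′ : ∀ {p q r u v w o} → p ≡ a - 1ℤ → q ≡ a - 1ℤ → r ≡ a - 1ℤ → u ≡ c → v ≡ c → w ≡ c → o ≡ 1ℤ →
          1ℤ * p + (1ℤ * q + (1ℤ * r + (- 1ℤ * u + (- 1ℤ * v + (- 1ℤ * w + (+ 3 * o + 0ℤ)))))) ≡ + 3 * (a - 1ℤ) - + 3 * (c - 1ℤ)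
        final′ refl refl refl refl refl refl refl = s′ a c
          where
          s′ : ∀ a c → 1ℤ * (a - 1ℤ) + (1ℤ * (a - 1ℤ) + (1ℤ * (a - 1ℤ) + (- 1ℤ * c + (- 1ℤ * c + (- 1ℤ * c + (+ 3 * 1ℤ + 0ℤ)))))) ≡ + 3 * (a - 1ℤ) - + 3 * (c - 1ℤ)
          s′ = solve-∀
      lower : + 3 * (a - 1ℤ) - + 3 * (c - 1ℤ) ≤ sum f
      lower = subst (_≤ sum f) total (sum-mono g f g≤f)
      final : ∀ a c → + 2 * a * 1ℤ - (+ 3 * (a - 1ℤ) - + 3 * (c - 1ℤ)) ≡ + 3 * c - a
      final = solve-∀

-- The averaged bound for local graphs

module LocalBounds where
  open IntegerSums
  open DistanceSchemes
  open BoseMesnerAlgebra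
  open ParameterBounds

  sum-exchange : ∀ {m n} (g : Fin m → ℤ) (v : Fin n → ℤ) (U : Fin n → Fin m → ℤ) →
    sum (λ z → g z * sum (λ y → v y * U y z)) ≡ sum (λ y → v y * sum (λ z → g z * U y z))
  sum-exchange g v U = trans
    (sum-cong-≗ (λ z → trans (*-distribˡ-sum (g z) (λ y → v y * U y z)) (sum-cong-≗ (λ y → shape (g z) (v y) (U y z)))))
    (trans (∑-comm (λ z y → v y * (g z * U y z))) (sum-cong-≗ (λ y → sym (*-distribˡ-sum (v y) (λ z → g z * U y z)))))
    where
    shape : ∀ p q r → p * (q * r) ≡ q * (p * r)
    shape = solve-∀

  -- The local graphs have least eigenvalue ≥ -2 because θ₁ = b₁ - 1.  Averaging this against the squares
  -- of Bose-Mesner elements vanishing on the eigenspace of θ₁ shows that the least eigenvalue is ≥ -4.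
  module LocalBound {n : ℕ} (a b c : ℤ) (a>0 : 0ℤ < a) (b>0 : 0ℤ < b) (c>0 : 0ℤ < c) (S : Scheme n (shilla a b c)) where
    open Scheme S
    open BoseMesner S
    open Arithmetic a b c a>0 b>0 c>0 S

    form : (Fin 4 → ℤ) → (Fin n → ℤ) → ℤ
    form g v = sum (λ y → v y * sum (λ y′ → v y′ * g (d y y′)))

    form-nonneg : ∀ v → 0ℤ ≤ form u v
    form-nonneg v = cancel-positive-≤ κ>0 (subst (0ℤ ≤_) squares (sum-nonneg (λ z → L z * L z) (λ z → square-nonneg (L z))))
      where
      L : Fin n → ℤ
      L z = sum (λ y → v y * u (d y z))
      inner : ∀ y → sum (λ z → L z * u (d y z)) ≡ κ * sum (λ y′ → v y′ * u (d y y′))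
      inner y = trans (sum-cong-≗ (λ z → ℤ.*-comm (L z) (u (d y z))))
        (trans (sum-exchange (λ z → u (d y z)) v (λ y′ z → u (d y′ z)))
        (trans (sum-cong-≗ (λ y′ → trans (cong (v y′ *_) (u-idem y y′)) (shape (v y′) κ (u (d y y′)))))
          (sym (*-distribˡ-sum κ (λ y′ → v y′ * u (d y y′))))))
        where
        shape : ∀ p q r → p * (q * r) ≡ q * (p * r)
        shape = solve-∀
      squares : sum (λ z → L z * L z) ≡ κ * form u v
      squares = trans (sum-exchange L v (λ y z → u (d y z))) (trans
        (sum-cong-≗ (λ y → trans (cong (v y *_) (inner y)) (shape (v y) κ (sum (λ y′ → v y′ * u (d y y′))))))
        (sym (*-distribˡ-sum κ (λ y → v y * sum (λ y′ → v y′ * u (d y y′))))))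
        where
        shape : ∀ p q r → p * (q * r) ≡ q * (p * r)
        shape = solve-∀

    X : Fin 4 → ℤ
    X i = + 2 * u i - b

    -- X is, up to scaling, the Gram matrix of the projections of the neighbours of x orthogonally to x.
    local-nonneg : ∀ x v → (∀ y → v y * u (d y x) ≡ b * v y) → 0ℤ ≤ form X v
    local-nonneg x v supp = cancel-positive-≤ {+ 2} (+<+ (s≤s z≤n)) (subst (0ℤ ≤_) total (form-nonneg w))
      where
      s : ℤ
      s = sum v
      w L : Fin n → ℤ
      -- The combination given by v pairs with x to bs and ⟨x, x⟩ = 2b, so s/2 copies of x have to
      -- be subtracted; doubling keeps the vector integral.
      w y = + 2 * v y - s * δ x y
      L y = sum (λ y′ → v y′ * u (d y y′))
      Q = sum (λ y → v y * L y)
      at-x : sum (λ y → v y * u (d y x)) ≡ b * s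
      at-x = trans (sum-cong-≗ supp) (sym (*-distribˡ-sum b v))
      L-x : L x ≡ b * s
      L-x = trans (sum-cong-≗ (λ y → cong (λ i → v y * u i) (d-sym x y))) at-x
      row : ∀ y → sum (λ y′ → w y′ * u (d y y′)) ≡ + 2 * L y - s * u (d y x)
      row y = trans (sum-combination
          ((+ 2 , λ y′ → v y′ * u (d y y′)) ∷ (- s , λ y′ → δ x y′ * u (d y y′)) ∷ [])
          (λ y′ → shape (v y′) s (δ x y′) (u (d y y′))))
        (trans (cong (λ e → + 2 * L y + (- s * e + 0ℤ)) (sum-δ x (λ y′ → u (d y y′)))) (shape′ (L y) s (u (d y x))))
        where
        shape : ∀ p s q r → (+ 2 * p - s * q) * r ≡ + 2 * (p * r) + (- s * (q * r) + 0ℤ)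
        shape = solve-∀
        shape′ : ∀ p s q → + 2 * p + (- s * q + 0ℤ) ≡ + 2 * p - s * q
        shape′ = solve-∀
      X-row : ∀ y → sum (λ y′ → v y′ * X (d y y′)) ≡ + 2 * L y - b * s
      X-row y = trans (sum-combination ((+ 2 , λ y′ → v y′ * u (d y y′)) ∷ (- b , v) ∷ [])
          (λ y′ → shape (v y′) (u (d y y′)) b)) (shape′ (L y) b s)
        where
        shape : ∀ p q b → p * (+ 2 * q - b) ≡ + 2 * (p * q) + (- b * p + 0ℤ)
        shape = solve-∀
        shape′ : ∀ p b s → + 2 * p + (- b * s + 0ℤ) ≡ + 2 * p - b * s
        shape′ = solve-∀
      X-form : form X v ≡ + 2 * Q - b * s * s
      X-form = trans (sum-cong-≗ (λ y → cong (v y *_) (X-row y))) (trans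
        (sum-combination ((+ 2 , λ y → v y * L y) ∷ (- (b * s) , v) ∷ []) (λ y → shape (v y) (L y) (b * s)))
        (shape′ Q b s))
        where
        shape : ∀ p q b → p * (+ 2 * q - b) ≡ + 2 * (p * q) + (- b * p + 0ℤ)
        shape = solve-∀
        shape′ : ∀ p b s → + 2 * p + (- (b * s) * s + 0ℤ) ≡ + 2 * p - b * s * s
        shape′ = solve-∀
      total : form u w ≡ + 2 * form X v
      total = trans (sum-cong-≗ (λ y → cong (w y *_) (row y))) (trans
        (sum-combination ((+ 4 , λ y → v y * L y) ∷ (- (+ 2 * s) , λ y → v y * u (d y x)) ∷
            (- (+ 2 * s) , λ y → δ x y * L y) ∷ (s * s , λ y → δ x y * u (d y x)) ∷ [])
          (λ y → shape (v y) s (δ x y) (L y) (u (d y x))))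
        (trans (final at-x (trans (sum-δ x L) L-x) (trans (sum-δ x (λ y → u (d y x))) (cong u (d-refl x))))
          (cong (+ 2 *_) (sym X-form))))
        where
        shape : ∀ v s e l m → (+ 2 * v - s * e) * (+ 2 * l - s * m) ≡
          + 4 * (v * l) + (- (+ 2 * s) * (v * m) + (- (+ 2 * s) * (e * l) + (s * s * (e * m) + 0ℤ)))
        shape = solve-∀
        final : ∀ {p q r} → p ≡ b * s → q ≡ b * s → r ≡ + 2 * b →
          + 4 * Q + (- (+ 2 * s) * p + (- (+ 2 * s) * q + (s * s * r + 0ℤ))) ≡ + 2 * (+ 2 * Q - b * s * s)
        final refl refl refl = shape′ Q b s
          where
          shape′ : ∀ q b s → + 4 * q + (- (+ 2 * s) * (b * s) + (- (+ 2 * s) * (b * s) + (s * s * (+ 2 * b) + 0ℤ))) ≡ + 2 * (+ 2 * q - b * s * s)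
          shape′ = solve-∀

    module _ (ζ : Fin 4 → ℤ) where
      H : Fin 4 → ℤ
      H i = X i * convolution ζ ζ i

      -- `local-nonneg` is applied, for each w, to ζ(d w y) on the neighbours y of x. Adding over w
      -- turns the products of values of ζ into a convolution, and the sum over pairs of neighbours
      -- of x is 2a times the row of `T` at distance one.
      averaged : 0ℤ ≤ T π H 1F
      averaged = cancel-positive-≤ (*-positive {+ 2} (+<+ (s≤s z≤n)) a>0) (subst (0ℤ ≤_) total
        (*-nonneg (ℤ.<⇒≤ (*-positive c>0 a>0)) (sum-nonneg (λ w → form X (v w)) (λ w → local-nonneg x (v w) (support w)))))
        where
        x : Fin n
        x = proj₁ far
        v : Fin n → Fin n → ℤ
        v w y = δ 1F (d x y) * ζ (d w y)
        support : ∀ w y → v w y * u (d y x) ≡ b * v w y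
        support w y = trans (cong (λ i → v w y * u i) (d-sym y x)) (go (d x y) (ζ (d w y)))
          where
          off : ∀ b z m → 0ℤ * z * m ≡ b * (0ℤ * z)
          off = solve-∀
          on : ∀ b z → 1ℤ * z * b ≡ b * (1ℤ * z)
          on = solve-∀
          go : ∀ i z → δ 1F i * z * u i ≡ b * (δ 1F i * z)
          go 0F z = off b z (u 0F)
          go 1F z = on b z
          go 2F z = off b z (u 2F)
          go 3F z = off b z (u 3F)
        F : Fin n → Fin n → ℤ
        F y y′ = sum (λ w → ζ (d w y) * ζ (d w y′))
        regroup : sum (λ w → form X (v w)) ≡
          sum (λ y → δ 1F (d x y) * sum (λ y′ → δ 1F (d x y′) * X (d y y′) * F y y′))
        regroup = trans (∑-comm (λ w y → v w y * sum (λ y′ → v w y′ * X (d y y′)))) (sum-cong-≗ λ y →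
          trans (sum-cong-≗ (λ w → trans (ℤ.*-assoc (δ 1F (d x y)) (ζ (d w y)) (sum (λ y′ → v w y′ * X (d y y′))))
              (cong (λ e → δ 1F (d x y) * (ζ (d w y) * e))
                (sum-cong-≗ (λ y′ → shape (δ 1F (d x y′)) (ζ (d w y′)) (X (d y y′)))))))
            (trans (sym (*-distribˡ-sum (δ 1F (d x y)) (λ w → ζ (d w y) * sum (λ y′ → δ 1F (d x y′) * X (d y y′) * ζ (d w y′)))))
              (cong (δ 1F (d x y) *_) (sum-exchange (λ w → ζ (d w y)) (λ y′ → δ 1F (d x y′) * X (d y y′)) (λ y′ w → ζ (d w y′))))))
          where
          shape : ∀ p q r → p * q * r ≡ p * r * q
          shape = solve-∀
        F-eq : ∀ y y′ → c * a * F y y′ ≡ convolution ζ ζ (d y y′)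
        F-eq y y′ = trans (cong (c * a *_) (sum-cong-≗ (λ w → cong₂ (λ i j → ζ i * ζ j) (d-sym w y) (d-sym w y′)))) (product ζ ζ y y′)
        inner : ∀ y → c * a * sum (λ y′ → δ 1F (d x y′) * X (d y y′) * F y y′) ≡ T π H (d y x)
        inner y = trans (*-distribˡ-sum (c * a) (λ y′ → δ 1F (d x y′) * X (d y y′) * F y y′))
          (trans (sum-cong-≗ (λ y′ → trans (shape (c * a) (δ 1F (d x y′)) (X (d y y′)) (F y y′))
            (cong (λ e → δ 1F (d x y′) * (X (d y y′) * e)) (F-eq y y′)))) (neighbours H y x))
          where
          shape : ∀ c p q r → c * (p * q * r) ≡ p * (q * (c * r))
          shape = solve-∀
        total : c * a * sum (λ w → form X (v w)) ≡ + 2 * a * T π H 1F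
        total = trans (cong (c * a *_) regroup) (trans
          (*-distribˡ-sum (c * a) (λ y → δ 1F (d x y) * sum (λ y′ → δ 1F (d x y′) * X (d y y′) * F y y′)))
          (trans (sum-cong-≗ (λ y → trans (shape (c * a) (δ 1F (d x y)) (sum (λ y′ → δ 1F (d x y′) * X (d y y′) * F y y′)))
              (trans (cong (δ 1F (d x y) *_) (inner y)) (at-one y))))
            (trans (sym (*-distribˡ-sum (T π H 1F) (λ y → δ 1F (d x y) * 1ℤ)))
              (trans (cong (T π H 1F *_) (trans (neighbours (λ _ → 1ℤ) x x) (cong (T π (λ _ → 1ℤ)) (d-refl x)))) (shape′ (T π H 1F) a)))))
          where
          shape : ∀ c p q → c * (p * q) ≡ p * (c * q)
          shape = solve-∀
          shape′ : ∀ h a → h * (+ 2 * a * 1ℤ) ≡ + 2 * a * h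
          shape′ = solve-∀
          at-one : ∀ y → δ 1F (d x y) * T π H (d y x) ≡ T π H 1F * (δ 1F (d x y) * 1ℤ)
          at-one y = trans (cong (λ i → δ 1F (d x y) * T π H i) (d-sym y x)) (go (d x y))
            where
            off : ∀ h h′ → 0ℤ * h ≡ h′ * (0ℤ * 1ℤ)
            off = solve-∀
            on : ∀ h → 1ℤ * h ≡ h * (1ℤ * 1ℤ)
            on = solve-∀
            go : ∀ i → δ 1F i * T π H i ≡ T π H 1F * (δ 1F i * 1ℤ)
            go 0F = off (T π H 0F) (T π H 1F)
            go 1F = on (T π H 1F)
            go 2F = off (T π H 2F) (T π H 1F)
            go 3F = off (T π H 3F) (T π H 1F)

    module _ (c≤2a : c ≤ + 2 * a) where
      private
       module Optimal where
        -- Up to positive factors the averaged form is the quadratic form in α and β found by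
        -- `combine`, with α²-coefficient 2(a + 2) - c. Minimising over α, with β equal to that
        -- coefficient, gives these values.
        α β : ℤ
        α = - (c * (b + c - + 2))
        β = + 2 * (a + + 2) - c

        -- α(A - a) + βc A₂; recall that cA₂ = (A + 2)(A - a).
        ζ : Fin 4 → ℤ
        ζ 0F = - (a * α)
        ζ 1F = α
        ζ 2F = β * c
        ζ 3F = 0ℤ
        F0 : ∀ a b c α β s → c * a * (- (a * α)) * (- (a * α)) + c * a * α * ((+ 2 * a) * α) + a * (β * c) * (((+ 2 * a) * ((- (a * α)) + (a - + 2) * α + (a + + 1) * (β * c))) - (a - + 2) * ((+ 2 * a) * α) - (+ 2 * a) * (- (a * α))) + 0ℤ * s ≡ c * a * (α * α * (a * a + + 2 * a) + β * β * c * (+ 2 * a * (a + 1ℤ)))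
        F0 = solve-∀

        F1 : ∀ a b c α β s → c * a * (- (a * α)) * α + c * a * α * ((- (a * α)) + (a - + 2) * α + (a + + 1) * (β * c)) + a * (β * c) * ((((+ 2 * a) * α) + (a - + 2) * ((- (a * α)) + (a - + 2) * α + (a + + 1) * (β * c)) + (a + + 1) * (c * α + (+ 2 * a - b - c) * (β * c) + b * 0ℤ)) - (a - + 2) * ((- (a * α)) + (a - + 2) * α + (a + + 1) * (β * c)) - (+ 2 * a) * α) + 0ℤ * s ≡ c * a * (α * α * (- a - + 2) + + 2 * α * β * c * (a + 1ℤ) + β * β * c * ((a + 1ℤ) * (+ 2 * a - b - c)))
        F1 = solve-∀

        F2 : ∀ a b c α β s → c * a * (- (a * α)) * (β * c) + c * a * α * (c * α + (+ 2 * a - b - c) * (β * c) + b * 0ℤ) + a * (β * c) * ((c * ((- (a * α)) + (a - + 2) * α + (a + + 1) * (β * c)) + (+ 2 * a - b - c) * (c * α + (+ 2 * a - b - c) * (β * c) + b * 0ℤ) + b * (a * (β * c) + a * 0ℤ)) - (a - + 2) * (c * α + (+ 2 * a - b - c) * (β * c) + b * 0ℤ) - (+ 2 * a) * (β * c)) + 0ℤ * s ≡ c * a * (α * α * c + + 2 * α * β * c * (a - b - c) + β * β * c * (c * (a + 1ℤ) + (+ 2 * a - b - c) * (+ 2 * a - b - c) + a * b - (a - + 2) * (+ 2 * a - b - c) - + 2 * a))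
        F2 = solve-∀

        combine : ∀ a b c α β →
          (+ 3 * (α * α * (a * a + + 2 * a) + β * β * c * (+ 2 * a * (a + 1ℤ))) + (a - + 2) * (α * α * (- a - + 2) + + 2 * α * β * c * (a + 1ℤ) + β * β * c * ((a + 1ℤ) * (+ 2 * a - b - c))) - (a + 1ℤ) * (α * α * c + + 2 * α * β * c * (a - b - c) + β * β * c * (c * (a + 1ℤ) + (+ 2 * a - b - c) * (+ 2 * a - b - c) + a * b - (a - + 2) * (+ 2 * a - b - c) - + 2 * a))) ≡
          (a + 1ℤ) * (α * α * (+ 2 * (a + + 2) - c) + + 2 * α * β * c * (b + c - + 2) + β * β * c * ((b + c) * (a + + 4 - b - c) - c))
        combine = solve-∀

        specialise : ∀ a b c → let α = - (c * (b + c - + 2)) ; β = + 2 * (a + + 2) - c in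
          α * α * (+ 2 * (a + + 2) - c) + + 2 * α * β * c * (b + c - + 2) + β * β * c * ((b + c) * (a + + 4 - b - c) - c) ≡
          c * (+ 2 * (a + + 2) - c) * ((a + + 2) * (b + c) - c) * (+ 8 + + 2 * a - + 2 * b - + 3 * c)
        specialise = solve-∀

        F₀ F₁ F₂ : ℤ
        F₀ = α * α * (a * a + + 2 * a) + β * β * c * (+ 2 * a * (a + 1ℤ))
        F₁ = α * α * (- a - + 2) + + 2 * α * β * c * (a + 1ℤ) + β * β * c * ((a + 1ℤ) * (+ 2 * a - b - c))
        F₂ = α * α * c + + 2 * α * β * c * (a - b - c) + β * β * c * (c * (a + 1ℤ) + (+ 2 * a - b - c) * (+ 2 * a - b - c) + a * b - (a - + 2) * (+ 2 * a - b - c) - + 2 * a)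

        N₁ N₂ : ℤ
        N₁ = c * (+ 2 * (a + + 2) - c)
        N₂ = (a + + 2) * (b + c) - c

        T-H : T π (H ζ) 1F ≡ c * a * b * ((a + 1ℤ) * (N₁ * N₂ * (+ 8 + + 2 * a - + 2 * b - + 3 * c)))
        T-H = trans (expand (F0 a b c α β (S₃ ζ 0F)) (F1 a b c α β (S₃ ζ 1F)) (F2 a b c α β (S₃ ζ 2F)))
          (cong (c * a * b *_) (trans (combine a b c α β) (cong ((a + 1ℤ) *_) (specialise a b c))))
          where
          expand : convolution ζ ζ 0F ≡ c * a * F₀ → convolution ζ ζ 1F ≡ c * a * F₁ → convolution ζ ζ 2F ≡ c * a * F₂ →
            T π (H ζ) 1F ≡ c * a * b * (+ 3 * F₀ + (a - + 2) * F₁ - (a + 1ℤ) * F₂)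
          expand e₀ e₁ e₂ = trans (cong₂ _+_ (cong₂ (λ s t → (+ 2 * (+ 2 * b) - b) * s + (a - + 2) * ((+ 2 * b - b) * t)) e₀ e₁)
              (cong (λ s → (a + 1ℤ) * ((+ 2 * 0ℤ - b) * s)) e₂)) (shape a b (c * a) F₀ F₁ F₂)
            where
            shape : ∀ a b m f g h → (+ 2 * (+ 2 * b) - b) * (m * f) + (a - + 2) * ((+ 2 * b - b) * (m * g)) + (a + 1ℤ) * ((+ 2 * 0ℤ - b) * (m * h)) ≡
              m * b * (+ 3 * f + (a - + 2) * g - (a + 1ℤ) * h)
            shape = solve-∀

      -- Every factor in `T-H` except the last is positive; c ≤ 2a ensures this for 2(a + 2) - c.
      least-eigenvalue : + 2 * b + + 3 * c ≤ + 2 * a + + 8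
      least-eigenvalue = 0≤-⇒≤ (subst (0ℤ ≤_) (shape a b c) (cancel-positive-≤ (*-positive N₁>0 N₂>0)
        (cancel-positive-≤ (ℤ.+-mono-< a>0 (+<+ (s≤s z≤n))) (cancel-positive-≤ (*-positive (*-positive c>0 a>0) b>0)
          (subst (0ℤ ≤_) T-H (averaged ζ))))))
        where
        open Optimal
        shape : ∀ a b c → + 8 + + 2 * a - + 2 * b - + 3 * c ≡ + 2 * a + + 8 - (+ 2 * b + + 3 * c)
        shape = solve-∀
        N₁>0 : 0ℤ < N₁
        N₁>0 = *-positive c>0 (ℤ.<-≤-trans (+<+ {n = 4} (s≤s z≤n)) (0≤-⇒≤ (subst (0ℤ ≤_) (s a c) (≤⇒0≤- c≤2a))))
          where
          s : ∀ a c → + 2 * a - c ≡ + 2 * (a + + 2) - c - + 4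
          s = solve-∀
        N₂>0 : 0ℤ < N₂
        N₂>0 = subst (0ℤ <_) (s a b c) (ℤ.+-mono-< (*-positive (ℤ.+-mono-< a>0 (+<+ {n = 2} (s≤s z≤n))) b>0)
          (*-positive (ℤ.+-mono-< a>0 (+<+ {n = 1} (s≤s z≤n))) c>0))
          where
          s : ∀ a b c → (a + + 2) * b + (a + 1ℤ) * c ≡ (a + + 2) * (b + c) - c
          s = solve-∀

-- The finite search for intersection arrays

module Arrays where
  open IntegerSums
  open DistanceSchemes
  open BoseMesnerAlgebra
  open ParameterBounds
  open LocalBounds
  import Data.Nat.DivMod as ℕ
  open import Data.Nat.Divisibility using (_∣_; _∣?_; divides)
  open import Data.Nat.Tactic.RingSolver renaming (solve-∀ to ℕ-solve-∀)

  -- The indices are a₃, c₂ and t = b₂/c₂.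
  data Case : ℕ → ℕ → ℕ → Set where
    odd       : Case 2 1 3
    hexagon   : Case 3 1 4
    hamming   : Case 3 2 1
    no-graph  : Case 3 2 2
    doro      : Case 5 2 2
    johnson   : Case 9 4 1

  module _ (a c t k₂ m : ℕ) (a≥1 : 1 ℕ.≤ a) (c≥1 : 1 ℕ.≤ c) (t≥1 : 1 ℕ.≤ t)
    (k₂-eq : c ℕ.* k₂ ≡ 2 ℕ.* a ℕ.* (a ℕ.+ 1)) (claw : a ℕ.≤ 3 ℕ.* c)
    (least : (2 ℕ.* t ℕ.+ 3) ℕ.* c ℕ.≤ 2 ℕ.* a ℕ.+ 8)
    (multiplicity : (t ℕ.* (a ℕ.+ 2) ℕ.+ (a ℕ.+ 1)) ℕ.* m ≡ 2 ℕ.* t ℕ.* (1 ℕ.+ 2 ℕ.* a ℕ.+ k₂ ℕ.+ 2 ℕ.* (a ℕ.+ 1) ℕ.* t)) where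

    private
      -- For t ≥ 2 the eigenvalue bound gives 7c ≤ 2a + 8, and a ≤ 3c turns it into 7a ≤ 6a + 24.
      large : 2 ℕ.≤ t → a ℕ.≤ 24
      large t≥2 = ℕ.+-cancelˡ-≤ (6 ℕ.* a) a 24 (begin
        6 ℕ.* a ℕ.+ a           ≡⟨ s₁ a ⟩
        7 ℕ.* a                 ≤⟨ ℕ.*-monoʳ-≤ 7 claw ⟩
        7 ℕ.* (3 ℕ.* c)         ≡⟨ s₂ c ⟩
        3 ℕ.* ((2 ℕ.* 2 ℕ.+ 3) ℕ.* c) ≤⟨ ℕ.*-monoʳ-≤ 3 (ℕ.≤-trans (ℕ.*-monoˡ-≤ c (ℕ.+-monoˡ-≤ 3 (ℕ.*-monoʳ-≤ 2 t≥2))) least) ⟩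
        3 ℕ.* (2 ℕ.* a ℕ.+ 8)   ≡⟨ s₃ a ⟩
        6 ℕ.* a ℕ.+ 24          ∎)
        where
        open ℕ.≤-Reasoning
        s₁ : ∀ a → 6 ℕ.* a ℕ.+ a ≡ 7 ℕ.* a
        s₁ = ℕ-solve-∀
        s₂ : ∀ c → 7 ℕ.* (3 ℕ.* c) ≡ 3 ℕ.* (7 ℕ.* c)
        s₂ = ℕ-solve-∀
        s₃ : ∀ a → 3 ℕ.* (2 ℕ.* a ℕ.+ 8) ≡ 6 ℕ.* a ℕ.+ 24
        s₃ = ℕ-solve-∀

      module _ (t≡1 : t ≡ 1) where
        mult : (2 ℕ.* a ℕ.+ 3) ℕ.* m ≡ 2 ℕ.* (4 ℕ.* a ℕ.+ 3 ℕ.+ k₂)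
        mult = trans (cong (ℕ._* m) (s₁ a)) (trans (subst (λ t → (t ℕ.* (a ℕ.+ 2) ℕ.+ (a ℕ.+ 1)) ℕ.* m ≡
          2 ℕ.* t ℕ.* (1 ℕ.+ 2 ℕ.* a ℕ.+ k₂ ℕ.+ 2 ℕ.* (a ℕ.+ 1) ℕ.* t)) t≡1 multiplicity) (s₂ a k₂))
          where
          s₁ : ∀ a → 2 ℕ.* a ℕ.+ 3 ≡ 1 ℕ.* (a ℕ.+ 2) ℕ.+ (a ℕ.+ 1)
          s₁ = ℕ-solve-∀
          s₂ : ∀ a k → 2 ℕ.* 1 ℕ.* (1 ℕ.+ 2 ℕ.* a ℕ.+ k ℕ.+ 2 ℕ.* (a ℕ.+ 1) ℕ.* 1) ≡ 2 ℕ.* (4 ℕ.* a ℕ.+ 3 ℕ.+ k)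
          s₂ = ℕ-solve-∀

        k₂-upper : k₂ ℕ.≤ 6 ℕ.* a ℕ.+ 6
        k₂-upper = ℕ.*-cancelʳ-≤ k₂ (6 ℕ.* a ℕ.+ 6) a {{ℕ.>-nonZero a≥1}} (begin
          k₂ ℕ.* a                        ≤⟨ ℕ.*-monoʳ-≤ k₂ claw ⟩
          k₂ ℕ.* (3 ℕ.* c)                ≡⟨ s₁ k₂ c ⟩
          3 ℕ.* (c ℕ.* k₂)                ≡⟨ cong (3 ℕ.*_) k₂-eq ⟩
          3 ℕ.* (2 ℕ.* a ℕ.* (a ℕ.+ 1))   ≡⟨ s₂ a ⟩
          (6 ℕ.* a ℕ.+ 6) ℕ.* a           ∎)
          where
          open ℕ.≤-Reasoning
          s₁ : ∀ k c → k ℕ.* (3 ℕ.* c) ≡ 3 ℕ.* (c ℕ.* k)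
          s₁ = ℕ-solve-∀
          s₂ : ∀ a → 3 ℕ.* (2 ℕ.* a ℕ.* (a ℕ.+ 1)) ≡ (6 ℕ.* a ℕ.+ 6) ℕ.* a
          s₂ = ℕ-solve-∀

        k₂-lower : 5 ℕ.* a ℕ.* (a ℕ.+ 1) ℕ.≤ (a ℕ.+ 4) ℕ.* k₂
        k₂-lower = ℕ.*-cancelˡ-≤ 2 (begin
          2 ℕ.* (5 ℕ.* a ℕ.* (a ℕ.+ 1))     ≡⟨ s₁ a ⟩
          5 ℕ.* (2 ℕ.* a ℕ.* (a ℕ.+ 1))     ≡⟨ cong (5 ℕ.*_) (sym k₂-eq) ⟩
          5 ℕ.* (c ℕ.* k₂)                  ≡⟨ sym (ℕ.*-assoc 5 c k₂) ⟩
          5 ℕ.* c ℕ.* k₂                    ≤⟨ ℕ.*-monoˡ-≤ k₂ (subst (λ t → (2 ℕ.* t ℕ.+ 3) ℕ.* c ℕ.≤ 2 ℕ.* a ℕ.+ 8) t≡1 least) ⟩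
          (2 ℕ.* a ℕ.+ 8) ℕ.* k₂            ≡⟨ s₂ a k₂ ⟩
          2 ℕ.* ((a ℕ.+ 4) ℕ.* k₂)          ∎)
          where
          open ℕ.≤-Reasoning
          s₁ : ∀ a → 2 ℕ.* (5 ℕ.* a ℕ.* (a ℕ.+ 1)) ≡ 5 ℕ.* (2 ℕ.* a ℕ.* (a ℕ.+ 1))
          s₁ = ℕ-solve-∀
          s₂ : ∀ a k → (2 ℕ.* a ℕ.+ 8) ℕ.* k ≡ 2 ℕ.* ((a ℕ.+ 4) ℕ.* k)
          s₂ = ℕ-solve-∀

        m≤9 : m ℕ.≤ 9
        m≤9 = ℕ.≤-pred (ℕ.*-cancelˡ-< (2 ℕ.* a ℕ.+ 3) m 10 (begin-strict
          (2 ℕ.* a ℕ.+ 3) ℕ.* m                       ≡⟨ mult ⟩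
          2 ℕ.* (4 ℕ.* a ℕ.+ 3 ℕ.+ k₂)                ≤⟨ ℕ.*-monoʳ-≤ 2 (ℕ.+-monoʳ-≤ (4 ℕ.* a ℕ.+ 3) k₂-upper) ⟩
          2 ℕ.* (4 ℕ.* a ℕ.+ 3 ℕ.+ (6 ℕ.* a ℕ.+ 6))   ≡⟨ s₁ a ⟩
          20 ℕ.* a ℕ.+ 18                             <⟨ ℕ.+-monoʳ-< (20 ℕ.* a) (ℕ.m≤m+n 19 11) ⟩
          20 ℕ.* a ℕ.+ 30                             ≡⟨ s₂ a ⟩
          (2 ℕ.* a ℕ.+ 3) ℕ.* 10                      ∎))
          where
          open ℕ.≤-Reasoning
          s₁ : ∀ a → 2 ℕ.* (4 ℕ.* a ℕ.+ 3 ℕ.+ (6 ℕ.* a ℕ.+ 6)) ≡ 20 ℕ.* a ℕ.+ 18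
          s₁ = ℕ-solve-∀
          s₂ : ∀ a → 20 ℕ.* a ℕ.+ 30 ≡ (2 ℕ.* a ℕ.+ 3) ℕ.* 10
          s₂ = ℕ-solve-∀

        -- Otherwise the left side of `mult` is odd.
        m≢9 : m ≢ 9
        m≢9 refl = ℕ.even≢odd (4 ℕ.* a ℕ.+ 3 ℕ.+ k₂) (9 ℕ.* a ℕ.+ 13) (trans (sym mult) (s a))
          where
          s : ∀ a → (2 ℕ.* a ℕ.+ 3) ℕ.* 9 ≡ suc (2 ℕ.* (9 ℕ.* a ℕ.+ 13))
          s = ℕ-solve-∀

        -- For t = 1 the two inequalities alone leave infinitely many pairs (a, c). The multiplicity
        -- cuts them off: k₂ ≤ 6a + 6 gives m ≤ 9, parity improves this to m ≤ 8, so k₂ ≤ 4a + 9,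
        -- while 5c ≤ 2a + 8 makes k₂ at least 5a(a + 1)/(a + 4).
        small : a ℕ.≤ 24
        small = ℕ.≮⇒≥ (λ a>24 → ℕ.<-irrefl refl (begin-strict
          a ℕ.* 20 ℕ.+ 36              <⟨ ℕ.+-monoʳ-< (a ℕ.* 20) (ℕ.≤-trans (ℕ.m≤m+n 37 13) (ℕ.*-monoˡ-≤ 2 a>24)) ⟩
          a ℕ.* 20 ℕ.+ a ℕ.* 2         ≡⟨ s₁ a ⟩
          a ℕ.* 22                     ≤⟨ ℕ.*-monoʳ-≤ a (ℕ.≤-trans (ℕ.m≤m+n 22 3) a>24) ⟩
          a ℕ.* a                      ≤⟨ ℕ.+-cancelˡ-≤ (4 ℕ.* (a ℕ.* a) ℕ.+ 5 ℕ.* a) (a ℕ.* a) (a ℕ.* 20 ℕ.+ 36) (begin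
            4 ℕ.* (a ℕ.* a) ℕ.+ 5 ℕ.* a ℕ.+ a ℕ.* a     ≡⟨ s₂ a ⟩
            5 ℕ.* a ℕ.* (a ℕ.+ 1)                       ≤⟨ k₂-lower ⟩
            (a ℕ.+ 4) ℕ.* k₂                            ≤⟨ ℕ.*-monoʳ-≤ (a ℕ.+ 4) k₂-small ⟩
            (a ℕ.+ 4) ℕ.* (4 ℕ.* a ℕ.+ 9)               ≡⟨ s₃ a ⟩
            4 ℕ.* (a ℕ.* a) ℕ.+ 5 ℕ.* a ℕ.+ (a ℕ.* 20 ℕ.+ 36) ∎) ⟩
          a ℕ.* 20 ℕ.+ 36              ∎))
          where
          open ℕ.≤-Reasoning
          s₁ : ∀ a → a ℕ.* 20 ℕ.+ a ℕ.* 2 ≡ a ℕ.* 22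
          s₁ = ℕ-solve-∀
          s₂ : ∀ a → 4 ℕ.* (a ℕ.* a) ℕ.+ 5 ℕ.* a ℕ.+ a ℕ.* a ≡ 5 ℕ.* a ℕ.* (a ℕ.+ 1)
          s₂ = ℕ-solve-∀
          s₃ : ∀ a → (a ℕ.+ 4) ℕ.* (4 ℕ.* a ℕ.+ 9) ≡ 4 ℕ.* (a ℕ.* a) ℕ.+ 5 ℕ.* a ℕ.+ (a ℕ.* 20 ℕ.+ 36)
          s₃ = ℕ-solve-∀
          k₂-small : k₂ ℕ.≤ 4 ℕ.* a ℕ.+ 9
          k₂-small = ℕ.+-cancelˡ-≤ (4 ℕ.* a ℕ.+ 3) k₂ (4 ℕ.* a ℕ.+ 9) (ℕ.*-cancelˡ-≤ 2 (begin
            2 ℕ.* (4 ℕ.* a ℕ.+ 3 ℕ.+ k₂)    ≡⟨ sym mult ⟩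
            (2 ℕ.* a ℕ.+ 3) ℕ.* m           ≤⟨ ℕ.*-monoʳ-≤ (2 ℕ.* a ℕ.+ 3) (ℕ.≤-pred (ℕ.≤∧≢⇒< m≤9 m≢9)) ⟩
            (2 ℕ.* a ℕ.+ 3) ℕ.* 8           ≡⟨ s₄ a ⟩
            2 ℕ.* (4 ℕ.* a ℕ.+ 3 ℕ.+ (4 ℕ.* a ℕ.+ 9)) ∎))
            where
            s₄ : ∀ a → (2 ℕ.* a ℕ.+ 3) ℕ.* 8 ≡ 2 ℕ.* (4 ℕ.* a ℕ.+ 3 ℕ.+ (4 ℕ.* a ℕ.+ 9))
            s₄ = ℕ-solve-∀

    a≤24 : a ℕ.≤ 24
    a≤24 with t ℕ.≟ 1
    ... | yes t≡1 = small t≡1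
    ... | no  t≢1 = large (ℕ.≤∧≢⇒< t≥1 (t≢1 ∘ sym))

    private
      Listed : ℕ → ℕ → ℕ → Set
      Listed a c t = (a ≡ 2 × c ≡ 1 × t ≡ 3) ⊎ (a ≡ 3 × c ≡ 1 × t ≡ 4) ⊎ (a ≡ 3 × c ≡ 2 × t ≡ 1) ⊎
        (a ≡ 3 × c ≡ 2 × t ≡ 2) ⊎ (a ≡ 5 × c ≡ 2 × t ≡ 2) ⊎ (a ≡ 9 × c ≡ 4 × t ≡ 1)

      Listed? : ∀ a c t → Dec (Listed a c t)
      Listed? a c t = is 2 1 3 ⊎-dec is 3 1 4 ⊎-dec is 3 2 1 ⊎-dec is 3 2 2 ⊎-dec is 5 2 2 ⊎-dec is 9 4 1
        where
        is : ∀ p q r → Dec (a ≡ p × c ≡ q × t ≡ r)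
        is p q r = (a ℕ.≟ p) ×-dec (c ℕ.≟ q) ×-dec (t ℕ.≟ r)

      -- The ranges come from 5c ≤ 2a + 8 ≤ 56 and 2t + 3 ≤ 56. With k₂ written as the quotient 2a(a
      -- + 1)/c, integrality of the multiplicity is a divisibility.
      search : ∀ (i : Fin 24) (j : Fin 11) (l : Fin 26) → let a = suc (toℕ i) ; c = suc (toℕ j) ; t = suc (toℕ l) in
        (2 ℕ.* t ℕ.+ 3) ℕ.* c ℕ.≤ 2 ℕ.* a ℕ.+ 8 → a ℕ.≤ 3 ℕ.* c → c ∣ 2 ℕ.* a ℕ.* (a ℕ.+ 1) →
        (t ℕ.* (a ℕ.+ 2) ℕ.+ (a ℕ.+ 1)) ∣
          2 ℕ.* t ℕ.* (1 ℕ.+ 2 ℕ.* a ℕ.+ (2 ℕ.* a ℕ.* (a ℕ.+ 1)) ℕ./ c ℕ.+ 2 ℕ.* (a ℕ.+ 1) ℕ.* t) → Listed a c t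
      search = toWitness {a? = Fin.all? λ i → Fin.all? λ j → Fin.all? λ l →
        let a = suc (toℕ i) ; c = suc (toℕ j) ; t = suc (toℕ l) in
        ((2 ℕ.* t ℕ.+ 3) ℕ.* c ℕ.≤? 2 ℕ.* a ℕ.+ 8) →-dec (a ℕ.≤? 3 ℕ.* c) →-dec (c ∣? 2 ℕ.* a ℕ.* (a ℕ.+ 1)) →-dec
        ((t ℕ.* (a ℕ.+ 2) ℕ.+ (a ℕ.+ 1)) ∣?
          2 ℕ.* t ℕ.* (1 ℕ.+ 2 ℕ.* a ℕ.+ (2 ℕ.* a ℕ.* (a ℕ.+ 1)) ℕ./ c ℕ.+ 2 ℕ.* (a ℕ.+ 1) ℕ.* t)) →-dec
        Listed? a c t} _

      case : Listed a c t → Case a c t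
      case (inj₁ (refl , refl , refl)) = odd
      case (inj₂ (inj₁ (refl , refl , refl))) = hexagon
      case (inj₂ (inj₂ (inj₁ (refl , refl , refl)))) = hamming
      case (inj₂ (inj₂ (inj₂ (inj₁ (refl , refl , refl))))) = no-graph
      case (inj₂ (inj₂ (inj₂ (inj₂ (inj₁ (refl , refl , refl)))))) = doro
      case (inj₂ (inj₂ (inj₂ (inj₂ (inj₂ (refl , refl , refl)))))) = johnson

      bounded : 2 ℕ.* a ℕ.+ 8 ℕ.≤ 56
      bounded = ℕ.+-monoˡ-≤ 8 (ℕ.*-monoʳ-≤ 2 a≤24)

      c≤11 : c ℕ.≤ 11
      c≤11 = ℕ.≤-pred (ℕ.*-cancelˡ-< 5 c 12 (ℕ.≤-<-trans (ℕ.≤-trans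
        (ℕ.*-monoˡ-≤ c (ℕ.+-monoˡ-≤ 3 (ℕ.*-monoʳ-≤ 2 t≥1))) (ℕ.≤-trans least bounded)) (ℕ.m≤m+n 57 3)))

      t≤26 : t ℕ.≤ 26
      t≤26 = ℕ.≤-pred (ℕ.*-cancelˡ-< 2 t 27 (ℕ.+-cancelʳ-< 3 (2 ℕ.* t) 54 (ℕ.≤-<-trans (ℕ.≤-trans
        (ℕ.m≤m*n (2 ℕ.* t ℕ.+ 3) c {{ℕ.>-nonZero c≥1}}) (ℕ.≤-trans least bounded)) (ℕ.n<1+n 56))))

    classify : Case a c t
    classify = case (go a c t a≥1 c≥1 t≥1 a≤24 c≤11 t≤26 k₂-eq claw least multiplicity)
      where
      go : ∀ a c t → 1 ℕ.≤ a → 1 ℕ.≤ c → 1 ℕ.≤ t → a ℕ.≤ 24 → c ℕ.≤ 11 → t ℕ.≤ 26 →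
        c ℕ.* k₂ ≡ 2 ℕ.* a ℕ.* (a ℕ.+ 1) → a ℕ.≤ 3 ℕ.* c → (2 ℕ.* t ℕ.+ 3) ℕ.* c ℕ.≤ 2 ℕ.* a ℕ.+ 8 →
        (t ℕ.* (a ℕ.+ 2) ℕ.+ (a ℕ.+ 1)) ℕ.* m ≡ 2 ℕ.* t ℕ.* (1 ℕ.+ 2 ℕ.* a ℕ.+ k₂ ℕ.+ 2 ℕ.* (a ℕ.+ 1) ℕ.* t) → Listed a c t
      go (suc a) (suc c) (suc t) _ _ _ pa pc pt e₁ e₂ e₃ e₄ =
        subst₂ (λ x y → Listed (suc x) (suc y) (suc t)) (Fin.toℕ-fromℕ< pa) (Fin.toℕ-fromℕ< pc)
          (subst (λ z → Listed (suc (toℕ i)) (suc (toℕ j)) (suc z)) (Fin.toℕ-fromℕ< pt)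
            (search i j l (transport (λ a c t → (2 ℕ.* suc t ℕ.+ 3) ℕ.* suc c ℕ.≤ 2 ℕ.* suc a ℕ.+ 8) e₃)
              (transport (λ a c t → suc a ℕ.≤ 3 ℕ.* suc c) e₂)
              (transport (λ a c t → suc c ∣ 2 ℕ.* suc a ℕ.* (suc a ℕ.+ 1)) (divides k₂ (trans (sym e₁) (ℕ.*-comm (suc c) k₂))))
              (transport (λ a c t → (suc t ℕ.* (suc a ℕ.+ 2) ℕ.+ (suc a ℕ.+ 1)) ∣
                2 ℕ.* suc t ℕ.* (1 ℕ.+ 2 ℕ.* suc a ℕ.+ (2 ℕ.* suc a ℕ.* (suc a ℕ.+ 1)) ℕ./ suc c ℕ.+ 2 ℕ.* (suc a ℕ.+ 1) ℕ.* suc t))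
                (divides m (trans (cong (λ k → 2 ℕ.* suc t ℕ.* (1 ℕ.+ 2 ℕ.* suc a ℕ.+ k ℕ.+ 2 ℕ.* (suc a ℕ.+ 1) ℕ.* suc t)) quotient)
                  (trans (sym e₄) (ℕ.*-comm (suc t ℕ.* (suc a ℕ.+ 2) ℕ.+ (suc a ℕ.+ 1)) m)))))))
        where
        i = fromℕ< pa
        j = fromℕ< pc
        l = fromℕ< pt
        transport : ∀ (P : ℕ → ℕ → ℕ → Set) → P a c t → P (toℕ i) (toℕ j) (toℕ l)
        transport P p rewrite Fin.toℕ-fromℕ< pa | Fin.toℕ-fromℕ< pc | Fin.toℕ-fromℕ< pt = p
        quotient : (2 ℕ.* suc a ℕ.* (suc a ℕ.+ 1)) ℕ./ suc c ≡ k₂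
        quotient = trans (cong (ℕ._/ suc c) (trans (sym e₁) (ℕ.*-comm (suc c) k₂))) (ℕ.m*n/n≡m k₂ (suc c))

-- Reduction of a Shilla graph to six parameter triples

module Reduction where
  open IntegerSums
  open DistanceSchemes
  open ApproximateEigenvectors
  open IntegralEigenvalues
  open BoseMesnerAlgebra
  open ParameterBounds
  open LocalBounds
  open Arrays
  open import Defs using (IsEigenvalue; adjacencyMatrix; fromℤ)

  positive⇒+ : ∀ {z} → 0ℤ < z → ∃[ m ] z ≡ + suc m
  positive⇒+ {+ suc m} _ = m , refl
  positive⇒+ {+ zero} (+<+ ())

  positive-factor : ∀ {p q} → 0ℤ < p → 0ℤ < p * q → 0ℤ < q
  positive-factor {p} {+ zero} _ pos = contradiction (subst (0ℤ <_) (ℤ.*-zeroʳ p) pos) (ℤ.<-irrefl refl)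
  positive-factor {p} {+ suc q} _ _ = +<+ (s≤s z≤n)
  positive-factor {+ suc p} { -[1+ q ]} _ ()
  positive-factor {+ zero} { -[1+ q ]} (+<+ ()) _

  module Classification {n : ℕ} (a b c : ℕ) (a>0 : 0ℤ < + a) (b>0 : 0ℤ < + b) (c>0 : 0ℤ < + c)
    (S : Scheme n (shilla (+ a) (+ b) (+ c))) where
    open Scheme S
    open Arithmetic (+ a) (+ b) (+ c) a>0 b>0 c>0 S hiding (π)
    open LocalBound (+ a) (+ b) (+ c) a>0 b>0 c>0 S using (least-eigenvalue)

    a₂-nonneg : 0ℤ ≤ + 2 * + a - + b - + c
    a₂-nonneg = let x , y , xy = distance-2 in
      subst (0ℤ ≤_) (trans (neighbours (δ 2F) x y) (trans (cong (T (shilla (+ a) (+ b) (+ c)) (δ 2F)) xy) (shape (+ a) (+ b) (+ c))))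
        (sum-nonneg _ (λ z → *-nonneg (δ-nonneg 1F (d y z)) (δ-nonneg 2F (d x z))))
      where
      δ-nonneg : ∀ (i j : Fin 4) → 0ℤ ≤ δ i j
      δ-nonneg = finite₂ (λ i j → 0ℤ ℤ.≤? δ i j)
      shape : ∀ a b c → c * 0ℤ + (+ 2 * a - b - c) * 1ℤ + b * 0ℤ ≡ + 2 * a - b - c
      shape = solve-∀

    least : + 2 * + b + + 3 * + c ≤ + 2 * + a + + 8
    least = least-eigenvalue (0≤-⇒≤ (subst (0ℤ ≤_) (shape (+ a) (+ b) (+ c)) (ℤ.+-mono-≤ a₂-nonneg (ℤ.<⇒≤ b>0))))
      where
      shape : ∀ a b c → + 2 * a - b - c + b ≡ + 2 * a - c
      shape = solve-∀

    x₀ : Fin n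
    x₀ = proj₁ far

    n>0 : 0ℤ < + n
    n>0 = go x₀
      where
      go : ∀ {n} → Fin n → 0ℤ < + n
      go {suc n} _ = +<+ (s≤s z≤n)

    classified : ∃[ t ] b ≡ c ℕ.* t × Case a c t
    classified = suc t′ , b≡ct , classify a c (suc t′) (suc k₂′) (suc m′) (ℕ-pos a>0) (ℕ-pos c>0) (s≤s z≤n)
        k₂-ℕ (ℤ.drop‿+≤+ (subst (+ a ≤_) (sym (ℤ.pos-* 3 c)) claw)) least-ℕ mult-ℕ
      where
      ℕ-pos : ∀ {a} → 0ℤ < + a → 1 ℕ.≤ a
      ℕ-pos (+<+ p) = p
      quotient = c∣b x₀
      t = proj₁ quotient
      t-pos = positive⇒+ (positive-factor c>0 (subst (0ℤ <_) (proj₂ quotient) b>0))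
      t′ = proj₁ t-pos
      bt : + b ≡ + c * + suc t′
      bt = trans (proj₂ quotient) (cong (+ c *_) (proj₂ t-pos))
      b≡ct : b ≡ c ℕ.* suc t′
      b≡ct = ℤ.+-injective (trans bt (sym (ℤ.pos-* c (suc t′))))
      k₂-pos = positive⇒+ (positive-factor c>0 (subst (0ℤ <_) (sym (k₂-eq x₀))
        (*-positive (*-positive {+ 2} (+<+ (s≤s z≤n)) a>0) (ℤ.+-mono-< a>0 (+<+ (s≤s z≤n))))))
      k₂′ = proj₁ k₂-pos
      m-trace = trace
      m-pos = positive⇒+ (positive-factor κ>0 (subst (0ℤ <_) (proj₂ m-trace)
        (*-positive n>0 (*-positive {+ 2} (+<+ (s≤s z≤n)) b>0))))
      m′ = proj₁ m-pos
      k₂-ℕ : c ℕ.* suc k₂′ ≡ 2 ℕ.* a ℕ.* (a ℕ.+ 1)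
      k₂-ℕ = ℤ.+-injective (trans (ℤ.pos-* c (suc k₂′)) (trans (cong (+ c *_) (sym (proj₂ k₂-pos)))
        (trans (k₂-eq x₀) (sym (trans (ℤ.pos-* (2 ℕ.* a) (a ℕ.+ 1)) (cong (_* + (a ℕ.+ 1)) (ℤ.pos-* 2 a)))))))
      least-ℕ : (2 ℕ.* suc t′ ℕ.+ 3) ℕ.* c ℕ.≤ 2 ℕ.* a ℕ.+ 8
      least-ℕ = ℤ.drop‿+≤+ (subst₂ _≤_ lhs (cong (_+ + 8) (sym (ℤ.pos-* 2 a))) least)
        where
        lhs : + 2 * + b + + 3 * + c ≡ + ((2 ℕ.* suc t′ ℕ.+ 3) ℕ.* c)
        lhs = trans (cong (λ e → + 2 * e + + 3 * + c) bt) (trans (shape (+ c) (+ suc t′))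
          (sym (trans (ℤ.pos-* (2 ℕ.* suc t′ ℕ.+ 3) c) (cong (λ e → (e + + 3) * + c) (ℤ.pos-* 2 (suc t′))))))
          where
          shape : ∀ c t → + 2 * (c * t) + + 3 * c ≡ (+ 2 * t + + 3) * c
          shape = solve-∀
      order-t : + n ≡ 1ℤ + + 2 * + a + + suc k₂′ + + 2 * (+ a + 1ℤ) * + suc t′
      order-t = trans (Ratio.order (+ suc t′) bt x₀) (cong (λ e → 1ℤ + + 2 * + a + e + + 2 * (+ a + 1ℤ) * + suc t′) (proj₂ k₂-pos))
      mult : (+ suc t′ * (+ a + + 2) + (+ a + 1ℤ)) * + suc m′ ≡ + 2 * + suc t′ * (1ℤ + + 2 * + a + + suc k₂′ + + 2 * (+ a + 1ℤ) * + suc t′)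
      mult = cancel-positive-≡ c>0 (trans (shape (+ a) (+ c) (+ suc t′) (+ suc m′))
        (trans (cong₂ (λ b m → ((+ a + + 2) * b + (+ a + 1ℤ) * + c) * m) (sym bt) (sym (proj₂ m-pos)))
        (trans (sym (proj₂ m-trace)) (trans (cong₂ (λ n b → n * (+ 2 * b)) order-t bt)
          (shape′ (1ℤ + + 2 * + a + + suc k₂′ + + 2 * (+ a + 1ℤ) * + suc t′) (+ c) (+ suc t′))))))
        where
        shape : ∀ a c t m → c * ((t * (a + + 2) + (a + 1ℤ)) * m) ≡ ((a + + 2) * (c * t) + (a + 1ℤ) * c) * m
        shape = solve-∀
        shape′ : ∀ n c t → n * (+ 2 * (c * t)) ≡ c * (+ 2 * t * n)
        shape′ = solve-∀
      mult-ℕ : (suc t′ ℕ.* (a ℕ.+ 2) ℕ.+ (a ℕ.+ 1)) ℕ.* suc m′ ≡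
        2 ℕ.* suc t′ ℕ.* (1 ℕ.+ 2 ℕ.* a ℕ.+ suc k₂′ ℕ.+ 2 ℕ.* (a ℕ.+ 1) ℕ.* suc t′)
      mult-ℕ = ℤ.+-injective (trans (ℤ.pos-* (suc t′ ℕ.* (a ℕ.+ 2) ℕ.+ (a ℕ.+ 1)) (suc m′))
        (trans (cong (λ e → (e + + (a ℕ.+ 1)) * + suc m′) (ℤ.pos-* (suc t′) (a ℕ.+ 2))) (trans mult
        (sym (trans (ℤ.pos-* (2 ℕ.* suc t′) (1 ℕ.+ 2 ℕ.* a ℕ.+ suc k₂′ ℕ.+ 2 ℕ.* (a ℕ.+ 1) ℕ.* suc t′))
          (cong₂ _*_ (ℤ.pos-* 2 (suc t′)) (cong₂ (λ p q → 1ℤ + p + + suc k₂′ + q) (ℤ.pos-* 2 a)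
            (trans (ℤ.pos-* (2 ℕ.* (a ℕ.+ 1)) (suc t′)) (cong (_* + suc t′) (ℤ.pos-* 2 (a ℕ.+ 1)))))))))))

  module _ {n : ℕ} (Γ : Graph (Fin n)) where
    open Graph Γ

    -- The indices are a₃, b₂ and c₂. This is what the identifications use of Γ: its metric with the
    -- parameters in normal form, and adjacency as distance one.
    record Realization (a b c : ℕ) : Set where
      field
        metric : Scheme n (shilla (+ a) (+ b) (+ c))
        ∼⇒1    : ∀ {x y} → x ∼ y → Scheme.d metric x y ≡ 1F
        1⇒∼    : ∀ {x y} → Scheme.d metric x y ≡ 1F → x ∼ y

    private
      parameters-≡ : ∀ {k k′ a₁ a₁′ b₁ b₁′ c₂ c₂′ a₂ a₂′ b₂ b₂′ c₃ c₃′ a₃ a₃′} → k ≡ k′ → a₁ ≡ a₁′ → b₁ ≡ b₁′ →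
        c₂ ≡ c₂′ → a₂ ≡ a₂′ → b₂ ≡ b₂′ → c₃ ≡ c₃′ → a₃ ≡ a₃′ →
        record { k = k ; a₁ = a₁ ; b₁ = b₁ ; c₂ = c₂ ; a₂ = a₂ ; b₂ = b₂ ; c₃ = c₃ ; a₃ = a₃ } ≡
        record { k = k′ ; a₁ = a₁′ ; b₁ = b₁′ ; c₂ = c₂′ ; a₂ = a₂′ ; b₂ = b₂′ ; c₃ = c₃′ ; a₃ = a₃′ }
      parameters-≡ refl refl refl refl refl refl refl refl = refl

    module _ (Γ-shilla : Shilla Γ) (bΓ≡2 : Shilla.bΓ Γ-shilla ≡ + 2) where
      open Shilla Γ-shilla renaming (a to a′)
      open DistanceScheme distanceRegular

      private
        N-positive : ∀ {x y z j m} → N j x y ≡ + m → d y z ≡ 1F → d x z ≡ j → 0ℤ < + m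
        N-positive {x} {y} {z} {j} {zero} e p q = contradiction
          (trans (sym (product-on p q)) (sum-nonneg-zero (λ z → δ 1F (d y z) * δ j (d x z))
            (λ z → *-nonneg (δ-nonneg 1F (d y z)) (δ-nonneg j (d x z))) e z)) λ ()
          where
          δ-nonneg : ∀ (i j : Fin 4) → 0ℤ ≤ δ i j
          δ-nonneg = finite₂ (λ i j → 0ℤ ℤ.≤? δ i j)
        N-positive {m = suc m} _ _ _ = +<+ (s≤s z≤n)

        b₂>0 : 0ℤ < + b 2F
        b₂>0 = let x , z , y , xz , zy , xy = step-far in
          N-positive (N-b y z 2F 3F refl (trans (d-sym y z) zy)) (trans (d-sym z x) xz) (trans (d-sym y x) xy)
        c₃>0 : 0ℤ < + c 3F
        c₃>0 = let x , z , y , xz , zy , xy = step-far in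
          N-positive (N-c y x 3F 2F refl (trans (d-sym y x) xy)) xz (trans (d-sym y z) zy)
        c₂>0 : 0ℤ < + c 2F
        c₂>0 = let x , z , y , xz , zy , xy = step-far in from-walk zy (d⇒Distance zy)
          where
          open import Defs using (Distance; Walk; []; _∷_)
          from-walk : ∀ {z y} → d z y ≡ 2F → Distance Γ z y 2 → 0ℤ < + c 2F
          from-walk {z} {y} zy (_∷_ {y = u} z∼u (u∼y ∷ []) , _) =
            N-positive (N-c z y 2F 1F refl zy) (trans (d-sym y u) (∼⇒d u∼y)) (∼⇒d z∼u)

        A : ℤ
        A = + valency - + c 3F

        a₃≡A : a′ 3F ≡ A
        a₃≡A = trans (cong (λ e → + valency - + e - + c 3F) b-3) (shape (+ valency) (+ c 3F))
          where
          shape : ∀ k c → k - 0ℤ - c ≡ k - c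
          shape = solve-∀

        eigenvalue : IsEigenvalue (adjacencyMatrix Γ) (fromℤ A)
        eigenvalue = let _ , _ , _ , e , _ = θ₁≡a₃ in subst (λ θ → IsEigenvalue (adjacencyMatrix Γ) (fromℤ θ)) a₃≡A e

        quadratic : + valency + a′ 1F * A - A * A ≡ 0ℤ
        quadratic = approximate-eigenvalue⇒quadratic Γ scheme (λ e → ℤ.<-irrefl (sym e) b₂>0)
          (approximate Γ scheme (λ _ _ → ∼⇒d) (λ _ _ → d⇒∼) {A} eigenvalue)

        a₁-eq : a′ 1F ≡ A - + 2
        a₁-eq = trans (shape (a′ 1F) A) (cong (λ e → A - e) (trans (cong (_- a′ 1F) (sym a₃≡A)) bΓ≡2))
          where
          shape : ∀ p q → p ≡ q - (q - p)
          shape = solve-∀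

        k-eq : + valency ≡ + 2 * A
        k-eq = trans (shape (+ valency) (a′ 1F) A) (trans (cong (λ e → e + A * A - a′ 1F * A) quadratic)
          (trans (cong (λ e → 0ℤ + A * A - e * A) a₁-eq) (shape′ A)))
          where
          shape : ∀ k p q → k ≡ (k + p * q - q * q) + q * q - p * q
          shape = solve-∀
          shape′ : ∀ q → 0ℤ + q * q - (q - + 2) * q ≡ + 2 * q
          shape′ = solve-∀

        c₃-eq : A ≡ + c 3F
        c₃-eq = trans (shape A) (trans (cong (_- A) (sym k-eq)) (shape′ (+ valency) (+ c 3F)))
          where
          shape : ∀ q → q ≡ + 2 * q - q
          shape = solve-∀
          shape′ : ∀ k c → k - (k - c) ≡ c
          shape′ = solve-∀

        b₁-eq : + b 1F ≡ + c 3F + 1ℤ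
        b₁-eq = trans (shape (+ valency) (+ b 1F) (+ c 1F)) (trans (cong (λ e → + valency - e - + c 1F) a₁-eq)
          (trans (cong₂ (λ p q → p - (A - + 2) - + q) k-eq c-1) (trans (shape′ A) (cong (_+ 1ℤ) c₃-eq))))
          where
          shape : ∀ k b c → b ≡ k - (k - b - c) - c
          shape = solve-∀
          shape′ : ∀ q → + 2 * q - (q - + 2) - + 1 ≡ q + 1ℤ
          shape′ = solve-∀

        π-eq : π ≡ shilla (+ c 3F) (+ b 2F) (+ c 2F)
        π-eq = parameters-≡ (trans k-eq (cong (+ 2 *_) c₃-eq)) (trans a₁-eq (cong (_- + 2) c₃-eq)) b₁-eq refl
          (cong (λ e → e - + b 2F - + c 2F) (trans k-eq (cong (+ 2 *_) c₃-eq))) refl refl c₃-eq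

      realization : Realization (c 3F) (b 2F) (c 2F)
      realization = record
        { metric = record
          { d = d ; d-refl = d-refl ; d-zero = d-zero ; d-sym = d-sym ; d-tri = d-tri
          ; neighbours = λ f x y → trans (neighbours f x y) (cong (λ π → T π f (d x y)) π-eq) ; far = far }
        ; ∼⇒1 = ∼⇒d ; 1⇒∼ = d⇒∼ }

      cases : ∃[ a ] ∃[ c ] ∃[ t ] Case a c t × Realization a (c ℕ.* t) c
      cases = c 3F , c 2F , t , proj₂ (proj₂ classified) ,
          subst (λ e → Realization (c 3F) e (c 2F)) (proj₁ (proj₂ classified)) realization
        where
        classified = Classification.classified (c 3F) (b 2F) (c 2F) c₃>0 b₂>0 c₂>0 (Realization.metric realization)
        t = proj₁ classified

-- Enumerations, intersection numbers and the excluded array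

module Enumerations where
  open IntegerSums
  open DistanceSchemes
  open BoseMesnerAlgebra
  open ParameterBounds
  open Reduction
  open import Data.Fin.Subset using (Subset; inside; outside; ∣_∣)
  open import Data.Vec using ([]; _∷_)
  open import Function.Bundles using (mk↔ₛ′)
  open import Function.Definitions using (Injective)

  -- A count known as an integer sum becomes an indexed list of vertices, and `sum-over` brings sums
  -- along the list back to intersection numbers.
  record Enumeration {n : ℕ} (m : ℕ) (P : Fin n → Set) (χ : Fin n → ℤ) : Set where
    field
      at        : Fin m → Fin n
      injective : Injective _≡_ _≡_ at
      holds     : ∀ i → P (at i)
      complete  : ∀ {z} → P z → ∃[ i ] at i ≡ z
      sum-over  : ∀ (g : Fin n → ℤ) → sum (λ z → χ z * g z) ≡ sum (λ i → g (at i))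

  private
    uncons : ∀ t → t ≡ - 1ℤ + (1ℤ + t)
    uncons = solve-∀

  enumerate : ∀ {n m} {P : Fin n → Set} (P? : ∀ z → Dec (P z)) (χ : Fin n → ℤ) →
    (∀ {z} → P z → χ z ≡ 1ℤ) → (∀ {z} → ¬ P z → χ z ≡ 0ℤ) → sum χ ≡ + m → Enumeration m P χ
  enumerate {zero} {zero} P? χ on off e = record
    { at = λ () ; injective = λ { {()} } ; holds = λ () ; complete = λ { {()} } ; sum-over = λ _ → refl }
  enumerate {zero} {suc m} P? χ on off ()
  enumerate {suc n} {m} {P} P? χ on off e = go (P? 0F) m e
    where
    go : Dec (P 0F) → ∀ m → sum χ ≡ + m → Enumeration m P χ
    go (no ¬p) m e = record
      { at = suc ∘ at ; injective = injective ∘ Fin.suc-injective ; holds = holds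
      ; complete = λ { {zero} p → contradiction p ¬p ; {suc z} p → let i , q = complete p in i , cong suc q }
      ; sum-over = λ g → trans (cong (_+ sum (λ z → χ (suc z) * g (suc z))) (cong (_* g 0F) (off ¬p)))
          (trans (ℤ.+-identityˡ (sum (λ z → χ (suc z) * g (suc z)))) (sum-over (g ∘ suc))) }
      where
      open Enumeration (enumerate {m = m} (P? ∘ suc) (χ ∘ suc) on off
        (trans (sym (ℤ.+-identityˡ (sum (χ ∘ suc)))) (trans (cong (_+ sum (χ ∘ suc)) (sym (off ¬p))) e)))
    go (yes p) zero e = contradiction (trans (cong (_+ sum (χ ∘ suc)) (sym (on p))) e) λ e′ →
      ℤ.<-irrefl (sym e′) (ℤ.<-≤-trans (+<+ {n = 1} (s≤s z≤n)) (ℤ.≤-trans (ℤ.≤-reflexive (sym (ℤ.+-identityʳ 1ℤ)))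
        (ℤ.+-monoʳ-≤ 1ℤ (sum-nonneg (χ ∘ suc) (λ z → nonneg (P? (suc z)))))))
      where
      nonneg : ∀ {z} → Dec (P z) → 0ℤ ≤ χ z
      nonneg (yes q) = subst (0ℤ ≤_) (sym (on q)) (+≤+ z≤n)
      nonneg (no ¬q) = subst (0ℤ ≤_) (sym (off ¬q)) (+≤+ z≤n)
    go (yes p) (suc m) e = record
      { at = at′
      ; injective = λ { {zero} {zero} _ → refl ; {suc i} {suc j} q → cong suc (injective (Fin.suc-injective q))
                      ; {zero} {suc j} () ; {suc i} {zero} () }
      ; holds = λ { zero → p ; (suc i) → holds i }
      ; complete = λ { {zero} _ → zero , refl ; {suc z} q → let i , r = complete q in suc i , cong suc r }
      ; sum-over = λ g → cong₂ _+_ (trans (cong (_* g 0F) (on p)) (ℤ.*-identityˡ (g 0F))) (sum-over (g ∘ suc)) }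
      where
      open Enumeration (enumerate {m = m} (P? ∘ suc) (χ ∘ suc) on off
        (trans (uncons (sum (χ ∘ suc))) (trans (cong (λ t → - 1ℤ + (t + sum (χ ∘ suc))) (sym (on p))) (cong (_+_ (- 1ℤ)) e))))
      at′ : Fin (suc m) → Fin (suc n)
      at′ zero    = zero
      at′ (suc i) = suc (at i)

  module Counting {n : ℕ} {π : Parameters} (S : Scheme n π) where
    open Scheme S
    open BoseMesner S
    open Parameters π

    Joint : Fin 4 → Fin 4 → Fin n → Fin n → Fin n → Set
    Joint i j x y z = d x z ≡ i × d y z ≡ j

    joint? : ∀ i j x y z → Dec (Joint i j x y z)
    joint? i j x y z with d x z Fin.≟ i | d y z Fin.≟ j
    ... | yes p | yes q = yes (p , q)
    ... | no ¬p | _     = no (¬p ∘ proj₁)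
    ... | _     | no ¬q = no (¬q ∘ proj₂)

    joint-on : ∀ {i j x y z} → Joint i j x y z → δ i (d x z) * δ j (d y z) ≡ 1ℤ
    joint-on {i} {j} (p , q) = cong₂ _*_ (trans (cong (δ i) p) (δ-refl i)) (trans (cong (δ j) q) (δ-refl j))

    joint-off : ∀ {i j x y z} → ¬ Joint i j x y z → δ i (d x z) * δ j (d y z) ≡ 0ℤ
    joint-off {i} {j} {x} {y} {z} ¬p with d x z Fin.≟ i
    ... | no ne = trans (cong (_* δ j (d y z)) (δ-≢ (ne ∘ sym))) (ℤ.*-zeroˡ (δ j (d y z)))
    ... | yes e = trans (cong (δ i (d x z) *_) (δ-≢ {i = j} (λ e′ → ¬p (e , sym e′)))) (ℤ.*-zeroʳ (δ i (d x z)))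

    joint : ∀ {m} i j x y → sum (λ z → δ i (d x z) * δ j (d y z)) ≡ + m →
      Enumeration m (Joint i j x y) (λ z → δ i (d x z) * δ j (d y z))
    joint i j x y = enumerate (joint? i j x y) _ joint-on joint-off

    Sphere : ℕ → Fin 4 → Fin n → Set
    Sphere m i x = Enumeration m (λ z → d x z ≡ i) (λ z → δ i (d x z))

    enumerate-sphere : ∀ {m} i x → sum (λ z → δ i (d x z)) ≡ + m → Sphere m i x
    enumerate-sphere i x = enumerate (λ z → d x z Fin.≟ i) _
      (λ e → trans (cong (δ i) e) (δ-refl i)) (λ ne → δ-≢ (ne ∘ sym))

    sum-sphere : ∀ {m y} → (N : Sphere m 1F y) → ∀ (g : Fin 4 → ℤ) z →
      sum (λ i → g (d (Enumeration.at N i) z)) ≡ T π g (d y z)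
    sum-sphere {y = y} N g z = trans (sym (Enumeration.sum-over N (λ w → g (d w z))))
      (trans (sum-cong-≗ (λ w → cong (λ e → δ 1F (d y w) * g e) (d-sym w z)))
        (trans (neighbours g z y) (cong (T π g) (d-sym z y))))

    -- For numerical parameters the equation on `v` holds by `refl`, so each intersection number of
    -- a concrete array is one evaluation of `convolution`.
    intersection : ∀ (f g : Fin 4 → ℤ) v {x y h} → 0ℤ < c₂ * c₃ → c₂ * c₃ * v ≡ convolution f g h → d x y ≡ h →
      sum (λ z → f (d x z) * g (d y z)) ≡ v
    intersection f g v {x} {y} pos e p = cancel-positive-≡ pos
      (trans (product f g x y) (trans (cong (convolution f g) p) (sym e)))

    unique : ∀ {i j x y z z′} → sum (λ z → δ i (d x z) * δ j (d y z)) ≡ 1ℤ →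
      Joint i j x y z → Joint i j x y z′ → z ≡ z′
    unique {i} {j} {x} {y} e p p′ = let open Enumeration (joint {1} i j x y e) in same (complete p) (complete p′)
      where
      same : ∀ {at : Fin 1 → Fin n} {z z′} → ∃[ i ] at i ≡ z → ∃[ i ] at i ≡ z′ → z ≡ z′
      same (0F , q) (0F , q′) = trans (sym q) q′

    none : ∀ {i j x y z} → sum (λ z → δ i (d x z) * δ j (d y z)) ≡ 0ℤ → ¬ Joint i j x y z
    none {i} {j} {x} {y} e p = let open Enumeration (joint {0} i j x y e) in absurd (complete p)
      where
      absurd : ∀ {A : Set} {P : Fin 0 → Set} → ∃ P → A
      absurd (() , _)

  injective⇒surjective : ∀ {n} (f : Fin n → Fin n) → Injective _≡_ _≡_ f → ∀ y → ∃[ x ] f x ≡ y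
  injective⇒surjective {suc n} f inj y with Fin.any? (λ x → f x Fin.≟ y)
  ... | yes p = p
  ... | no ¬p = contradiction
    (Fin.injective⇒≤ {f = λ x → Fin.punchOut (off x)} (λ {x} {x′} e → inj (Fin.punchOut-injective (off x) (off x′) e)))
    (ℕ.<-irrefl refl)
    where
    off : ∀ x → y ≢ f x
    off x e = ¬p (x , sym e)

  -- `rank` bounds the size of W by N = n. Hence an injective f is onto: `rank ∘ f` is an injection
  -- of a finite set into itself.
  isomorphism : ∀ {n N} {W : Set} {Γ : Graph (Fin n)} {Δ : Graph W} → n ≡ N →
    (rank : W → Fin N) → (∀ {v w} → rank v ≡ rank w → v ≡ w) → (f : Fin n → W) → (∀ {x y} → f x ≡ f y → x ≡ y) →
    (∀ x y → Graph._∼_ Γ x y ⇔ Graph._∼_ Δ (f x) (f y)) → Γ ≅ Δ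
  isomorphism {n} {W = W} refl rank rank-inj f f-inj adj = record
    { vertices = mk↔ₛ′ f f⁻¹ f∘f⁻¹ (λ x → f-inj (f∘f⁻¹ (f x))) ; adjacency = adj }
    where
    preimage : ∀ w → ∃[ x ] rank (f x) ≡ rank w
    preimage w = injective⇒surjective (rank ∘ f) (f-inj ∘ rank-inj) (rank w)
    f⁻¹ : W → Fin n
    f⁻¹ w = proj₁ (preimage w)
    f∘f⁻¹ : ∀ w → f (f⁻¹ w) ≡ w
    f∘f⁻¹ w = rank-inj (proj₂ (preimage w))

  binomial : ℕ → ℕ → ℕ
  binomial zero    zero    = 1
  binomial zero    (suc k) = 0
  binomial (suc n) zero    = binomial n zero
  binomial (suc n) (suc k) = binomial n k ℕ.+ binomial n (suc k)

  subset-rank : ∀ {n} k (S : Subset n) → ∣ S ∣ ≡ k → Fin (binomial n k)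
  subset-rank zero    []            _ = zero
  subset-rank zero    (outside ∷ S) e = subset-rank zero S e
  subset-rank (suc k) (inside  ∷ S) e = subset-rank k S (ℕ.suc-injective e) Fin.↑ˡ _
  subset-rank (suc k) (outside ∷ S) e = _ Fin.↑ʳ subset-rank (suc k) S e
  subset-rank (suc k) []            ()
  subset-rank zero    (inside  ∷ S) ()

  subset-rank-injective : ∀ {n} k (S S′ : Subset n) e e′ → subset-rank k S e ≡ subset-rank k S′ e′ → S ≡ S′
  subset-rank-injective zero [] [] _ _ _ = refl
  subset-rank-injective zero (outside ∷ S) (outside ∷ S′) e e′ p = cong (outside ∷_) (subset-rank-injective zero S S′ e e′ p)
  subset-rank-injective (suc k) (inside ∷ S) (inside ∷ S′) e e′ p =
    cong (inside ∷_) (subset-rank-injective k S S′ _ _ (Fin.↑ˡ-injective _ _ _ p))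
  subset-rank-injective (suc k) (outside ∷ S) (outside ∷ S′) e e′ p =
    cong (outside ∷_) (subset-rank-injective (suc k) S S′ e e′ (Fin.↑ʳ-injective _ _ _ p))
  subset-rank-injective {suc n} (suc k) (inside ∷ S) (outside ∷ S′) e e′ p = contradiction
    (trans (sym (Fin.splitAt-↑ˡ _ _ _)) (trans (cong (Fin.splitAt (binomial n k)) p) (Fin.splitAt-↑ʳ (binomial n k) _ _))) λ ()
  subset-rank-injective {suc n} (suc k) (outside ∷ S) (inside ∷ S′) e e′ p = contradiction
    (trans (sym (Fin.splitAt-↑ˡ _ _ _)) (trans (cong (Fin.splitAt (binomial n k)) (sym p)) (Fin.splitAt-↑ʳ (binomial n k) _ _))) λ ()
  subset-rank-injective zero (inside ∷ S) _ () _ _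
  subset-rank-injective zero _ (inside ∷ S′) _ () _

  KSubset-≡ : ∀ {n k} {S T : KSubset n k} → proj₁ S ≡ proj₁ T → S ≡ T
  KSubset-≡ {S = S , p} {.S , q} refl = cong (S ,_) (ℕ.≡-irrelevant p q)

  KSubset-rank : ∀ {n k} → KSubset n k → Fin (binomial n k)
  KSubset-rank {k = k} (S , e) = subset-rank k S e

  KSubset-rank-injective : ∀ {n k} {S T : KSubset n k} → KSubset-rank S ≡ KSubset-rank T → S ≡ T
  KSubset-rank-injective {k = k} {S , e} {T , e′} p = KSubset-≡ (subset-rank-injective k S T e e′ p)

  module NoGraph {n : ℕ} (S : Scheme n (shilla (+ 3) (+ 4) (+ 2))) where
    open Scheme S
    open Counting S
    open Metric S
    open Existence S
    open Arithmetic (+ 3) (+ 4) (+ 2) (+<+ (s≤s z≤n)) (+<+ (s≤s z≤n)) (+<+ (s≤s z≤n)) S using (distance-2)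

    private
      pos : 0ℤ < + 6
      pos = +<+ (s≤s z≤n)

    -- Here a₁ = 1 and a₂ = 0. Let x ∼ y ∼ z with d(x, z) = 2, and let t complete the triangle on y
    -- and z. If t ∼ x, then y and t have the two common neighbours x and z. Distance 2 from x
    -- contradicts a₂ = 0, t = x would make x and z adjacent, and distance 3 is too far from y.
    absurd : ⊥
    absurd =
      let x , z , xz = distance-2
          y , xy , zy = exists₂ 1F 1F x z (subst (0ℤ <_) (sym (intersection (δ 1F) (δ 1F) (+ 2) pos refl xz)) (+<+ (s≤s z≤n)))
          t , yt , zt = exists₂ 1F 1F y z (subst (0ℤ <_) (sym (intersection (δ 1F) (δ 1F) (+ 1) pos refl (trans (d-sym y z) zy))) (+<+ (s≤s z≤n)))
      in contradict xz xy zy yt zt (d x t) refl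
      where
      contradict : ∀ {x y z t} → d x z ≡ 2F → d x y ≡ 1F → d z y ≡ 1F → d y t ≡ 1F → d z t ≡ 1F → ∀ i → d x t ≡ i → ⊥
      contradict {x} {y} {z} {t} xz xy zy yt zt 0F e = contradiction
        (trans (sym xz) (trans (cong (λ x → d x z) (d-zero e)) (trans (d-sym t z) zt))) λ ()
      contradict {x} {y} {z} {t} xz xy zy yt zt 1F e = contradiction
        (trans (sym (d-refl z)) (trans (cong (λ u → d u z) (sym x≡z)) xz)) λ ()
        where
        x≡z : x ≡ z
        x≡z = unique {1F} {1F} {y} {t} (intersection (δ 1F) (δ 1F) (+ 1) pos refl yt)
          (trans (d-sym y x) xy , trans (d-sym t x) e) (trans (d-sym y z) zy , trans (d-sym t z) zt)
      contradict {x} {y} {z} {t} xz xy zy yt zt 2F e =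
        none {1F} {2F} {z} {x} (intersection (δ 1F) (δ 2F) 0ℤ pos refl (trans (d-sym z x) xz)) (zt , e)
      contradict {x} {y} {z} {t} xz xy zy yt zt 3F e with subst (λ i → Triangle 1F i (d y t)) e (triangle-at xy t)
      ... | _ , p , _ rewrite yt = contradiction p λ { (s≤s (s≤s ())) }

-- Vertices as sums of points

module GramCoordinates where
  open IntegerSums
  open DistanceSchemes
  open BoseMesnerAlgebra
  open ParameterBounds
  open Reduction
  open Enumerations
  open import Data.Fin.Subset using (Subset; ∣_∣; _∩_)
  open import Data.Vec using ([]; _∷_; tabulate)

  indicator-tabulate : ∀ {n} (p : Fin n → Bool) i → indicator (tabulate p) i ≡ (if p i then 1ℤ else 0ℤ)
  indicator-tabulate p zero    = refl
  indicator-tabulate p (suc i) = indicator-tabulate (p ∘ suc) i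

  indicator-∩ : ∀ {n} (S S′ : Subset n) i → indicator (S ∩ S′) i ≡ indicator S i * indicator S′ i
  indicator-∩ (true  ∷ S) (true  ∷ S′) zero = refl
  indicator-∩ (true  ∷ S) (false ∷ S′) zero = refl
  indicator-∩ (false ∷ S) (true  ∷ S′) zero = refl
  indicator-∩ (false ∷ S) (false ∷ S′) zero = refl
  indicator-∩ (_ ∷ S) (_ ∷ S′) (suc i) = indicator-∩ S S′ i

  indicator-square : ∀ {n} (S : Subset n) i → indicator S i * indicator S i ≡ indicator S i
  indicator-square (true  ∷ S) zero    = refl
  indicator-square (false ∷ S) zero    = refl
  indicator-square (_ ∷ S)     (suc i) = indicator-square S i

  -- If the vectors Eᵢ behave like (multiples of) the characteristic vectors of m points, shifted by a constant,
  -- and every vertex is a sum of σ of these points, then distances are determined by intersections.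
  module Coordinates {n : ℕ} {π : Parameters} (S : Scheme n π) (u : Fin 4 → ℤ) (κ : ℤ) (κ>0 : 0ℤ < κ)
    (idem : ∀ x y → sum (λ z → u (Scheme.d S x z) * u (Scheme.d S y z)) ≡ κ * u (Scheme.d S x y)) where
    open Scheme S
    open Form S u
    open Positive κ κ>0 idem

    combination : ∀ {m} → (Fin m → ℤ) → (Fin m → Vect) → Vect
    combination {zero}  f E = []
    combination {suc m} f E = scale (f 0F) (E 0F) ++ combination (f ∘ suc) (E ∘ suc)

    combination-· : ∀ {m} (f : Fin m → ℤ) (E : Fin m → Vect) z →
      combination f E · z ≡ sum (λ i → f i * E i · z)
    combination-· {zero}  f E z = refl
    combination-· {suc m} f E z = trans (++-· (scale (f 0F) (E 0F)) (combination (f ∘ suc) (E ∘ suc)) z)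
      (cong₂ _+_ (scale-· (f 0F) (E 0F) z) (combination-· (f ∘ suc) (E ∘ suc) z))

    ●-combination : ∀ {m} v (f : Fin m → ℤ) (E : Fin m → Vect) → v ● combination f E ≡ sum (λ i → f i * v ● E i)
    ●-combination {zero}  v f E = refl
    ●-combination {suc m} v f E = trans (●-++ v (scale (f 0F) (E 0F)) (combination (f ∘ suc) (E ∘ suc)))
      (cong₂ _+_ (●-scale v (f 0F) (E 0F)) (●-combination v (f ∘ suc) (E ∘ suc)))

    module _ {m : ℕ} (E : Fin m → Vect) (c γ ε α β σ : ℤ) (gram : ∀ i j → E i ● E j ≡ α * δ i j + β) where

      residue : (Fin m → ℤ) → Fin n → Vect
      residue f z = (c , z) ∷ combination (λ i → - f i) E

      module _ (f : Fin m → ℤ) (z : Fin n) (size : sum f ≡ σ) where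

        residue-· : ∀ w (h : Fin m → ℤ) → (∀ i → E i · w ≡ γ * h i + ε) →
          residue f z · w ≡ c * u (d z w) - (γ * sum (λ i → f i * h i) + ε * σ)
        residue-· w h value = trans (cong (_+_ (c * u (d z w))) (trans (combination-· (λ i → - f i) E w)
            (trans (sum-combination ((- γ , λ i → f i * h i) ∷ (- ε , f) ∷ [])
              (λ i → trans (cong (- f i *_) (value i)) (shape (f i) γ (h i) ε)))
            (cong (λ s → - γ * sum (λ i → f i * h i) + (- ε * s + 0ℤ)) size))))
          (shape′ (c * u (d z w)) γ (sum (λ i → f i * h i)) ε σ)
          where
          shape : ∀ p γ q ε → - p * (γ * q + ε) ≡ - γ * (p * q) + (- ε * p + 0ℤ)
          shape = solve-∀
          shape′ : ∀ x γ q ε σ → x + (- γ * q + (- ε * σ + 0ℤ)) ≡ x - (γ * q + ε * σ)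
          shape′ = solve-∀

        -- Stated for arbitrary integers `f`, because for the Johnson graph it is the nonnegativity
        -- of this norm that forces the coordinates to be 0 or 1.
        residue-norm : (∀ i → E i · z ≡ γ * f i + ε) → let q = sum (λ i → f i * f i) in
          residue f z ● residue f z ≡ c * c * u 0F + - (+ 2 * c * (γ * q + ε * σ)) + (α * q + β * σ * σ)
        residue-norm value = trans (cong₂ _+_ (cong (c *_) (trans (residue-· z f value) (cong (λ p → c * p - (γ * q + ε * σ)) (cong u (d-refl z))))) rest)
          (shape c (u 0F) (γ * q + ε * σ) (α * q + β * σ * σ))
          where
          q = sum (λ i → f i * f i)
          C = combination (λ i → - f i) E
          E●C : ∀ i → E i ● C ≡ - (α * f i + β * σ)
          E●C i = trans (●-combination (E i) (λ j → - f j) E) (trans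
            (sum-combination ((- α , λ j → δ i j * f j) ∷ (- β , f) ∷ [])
              (λ j → trans (cong (- f j *_) (gram i j)) (shape₁ (f j) α (δ i j) β)))
            (trans (cong₂ (λ p q → - α * p + (- β * q + 0ℤ)) (sum-δ i f) size) (shape₂ α (f i) β σ)))
            where
            shape₁ : ∀ p α q β → - p * (α * q + β) ≡ - α * (q * p) + (- β * p + 0ℤ)
            shape₁ = solve-∀
            shape₂ : ∀ α p β σ → - α * p + (- β * σ + 0ℤ) ≡ - (α * p + β * σ)
            shape₂ = solve-∀
          point : C · z ≡ - (γ * q + ε * σ)
          point = trans (sym (cancel (c * u (d z z)) (C · z))) (trans (cong (_- c * u (d z z)) (residue-· z f value))
            (cancel′ (c * u (d z z)) (γ * q + ε * σ)))
            where
            cancel : ∀ a b → a + b - a ≡ b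
            cancel = solve-∀
            cancel′ : ∀ a b → a - b - a ≡ - b
            cancel′ = solve-∀
          square : C ● C ≡ α * q + β * σ * σ
          square = trans (●-combination C (λ i → - f i) E) (trans
            (sum-combination ((α , λ i → f i * f i) ∷ (β * σ , f) ∷ [])
              (λ i → trans (cong (- f i *_) (trans (●-sym C (E i)) (E●C i))) (shape₃ (f i) α β σ)))
            (trans (cong (λ s → α * q + (β * σ * s + 0ℤ)) size) (cong (_+_ (α * q)) (ℤ.+-identityʳ (β * σ * σ)))))
            where
            shape₃ : ∀ p α β σ → - p * - (α * p + β * σ) ≡ α * (p * p) + (β * σ * p + 0ℤ)
            shape₃ = solve-∀
          rest : residue f z ● C ≡ c * - (γ * q + ε * σ) + (α * q + β * σ * σ)
          rest = trans (●-sym (residue f z) C) (cong₂ (λ p q → c * p + q) point square)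
          shape : ∀ c u p q → c * (c * u - p) + (c * - p + q) ≡ c * c * u + - (+ 2 * c * p) + q
          shape = solve-∀

      -- A point pairs to γ + ε with the vertices containing it and to ε with the others. The left
      -- side of the numerical equation is then the norm of c z minus the points of z, so this
      -- vector is null, and pairing it with w gives the distance.
      distance-formula : (P : Fin n → Subset m) → (∀ z → sum (indicator (P z)) ≡ σ) →
        (∀ i z → E i · z ≡ γ * indicator (P z) i + ε) →
        c * c * u 0F + - (+ 2 * c * (γ * σ + ε * σ)) + (α * σ + β * σ * σ) ≡ 0ℤ →
        ∀ z w → c * u (d z w) ≡ γ * + ∣ P z ∩ P w ∣ + ε * σ
      distance-formula P size value vanish z w = trans (ℤ.i-j≡0⇒i≡j (c * u (d z w)) (γ * s + ε * σ)
          (trans (sym (residue-· (f z) z (size z) w (f w) (λ i → value i w))) (null (residue (f z) z) norm w)))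
        (cong (λ s → γ * s + ε * σ)
          (trans (sum-cong-≗ (λ i → sym (indicator-∩ (P z) (P w) i))) (sum-indicator (P z ∩ P w))))
        where
        f : Fin n → Fin m → ℤ
        f z = indicator (P z)
        s = sum (λ i → f z i * f w i)
        norm : residue (f z) z ● residue (f z) z ≡ 0ℤ
        norm = trans (residue-norm (f z) z (size z) (λ i → value i z))
          (trans (cong (λ q → c * c * u 0F + - (+ 2 * c * (γ * q + ε * σ)) + (α * q + β * σ * σ))
            (trans (sum-cong-≗ (indicator-square (P z))) (size z))) vanish)

-- Null triangles in the eigenspace of -3

module NullTriangles where
  open IntegerSums
  open DistanceSchemes
  open BoseMesnerAlgebra
  open ParameterBounds

  -- The function 8(-1/2)ⁱ, an eigenfunction of -3 both for the array {6,4,2;1,2,3} and for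
  -- {6,4,4;1,1,3}.
  w : Fin 4 → ℤ
  w 0F = + 8
  w 1F = - (+ 4)
  w 2F = + 2
  w 3F = - (+ 1)

  Zero : Fin 4 → Fin 4 → Fin 4 → Set
  Zero p q r = w p + (w q + w r) ≡ 0ℤ

  -- If w spans the eigenspace of -3, the characteristic vector of a triangle is null in it.
  module NullLines {n : ℕ} {π : Parameters} (S : Scheme n π) (κ : ℤ) (κ>0 : 0ℤ < κ)
    (idem : ∀ x y → sum (λ z → w (Scheme.d S x z) * w (Scheme.d S y z)) ≡ κ * w (Scheme.d S x y)) where
    open Scheme S

    line-zero : ∀ {p q r} → d p q ≡ 1F → d p r ≡ 1F → d q r ≡ 1F → ∀ z → Zero (d p z) (d q z) (d r z)
    line-zero {p} {q} {r} pq pr qr z = trans (shape (w (d p z)) (w (d q z)) (w (d r z))) (null v norm z)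
      where
      open Form S w
      open Positive κ κ>0 idem
      v : Vect
      v = (1ℤ , p) ∷ (1ℤ , q) ∷ (1ℤ , r) ∷ []
      shape : ∀ a b c → a + (b + c) ≡ 1ℤ * a + (1ℤ * b + (1ℤ * c + 0ℤ))
      shape = solve-∀
      norm : v ● v ≡ 0ℤ
      norm rewrite d-refl p | d-refl q | d-refl r | d-sym q p | d-sym r p | d-sym r q | pq | pr | qr = refl

-- The Odd graph of valency 4

module OddGraphO₄ where
  open IntegerSums
  open DistanceSchemes
  open BoseMesnerAlgebra
  open ParameterBounds
  open Reduction
  open Enumerations
  open GramCoordinates
  open import Data.Fin.Subset using (Subset; ∣_∣; _∩_)
  open import Data.Sum using ([_,_]′)
  open import Data.Vec using (tabulate)
  open import Function.Base using (const)

  sum-⊎ : (h : Fin 4 ⊎ Fin 3 → ℤ) → sum {7} (h ∘ Fin.splitAt 4) ≡ sum (h ∘ inj₁) + sum (h ∘ inj₂)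
  sum-⊎ h = shape (h (inj₁ 0F)) (h (inj₁ 1F)) (h (inj₁ 2F)) (h (inj₁ 3F)) (h (inj₂ 0F)) (h (inj₂ 1F)) (h (inj₂ 2F))
    where
    shape : ∀ p q r s t u v → p + (q + (r + (s + (t + (u + (v + 0ℤ)))))) ≡ (p + (q + (r + (s + 0ℤ)))) + (t + (u + (v + 0ℤ)))
    shape = solve-∀

  δ⊎ : Fin 4 ⊎ Fin 3 → Fin 4 ⊎ Fin 3 → ℤ
  δ⊎ (inj₁ i) (inj₁ j) = δ i j
  δ⊎ (inj₂ i) (inj₂ j) = δ i j
  δ⊎ (inj₁ i) (inj₂ j) = 0ℤ
  δ⊎ (inj₂ i) (inj₁ j) = 0ℤ

  δ-⊎ : ∀ (i j : Fin 7) → δ i j ≡ δ⊎ (Fin.splitAt 4 i) (Fin.splitAt 4 j)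
  δ-⊎ = toWitness {a? = Fin.all? λ i → Fin.all? λ j → δ i j ℤ.≟ δ⊎ (Fin.splitAt 4 i) (Fin.splitAt 4 j)} _

  δ-punchIn : ∀ {n} (p : Fin (suc n)) i j → δ (Fin.punchIn p i) (Fin.punchIn p j) ≡ δ i j
  δ-punchIn p i j with i Fin.≟ j
  ... | yes refl = trans (δ-refl (Fin.punchIn p i)) (sym (δ-refl i))
  ... | no i≢j = trans (δ-≢ (λ e → i≢j (Fin.punchIn-injective p i j e))) (sym (δ-≢ i≢j))

  -- Vertices of O₄ are 3-subsets of 7 points.  A pair of adjacent vertices x ∼ y, i.e. disjoint triples, determines the
  -- point outside x ∪ y, whose characteristic vector is (Σ Γ(x))/3 - y up to a constant.  Four points arise from a fixed x
  -- and its neighbours, the other three from a neighbour y of x and the neighbours of y other than x.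
  module OddGraph {n : ℕ} (Γ : Graph (Fin n)) (R : Realization Γ 2 3 1) where
    open Realization R renaming (metric to S)
    open Scheme S
    open Counting S
    open Metric S

    π : Parameters
    π = shilla (+ 2) (+ 3) (+ 1)

    pos : 0ℤ < + 2
    pos = +<+ (s≤s z≤n)

    -- Eigenfunction of -3, with an eigenspace of dimension 35·12/70 = 6, in which the seven points
    -- sum to zero.
    u : Fin 4 → ℤ
    u 0F = + 12
    u 1F = - (+ 9)
    u 2F = + 5
    u 3F = - (+ 2)

    T-u : ∀ i → T π u i ≡ - (+ 3) * u i
    T-u 0F = refl
    T-u 1F = refl
    T-u 2F = refl
    T-u 3F = refl

    abstract
      u-idem : ∀ x y → sum (λ z → u (d x z) * u (d y z)) ≡ + 70 * u (d x y)
      u-idem x y = go (d x y) refl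
        where
        go : ∀ i → d x y ≡ i → sum (λ z → u (d x z) * u (d y z)) ≡ + 70 * u i
        go 0F e = intersection u u _ pos refl e
        go 1F e = intersection u u _ pos refl e
        go 2F e = intersection u u _ pos refl e
        go 3F e = intersection u u _ pos refl e

      order : n ≡ 35
      order = ℤ.+-injective (trans (sym (sum-1 n)) (intersection (λ _ → 1ℤ) (λ _ → 1ℤ) (+ 35) pos refl (d-refl (proj₁ far))))

      neighbourhood : ∀ x → Sphere 4 1F x
      neighbourhood x = enumerate-sphere 1F x (trans (sum-cong-≗ (λ z → sym (ℤ.*-identityʳ (δ 1F (d x z)))))
        (intersection (δ 1F) (λ _ → 1ℤ) (+ 4) pos refl (d-refl x)))

    -- In O₄ the distances 0, 1, 2, 3 stand for intersections of size 3, 0, 2, 1. A triple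
    -- containing the point outside two disjoint triples meets them in two elements altogether,
    -- which gives the three patterns listed.
    F : Fin 4 → Fin 4 → Bool
    F 1F 2F = true
    F 2F 1F = true
    F 3F 3F = true
    F _  _  = false

    bit : Bool → ℤ
    bit b = if b then 1ℤ else 0ℤ

    module Y = Enumeration (neighbourhood (proj₁ far))

    x₀ y₀ : Fin n
    x₀ = proj₁ far
    y₀ = Y.at 0F

    module X = Enumeration (neighbourhood y₀)

    abstract
      position : ∃[ i ] X.at i ≡ x₀
      position = X.complete (trans (d-sym y₀ x₀) (Y.holds 0F))

    i₀ : Fin 4
    i₀ = proj₁ position

    Point : Set
    Point = Fin 4 ⊎ Fin 3

    base arm : Point → Fin n
    base = [ const x₀ , const y₀ ]′
    arm  = [ Y.at , X.at ∘ Fin.punchIn i₀ ]′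

    around : Point → Fin 4 → Fin n
    around = [ const Y.at , const X.at ]′

    base∼arm : ∀ p → d (base p) (arm p) ≡ 1F
    base∼arm (inj₁ i) = Y.holds i
    base∼arm (inj₂ j) = X.holds (Fin.punchIn i₀ j)

    open Form S u
    open Positive (+ 70) (+<+ (s≤s z≤n)) u-idem using (●-sym)
    open Coordinates S u (+ 70) (+<+ (s≤s z≤n)) u-idem using (distance-formula)

    total : ∀ {m} → (Fin m → Fin n) → Vect
    total {zero}  e = []
    total {suc m} e = (1ℤ , e 0F) ∷ total (e ∘ suc)

    total-· : ∀ {m} (e : Fin m → Fin n) z → total e · z ≡ sum (λ i → u (d (e i) z))
    total-· {zero}  e z = refl
    total-· {suc m} e z = cong₂ _+_ (ℤ.*-identityˡ (u (d (e 0F) z))) (total-· (e ∘ suc) z)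

    ●-total : ∀ {m} v (e : Fin m → Fin n) → v ● total e ≡ sum (λ i → v · e i)
    ●-total {zero}  v e = refl
    ●-total {suc m} v e = cong₂ _+_ (ℤ.*-identityˡ (v · e 0F)) (●-total v (e ∘ suc))

    E : Point → Vect
    E p = (- (+ 3) , arm p) ∷ total (around p)

    E-· : ∀ p z → E p · z ≡ - (+ 3) * u (d (arm p) z) + - (+ 3) * u (d (base p) z)
    E-· p z = cong (_+_ (- (+ 3) * u (d (arm p) z))) (trans (total-· (around p) z) (trans (around-sum p) (T-u (d (base p) z))))
      where
      around-sum : ∀ p → sum (λ i → u (d (around p i) z)) ≡ T π u (d (base p) z)
      around-sum (inj₁ _) = sum-sphere (neighbourhood x₀) u z
      around-sum (inj₂ _) = sum-sphere (neighbourhood y₀) u z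

    inside : Fin n → Point → ℤ
    inside z p = bit (F (d (base p) z) (d (arm p) z))

    E-inside : ∀ p z → E p · z ≡ + 21 * inside z p + - (+ 9)
    E-inside p z = trans (E-· p z) (table (d (base p) z) (d (arm p) z) (triangle-at (base∼arm p) z)
      (λ { (e , e′) → none {1F} {1F} {base p} {arm p} (intersection (δ 1F) (δ 1F) 0ℤ pos refl (base∼arm p)) (e , e′) })
      (λ { (e , e′) → none {2F} {2F} {base p} {arm p} (intersection (δ 2F) (δ 2F) 0ℤ pos refl (base∼arm p)) (e , e′) }))
      where
      table : ∀ i j → Triangle 1F i j → ¬ (i ≡ 1F × j ≡ 1F) → ¬ (i ≡ 2F × j ≡ 2F) →
        - (+ 3) * u j + - (+ 3) * u i ≡ + 21 * bit (F i j) + - (+ 9)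
      table = finite₂ (λ i j → Triangle? 1F i j →-dec (¬? ((i Fin.≟ 1F) ×-dec (j Fin.≟ 1F))) →-dec
        (¬? ((i Fin.≟ 2F) ×-dec (j Fin.≟ 2F))) →-dec (- (+ 3) * u j + - (+ 3) * u i ℤ.≟ + 21 * bit (F i j) + - (+ 9)))

    punctured : ∀ (g : Fin 4 → ℤ) → sum (g ∘ Fin.punchIn i₀) ≡ sum g - g i₀
    punctured g = trans (shape (sum (g ∘ Fin.punchIn i₀)) (g i₀)) (cong (_- g i₀) (sym (sum-remove {i = i₀} g)))
      where
      shape : ∀ p q → p ≡ q + p - q
      shape = solve-∀

    -- As functions on the vertices, the four vectors `E` about x₀ add up to -3x₀ and the three
    -- about y₀ to 3x₀. Each value is 21 or 0, minus 9, so 21 times the number of points of z is 63.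
    size : ∀ z → sum (inside z ∘ Fin.splitAt 4) ≡ + 3
    size z = cancel-positive-≡ {+ 21} (+<+ (s≤s z≤n)) (trans (recover (sum (inside z ∘ Fin.splitAt 4)))
        (cong (_+ + 63) (trans (sym constant) vanish)))
      where
      recover : ∀ s → + 21 * s ≡ (+ 21 * s - + 63) + + 63
      recover = solve-∀
      constant : sum {7} (λ i → E (Fin.splitAt 4 i) · z) ≡ + 21 * sum (inside z ∘ Fin.splitAt 4) - + 63
      constant = trans (sum-combination ((+ 21 , inside z ∘ Fin.splitAt 4) ∷ (- (+ 9) , λ _ → 1ℤ) ∷ [])
          (λ i → trans (E-inside (Fin.splitAt 4 i) z) (shape (inside z (Fin.splitAt 4 i)))))
        (shape′ (sum (inside z ∘ Fin.splitAt 4)))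
        where
        shape : ∀ p → + 21 * p + - (+ 9) ≡ + 21 * p + (- (+ 9) * 1ℤ + 0ℤ)
        shape = solve-∀
        shape′ : ∀ s → + 21 * s + (- (+ 63) + 0ℤ) ≡ + 21 * s - + 63
        shape′ = solve-∀
      ux = u (d x₀ z)
      uy = u (d y₀ z)
      first : sum (λ i → E (inj₁ i) · z) ≡ - (+ 3) * ux
      first = trans (sum-combination ((- (+ 3) , λ i → u (d (Y.at i) z)) ∷ (- (+ 3) * ux , λ _ → 1ℤ) ∷ [])
          (λ i → trans (E-· (inj₁ i) z) (shape (u (d (Y.at i) z)) ux)))
        (trans (cong (λ s → - (+ 3) * s + (- (+ 3) * ux * + 4 + 0ℤ)) (trans (sum-sphere (neighbourhood x₀) u z) (T-u (d x₀ z)))) (shape′ ux))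
        where
        shape : ∀ p q → - (+ 3) * p + - (+ 3) * q ≡ - (+ 3) * p + (- (+ 3) * q * 1ℤ + 0ℤ)
        shape = solve-∀
        shape′ : ∀ p → - (+ 3) * (- (+ 3) * p) + (- (+ 3) * p * + 4 + 0ℤ) ≡ - (+ 3) * p
        shape′ = solve-∀
      second : sum (λ j → E (inj₂ j) · z) ≡ + 3 * ux
      second = trans (sum-combination ((- (+ 3) , λ j → u (d (X.at (Fin.punchIn i₀ j)) z)) ∷ (- (+ 3) * uy , λ _ → 1ℤ) ∷ [])
          (λ j → trans (E-· (inj₂ j) z) (shape (u (d (X.at (Fin.punchIn i₀ j)) z)) uy)))
        (trans (cong (λ s → - (+ 3) * s + (- (+ 3) * uy * + 3 + 0ℤ)) (trans (punctured (λ i → u (d (X.at i) z)))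
            (cong₂ _-_ (trans (sum-sphere (neighbourhood y₀) u z) (T-u (d y₀ z))) (cong (λ x → u (d x z)) (proj₂ position)))))
          (shape′ ux uy))
        where
        shape : ∀ p q → - (+ 3) * p + - (+ 3) * q ≡ - (+ 3) * p + (- (+ 3) * q * 1ℤ + 0ℤ)
        shape = solve-∀
        shape′ : ∀ p q → - (+ 3) * (- (+ 3) * q - p) + (- (+ 3) * q * + 3 + 0ℤ) ≡ + 3 * p
        shape′ = solve-∀
      vanish : sum {7} (λ i → E (Fin.splitAt 4 i) · z) ≡ 0ℤ
      vanish = trans (sum-⊎ (λ p → E p · z)) (trans (cong₂ _+_ first second) (shape ux))
        where
        shape : ∀ p → - (+ 3) * p + + 3 * p ≡ 0ℤ
        shape = solve-∀

    fork : ∀ {x y z} → d x y ≡ 1F → d x z ≡ 1F → y ≢ z → d y z ≡ 2F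
    fork {x} {y} {z} p q y≢z = go (d y z) refl
      where
      go : ∀ i → d y z ≡ i → d y z ≡ 2F
      go 0F e = contradiction (d-zero e) y≢z
      go 1F e = contradiction (q , e) (none {1F} {1F} {x} {y} (intersection (δ 1F) (δ 1F) 0ℤ pos refl p))
      go 2F e = e
      go 3F e = contradiction (subst (Triangle 1F (d x z)) e (triangle-at p z)) λ t →
        too-far (subst (λ i → Triangle 1F i 3F) q t)
        where
        too-far : ¬ Triangle 1F 1F 3F
        too-far (_ , _ , s≤s (s≤s ()))

    -- In the model, the neighbours of x are the four triples in the complement of x, and the i-th
    -- point is the one that the i-th of them omits.
    inside-fork : ∀ {x} (N : Sphere 4 1F x) i k → let open Enumeration N in bit (F (d x (at k)) (d (at i) (at k))) ≡ 1ℤ - δ i k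
    inside-fork {x} N i k = go (i Fin.≟ k)
      where
      open Enumeration N
      go : Dec (i ≡ k) → bit (F (d x (at k)) (d (at i) (at k))) ≡ 1ℤ - δ i k
      go (yes refl) = trans (cong₂ (λ p q → bit (F p q)) (holds i) (d-refl (at i))) (cong (_-_ 1ℤ) (sym (δ-refl i)))
      go (no i≢k) = trans (cong₂ (λ p q → bit (F p q)) (holds k) (fork (holds i) (holds k) (i≢k ∘ injective))) (cong (_-_ 1ℤ) (sym (δ-≢ i≢k)))

    -- In the model, the points of the second kind lie in x₀, hence in no neighbour of x₀. The
    -- pattern to be excluded makes two neighbours of x₀ adjacent to w, which contradicts c₂ = 1.
    inside-across : ∀ j k → bit (F (d y₀ (Y.at k)) (d (X.at (Fin.punchIn i₀ j)) (Y.at k))) ≡ 0ℤ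
    inside-across j 0F = cong (λ p → bit (F p (d (X.at (Fin.punchIn i₀ j)) y₀))) (d-refl y₀)
    inside-across j k@(suc k′) = trans (cong (λ p → bit (F p (d w (Y.at k)))) y₀y) (go (d w (Y.at k)) refl)
      where
      w = X.at (Fin.punchIn i₀ j)
      y₀y : d y₀ (Y.at k) ≡ 2F
      y₀y = fork (Y.holds 0F) (Y.holds k) (λ e → contradiction (Y.injective e) λ ())
      x₀w : d x₀ w ≡ 2F
      x₀w = fork (trans (d-sym y₀ x₀) (Y.holds 0F)) (X.holds (Fin.punchIn i₀ j))
        (λ e → Fin.punchInᵢ≢i i₀ j (X.injective (trans (sym e) (sym (proj₂ position)))))
      go : ∀ i → d w (Y.at k) ≡ i → bit (F 2F i) ≡ 0ℤ
      go 0F e = refl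
      go 1F e = contradiction (Y.injective (unique {1F} {1F} {x₀} {w} (intersection (δ 1F) (δ 1F) (+ 1) pos refl x₀w)
        (Y.holds 0F , trans (d-sym w y₀) (X.holds (Fin.punchIn i₀ j))) (Y.holds k , e))) λ ()
      go 2F e = refl
      go 3F e = refl

    gram : ∀ p q → E p ● E q ≡ + 63 * δ⊎ p q + - (+ 9)
    gram (inj₁ i) (inj₁ j) = within (inj₁ i) Y.at j i (λ k → inside-fork (neighbourhood x₀) i k)
      where
      within : ∀ p (e : Fin 4 → Fin n) j i → (∀ k → inside (e k) p ≡ 1ℤ - δ i k) →
        - (+ 3) * E p · e j + E p ● total e ≡ + 63 * δ i j + - (+ 9)
      within p e j i h = trans (cong₂ (λ s t → - (+ 3) * s + t) (value j) (trans (●-total (E p) e) (sum-cong-≗ value))) (table i j)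
        where
        value : ∀ k → E p · e k ≡ + 21 * (1ℤ - δ i k) + - (+ 9)
        value k = trans (E-inside p (e k)) (cong (λ s → + 21 * s + - (+ 9)) (h k))
        table : ∀ i j → - (+ 3) * (+ 21 * (1ℤ - δ i j) + - (+ 9)) + sum (λ k → + 21 * (1ℤ - δ i k) + - (+ 9)) ≡ + 63 * δ i j + - (+ 9)
        table = finite₂ (λ i j → _ ℤ.≟ _)
    gram (inj₂ i) (inj₂ j) = trans (within (inj₂ i) X.at (Fin.punchIn i₀ j) (Fin.punchIn i₀ i) (λ k → inside-fork (neighbourhood y₀) (Fin.punchIn i₀ i) k))
      (cong (λ s → + 63 * s + - (+ 9)) (δ-punchIn i₀ i j))
      where
      within : ∀ p (e : Fin 4 → Fin n) j i → (∀ k → inside (e k) p ≡ 1ℤ - δ i k) →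
        - (+ 3) * E p · e j + E p ● total e ≡ + 63 * δ i j + - (+ 9)
      within p e j i h = trans (cong₂ (λ s t → - (+ 3) * s + t) (value j) (trans (●-total (E p) e) (sum-cong-≗ value))) (table i j)
        where
        value : ∀ k → E p · e k ≡ + 21 * (1ℤ - δ i k) + - (+ 9)
        value k = trans (E-inside p (e k)) (cong (λ s → + 21 * s + - (+ 9)) (h k))
        table : ∀ i j → - (+ 3) * (+ 21 * (1ℤ - δ i j) + - (+ 9)) + sum (λ k → + 21 * (1ℤ - δ i k) + - (+ 9)) ≡ + 63 * δ i j + - (+ 9)
        table = finite₂ (λ i j → _ ℤ.≟ _)
    gram (inj₁ i) (inj₂ j) = trans (●-sym (E (inj₁ i)) (E (inj₂ j))) (gram (inj₂ j) (inj₁ i))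
    gram (inj₂ j) (inj₁ i) = cong₂ (λ s t → - (+ 3) * s + t) (value i)
        (trans (●-total (E (inj₂ j)) Y.at) (sum-cong-≗ value))
      where
      value : ∀ k → E (inj₂ j) · Y.at k ≡ - (+ 9)
      value k = trans (E-inside (inj₂ j) (Y.at k)) (cong (λ s → + 21 * s + - (+ 9)) (inside-across j k))

    P : Fin n → Subset 7
    P z = tabulate (λ i → F (d (base (Fin.splitAt 4 i)) z) (d (arm (Fin.splitAt 4 i)) z))

    indicator-P : ∀ z i → indicator (P z) i ≡ inside z (Fin.splitAt 4 i)
    indicator-P z = indicator-tabulate _

    size-P : ∀ z → sum (indicator (P z)) ≡ + 3
    size-P z = trans (sum-cong-≗ (indicator-P z)) (size z)

    formula : ∀ z w → + 3 * u (d z w) ≡ + 21 * + ∣ P z ∩ P w ∣ + - (+ 9) * + 3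
    formula = distance-formula (E ∘ Fin.splitAt 4) (+ 3) (+ 21) (- (+ 9)) (+ 63) (- (+ 9)) (+ 3)
      (λ i j → trans (gram (Fin.splitAt 4 i) (Fin.splitAt 4 j)) (cong (λ s → + 63 * s + - (+ 9)) (sym (δ-⊎ i j))))
      P size-P (λ i z → trans (E-inside (Fin.splitAt 4 i) z) (cong (λ s → + 21 * s + - (+ 9)) (sym (indicator-P z i)))) refl

    triple : Fin n → KSubset 7 3
    triple z = P z , ℤ.+-injective (trans (sym (sum-indicator (P z))) (size-P z))

    intersection-size : ∀ {m m′} → + 21 * + m + - (+ 9) * + 3 ≡ + 21 * + m′ + - (+ 9) * + 3 → m ≡ m′
    intersection-size {m} {m′} e = ℤ.+-injective (cancel-positive-≡ {+ 21} (+<+ (s≤s z≤n)) (cancel-+ (- (+ 27)) e))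

    same : ∀ z w → P z ≡ P w → z ≡ w
    same z w e = d-zero (table (d z w) (ℤ.*-cancelˡ-≡ (+ 3) (u (d z w)) (u 0F)
      (trans (formula z w) (trans (cong (λ Q → + 21 * + ∣ P z ∩ Q ∣ + - (+ 9) * + 3) (sym e)) (trans (sym (formula z z)) (cong (λ i → + 3 * u i) (d-refl z)))))))
      where
      table : ∀ i → u i ≡ u 0F → i ≡ 0F
      table 0F _ = refl
      table 1F ()
      table 2F ()
      table 3F ()

    adjacent : ∀ z w → d z w ≡ 1F ⇔ ∣ P z ∩ P w ∣ ≡ 0
    adjacent z w = mk⇔
      (λ e → intersection-size {∣ P z ∩ P w ∣} {0} (trans (sym (formula z w)) (cong (λ i → + 3 * u i) e)))
      (λ e → table (d z w) (ℤ.*-cancelˡ-≡ (+ 3) (u (d z w)) (u 1F) (trans (formula z w) (cong (λ m → + 21 * + m + - (+ 9) * + 3) e))))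
      where
      table : ∀ i → u i ≡ u 1F → i ≡ 1F
      table 0F ()
      table 1F _ = refl
      table 2F ()
      table 3F ()

    result : Γ ≅ oddGraph 4
    result = isomorphism order KSubset-rank (λ {v} {w} → KSubset-rank-injective {S = v} {w}) triple
      (λ {x} {y} e → same x y (cong proj₁ e))
      (λ x y → mk⇔ (Equivalence.to (adjacent x y) ∘ ∼⇒1) (1⇒∼ ∘ Equivalence.from (adjacent x y)))
      where open import Function.Bundles using (module Equivalence)

-- The Hamming graph H(3,3)

module HammingGraphH33 where
  open IntegerSums
  open DistanceSchemes
  open BoseMesnerAlgebra
  open ParameterBounds
  open Reduction
  open Enumerations
  open NullTriangles
  open import Data.Vec using (Vec; []; _∷_)
  open import Defs using (hammingDistance)

  ternary-rank : Vec (Fin 3) 3 → Fin 27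
  ternary-rank (p ∷ q ∷ r ∷ []) = Fin.combine p (Fin.combine q r)

  ternary-rank-injective : ∀ {v w} → ternary-rank v ≡ ternary-rank w → v ≡ w
  ternary-rank-injective {p ∷ q ∷ r ∷ []} {p′ ∷ q′ ∷ r′ ∷ []} e =
    let e₁ , e′ = Fin.combine-injective p (Fin.combine q r) p′ (Fin.combine q′ r′) e
        e₂ , e₃ = Fin.combine-injective q r q′ r′ e′
    in cong₂ _∷_ e₁ (cong₂ _∷_ e₂ (cong (_∷ []) e₃))

  ternary-distance : ∀ (p q r p′ q′ r′ : Fin 3) →
    + hammingDistance (p ∷ q ∷ r ∷ []) (p′ ∷ q′ ∷ r′ ∷ []) ≡ + 3 - (δ p p′ + (δ q q′ + δ r r′))
  ternary-distance = toWitness {a? = Fin.all? λ p → Fin.all? λ q → Fin.all? λ r → Fin.all? λ p′ → Fin.all? λ q′ → Fin.all? λ r′ →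
    + hammingDistance (p ∷ q ∷ r ∷ []) (p′ ∷ q′ ∷ r′ ∷ []) ℤ.≟ + 3 - (δ p p′ + (δ q q′ + δ r r′))} _

  -- The three lines through a vertex x are coordinate axes: the i-th coordinate of z is the point nearest to z on the i-th line.
  module Hamming {n : ℕ} (Γ : Graph (Fin n)) (R : Realization Γ 3 2 2) where
    open Realization R renaming (metric to S)
    open Scheme S
    open Counting S
    open Metric S
    open Existence S
    open Arithmetic (+ 3) (+ 2) (+ 2) (+<+ (s≤s z≤n)) (+<+ (s≤s z≤n)) (+<+ (s≤s z≤n)) S using (coclique; Coclique)

    pos : 0ℤ < + 6
    pos = +<+ (s≤s z≤n)

    -- Eigenfunction of 3 which is also 2 minus the distance, so the comparison with the Hamming
    -- distance is linear.
    u : Fin 4 → ℤ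
    u 0F = + 2
    u 1F = + 1
    u 2F = 0ℤ
    u 3F = - (+ 1)

    abstract
      u-idem : ∀ x y → sum (λ z → u (d x z) * u (d y z)) ≡ + 9 * u (d x y)
      u-idem x y = go (d x y) refl
        where
        go : ∀ i → d x y ≡ i → sum (λ z → u (d x z) * u (d y z)) ≡ + 9 * u i
        go 0F e = intersection u u _ pos refl e
        go 1F e = intersection u u _ pos refl e
        go 2F e = intersection u u _ pos refl e
        go 3F e = intersection u u _ pos refl e

      w-idem : ∀ x y → sum (λ z → w (d x z) * w (d y z)) ≡ + 27 * w (d x y)
      w-idem x y = go (d x y) refl
        where
        go : ∀ i → d x y ≡ i → sum (λ z → w (d x z) * w (d y z)) ≡ + 27 * w i
        go 0F e = intersection w w _ pos refl e
        go 1F e = intersection w w _ pos refl e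
        go 2F e = intersection w w _ pos refl e
        go 3F e = intersection w w _ pos refl e

      order : n ≡ 27
      order = ℤ.+-injective (trans (sym (sum-1 n)) (intersection (λ _ → 1ℤ) (λ _ → 1ℤ) (+ 27) pos refl (d-refl (proj₁ far))))

      -- Pairwise nonadjacent neighbours of x lie on different lines through x, so these three span
      -- the axes.
      frame : ∃[ x ] ∃[ y₁ ] ∃[ y₂ ] ∃[ y₃ ] Coclique x y₁ y₂ y₃
      frame = coclique

      third : ∀ {x y} → d x y ≡ 1F → ∃[ z ] d x z ≡ 1F × d y z ≡ 1F
      third {x} {y} e = exists₂ 1F 1F x y (subst (0ℤ <_) (sym (intersection (δ 1F) (δ 1F) (+ 1) pos refl e)) (+<+ (s≤s z≤n)))

    open NullLines S (+ 27) (+<+ (s≤s z≤n)) w-idem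

    -- A null triangle has the distances i, i + 1, i + 1 in some order, so one of its points is
    -- strictly nearest and comparison with the first entry finds it.
    near : Fin 4 → Fin 4 → Fin 4 → Fin 3
    near p q r with toℕ q ℕ.<? toℕ p | toℕ r ℕ.<? toℕ p
    ... | yes _ | _     = 1F
    ... | no  _ | yes _ = 2F
    ... | no  _ | no  _ = 0F

    x : Fin n
    x = proj₁ frame

    arm arm′ : Fin 3 → Fin n
    arm 0F = proj₁ (proj₂ frame)
    arm 1F = proj₁ (proj₂ (proj₂ frame))
    arm 2F = proj₁ (proj₂ (proj₂ (proj₂ frame)))

    x-arm : ∀ i → d x (arm i) ≡ 1F
    x-arm 0F = proj₁ (proj₂ (proj₂ (proj₂ (proj₂ frame))))
    x-arm 1F = proj₁ (proj₂ (proj₂ (proj₂ (proj₂ (proj₂ frame)))))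
    x-arm 2F = proj₁ (proj₂ (proj₂ (proj₂ (proj₂ (proj₂ (proj₂ frame))))))

    arm-arm : ∀ {i j} → i ≢ j → d (arm i) (arm j) ≡ 2F
    arm-arm {i} {j} = go i j (proj₂ (proj₂ (proj₂ (proj₂ frame))))
      where
      go : ∀ i j → Coclique x (arm 0F) (arm 1F) (arm 2F) → i ≢ j → d (arm i) (arm j) ≡ 2F
      go 0F 1F (_ , _ , _ , e , _ , _) _ = e
      go 0F 2F (_ , _ , _ , _ , e , _) _ = e
      go 1F 2F (_ , _ , _ , _ , _ , e) _ = e
      go 1F 0F (_ , _ , _ , e , _ , _) _ = trans (d-sym (arm 1F) (arm 0F)) e
      go 2F 0F (_ , _ , _ , _ , e , _) _ = trans (d-sym (arm 2F) (arm 0F)) e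
      go 2F 1F (_ , _ , _ , _ , _ , e) _ = trans (d-sym (arm 2F) (arm 1F)) e
      go 0F 0F _ ne = contradiction refl ne
      go 1F 1F _ ne = contradiction refl ne
      go 2F 2F _ ne = contradiction refl ne

    arm′ i = proj₁ (third (x-arm i))

    x-arm′ : ∀ i → d x (arm′ i) ≡ 1F
    x-arm′ i = proj₁ (proj₂ (third (x-arm i)))

    arm-arm′ : ∀ i → d (arm i) (arm′ i) ≡ 1F
    arm-arm′ i = proj₂ (proj₂ (third (x-arm i)))

    line : Fin 3 → Fin 3 → Fin n
    line i 0F = x
    line i 1F = arm i
    line i 2F = arm′ i

    line-pattern : ∀ i z → Zero (d x z) (d (arm i) z) (d (arm′ i) z)
    line-pattern i = line-zero (x-arm i) (x-arm′ i) (arm-arm′ i)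

    coordinate : Fin n → Fin 3 → Fin 3
    coordinate z i = near (d x z) (d (arm i) z) (d (arm′ i) z)

    open Form S u
    open Positive (+ 9) (+<+ (s≤s z≤n)) u-idem

    -- Stands for the indicator of the words with i-th coordinate s, shifted to be orthogonal to the
    -- constants: its values are 2 and -1.
    U : Fin 3 → Fin 3 → Vect
    U i s = (+ 3 , line i s) ∷ (- 1ℤ , x) ∷ (- 1ℤ , arm i) ∷ (- 1ℤ , arm′ i) ∷ []

    pick : Fin 4 → Fin 4 → Fin 4 → Fin 3 → Fin 4
    pick p q r 0F = p
    pick p q r 1F = q
    pick p q r 2F = r

    U-· : ∀ i s z → U i s · z ≡ + 3 * δ s (coordinate z i) + - 1ℤ
    U-· i s z = trans (cong (λ e → + 3 * u e + (- 1ℤ * u (d x z) + (- 1ℤ * u (d (arm i) z) + (- 1ℤ * u (d (arm′ i) z) + 0ℤ)))) (picked s))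
      (table (d x z) (d (arm i) z) (d (arm′ i) z) (line-pattern i z) s)
      where
      picked : ∀ s → d (line i s) z ≡ pick (d x z) (d (arm i) z) (d (arm′ i) z) s
      picked 0F = refl
      picked 1F = refl
      picked 2F = refl
      table : ∀ p q r → Zero p q r → ∀ s →
        + 3 * u (pick p q r s) + (- 1ℤ * u p + (- 1ℤ * u q + (- 1ℤ * u r + 0ℤ))) ≡ + 3 * δ s (near p q r) + - 1ℤ
      table = finite₃ (λ p q r → (w p + (w q + w r) ℤ.≟ 0ℤ) →-dec Fin.all? λ s →
        + 3 * u (pick p q r s) + (- 1ℤ * u p + (- 1ℤ * u q + (- 1ℤ * u r + 0ℤ))) ℤ.≟ + 3 * δ s (near p q r) + - 1ℤ)

    coordinate-same : ∀ i s → coordinate (line i s) i ≡ s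
    coordinate-same i 0F = trans (cong₂ (λ q r → near (d x x) q r) (trans (d-sym (arm i) x) (x-arm i)) (trans (d-sym (arm′ i) x) (x-arm′ i)))
      (cong (λ p → near p 1F 1F) (d-refl x))
    coordinate-same i 1F = cong₂ (λ p q → near p q (d (arm′ i) (arm i))) (x-arm i) (d-refl (arm i))
    coordinate-same i 2F = trans (cong₂ (λ p q → near p q (d (arm′ i) (arm′ i))) (x-arm′ i) (arm-arm′ i))
      (cong (near 1F 1F) (d-refl (arm′ i)))

    arm-arm′-far : ∀ {i j} → i ≢ j → d (arm i) (arm′ j) ≡ 2F
    arm-arm′-far {i} {j} ne = table (d (arm′ j) (arm i)) (trans (cong₂ (λ p q → w p + (w q + w (d (arm′ j) (arm i))))
        (sym (x-arm i)) (sym (arm-arm (ne ∘ sym)))) (line-pattern j (arm i))) (d-sym (arm i) (arm′ j))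
      where
      table : ∀ r → Zero 1F 2F r → ∀ {e} → e ≡ r → e ≡ 2F
      table 0F ()
      table 1F ()
      table 2F _ e = e
      table 3F ()

    coordinate-other : ∀ {i j} → i ≢ j → ∀ s → coordinate (line j s) i ≡ 0F
    coordinate-other {i} {j} ne 0F = coordinate-same i 0F
    coordinate-other {i} {j} ne 1F = trans (cong₂ (λ p q → near p q (d (arm′ i) (arm j))) (x-arm j) (arm-arm ne))
      (cong (near 1F 2F) (trans (d-sym (arm′ i) (arm j)) (arm-arm′-far (ne ∘ sym))))
    coordinate-other {i} {j} ne 2F = trans (cong₂ (λ p q → near p q (d (arm′ i) (arm′ j))) (x-arm′ j) (arm-arm′-far ne))
      (go (d (arm′ i) (arm′ j)) (trans (cong₂ (λ p q → w p + (w q + w (d (arm′ i) (arm′ j)))) (sym (x-arm′ j)) (sym (arm-arm′-far ne))) (line-pattern i (arm′ j))))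
      where
      go : ∀ r → Zero 1F 2F r → near 1F 2F r ≡ 0F
      go 0F ()
      go 1F ()
      go 2F _ = refl
      go 3F ()

    U-same : ∀ i s → U i s ● U i s ≡ + 6
    U-same i s = trans (combine (at s) (at 0F) (at 1F) (at 2F)) (table s)
      where
      at : ∀ t → U i s · line i t ≡ + 3 * δ s t + - 1ℤ
      at t = trans (U-· i s (line i t)) (cong (λ c → + 3 * δ s c + - 1ℤ) (coordinate-same i t))
      combine : ∀ {a b c d a′ b′ c′ d′} → a ≡ a′ → b ≡ b′ → c ≡ c′ → d ≡ d′ →
        + 3 * a + (- 1ℤ * b + (- 1ℤ * c + (- 1ℤ * d + 0ℤ))) ≡ + 3 * a′ + (- 1ℤ * b′ + (- 1ℤ * c′ + (- 1ℤ * d′ + 0ℤ)))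
      combine refl refl refl refl = refl
      table : ∀ s → + 3 * (+ 3 * δ s s + - 1ℤ) + (- 1ℤ * (+ 3 * δ s 0F + - 1ℤ) + (- 1ℤ * (+ 3 * δ s 1F + - 1ℤ) + (- 1ℤ * (+ 3 * δ s 2F + - 1ℤ) + 0ℤ))) ≡ + 6
      table 0F = refl
      table 1F = refl
      table 2F = refl

    U-other : ∀ {i j} → i ≢ j → ∀ s t → U i s ● U j t ≡ 0ℤ
    U-other {i} {j} ne s t = trans (combine (at t) (at 0F) (at 1F) (at 2F)) (shape (+ 3 * δ s 0F + - 1ℤ))
      where
      at : ∀ t → U i s · line j t ≡ + 3 * δ s 0F + - 1ℤ
      at t = trans (U-· i s (line j t)) (cong (λ c → + 3 * δ s c + - 1ℤ) (coordinate-other ne t))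
      combine : ∀ {a b c d e} → a ≡ e → b ≡ e → c ≡ e → d ≡ e →
        + 3 * a + (- 1ℤ * b + (- 1ℤ * c + (- 1ℤ * d + 0ℤ))) ≡ + 3 * e + (- 1ℤ * e + (- 1ℤ * e + (- 1ℤ * e + 0ℤ)))
      combine refl refl refl refl = refl
      shape : ∀ e → + 3 * e + (- 1ℤ * e + (- 1ℤ * e + (- 1ℤ * e + 0ℤ))) ≡ 0ℤ
      shape = solve-∀

    -- 3z is the sum of its three vectors `U`: these are mutually orthogonal of norm 6 and pair with
    -- z to 2, so the difference has norm 18 - 36 + 18 = 0.
    formula : ∀ z v → + 3 * u (d z v) ≡ sum (λ i → + 3 * δ (coordinate z i) (coordinate v i) + - 1ℤ)
    formula z v = recover (+ 3 * u (d z v)) (sum (λ i → + 3 * δ (coordinate z i) (coordinate v i) + - 1ℤ))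
        (trans (sym (residue-· v)) (null residue norm v))
      where
      C : Fin 3 → Vect
      C i = U i (coordinate z i)
      residue : Vect
      residue = (+ 3 , z) ∷ scale (- 1ℤ) (C 0F ++ (C 1F ++ C 2F))
      sum-· : ∀ v → (C 0F ++ (C 1F ++ C 2F)) · v ≡ sum (λ i → C i · v)
      sum-· v = trans (++-· (C 0F) (C 1F ++ C 2F) v) (trans (cong (_+_ (C 0F · v)) (++-· (C 1F) (C 2F) v)) (shape (C 0F · v) (C 1F · v) (C 2F · v)))
        where
        shape : ∀ a b c → a + (b + c) ≡ a + (b + (c + 0ℤ))
        shape = solve-∀
      residue-· : ∀ v → residue · v ≡ + 3 * u (d z v) - sum (λ i → + 3 * δ (coordinate z i) (coordinate v i) + - 1ℤ)
      residue-· v = trans (cong (_+_ (+ 3 * u (d z v))) (trans (scale-· (- 1ℤ) (C 0F ++ (C 1F ++ C 2F)) v)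
          (cong (- 1ℤ *_) (trans (sum-· v) (sum-cong-≗ (λ i → U-· i (coordinate z i) v))))))
        (shape (+ 3 * u (d z v)) (sum (λ i → + 3 * δ (coordinate z i) (coordinate v i) + - 1ℤ)))
        where
        shape : ∀ a b → a + - 1ℤ * b ≡ a - b
        shape = solve-∀
      C-residue : ∀ i → residue ● C i ≡ 0ℤ
      C-residue i = trans (●-sym residue (C i)) (trans (cong₂ _+_
          (cong (+ 3 *_) (trans (U-· i (coordinate z i) z) (cong (λ e → + 3 * e + - 1ℤ) (δ-refl (coordinate z i)))))
          (trans (●-scale (C i) (- 1ℤ) (C 0F ++ (C 1F ++ C 2F))) (cong (- 1ℤ *_)
            (trans (●-++ (C i) (C 0F) (C 1F ++ C 2F)) (trans (cong (_+_ (C i ● C 0F)) (●-++ (C i) (C 1F) (C 2F))) (total i))))))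
        refl)
        where
        total : ∀ i → C i ● C 0F + (C i ● C 1F + C i ● C 2F) ≡ + 6
        total 0F = cong₂ _+_ (U-same 0F (coordinate z 0F)) (cong₂ _+_ (U-other (λ ()) (coordinate z 0F) (coordinate z 1F)) (U-other (λ ()) (coordinate z 0F) (coordinate z 2F)))
        total 1F = cong₂ _+_ (U-other (λ ()) (coordinate z 1F) (coordinate z 0F)) (cong₂ _+_ (U-same 1F (coordinate z 1F)) (U-other (λ ()) (coordinate z 1F) (coordinate z 2F)))
        total 2F = cong₂ _+_ (U-other (λ ()) (coordinate z 2F) (coordinate z 0F)) (cong₂ _+_ (U-other (λ ()) (coordinate z 2F) (coordinate z 1F)) (U-same 2F (coordinate z 2F)))
      norm : residue ● residue ≡ 0ℤ
      norm = trans (cong₂ (λ a b → + 3 * a + b) self (trans (●-scale residue (- 1ℤ) (C 0F ++ (C 1F ++ C 2F))) (cong (- 1ℤ *_) zero-sum))) refl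
        where
        self : residue · z ≡ 0ℤ
        self = trans (residue-· z) (cong₂ (λ a b → + 3 * a - b) (cong u (d-refl z))
          (sum-cong-≗ (λ i → cong (λ e → + 3 * e + - 1ℤ) (δ-refl (coordinate z i)))))
        zero-sum : residue ● (C 0F ++ (C 1F ++ C 2F)) ≡ 0ℤ
        zero-sum = trans (●-++ residue (C 0F) (C 1F ++ C 2F)) (cong₂ _+_ (C-residue 0F)
          (trans (●-++ residue (C 1F) (C 2F)) (cong₂ _+_ (C-residue 1F) (C-residue 2F))))
      recover : ∀ a b → a - b ≡ 0ℤ → a ≡ b
      recover a b e = ℤ.i-j≡0⇒i≡j a b e

    word : Fin n → Vec (Fin 3) 3
    word z = coordinate z 0F ∷ coordinate z 1F ∷ coordinate z 2F ∷ []

    distance : ∀ z v → u (d z v) ≡ + 2 - + hammingDistance (word z) (word v)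
    distance z v = ℤ.*-cancelˡ-≡ (+ 3) (u (d z v)) (+ 2 - + hammingDistance (word z) (word v)) (trans (formula z v)
      (trans (shape (δ (coordinate z 0F) (coordinate v 0F)) (δ (coordinate z 1F) (coordinate v 1F)) (δ (coordinate z 2F) (coordinate v 2F)))
        (cong (λ h → + 3 * (+ 2 - h)) (sym (ternary-distance (coordinate z 0F) (coordinate z 1F) (coordinate z 2F)
          (coordinate v 0F) (coordinate v 1F) (coordinate v 2F))))))
      where
      shape : ∀ a b c → (+ 3 * a + - 1ℤ) + ((+ 3 * b + - 1ℤ) + ((+ 3 * c + - 1ℤ) + 0ℤ)) ≡ + 3 * (+ 2 - (+ 3 - (a + (b + c))))
      shape = solve-∀

    distance-ℤ : ∀ i h → u i ≡ + 2 - + h → toℕ i ≡ h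
    distance-ℤ i h e = ℤ.+-injective (trans (table i) (trans (cong (λ e → + 2 - e) e) (shape (+ h))))
      where
      table : ∀ i → + toℕ i ≡ + 2 - u i
      table 0F = refl
      table 1F = refl
      table 2F = refl
      table 3F = refl
      shape : ∀ h → + 2 - (+ 2 - h) ≡ h
      shape = solve-∀

    word-distance : ∀ z v → toℕ (d z v) ≡ hammingDistance (word z) (word v)
    word-distance z v = distance-ℤ (d z v) _ (distance z v)

    result : Γ ≅ hammingGraph 3 3
    result = isomorphism order ternary-rank (λ {v} {v′} → ternary-rank-injective {v} {v′}) word
      (λ {z} {v} e → d-zero (Fin.toℕ-injective (trans (word-distance z v) (trans (cong (λ ω → hammingDistance ω (word v)) e)
        (trans (sym (word-distance v v)) (cong toℕ (d-refl v)))))))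
      (λ z v → mk⇔ (λ e → trans (sym (word-distance z v)) (cong toℕ (∼⇒1 e)))
        (λ e → 1⇒∼ (Fin.toℕ-injective (trans (word-distance z v) e))))

-- Opposite vertices and reflections for the array of J(9,3)

module JohnsonOpposites where
  open IntegerSums
  open DistanceSchemes
  open BoseMesnerAlgebra
  open ParameterBounds
  open Reduction
  open Enumerations
  open GramCoordinates
  open import Function.Definitions using (Injective)

  too-many : ∀ {n m} {P : Fin n → Set} {χ} → Enumeration m P χ → (e : Fin (suc m) → Fin n) → (∀ i → P (e i)) → ¬ Injective _≡_ _≡_ e
  too-many {m = m} E e P-e inj = ℕ.<-irrefl refl (Fin.injective⇒≤ {suc m} {m} {λ i → proj₁ (complete (P-e i))}
    (λ {i} {j} p → inj (trans (sym (proj₂ (complete (P-e i)))) (trans (cong at p) (proj₂ (complete (P-e j)))))))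
    where open Enumeration E

  -- In J(9,3) the vectors g satisfy x + w + w′ = 0 for pairwise disjoint triples; a vertex w with its opposites
  -- splits Γ₃(w) into antipodal pairs spanning ten equiangular lines in dimension five.
  module JohnsonLocal {n : ℕ} (Γ : Graph (Fin n)) (R : Realization Γ 9 4 4) where
    open Realization R renaming (metric to S) public
    open Scheme S public
    open Counting S public
    open Metric S public
    open Existence S public

    pos : 0ℤ < + 36
    pos = +<+ (s≤s z≤n)

    -- In J(9,3) this is the size of the intersection minus 1. It is an eigenfunction of 9, with an
    -- eigenspace of dimension 84·2/21 = 8.
    g : Fin 4 → ℤ
    g 0F = + 2
    g 1F = + 1
    g 2F = 0ℤ
    g 3F = - (+ 1)

    abstract
      g-idem : ∀ x y → sum (λ z → g (d x z) * g (d y z)) ≡ + 21 * g (d x y)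
      g-idem x y = go (d x y) refl
        where
        go : ∀ i → d x y ≡ i → sum (λ z → g (d x z) * g (d y z)) ≡ + 21 * g i
        go 0F e = intersection g g _ pos refl e
        go 1F e = intersection g g _ pos refl e
        go 2F e = intersection g g _ pos refl e
        go 3F e = intersection g g _ pos refl e

      sphere-size : ∀ x → sum (λ z → δ 3F (d x z)) ≡ + 20
      sphere-size x = trans (sum-cong-≗ (λ z → sym (ℤ.*-identityʳ (δ 3F (d x z)))))
        (intersection (δ 3F) (λ _ → 1ℤ) (+ 20) pos refl (d-refl x))

      point-size : ∀ x → sum (λ z → δ 0F (d x z)) ≡ 1ℤ
      point-size x = trans (sum-cong-≗ (λ z → sym (ℤ.*-identityʳ (δ 0F (d x z)))))
        (intersection (δ 0F) (λ _ → 1ℤ) (+ 1) pos refl (d-refl x))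

      common : ∀ {x y} → d x y ≡ 2F → sum (λ z → δ 1F (d x z) * δ 1F (d y z)) ≡ + 4
      common = intersection (δ 1F) (δ 1F) (+ 4) pos refl

      common-adjacent : ∀ {x y} → d x y ≡ 1F → sum (λ z → δ 1F (d x z) * δ 1F (d y z)) ≡ + 7
      common-adjacent = intersection (δ 1F) (δ 1F) (+ 7) pos refl

    open Form S g public
    open Positive (+ 21) (+<+ (s≤s z≤n)) g-idem public

    g-injective : ∀ i j → g i ≡ g j → i ≡ j
    g-injective = finite₂ (λ i j → (g i ℤ.≟ g j) →-dec (i Fin.≟ j))

    at : ∀ {x y i} → g (d x y) ≡ g i → d x y ≡ i
    at {x} {y} {i} = g-injective (d x y) i

    triangle-norm : ∀ a b c p q r → let v = (p , a) ∷ (q , b) ∷ (r , c) ∷ [] in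
      v ● v ≡ + 2 * (p * p + q * q + r * r + p * q * g (d a b) + p * r * g (d a c) + q * r * g (d b c))
    triangle-norm a b c p q r rewrite d-refl a | d-refl b | d-refl c | d-sym b a | d-sym c a | d-sym c b =
      shape p q r (g (d a b)) (g (d a c)) (g (d b c))
      where
      shape : ∀ p q r x y z → p * (p * + 2 + (q * x + (r * y + 0ℤ))) + (q * (p * x + (q * + 2 + (r * z + 0ℤ))) +
        (r * (p * y + (q * z + (r * + 2 + 0ℤ))) + 0ℤ)) ≡
        + 2 * (p * p + q * q + r * r + p * q * x + p * r * y + q * r * z)
      shape = solve-∀

    quad-norm : ∀ a b c e p q r t → let v = (p , a) ∷ (q , b) ∷ (r , c) ∷ (t , e) ∷ [] in
      v ● v ≡ + 2 * (p * p + q * q + r * r + t * t + p * q * g (d a b) + p * r * g (d a c) + p * t * g (d a e) +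
        q * r * g (d b c) + q * t * g (d b e) + r * t * g (d c e))
    quad-norm a b c e p q r t rewrite d-refl a | d-refl b | d-refl c | d-refl e | d-sym b a | d-sym c a | d-sym e a
      | d-sym c b | d-sym e b | d-sym e c = shape p q r t (g (d a b)) (g (d a c)) (g (d a e)) (g (d b c)) (g (d b e)) (g (d c e))
      where
      shape : ∀ p q r t x y z u v w → p * (p * + 2 + (q * x + (r * y + (t * z + 0ℤ)))) + (q * (p * x + (q * + 2 + (r * u + (t * v + 0ℤ)))) +
        (r * (p * y + (q * u + (r * + 2 + (t * w + 0ℤ)))) + (t * (p * z + (q * v + (r * w + (t * + 2 + 0ℤ)))) + 0ℤ))) ≡
        + 2 * (p * p + q * q + r * r + t * t + p * q * x + p * r * y + p * t * z + q * r * u + q * t * v + r * t * w)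
      shape = solve-∀

    fan-norm : ∀ a b c e → let v = (1ℤ , a) ∷ (1ℤ , b) ∷ (- 1ℤ , c) ∷ (- 1ℤ , e) ∷ [] in
      v ● v ≡ + 8 + + 2 * (g (d a b) - g (d a c) - g (d a e) - g (d b c) - g (d b e) + g (d c e))
    fan-norm a b c e = trans (quad-norm a b c e 1ℤ 1ℤ (- 1ℤ) (- 1ℤ))
      (shape (g (d a b)) (g (d a c)) (g (d a e)) (g (d b c)) (g (d b e)) (g (d c e)))
      where
      shape : ∀ x y z u v w → + 2 * (1ℤ * 1ℤ + 1ℤ * 1ℤ + - 1ℤ * - 1ℤ + - 1ℤ * - 1ℤ + 1ℤ * 1ℤ * x + 1ℤ * - 1ℤ * y + 1ℤ * - 1ℤ * z +
        1ℤ * - 1ℤ * u + 1ℤ * - 1ℤ * v + - 1ℤ * - 1ℤ * w) ≡ + 8 + + 2 * (x - y - z - u - v + w)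
      shape = solve-∀

    Triad : Fin n → Fin n → Fin n → Set
    Triad x w w′ = ∀ z → g (d x z) + (g (d w z) + g (d w′ z)) ≡ 0ℤ

    Parallelogram : Fin n → Fin n → Fin n → Fin n → Set
    Parallelogram a b c e = ∀ z → g (d a z) + g (d b z) ≡ g (d c z) + g (d e z)

    abstract
      -- p³₃₃ = 1 supplies the vertex, and three pairwise opposite vertices sum to a vector of norm
      -- 6 - 6 = 0.
      third : ∀ {x w} → d x w ≡ 3F → ∃[ w′ ] d x w′ ≡ 3F × d w w′ ≡ 3F × Triad x w w′
      third {x} {w} xw =
        let w′ , xw′ , ww′ = exists₂ 3F 3F x w (subst (0ℤ <_) (sym (intersection (δ 3F) (δ 3F) (+ 1) pos refl xw)) (+<+ (s≤s z≤n)))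
        in w′ , xw′ , ww′ , λ z → trans (shape (g (d x z)) (g (d w z)) (g (d w′ z)))
          (null ((1ℤ , x) ∷ (1ℤ , w) ∷ (1ℤ , w′) ∷ []) (trans (triangle-norm x w w′ 1ℤ 1ℤ 1ℤ)
            (norm (cong g xw) (cong g xw′) (cong g ww′))) z)
        where
        shape : ∀ a b c → a + (b + c) ≡ 1ℤ * a + (1ℤ * b + (1ℤ * c + 0ℤ))
        shape = solve-∀
        norm : ∀ {a b c} → a ≡ - 1ℤ → b ≡ - 1ℤ → c ≡ - 1ℤ → + 2 * (1ℤ * 1ℤ + 1ℤ * 1ℤ + 1ℤ * 1ℤ + 1ℤ * 1ℤ * a + 1ℤ * 1ℤ * b + 1ℤ * 1ℤ * c) ≡ 0ℤ
        norm refl refl refl = refl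

      -- a = b + c
      sum-of : ∀ {a b c} → d a b ≡ 1F → d a c ≡ 1F → d b c ≡ 3F → ∀ z → g (d a z) ≡ g (d b z) + g (d c z)
      sum-of {a} {b} {c} ab ac bc z = trans (shape (g (d a z)) (g (d b z)) (g (d c z))) (trans (cong (_+ (g (d b z) + g (d c z)))
          (null ((1ℤ , a) ∷ (- 1ℤ , b) ∷ (- 1ℤ , c) ∷ []) (trans (triangle-norm a b c 1ℤ (- 1ℤ) (- 1ℤ)) (norm (cong g ab) (cong g ac) (cong g bc))) z))
          (ℤ.+-identityˡ (g (d b z) + g (d c z))))
        where
        shape : ∀ a b c → a ≡ (1ℤ * a + (- 1ℤ * b + (- 1ℤ * c + 0ℤ))) + (b + c)
        shape = solve-∀
        norm : ∀ {a b c} → a ≡ 1ℤ → b ≡ 1ℤ → c ≡ - 1ℤ → + 2 * (1ℤ * 1ℤ + - 1ℤ * - 1ℤ + - 1ℤ * - 1ℤ + 1ℤ * - 1ℤ * a + 1ℤ * - 1ℤ * b + - 1ℤ * - 1ℤ * c) ≡ 0ℤ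
        norm refl refl refl = refl

      parallelogram : ∀ {a b c e} → g (d a b) - g (d a c) - g (d a e) - g (d b c) - g (d b e) + g (d c e) ≡ - (+ 4) → Parallelogram a b c e
      parallelogram {a} {b} {c} {e} h z = ℤ.i-j≡0⇒i≡j (g (d a z) + g (d b z)) (g (d c z) + g (d e z))
        (trans (shape (g (d a z)) (g (d b z)) (g (d c z)) (g (d e z)))
          (null ((1ℤ , a) ∷ (1ℤ , b) ∷ (- 1ℤ , c) ∷ (- 1ℤ , e) ∷ []) (trans (fan-norm a b c e) (cong (λ t → + 8 + + 2 * t) h)) z))
        where
        shape : ∀ a b c e → a + b - (c + e) ≡ 1ℤ * a + (1ℤ * b + (- 1ℤ * c + (- 1ℤ * e + 0ℤ)))
        shape = solve-∀

    -- For two vertices opposite w, twice the inner product of their components orthogonal to w. The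
    -- antipode of z in Γ₃(w) is -w - z, and `s` changes sign under it.
    s : Fin 4 → ℤ
    s i = + 2 * g i - 1ℤ

    module Antipodal (w : Fin n) where

      -- The values found below are 12 s(d x y): the projections of the 20 vertices opposite w form
      -- a tight frame in dimension 20·3/12 = 5.
      pairing₃ : Fin n → Fin n → ℤ
      pairing₃ x y = sum (λ z → δ 3F (d w z) * (s (d x z) * s (d y z)))

      abstract
        pairing-self : ∀ {x} → d w x ≡ 3F → pairing₃ x x ≡ + 36
        pairing-self {x} wx = let x′ , _ , _ , triad = third wx in
          trans (sum-combination ((1ℤ , λ z → δ 3F (d w z)) ∷ (+ 8 , λ z → δ 0F (d x z)) ∷ (+ 8 , λ z → δ 0F (d x′ z)) ∷ [])
              (λ z → pointwise (d w z) (d x z) (d x′ z) (triad z)))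
            (cong₂ (λ a b → 1ℤ * a + b) (sphere-size w) (cong₂ (λ a b → + 8 * a + (+ 8 * b + 0ℤ)) (point-size x) (point-size x′)))
          where
          pointwise : ∀ p q q′ → g p + (g q + g q′) ≡ 0ℤ →
            δ 3F p * (s q * s q) ≡ 1ℤ * δ 3F p + (+ 8 * δ 0F q + (+ 8 * δ 0F q′ + 0ℤ))
          pointwise = finite₃ (λ p q q′ → (g p + (g q + g q′) ℤ.≟ 0ℤ) →-dec
            (δ 3F p * (s q * s q) ℤ.≟ 1ℤ * δ 3F p + (+ 8 * δ 0F q + (+ 8 * δ 0F q′ + 0ℤ))))

        -- Let x′ and y′ be the antipodes. The product is 3 at x, y, x′, y′. At any other z opposite
        -- w it is 1, except that it is -1 at common neighbours of x and y′ or of x′ and y. With c₂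
        -- = 4 the sum is 20 - 2·4 - 2·4 + 4·2.
        pairing-adjacent : ∀ {x y} → d w x ≡ 3F → d w y ≡ 3F → d x y ≡ 1F → pairing₃ x y ≡ + 12
        pairing-adjacent {x} {y} wx wy xy =
          let x′ , wx′ , xx′ , tx = third wx
              y′ , wy′ , yy′ , ty = third wy
              xy′ = trans (d-sym x y′) (at {y′} {x} (opposite (d y′ x) (ty x) wx (trans (d-sym y x) xy)))
              x′y = at {x′} {y} (opposite (d x′ y) (tx y) wy xy)
              x′y′ = at {x′} {y′} (last (tx y′) (cong g wy′) (cong g xy′))
          in trans (sum-combination ((1ℤ , λ z → δ 3F (d w z)) ∷ (- (+ 2) , λ z → δ 1F (d x z) * δ 1F (d y′ z)) ∷
                (- (+ 2) , λ z → δ 1F (d x′ z) * δ 1F (d y z)) ∷ (+ 2 , λ z → δ 0F (d x z)) ∷ (+ 2 , λ z → δ 0F (d x′ z)) ∷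
                (+ 2 , λ z → δ 0F (d y z)) ∷ (+ 2 , λ z → δ 0F (d y′ z)) ∷ [])
              (λ z → pointwise (d w z) (d x z) (d x′ z) (tx z) (d y z) (d y′ z) (ty z)
                (triangle-at xy z) (triangle-at xy′ z) (triangle-at x′y z) (triangle-at x′y′ z)))
            (combine (sphere-size w) (common xy′) (common x′y) (point-size x) (point-size x′) (point-size y) (point-size y′))
          where
          opposite : ∀ {a b} c → g a + (g b + g c) ≡ 0ℤ → a ≡ 3F → b ≡ 1F → g c ≡ 0ℤ
          opposite c e refl refl = trans (sym (trans (sym (ℤ.+-assoc (- 1ℤ) 1ℤ (g c))) (ℤ.+-identityˡ (g c)))) e
          last : ∀ {a b c} → a + (b + c) ≡ 0ℤ → a ≡ - 1ℤ → b ≡ 0ℤ → c ≡ 1ℤ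
          last {c = c} e refl refl = trans (shape c) (cong (λ t → t + 1ℤ) e)
            where
            shape : ∀ c → c ≡ - 1ℤ + (0ℤ + c) + 1ℤ
            shape = solve-∀
          pointwise : ∀ p q q′ → g p + (g q + g q′) ≡ 0ℤ → ∀ r r′ → g p + (g r + g r′) ≡ 0ℤ →
            Triangle 1F q r → Triangle 2F q r′ → Triangle 2F q′ r → Triangle 1F q′ r′ →
            δ 3F p * (s q * s r) ≡ 1ℤ * δ 3F p + (- (+ 2) * (δ 1F q * δ 1F r′) + (- (+ 2) * (δ 1F q′ * δ 1F r) +
              (+ 2 * δ 0F q + (+ 2 * δ 0F q′ + (+ 2 * δ 0F r + (+ 2 * δ 0F r′ + 0ℤ))))))
          pointwise = finite₃ (λ p q q′ → (g p + (g q + g q′) ℤ.≟ 0ℤ) →-dec Fin.all? λ r → Fin.all? λ r′ → (g p + (g r + g r′) ℤ.≟ 0ℤ) →-dec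
            (Triangle? 1F q r →-dec Triangle? 2F q r′ →-dec Triangle? 2F q′ r →-dec Triangle? 1F q′ r′ →-dec
            (δ 3F p * (s q * s r) ℤ.≟ 1ℤ * δ 3F p + (- (+ 2) * (δ 1F q * δ 1F r′) + (- (+ 2) * (δ 1F q′ * δ 1F r) +
              (+ 2 * δ 0F q + (+ 2 * δ 0F q′ + (+ 2 * δ 0F r + (+ 2 * δ 0F r′ + 0ℤ)))))))))
          combine : ∀ {a b c e f h k} → a ≡ + 20 → b ≡ + 4 → c ≡ + 4 → e ≡ 1ℤ → f ≡ 1ℤ → h ≡ 1ℤ → k ≡ 1ℤ →
            1ℤ * a + (- (+ 2) * b + (- (+ 2) * c + (+ 2 * e + (+ 2 * f + (+ 2 * h + (+ 2 * k + 0ℤ)))))) ≡ + 12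
          combine refl refl refl refl refl refl refl = refl

        pairing-distant : ∀ {x y} → d w x ≡ 3F → d w y ≡ 3F → d x y ≡ 2F → pairing₃ x y ≡ - (+ 12)
        pairing-distant {x} {y} wx wy xy =
          let y′ , wy′ , _ , ty = third wy
              xy′ = trans (d-sym x y′) (at {y′} {x} (opposite (d y′ x) (ty x) wx (trans (d-sym y x) xy)))
          in trans (sum-combination ((- 1ℤ , λ z → δ 3F (d w z) * (s (d x z) * s (d y′ z))) ∷ [])
              (λ z → pointwise (d w z) (d y z) (d y′ z) (ty z) (s (d x z))))
            (cong (λ a → - 1ℤ * a + 0ℤ) (pairing-adjacent wx wy′ xy′))
          where
          opposite : ∀ {a b} c → g a + (g b + g c) ≡ 0ℤ → a ≡ 3F → b ≡ 2F → g c ≡ 1ℤ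
          opposite c e refl refl = trans (shape (g c)) (cong (_+ 1ℤ) e)
            where
            shape : ∀ c → c ≡ - 1ℤ + (0ℤ + c) + 1ℤ
            shape = solve-∀
          sign : ∀ p r r′ → g p + (g r + g r′) ≡ 0ℤ → δ 3F p * s r ≡ - (δ 3F p * s r′)
          sign = finite₃ (λ p r r′ → (g p + (g r + g r′) ℤ.≟ 0ℤ) →-dec (δ 3F p * s r ℤ.≟ - (δ 3F p * s r′)))
          pointwise : ∀ p r r′ → g p + (g r + g r′) ≡ 0ℤ → ∀ t → δ 3F p * (t * s r) ≡ - 1ℤ * (δ 3F p * (t * s r′)) + 0ℤ
          pointwise p r r′ e t = trans (shape (δ 3F p) t (s r)) (trans (cong (t *_) (sign p r r′ e)) (shape′ (δ 3F p) t (s r′)))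
            where
            shape : ∀ a t b → a * (t * b) ≡ t * (a * b)
            shape = solve-∀
            shape′ : ∀ a t b → t * - (a * b) ≡ - 1ℤ * (a * (t * b)) + 0ℤ
            shape′ = solve-∀

    -- With w at distance 3 from x, y₁, y₂, the norm of r = y₁ + y₂ - x forces some z ∈ Γ₃(w) with ⟨r, z⟩ ≠ 0, 1,
    -- and then r is z or its antipode.
    module _ {x y₁ y₂ : Fin n} (xy₁ : d x y₁ ≡ 1F) (xy₂ : d x y₂ ≡ 1F) (y₁y₂ : d y₁ y₂ ≡ 2F) where
     abstract
      -- Four vertices are opposite both y₁ and y₂, each at distance 2 or 3 from x. One at distance
      -- 2 has the vector x - y₁ - y₂, so of any two at least one is at distance 3.
      far-from : ∃[ w ] d w x ≡ 3F × d w y₁ ≡ 3F × d w y₂ ≡ 3F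
      far-from = select (joint {4} 3F 3F y₁ y₂ (intersection (δ 3F) (δ 3F) (+ 4) pos refl y₁y₂))
        where
        range : ∀ w → d y₁ w ≡ 3F → d x w ≡ 2F ⊎ d x w ≡ 3F
        range w e = table (d x w) (subst (Triangle 1F (d x w)) e (triangle-at xy₁ w))
          where
          table : ∀ i → Triangle 1F i 3F → i ≡ 2F ⊎ i ≡ 3F
          table = toWitness {a? = Fin.all? λ i → Triangle? 1F i 3F →-dec ((i Fin.≟ 2F) ⊎-dec (i Fin.≟ 3F))} _
        determined : ∀ w → d y₁ w ≡ 3F → d y₂ w ≡ 3F → d x w ≡ 2F → ∀ z → g (d w z) ≡ g (d x z) - (g (d y₁ z) + g (d y₂ z))
        determined w e₁ e₂ e z = trans (shape (g (d x z)) (g (d y₁ z)) (g (d y₂ z)) (g (d w z)))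
            (trans (cong (λ t → g (d x z) - (g (d y₁ z) + g (d y₂ z)) - t)
              (null ((1ℤ , x) ∷ (- 1ℤ , y₁) ∷ (- 1ℤ , y₂) ∷ (- 1ℤ , w) ∷ []) (trans (quad-norm x y₁ y₂ w 1ℤ (- 1ℤ) (- 1ℤ) (- 1ℤ))
                (norm (cong g xy₁) (cong g xy₂) (cong g e) (cong g y₁y₂) (cong g e₁) (cong g e₂))) z))
              (shape′ (g (d x z) - (g (d y₁ z) + g (d y₂ z)))))
          where
          shape : ∀ a b c e → e ≡ a - (b + c) - (1ℤ * a + (- 1ℤ * b + (- 1ℤ * c + (- 1ℤ * e + 0ℤ))))
          shape = solve-∀
          shape′ : ∀ a → a - 0ℤ ≡ a
          shape′ = solve-∀
          norm : ∀ {a b c e f h} → a ≡ 1ℤ → b ≡ 1ℤ → c ≡ 0ℤ → e ≡ 0ℤ → f ≡ - 1ℤ → h ≡ - 1ℤ →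
            + 2 * (1ℤ * 1ℤ + - 1ℤ * - 1ℤ + - 1ℤ * - 1ℤ + - 1ℤ * - 1ℤ + 1ℤ * - 1ℤ * a + 1ℤ * - 1ℤ * b + 1ℤ * - 1ℤ * c +
              - 1ℤ * - 1ℤ * e + - 1ℤ * - 1ℤ * f + - 1ℤ * - 1ℤ * h) ≡ 0ℤ
          norm refl refl refl refl refl refl = refl
        select : ∀ {χ} → Enumeration 4 (Joint 3F 3F y₁ y₂) χ → ∃[ w ] d w x ≡ 3F × d w y₁ ≡ 3F × d w y₂ ≡ 3F
        select W = choose (range (W.at 0F) (proj₁ (W.holds 0F))) (range (W.at 1F) (proj₁ (W.holds 1F)))
          where
          module W = Enumeration W
          found : ∀ i → d x (W.at i) ≡ 3F → ∃[ w ] d w x ≡ 3F × d w y₁ ≡ 3F × d w y₂ ≡ 3F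
          found i e = W.at i , trans (d-sym (W.at i) x) e , trans (d-sym (W.at i) y₁) (proj₁ (W.holds i)) , trans (d-sym (W.at i) y₂) (proj₂ (W.holds i))
          coincide : ∀ {v w} → (∀ z → g (d v z) ≡ g (d w z)) → v ≡ w
          coincide {v} {w} e = d-zero (at {v} {w} (trans (e w) (cong g (d-refl w))))
          choose : d x (W.at 0F) ≡ 2F ⊎ d x (W.at 0F) ≡ 3F → d x (W.at 1F) ≡ 2F ⊎ d x (W.at 1F) ≡ 3F →
            ∃[ w ] d w x ≡ 3F × d w y₁ ≡ 3F × d w y₂ ≡ 3F
          choose (inj₂ e) _ = found 0F e
          choose (inj₁ _) (inj₂ e) = found 1F e
          choose (inj₁ e) (inj₁ e′) = contradiction (W.injective (coincide (λ z →
            trans (determined (W.at 0F) (proj₁ (W.holds 0F)) (proj₂ (W.holds 0F)) e z)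
              (sym (determined (W.at 1F) (proj₁ (W.holds 1F)) (proj₂ (W.holds 1F)) e′ z))))) λ ()

      reflect : ∃[ z ] Parallelogram x z y₁ y₂
      reflect = let w , wx , wy₁ , wy₂ = far-from in from-far w wx wy₁ wy₂
        where
        -- `ρ z` is 2⟨r, z⟩ - 1, so ρ² > 1 says that ⟨r, z⟩ is neither 0 nor 1. Over Γ₃(w) the frame
        -- values give Σ(ρ² - 1) = 3·36 - 6·12 - 20 = 16.
        ρ : Fin n → ℤ
        ρ z = s (d y₁ z) + s (d y₂ z) - s (d x z)
        total : ∀ w → let open Antipodal w in pairing₃ y₁ y₁ ≡ + 36 → pairing₃ y₂ y₂ ≡ + 36 → pairing₃ x x ≡ + 36 → pairing₃ y₁ y₂ ≡ - (+ 12) →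
          pairing₃ y₁ x ≡ + 12 → pairing₃ y₂ x ≡ + 12 → sum (λ z → δ 3F (d w z) * (ρ z * ρ z - 1ℤ)) ≡ + 16
        total w e₁ e₂ e₃ e₄ e₅ e₆ = trans (sum-combination
            ((1ℤ , λ z → δ 3F (d w z) * (s (d y₁ z) * s (d y₁ z))) ∷ (1ℤ , λ z → δ 3F (d w z) * (s (d y₂ z) * s (d y₂ z))) ∷
             (1ℤ , λ z → δ 3F (d w z) * (s (d x z) * s (d x z))) ∷ (+ 2 , λ z → δ 3F (d w z) * (s (d y₁ z) * s (d y₂ z))) ∷
             (- (+ 2) , λ z → δ 3F (d w z) * (s (d y₁ z) * s (d x z))) ∷ (- (+ 2) , λ z → δ 3F (d w z) * (s (d y₂ z) * s (d x z))) ∷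
             (- 1ℤ , λ z → δ 3F (d w z)) ∷ [])
            (λ z → shape (δ 3F (d w z)) (s (d y₁ z)) (s (d y₂ z)) (s (d x z))))
          (combine e₁ e₂ e₃ e₄ e₅ e₆ (sphere-size w))
          where
          shape : ∀ m a b c → m * ((a + b - c) * (a + b - c) - 1ℤ) ≡ 1ℤ * (m * (a * a)) + (1ℤ * (m * (b * b)) + (1ℤ * (m * (c * c)) +
            (+ 2 * (m * (a * b)) + (- (+ 2) * (m * (a * c)) + (- (+ 2) * (m * (b * c)) + (- 1ℤ * m + 0ℤ))))))
          shape = solve-∀
          combine : ∀ {a b c e f h k} → a ≡ + 36 → b ≡ + 36 → c ≡ + 36 → e ≡ - (+ 12) → f ≡ + 12 → h ≡ + 12 → k ≡ + 20 →
            1ℤ * a + (1ℤ * b + (1ℤ * c + (+ 2 * e + (- (+ 2) * f + (- (+ 2) * h + (- 1ℤ * k + 0ℤ)))))) ≡ + 16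
          combine refl refl refl refl refl refl refl = refl
        at-three : ∀ (p : Fin 4) t → 0ℤ < δ 3F p * t → p ≡ 3F
        at-three 0F t q = contradiction (subst (0ℤ <_) (ℤ.*-zeroˡ t) q) (ℤ.<-irrefl refl)
        at-three 1F t q = contradiction (subst (0ℤ <_) (ℤ.*-zeroˡ t) q) (ℤ.<-irrefl refl)
        at-three 2F t q = contradiction (subst (0ℤ <_) (ℤ.*-zeroˡ t) q) (ℤ.<-irrefl refl)
        at-three 3F t q = refl
        nontrivial : ∀ (p : Fin 4) → p ≡ 3F → ∀ t → 0ℤ < δ 3F p * t → 0ℤ < t
        nontrivial p refl t q = subst (0ℤ <_) (ℤ.*-identityˡ t) q
        inner : Fin 4 → Fin 4 → Fin 4 → ℤ
        inner p q r = g p + g q - g r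
        -- The norm of r - z is 4 - 2⟨r, z⟩. Used for z and for its antipode, this confines ⟨r, z⟩
        -- to the range from -1 to 2.
        bound : ∀ z → 0ℤ ≤ + 4 - + 2 * inner (d y₁ z) (d y₂ z) (d x z)
        bound z = subst (0ℤ ≤_) (trans (fan-norm y₁ y₂ x z) (value (cong g y₁y₂) (cong g (trans (d-sym y₁ x) xy₁)) (cong g (trans (d-sym y₂ x) xy₂))))
          (nonneg ((1ℤ , y₁) ∷ (1ℤ , y₂) ∷ (- 1ℤ , x) ∷ (- 1ℤ , z) ∷ []))
          where
          value : ∀ {a b c e f h} → a ≡ 0ℤ → b ≡ 1ℤ → c ≡ 1ℤ → + 8 + + 2 * (a - b - e - c - f + h) ≡ + 4 - + 2 * (e + f - h)
          value {e = e} {f} {h} refl refl refl = shape e f h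
            where
            shape : ∀ e f h → + 8 + + 2 * (0ℤ - 1ℤ - e - 1ℤ - f + h) ≡ + 4 - + 2 * (e + f - h)
            shape = solve-∀
        turn : ∀ a b {c} → c + (a + b) ≡ 0ℤ → c ≡ - 1ℤ → b ≡ 1ℤ - a
        turn a b e refl = trans (shape a b) (trans (cong (λ t → t + (1ℤ - a)) e) (ℤ.+-identityˡ (1ℤ - a)))
          where
          shape : ∀ a b → b ≡ - 1ℤ + (a + b) + (1ℤ - a)
          shape = solve-∀
        table : ∀ p q r → 0ℤ < (s p + s q - s r) * (s p + s q - s r) - 1ℤ → 0ℤ ≤ + 4 - + 2 * inner p q r →
          0ℤ ≤ + 2 + + 2 * inner p q r → inner p q r ≡ + 2 ⊎ inner p q r ≡ - 1ℤ
        table = finite₃ (λ p q r → (0ℤ ℤ.<? (s p + s q - s r) * (s p + s q - s r) - 1ℤ) →-dec (0ℤ ℤ.≤? + 4 - + 2 * inner p q r) →-dec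
          (0ℤ ℤ.≤? + 2 + + 2 * inner p q r) →-dec ((inner p q r ℤ.≟ + 2) ⊎-dec (inner p q r ℤ.≟ - 1ℤ)))
        swap-sides : ∀ {z} → Parallelogram y₁ y₂ x z → Parallelogram x z y₁ y₂
        swap-sides e v = sym (e v)
        conclude : ∀ z z′ → g (d y₁ z′) ≡ 1ℤ - g (d y₁ z) → g (d y₂ z′) ≡ 1ℤ - g (d y₂ z) → g (d x z′) ≡ 1ℤ - g (d x z) →
          0ℤ < ρ z * ρ z - 1ℤ → ∃[ z ] Parallelogram x z y₁ y₂
        conclude z z′ t₁ t₂ t zpos = finish (table (d y₁ z) (d y₂ z) (d x z) zpos (bound z)
            (subst (0ℤ ≤_) (trans (cong (λ i → + 4 - + 2 * i) opposite) (shape (inner (d y₁ z) (d y₂ z) (d x z)))) (bound z′)))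
          where
          opposite : inner (d y₁ z′) (d y₂ z′) (d x z′) ≡ 1ℤ - inner (d y₁ z) (d y₂ z) (d x z)
          opposite = trans (cong₂ _-_ (cong₂ _+_ t₁ t₂) t) (shape (g (d y₁ z)) (g (d y₂ z)) (g (d x z)))
            where
            shape : ∀ a b c → 1ℤ - a + (1ℤ - b) - (1ℤ - c) ≡ 1ℤ - (a + b - c)
            shape = solve-∀
          shape : ∀ i → + 4 - + 2 * (1ℤ - i) ≡ + 2 + + 2 * i
          shape = solve-∀
          close : ∀ v → inner (d y₁ v) (d y₂ v) (d x v) ≡ + 2 → ∃[ z ] Parallelogram x z y₁ y₂
          close v e = v , swap-sides (parallelogram (value (cong g y₁y₂) (cong g (trans (d-sym y₁ x) xy₁)) (cong g (trans (d-sym y₂ x) xy₂)) e))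
            where
            value : ∀ {a b c e f h} → a ≡ 0ℤ → b ≡ 1ℤ → c ≡ 1ℤ → e + f - h ≡ + 2 → a - b - e - c - f + h ≡ - (+ 4)
            value {e = e} {f} {h} refl refl refl i = trans (shape″ e f h) (cong (λ i → - (+ 2) - i) i)
              where
              shape″ : ∀ e f h → 0ℤ - 1ℤ - e - 1ℤ - f + h ≡ - (+ 2) - (e + f - h)
              shape″ = solve-∀
          finish : inner (d y₁ z) (d y₂ z) (d x z) ≡ + 2 ⊎ inner (d y₁ z) (d y₂ z) (d x z) ≡ - 1ℤ → ∃[ z ] Parallelogram x z y₁ y₂
          finish (inj₁ e) = close z e
          finish (inj₂ e) = close z′ (trans opposite (cong (λ i → 1ℤ - i) e))
        excess : ∀ w → d w x ≡ 3F → d w y₁ ≡ 3F → d w y₂ ≡ 3F → 0ℤ < sum (λ z → δ 3F (d w z) * (ρ z * ρ z - 1ℤ))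
        excess w wx wy₁ wy₂ = subst (0ℤ <_) (sym (total w (pairing-self wy₁) (pairing-self wy₂) (pairing-self wx)
            (pairing-distant wy₁ wy₂ y₁y₂) (pairing-adjacent wy₁ wx (trans (d-sym y₁ x) xy₁)) (pairing-adjacent wy₂ wx (trans (d-sym y₂ x) xy₂))))
            (+<+ (s≤s z≤n))
          where open Antipodal w
        turned : ∀ {w z z′} → Triad w z z′ → ∀ y → d w y ≡ 3F → g (d y z′) ≡ 1ℤ - g (d y z)
        turned {w} {z} {z′} triad y wy = turn (g (d y z)) (g (d y z′))
          (trans (cong₂ (λ i j → g (d w y) + (g i + g j)) (d-sym y z) (d-sym y z′)) (triad y)) (cong g wy)
        from-far : ∀ w → d w x ≡ 3F → d w y₁ ≡ 3F → d w y₂ ≡ 3F → ∃[ z ] Parallelogram x z y₁ y₂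
        from-far w wx wy₁ wy₂ =
          let z , zpos = sum-positive (λ z → δ 3F (d w z) * (ρ z * ρ z - 1ℤ)) (excess w wx wy₁ wy₂)
              wz = at-three (d w z) (ρ z * ρ z - 1ℤ) zpos
              z′ , _ , _ , triad = third wz
          in conclude z z′ (turned {w} {z} {z′} triad y₁ wy₁) (turned {w} {z} {z′} triad y₂ wy₂) (turned {w} {z} {z′} triad x wx)
               (nontrivial (d w z) wz (ρ z * ρ z - 1ℤ) zpos)

-- Common neighbours of two adjacent vertices of the Johnson graph

module JohnsonLines where
  open IntegerSums
  open DistanceSchemes
  open BoseMesnerAlgebra
  open ParameterBounds
  open LocalBounds
  open Reduction
  open Enumerations
  open GramCoordinates
  open JohnsonOpposites
  import Data.Vec.Relation.Unary.Unique.Propositional.Properties as Unique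
  open import Data.Vec using ([]; _∷_; lookup)
  open import Data.Vec.Relation.Unary.All using ([]; _∷_)
  open import Data.Vec.Relation.Unary.AllPairs using ([]; _∷_)

  -- The common neighbours of two adjacent vertices of J(9,3) form two cliques, of sizes 2 and 5.
  module JohnsonSplit {n : ℕ} (Γ : Graph (Fin n)) (R : Realization Γ 9 4 4) where
    open JohnsonLocal Γ R

    Λ : Fin n → Fin n → Fin n → Set
    Λ = Joint 1F 1F

    image : ∀ {a b c e} → Parallelogram a b c e → ∀ v → g (d b v) ≡ g (d c v) + g (d e v) - g (d a v)
    image {a} {b} {c} {e} p v = trans (shape (g (d a v)) (g (d b v))) (cong (_- g (d a v)) (p v))
      where
      shape : ∀ a b → b ≡ a + b - a
      shape = solve-∀

    image-at : ∀ {a b c e} → Parallelogram a b c e → ∀ v {p q r} → d c v ≡ p → d e v ≡ q → d a v ≡ r →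
      ∀ i → g p + g q - g r ≡ g i → d b v ≡ i
    image-at {a} {b} {c} {e} P v refl refl refl i h = at {b} {v} {i} (trans (image {a} {b} {c} {e} P v) h)

    flip : ∀ {x y i} → d x y ≡ i → d y x ≡ i
    flip {x} {y} e = trans (d-sym y x) e

    ≢-at : ∀ {x y} i → d x y ≡ suc i → x ≢ y
    ≢-at {x} i e refl = contradiction (trans (sym e) (d-refl x)) λ ()

    abstract
      -- Together with the reflections z + z′ - x and z + z′ - y there would be five common
      -- neighbours of z and z′, whereas c₂ = 4.
      no-bridge : ∀ {x y z z′ t} → d x y ≡ 1F → Λ x y z → Λ x y z′ → Λ x y t → d z z′ ≡ 2F → d t z ≡ 1F → d t z′ ≡ 1F → ⊥
      no-bridge {x} {y} {z} {z′} {t} xy (xz , yz) (xz′ , yz′) (xt , yt) zz′ tz tz′ =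
        let x* , X = reflect xz xz′ zz′
            y* , Y = reflect yz yz′ zz′
            x*z  = image-at X z (d-refl z) (flip zz′) xz 1F refl
            x*z′ = image-at X z′ zz′ (d-refl z′) xz′ 1F refl
            y*z  = image-at Y z (d-refl z) (flip zz′) yz 1F refl
            y*z′ = image-at Y z′ zz′ (d-refl z′) yz′ 1F refl
            x*x  = image-at X x (flip xz) (flip xz′) (d-refl x) 2F refl
            x*y  = image-at X y (flip yz) (flip yz′) xy 1F refl
            x*t  = image-at X t (flip tz) (flip tz′) xt 1F refl
            y*x  = image-at Y x (flip xz) (flip xz′) (flip xy) 1F refl
            y*y  = image-at Y y (flip yz) (flip yz′) (d-refl y) 2F refl
            y*t  = image-at Y t (flip tz) (flip tz′) yt 1F refl
            y*x* = image-at Y x* (flip x*z) (flip x*z′) (flip x*y) 1F refl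
        in too-many (joint {4} 1F 1F z z′ (common zz′)) (lookup (x ∷ y ∷ t ∷ x* ∷ y* ∷ []))
            (λ { 0F → flip xz , flip xz′ ; 1F → flip yz , flip yz′ ; 2F → flip tz , flip tz′
               ; 3F → flip x*z , flip x*z′ ; 4F → flip y*z , flip y*z′ })
            (λ {i} {j} → Unique.lookup-injective
              ((≢-at 0F xy ∷ ≢-at 0F xt ∷ ≢-at 1F (flip x*x) ∷ ≢-at 0F (flip y*x) ∷ []) ∷
               (≢-at 0F yt ∷ ≢-at 0F (flip x*y) ∷ ≢-at 1F (flip y*y) ∷ []) ∷
               (≢-at 0F (flip x*t) ∷ ≢-at 0F (flip y*t) ∷ []) ∷
               (≢-at 0F (flip y*x*) ∷ []) ∷ [] ∷ []) i j)

      -- Three pairwise nonadjacent common neighbours z₁, z₂, z₃ of x ∼ y satisfy x + y = z₁ + z₂ + z₃.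
      no-coclique : ∀ {x y z₁ z₂ z₃} → d x y ≡ 1F → Λ x y z₁ → Λ x y z₂ → Λ x y z₃ →
        d z₁ z₂ ≡ 2F → d z₁ z₃ ≡ 2F → d z₂ z₃ ≡ 2F → ⊥
      no-coclique {x} {y} {z₁} {z₂} {z₃} xy Λ₁@(xz₁ , yz₁) Λ₂@(xz₂ , yz₂) Λ₃@(xz₃ , yz₃) e₁₂ e₁₃ e₂₃ =
        let x* , X = reflect xz₁ xz₂ e₁₂
            x*y  = image-at X y (flip yz₁) (flip yz₂) xy 1F refl
            x*z₃ = image-at X z₃ e₁₃ e₂₃ xz₃ 3F refl
            decompose = λ v → trans (sum-of (flip x*y) yz₃ x*z₃ v) (cong (_+ g (d z₃ v)) (image {x} {x*} {z₁} {z₂} X v))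
            -- Paired with a fourth common neighbour z₄ of x and y, the relation says that three
            -- values of `g` sum to 2. So z₄ is adjacent to two of the zᵢ and is a bridge.
            z₄ , Λ₄@(xz₄ , yz₄) , n₁ , n₂ , n₃ = fresh (joint {7} 1F 1F x y (common-adjacent xy))
        in conclude Λ₄ (table (d z₁ z₄) (d z₂ z₄) (d z₃ z₄) (n₁ ∘ d-zero) (n₂ ∘ d-zero) (n₃ ∘ d-zero)
            (subst₂ (λ i j → g i ≡ g (d z₁ z₄) + g (d z₂ z₄) - g j + g (d z₃ z₄)) yz₄ xz₄ (decompose z₄)))
        where
        fresh : ∀ {χ} → Enumeration 7 (Λ x y) χ → ∃[ z ] Λ x y z × z₁ ≢ z × z₂ ≢ z × z₃ ≢ z
        fresh L = search (Fin.any? (λ i → ¬? (z₁ Fin.≟ at′ i) ×-dec ¬? (z₂ Fin.≟ at′ i) ×-dec ¬? (z₃ Fin.≟ at′ i)))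
          where
          open Enumeration L renaming (at to at′)
          Listed : Fin 7 → Set
          Listed i = Σ[ k ∈ Fin 3 ] at′ i ≡ lookup (z₁ ∷ z₂ ∷ z₃ ∷ []) k
          search : Dec (∃[ i ] z₁ ≢ at′ i × z₂ ≢ at′ i × z₃ ≢ at′ i) → ∃[ z ] Λ x y z × z₁ ≢ z × z₂ ≢ z × z₃ ≢ z
          search (yes (i , p)) = at′ i , holds i , p
          search (no ¬p) = contradiction (Fin.injective⇒≤ {7} {3} {λ i → proj₁ (listed i)}
              (λ {i} {j} e → injective (trans (proj₂ (listed i)) (trans (cong (lookup (z₁ ∷ z₂ ∷ z₃ ∷ [])) e) (sym (proj₂ (listed j)))))))
              λ { (s≤s (s≤s (s≤s ()))) }
            where
            listed : ∀ i → Listed i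
            listed i with z₁ Fin.≟ at′ i | z₂ Fin.≟ at′ i | z₃ Fin.≟ at′ i
            ... | yes e | _ | _ = 0F , sym e
            ... | no _ | yes e | _ = 1F , sym e
            ... | no _ | no _ | yes e = 2F , sym e
            ... | no n₁ | no n₂ | no n₃ = contradiction (i , n₁ , n₂ , n₃) ¬p
        table : ∀ p q r → p ≢ 0F → q ≢ 0F → r ≢ 0F → 1ℤ ≡ g p + g q - 1ℤ + g r →
          (p ≡ 1F × q ≡ 1F) ⊎ (p ≡ 1F × r ≡ 1F) ⊎ (q ≡ 1F × r ≡ 1F)
        table = finite₃ (λ p q r → ¬? (p Fin.≟ 0F) →-dec ¬? (q Fin.≟ 0F) →-dec ¬? (r Fin.≟ 0F) →-dec (1ℤ ℤ.≟ g p + g q - 1ℤ + g r) →-dec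
          (((p Fin.≟ 1F) ×-dec (q Fin.≟ 1F)) ⊎-dec ((p Fin.≟ 1F) ×-dec (r Fin.≟ 1F)) ⊎-dec ((q Fin.≟ 1F) ×-dec (r Fin.≟ 1F))))
        conclude : ∀ {z₄} → Λ x y z₄ → (d z₁ z₄ ≡ 1F × d z₂ z₄ ≡ 1F) ⊎ (d z₁ z₄ ≡ 1F × d z₃ z₄ ≡ 1F) ⊎ (d z₂ z₄ ≡ 1F × d z₃ z₄ ≡ 1F) → ⊥
        conclude Λ₄ (inj₁ (p , q))        = no-bridge xy Λ₁ Λ₂ Λ₄ e₁₂ (flip p) (flip q)
        conclude Λ₄ (inj₂ (inj₁ (p , q))) = no-bridge xy Λ₁ Λ₃ Λ₄ e₁₃ (flip p) (flip q)
        conclude Λ₄ (inj₂ (inj₂ (p , q))) = no-bridge xy Λ₂ Λ₃ Λ₄ e₂₃ (flip p) (flip q)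

      -- Of the four common neighbours of y and v two are x and its reflection y + v - x; the other
      -- two are adjacent to x.
      triple-common : ∀ {x y v} → d x y ≡ 1F → d x v ≡ 1F → d y v ≡ 2F →
        sum (λ z → δ 1F (d x z) * δ 1F (d y z) * δ 1F (d z v)) ≡ + 2
      triple-common {x} {y} {v} xy xv yv =
        let x* , X = reflect xy xv yv
            x*y = image-at X y (d-refl y) (flip yv) xy 1F refl
            x*v = image-at X v yv (d-refl v) xv 1F refl
        in trans (sum-combination ((1ℤ , λ z → δ 1F (d y z) * δ 1F (d v z)) ∷ (- 1ℤ , λ z → δ 0F (d x z)) ∷ (- 1ℤ , λ z → δ 0F (d x* z)) ∷ [])
            (λ z → trans (cong (λ i → δ 1F (d x z) * δ 1F (d y z) * δ 1F i) (d-sym z v))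
              (pointwise (d x z) (d x* z) (d y z) (d v z) (X z) (triangle-at xy z) (triangle-at xv z) (triangle-at x*y z) (triangle-at x*v z))))
          (combine (common yv) (point-size x) (point-size x*))
        where
        pointwise : ∀ p p* q r → g p + g p* ≡ g q + g r → Triangle 1F p q → Triangle 1F p r → Triangle 1F p* q → Triangle 1F p* r →
          δ 1F p * δ 1F q * δ 1F r ≡ 1ℤ * (δ 1F q * δ 1F r) + (- 1ℤ * δ 0F p + (- 1ℤ * δ 0F p* + 0ℤ))
        pointwise = finite₄ (λ p p* q r → (g p + g p* ℤ.≟ g q + g r) →-dec Triangle? 1F p q →-dec Triangle? 1F p r →-dec Triangle? 1F p* q →-dec
          Triangle? 1F p* r →-dec (δ 1F p * δ 1F q * δ 1F r ℤ.≟ 1ℤ * (δ 1F q * δ 1F r) + (- 1ℤ * δ 0F p + (- 1ℤ * δ 0F p* + 0ℤ))))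
        combine : ∀ {a b c} → a ≡ + 4 → b ≡ 1ℤ → c ≡ 1ℤ → 1ℤ * a + (- 1ℤ * b + (- 1ℤ * c + 0ℤ)) ≡ + 2
        combine refl refl refl = refl

    h k : Fin 4 → ℤ
    h i = δ 0F i + δ 1F i
    k = δ 2F

    module Edge {x y : Fin n} (xy : d x y ≡ 1F) where

      χ ω : Fin n → ℤ
      χ z = δ 1F (d x z) * δ 1F (d y z)
      ω z = δ 1F (d x z) * δ 2F (d y z)

      χ-cong : ∀ {A A′ : Fin n → ℤ} → (∀ z → Λ x y z → A z ≡ A′ z) → sum (λ z → χ z * A z) ≡ sum (λ z → χ z * A′ z)
      χ-cong {A} {A′} p = sum-cong-≗ (λ z → go z (joint? 1F 1F x y z))
        where
        go : ∀ z → Dec (Λ x y z) → χ z * A z ≡ χ z * A′ z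
        go z (yes l) = cong (χ z *_) (p z l)
        go z (no ¬l) = trans (cong (_* A z) (joint-off ¬l)) (trans (ℤ.*-zeroˡ (A z)) (sym (trans (cong (_* A′ z) (joint-off ¬l)) (ℤ.*-zeroˡ (A′ z)))))

      ω-cong : ∀ {A A′ : Fin n → ℤ} → (∀ z → Joint 1F 2F x y z → A z ≡ A′ z) → sum (λ z → ω z * A z) ≡ sum (λ z → ω z * A′ z)
      ω-cong {A} {A′} p = sum-cong-≗ (λ z → go z (joint? 1F 2F x y z))
        where
        go : ∀ z → Dec (Joint 1F 2F x y z) → ω z * A z ≡ ω z * A′ z
        go z (yes l) = cong (ω z *_) (p z l)
        go z (no ¬l) = trans (cong (_* A z) (joint-off ¬l)) (trans (ℤ.*-zeroˡ (A z)) (sym (trans (cong (_* A′ z) (joint-off ¬l)) (ℤ.*-zeroˡ (A′ z)))))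

      near : ∀ {z z′} → Λ x y z → Λ x y z′ → d z z′ ≢ 3F
      near {z} {z′} (xz , _) (xz′ , _) e = contradiction (subst₂ (λ i j → Triangle 1F i j) xz′ e (triangle-at xz z′)) λ { (_ , _ , s≤s (s≤s ())) }

      abstract
        degree : ∀ {z} → Λ x y z → sum (λ z′ → χ z′ * h (d z z′)) ≡ + 7 - sum (λ z′ → ω z′ * δ 1F (d z z′))
        degree {z} (xz , yz) = trans (sum-combination
            ((1ℤ , λ z′ → δ 1F (d x z′) * h (d z z′)) ∷ (- 1ℤ , λ z′ → δ 0F (d y z′)) ∷ (- 1ℤ , λ z′ → ω z′ * δ 1F (d z z′)) ∷ [])
            (λ z′ → pointwise (d x z′) (d y z′) (d z z′) (triangle-at xy z′) (triangle-at xz z′) (triangle-at yz z′)))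
          (trans (cong₂ (λ a b → 1ℤ * a + (- 1ℤ * b + (- 1ℤ * sum (λ z′ → ω z′ * δ 1F (d z z′)) + 0ℤ)))
              (intersection (δ 1F) h (+ 8) pos refl xz) (point-size y)) (shape (sum (λ z′ → ω z′ * δ 1F (d z z′)))))
          where
          pointwise : ∀ p q r → Triangle 1F p q → Triangle 1F p r → Triangle 1F q r →
            δ 1F p * δ 1F q * h r ≡ 1ℤ * (δ 1F p * h r) + (- 1ℤ * δ 0F q + (- 1ℤ * (δ 1F p * δ 2F q * δ 1F r) + 0ℤ))
          pointwise = finite₃ (λ p q r → Triangle? 1F p q →-dec Triangle? 1F p r →-dec Triangle? 1F q r →-dec
            (δ 1F p * δ 1F q * h r ℤ.≟ 1ℤ * (δ 1F p * h r) + (- 1ℤ * δ 0F q + (- 1ℤ * (δ 1F p * δ 2F q * δ 1F r) + 0ℤ))))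
          shape : ∀ t → 1ℤ * + 8 + (- 1ℤ * 1ℤ + (- 1ℤ * t + 0ℤ)) ≡ + 7 - t
          shape = solve-∀

        -- Each of the 10 neighbours of x at distance 2 from y is adjacent to two common neighbours
        -- of x and y. The closed degree of a common neighbour is 7 minus its neighbours of that
        -- kind, so the total is 7·7 - 10·2.
        edges : sum (λ z → χ z * sum (λ z′ → χ z′ * h (d z z′))) ≡ + 29
        edges = trans (χ-cong (λ z l → degree l)) (trans (sum-combination
            ((+ 7 , χ) ∷ (- 1ℤ , λ z → χ z * sum (λ z′ → ω z′ * δ 1F (d z z′))) ∷ [])
            (λ z → shape (χ z) (sum (λ z′ → ω z′ * δ 1F (d z z′)))))
          (cong₂ (λ a b → + 7 * a + (- 1ℤ * b + 0ℤ)) (common-adjacent xy)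
            (trans (sum-exchange χ ω (λ z′ z → δ 1F (d z z′))) (trans (ω-cong (λ v (xv , yv) → triple-common xy xv yv))
              (trans (sum-combination ((+ 2 , ω) ∷ []) (λ z → shape′ (ω z))) (cong (λ a → + 2 * a + 0ℤ) (intersection (δ 1F) (δ 2F) (+ 10) pos refl xy)))))))
          where
          shape : ∀ c t → c * (+ 7 - t) ≡ + 7 * c + (- 1ℤ * (c * t) + 0ℤ)
          shape = solve-∀
          shape′ : ∀ t → t * + 2 ≡ + 2 * t + 0ℤ
          shape′ = solve-∀

      module Classes {z₀ : Fin n} (l₀ : Λ x y z₀) where

        -- By `no-bridge`, being equal or adjacent is transitive among the common neighbours, and by
        -- `no-coclique` there are at most two classes. So two of them are related iff both or
        -- neither lie in the class of z₀.
        relation : ∀ {z z′} → Λ x y z → Λ x y z′ → h (d z z′) ≡ h (d z₀ z) * h (d z₀ z′) + k (d z₀ z) * k (d z₀ z′)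
        relation {z} {z′} l l′ = table (d z₀ z) (d z₀ z′) (d z z′) (triangle z₀ z z′) (near l₀ l) (near l₀ l′) (near l l′)
          (λ (e₁ , e₂ , e₃) → no-bridge xy l l′ l₀ e₃ e₁ e₂)
          (λ (e₁ , e₂ , e₃) → no-bridge xy l₀ l′ l e₂ (flip e₁) e₃)
          (λ (e₁ , e₂ , e₃) → no-bridge xy l₀ l l′ e₁ (flip e₂) (flip e₃))
          (λ (e₁ , e₂ , e₃) → no-coclique xy l₀ l l′ e₁ e₂ e₃)
          where
          is : ∀ p q r (i j l : Fin 4) → Dec (p ≡ i × q ≡ j × r ≡ l)
          is p q r i j l = (p Fin.≟ i) ×-dec (q Fin.≟ j) ×-dec (r Fin.≟ l)
          table : ∀ p q r → Triangle p q r → p ≢ 3F → q ≢ 3F → r ≢ 3F → ¬ (p ≡ 1F × q ≡ 1F × r ≡ 2F) → ¬ (p ≡ 1F × q ≡ 2F × r ≡ 1F) →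
            ¬ (p ≡ 2F × q ≡ 1F × r ≡ 1F) → ¬ (p ≡ 2F × q ≡ 2F × r ≡ 2F) → h r ≡ h p * h q + k p * k q
          table = finite₃ (λ p q r → Triangle? p q r →-dec ¬? (p Fin.≟ 3F) →-dec ¬? (q Fin.≟ 3F) →-dec ¬? (r Fin.≟ 3F) →-dec
            ¬? (is p q r 1F 1F 2F) →-dec ¬? (is p q r 1F 2F 1F) →-dec ¬? (is p q r 2F 1F 1F) →-dec ¬? (is p q r 2F 2F 2F) →-dec
            (h r ℤ.≟ h p * h q + k p * k q))

        A B : ℤ
        A = sum (λ z → χ z * h (d z₀ z))
        B = sum (λ z → χ z * k (d z₀ z))

        abstract
          A+B : A + B ≡ + 7
          A+B = trans (sym (∑-distrib-+ (λ z → χ z * h (d z₀ z)) (λ z → χ z * k (d z₀ z))))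
            (trans (sum-cong-≗ (λ z → sym (ℤ.*-distribˡ-+ (χ z) (h (d z₀ z)) (k (d z₀ z)))))
              (trans (χ-cong {A′ = λ _ → 1ℤ} (λ z l → table (d z₀ z) (near l₀ l)))
                (trans (sum-cong-≗ (λ z → ℤ.*-identityʳ (χ z))) (common-adjacent xy))))
            where
            table : ∀ i → i ≢ 3F → h i + k i ≡ 1ℤ
            table = toWitness {a? = Fin.all? λ i → ¬? (i Fin.≟ 3F) →-dec (h i + k i ℤ.≟ 1ℤ)} _

          A²+B² : A * A + B * B ≡ + 29
          A²+B² = trans (sym (trans (χ-cong (λ z l → trans (χ-cong (λ z′ l′ → relation l l′)) (inner z)))
              (trans (sum-combination ((A , λ z → χ z * h (d z₀ z)) ∷ (B , λ z → χ z * k (d z₀ z)) ∷ [])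
                (λ z → shape (χ z) (h (d z₀ z)) A (k (d z₀ z)) B)) (cong (_+_ (A * A)) (ℤ.+-identityʳ (B * B)))))) edges
            where
            shape : ∀ c a p b q → c * (a * p + b * q) ≡ p * (c * a) + (q * (c * b) + 0ℤ)
            shape = solve-∀
            shape′ : ∀ c a a′ b b′ → c * (a * a′ + b * b′) ≡ a * (c * a′) + (b * (c * b′) + 0ℤ)
            shape′ = solve-∀
            inner : ∀ z → sum (λ z′ → χ z′ * (h (d z₀ z) * h (d z₀ z′) + k (d z₀ z) * k (d z₀ z′))) ≡ h (d z₀ z) * A + k (d z₀ z) * B
            inner z = trans (sum-combination ((h (d z₀ z) , λ z′ → χ z′ * h (d z₀ z′)) ∷ (k (d z₀ z) , λ z′ → χ z′ * k (d z₀ z′)) ∷ [])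
                (λ z′ → shape′ (χ z′) (h (d z₀ z)) (h (d z₀ z′)) (k (d z₀ z)) (k (d z₀ z′))))
              (cong (_+_ (h (d z₀ z) * A)) (ℤ.+-identityʳ (k (d z₀ z) * B)))

          -- A + B = 7 and A² + B² = 29 leave only 2 and 5; either may be the class of z₀.
          sizes : (A ≡ + 2 × B ≡ + 5) ⊎ (A ≡ + 5 × B ≡ + 2)
          sizes = go A B (sum-nonneg (λ z → χ z * h (d z₀ z)) (λ z → *-nonneg (*-nonneg (δ-nonneg 1F (d x z)) (δ-nonneg 1F (d y z))) (h-nonneg (d z₀ z))))
              (sum-nonneg (λ z → χ z * k (d z₀ z)) (λ z → *-nonneg (*-nonneg (δ-nonneg 1F (d x z)) (δ-nonneg 1F (d y z))) (δ-nonneg 2F (d z₀ z)))) A+B A²+B²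
            where
            δ-nonneg : ∀ (i j : Fin 4) → 0ℤ ≤ δ i j
            δ-nonneg = finite₂ (λ i j → 0ℤ ℤ.≤? δ i j)
            h-nonneg : ∀ i → 0ℤ ≤ h i
            h-nonneg = toWitness {a? = Fin.all? λ i → 0ℤ ℤ.≤? h i} _
            table : ∀ (i j : Fin 8) → + toℕ i + + toℕ j ≡ + 7 → + toℕ i * + toℕ i + + toℕ j * + toℕ j ≡ + 29 →
              (+ toℕ i ≡ + 2 × + toℕ j ≡ + 5) ⊎ (+ toℕ i ≡ + 5 × + toℕ j ≡ + 2)
            table = toWitness {a? = Fin.all? λ i → Fin.all? λ j → (+ toℕ i + + toℕ j ℤ.≟ + 7) →-dec (+ toℕ i * + toℕ i + + toℕ j * + toℕ j ℤ.≟ + 29) →-dec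
              (((+ toℕ i ℤ.≟ + 2) ×-dec (+ toℕ j ℤ.≟ + 5)) ⊎-dec ((+ toℕ i ℤ.≟ + 5) ×-dec (+ toℕ j ℤ.≟ + 2)))} _
            go : ∀ A B → 0ℤ ≤ A → 0ℤ ≤ B → A + B ≡ + 7 → A * A + B * B ≡ + 29 → (A ≡ + 2 × B ≡ + 5) ⊎ (A ≡ + 5 × B ≡ + 2)
            go (+ a) (+ b) _ _ e e′ = subst₂ (λ a b → (+ a ≡ + 2 × + b ≡ + 5) ⊎ (+ a ≡ + 5 × + b ≡ + 2)) (Fin.toℕ-fromℕ< a<8) (Fin.toℕ-fromℕ< b<8)
                (table (fromℕ< a<8) (fromℕ< b<8) (trans (cong₂ (λ a b → + a + + b) (Fin.toℕ-fromℕ< a<8) (Fin.toℕ-fromℕ< b<8)) e)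
                  (trans (cong₂ (λ a b → + a * + a + + b * + b) (Fin.toℕ-fromℕ< a<8) (Fin.toℕ-fromℕ< b<8)) e′))
              where
              a<8 : a ℕ.< 8
              a<8 = s≤s (subst (a ℕ.≤_) (ℤ.+-injective e) (ℕ.m≤m+n a b))
              b<8 : b ℕ.< 8
              b<8 = s≤s (subst (b ℕ.≤_) (ℤ.+-injective e) (ℕ.m≤n+m b a))

      -- Model: for x = pqr and y = pqs, `K` consists of prs and qrs, and `L` of the five triples
      -- pqt.
      record Split : Set₁ where
        field
          K L : Fin n → Set
          χK χL : Fin n → ℤ
          small : Enumeration 2 K χK
          large : Enumeration 5 L χL
          K⊆Λ : ∀ {z} → K z → Λ x y z
          L⊆Λ : ∀ {z} → L z → Λ x y z
          cover : ∀ {z} → Λ x y z → K z ⊎ L z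
          K-clique : ∀ {z z′} → K z → K z′ → z ≢ z′ → d z z′ ≡ 1F
          L-clique : ∀ {z z′} → L z → L z′ → z ≢ z′ → d z z′ ≡ 1F
          K-L : ∀ {z z′} → K z → L z′ → d z z′ ≡ 2F

      private
       module Build {z₀ : Fin n} (l₀ : Λ x y z₀) where
        open Classes l₀

        M N : Fin n → Set
        M z = Λ x y z × d z₀ z ≢ 2F
        N z = Λ x y z × d z₀ z ≡ 2F

        M-enumeration : ∀ {m} → A ≡ + m → Enumeration m M (λ z → χ z * h (d z₀ z))
        M-enumeration = enumerate (λ z → joint? 1F 1F x y z ×-dec ¬? (d z₀ z Fin.≟ 2F)) _
          (λ {z} (l , ne) → cong₂ _*_ (joint-on l) (table (d z₀ z) (near l₀ l) ne))
          (λ {z} ¬p → off z (joint? 1F 1F x y z) ¬p)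
          where
          table : ∀ i → i ≢ 3F → i ≢ 2F → h i ≡ 1ℤ
          table = toWitness {a? = Fin.all? λ i → ¬? (i Fin.≟ 3F) →-dec ¬? (i Fin.≟ 2F) →-dec (h i ℤ.≟ 1ℤ)} _
          off : ∀ z → Dec (Λ x y z) → ¬ M z → χ z * h (d z₀ z) ≡ 0ℤ
          off z (no ¬l) _ = trans (cong (_* h (d z₀ z)) (joint-off ¬l)) (ℤ.*-zeroˡ (h (d z₀ z)))
          off z (yes l) ¬p = trans (cong (λ i → χ z * h i) (two (d z₀ z Fin.≟ 2F))) (ℤ.*-zeroʳ (χ z))
            where
            two : Dec (d z₀ z ≡ 2F) → d z₀ z ≡ 2F
            two (yes e) = e
            two (no ne) = contradiction (l , ne) ¬p

        N-enumeration : ∀ {m} → B ≡ + m → Enumeration m N (λ z → χ z * k (d z₀ z))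
        N-enumeration = enumerate (λ z → joint? 1F 1F x y z ×-dec (d z₀ z Fin.≟ 2F)) _
          (λ {z} (l , e) → cong₂ _*_ (joint-on l) (cong k e))
          (λ {z} ¬p → off z (joint? 1F 1F x y z) ¬p)
          where
          off : ∀ z → Dec (Λ x y z) → ¬ N z → χ z * k (d z₀ z) ≡ 0ℤ
          off z (no ¬l) _ = trans (cong (_* k (d z₀ z)) (joint-off ¬l)) (ℤ.*-zeroˡ (k (d z₀ z)))
          off z (yes l) ¬p = trans (cong (χ z *_) (δ-≢ {i = 2F} (λ e → ¬p (l , sym e)))) (ℤ.*-zeroʳ (χ z))

        M-or-N : ∀ {z} → Λ x y z → M z ⊎ N z
        M-or-N {z} l = go (d z₀ z Fin.≟ 2F)
          where
          go : Dec (d z₀ z ≡ 2F) → M z ⊎ N z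
          go (yes e) = inj₂ (l , e)
          go (no ne) = inj₁ (l , ne)

        distances : ∀ p q r → p ≢ 3F → q ≢ 3F → r ≢ 3F → h r ≡ h p * h q + k p * k q →
          (p ≢ 2F → q ≢ 2F → r ≢ 0F → r ≡ 1F) × (p ≡ 2F → q ≡ 2F → r ≢ 0F → r ≡ 1F) × (p ≢ 2F → q ≡ 2F → r ≡ 2F)
        distances = finite₃ (λ p q r → ¬? (p Fin.≟ 3F) →-dec ¬? (q Fin.≟ 3F) →-dec ¬? (r Fin.≟ 3F) →-dec (h r ℤ.≟ h p * h q + k p * k q) →-dec
          ((¬? (p Fin.≟ 2F) →-dec ¬? (q Fin.≟ 2F) →-dec ¬? (r Fin.≟ 0F) →-dec (r Fin.≟ 1F)) ×-dec
           ((p Fin.≟ 2F) →-dec (q Fin.≟ 2F) →-dec ¬? (r Fin.≟ 0F) →-dec (r Fin.≟ 1F)) ×-dec (¬? (p Fin.≟ 2F) →-dec (q Fin.≟ 2F) →-dec (r Fin.≟ 2F))))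

        facts : ∀ {z z′} → Λ x y z → Λ x y z′ → _
        facts {z} {z′} l l′ = distances (d z₀ z) (d z₀ z′) (d z z′) (near l₀ l) (near l₀ l′) (near l l′) (relation l l′)

        M-clique : ∀ {z z′} → M z → M z′ → z ≢ z′ → d z z′ ≡ 1F
        M-clique (l , e) (l′ , e′) ne = proj₁ (facts l l′) e e′ (ne ∘ d-zero)

        N-clique : ∀ {z z′} → N z → N z′ → z ≢ z′ → d z z′ ≡ 1F
        N-clique (l , e) (l′ , e′) ne = proj₁ (proj₂ (facts l l′)) e e′ (ne ∘ d-zero)

        M-N : ∀ {z z′} → M z → N z′ → d z z′ ≡ 2F
        M-N (l , e) (l′ , e′) = proj₂ (proj₂ (facts l l′)) e e′

        split : (A ≡ + 2 × B ≡ + 5) ⊎ (A ≡ + 5 × B ≡ + 2) → Split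
        split (inj₁ (a , b)) = record { K = M ; L = N ; small = M-enumeration a ; large = N-enumeration b ; K⊆Λ = proj₁ ; L⊆Λ = proj₁
          ; cover = M-or-N ; K-clique = M-clique ; L-clique = N-clique ; K-L = M-N }
        split (inj₂ (a , b)) = record { K = N ; L = M ; small = N-enumeration b ; large = M-enumeration a ; K⊆Λ = proj₁ ; L⊆Λ = proj₁
          ; cover = λ l → exchange (M-or-N l) ; K-clique = N-clique ; L-clique = M-clique ; K-L = λ p q → flip (M-N q p) }
          where
          exchange : ∀ {P Q : Set} → P ⊎ Q → Q ⊎ P
          exchange (inj₁ p) = inj₂ p
          exchange (inj₂ q) = inj₁ q

      abstract
        splitting : Split
        splitting = let z₀ , l₀ = exists₂ 1F 1F x y (subst (0ℤ <_) (sym (common-adjacent xy)) (+<+ (s≤s z≤n)))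
          in Build.split l₀ (Classes.sizes l₀)

-- Coordinates in the Johnson graph J(9,3)

module JohnsonGraphJ93 where
  open IntegerSums
  open DistanceSchemes
  open BoseMesnerAlgebra
  open ParameterBounds
  open Reduction
  open Enumerations
  open GramCoordinates
  open JohnsonOpposites
  open JohnsonLines
  open import Data.Fin.Subset using (Subset; ∣_∣; _∩_)
  open import Data.Vec using (tabulate)

  product-pred-nonneg : ∀ f → 0ℤ ≤ f * f - f
  product-pred-nonneg (+ zero)  = ℤ.≤-refl
  product-pred-nonneg (+ suc m) = subst (0ℤ ≤_) (shape (+ m)) (*-nonneg {+ m} {+ m + 1ℤ} (+≤+ z≤n) (+≤+ z≤n))
    where
    shape : ∀ m → m * (m + 1ℤ) ≡ (1ℤ + m) * (1ℤ + m) - (1ℤ + m)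
    shape = solve-∀
  product-pred-nonneg -[1+ m ] = ℤ.+-mono-≤ (square-nonneg -[1+ m ]) (+≤+ z≤n)

  -- Write x = e₁ + e₂ + e₃, with neighbours x - eᵢ + e_j.  For a maximal 4-clique {x, y₁, k, k′} the vector
  -- y₁ + k + k′ - 2x is 3e_j, and the other eight points differ from it by differences of adjacent vertices.
  module Johnson {n : ℕ} (Γ : Graph (Fin n)) (R : Realization Γ 9 4 4) where
    open JohnsonLocal Γ R
    open JohnsonSplit Γ R

    -- Labels for the nine reference vertices. With their distances tabulated in `D`, the Gram
    -- matrix of the nine points is decided by evaluation.
    data Index : Set where
      centre pivot : Index
      short : Fin 2 → Index
      long : Fin 5 → Index

    D : Index → Index → Fin 4
    D centre    centre    = 0F
    D pivot     pivot     = 0F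
    D (short i) (short j) = if does (i Fin.≟ j) then 0F else 1F
    D (long i)  (long j)  = if does (i Fin.≟ j) then 0F else 1F
    D (short _) (long _)  = 2F
    D (long _)  (short _) = 2F
    D centre    pivot     = 1F
    D centre    (short _) = 1F
    D centre    (long _)  = 1F
    D pivot     centre    = 1F
    D pivot     (short _) = 1F
    D pivot     (long _)  = 1F
    D (short _) centre    = 1F
    D (short _) pivot     = 1F
    D (long _)  centre    = 1F
    D (long _)  pivot     = 1F

    Sparse : Set
    Sparse = List (ℤ × Index)

    value : Sparse → Index → ℤ
    value [] j = 0ℤ
    value ((m , i) ∷ v) j = m * g (D i j) + value v j

    form : Sparse → Sparse → ℤ
    form v [] = 0ℤ
    form v ((m , j) ∷ w) = m * value v j + form v w

    E₀ : Sparse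
    E₀ = (1ℤ , pivot) ∷ (1ℤ , short 0F) ∷ (1ℤ , short 1F) ∷ (- (+ 2) , centre) ∷ []

    E : Fin 9 → Sparse
    E 0F = E₀
    E 1F = (+ 3 , centre) ∷ (- (+ 3) , pivot) ∷ E₀
    E 2F = (+ 3 , centre) ∷ (- (+ 3) , short 0F) ∷ E₀
    E 3F = (+ 3 , centre) ∷ (- (+ 3) , short 1F) ∷ E₀
    E (suc (suc (suc (suc l)))) = (+ 3 , long l) ∷ (- (+ 3) , pivot) ∷ E₀

    E-gram : ∀ i j → form (E i) (E j) ≡ + 9 * δ i j + - 1ℤ
    E-gram = toWitness {a? = Fin.all? λ i → Fin.all? λ j → form (E i) (E j) ℤ.≟ + 9 * δ i j + - 1ℤ} _

    abstract
      order : n ≡ 84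
      order = ℤ.+-injective (trans (sym (sum-1 n)) (intersection (λ _ → 1ℤ) (λ _ → 1ℤ) (+ 84) pos refl (d-refl (proj₁ far))))

      edge : ∃[ x ] ∃[ y ] d x y ≡ 1F
      edge = let x = proj₁ far ; y , xy , _ = exists₂ 1F 1F x x (subst (0ℤ <_)
                   (sym (intersection (δ 1F) (δ 1F) (+ 18) pos refl (d-refl x))) (+<+ (s≤s z≤n)))
             in x , y , xy

    module Labelled {x y : Fin n} (xy : d x y ≡ 1F) (sp : Edge.Split xy) where
      open Edge.Split sp
      module K = Enumeration small
      module L = Enumeration large

      point : Index → Fin n
      point centre    = x
      point pivot     = y
      point (short i) = K.at i
      point (long i)  = L.at i

      distance : ∀ i j → d (point i) (point j) ≡ D i j
      distance centre    centre    = d-refl x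
      distance pivot     pivot     = d-refl y
      distance centre    pivot     = xy
      distance centre    (short i) = proj₁ (K⊆Λ (K.holds i))
      distance centre    (long i)  = proj₁ (L⊆Λ (L.holds i))
      distance pivot     centre    = flip xy
      distance pivot     (short i) = proj₂ (K⊆Λ (K.holds i))
      distance pivot     (long i)  = proj₂ (L⊆Λ (L.holds i))
      distance (short i) centre    = flip (proj₁ (K⊆Λ (K.holds i)))
      distance (short i) pivot     = flip (proj₂ (K⊆Λ (K.holds i)))
      distance (long i)  centre    = flip (proj₁ (L⊆Λ (L.holds i)))
      distance (long i)  pivot     = flip (proj₂ (L⊆Λ (L.holds i)))
      distance (short i) (long j)  = K-L (K.holds i) (L.holds j)
      distance (long i)  (short j) = flip (K-L (K.holds j) (L.holds i))
      distance (short i) (short j) with i Fin.≟ j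
      ... | yes refl = d-refl (K.at i)
      ... | no i≢j   = K-clique (K.holds i) (K.holds j) (i≢j ∘ K.injective)
      distance (long i) (long j) with i Fin.≟ j
      ... | yes refl = d-refl (L.at i)
      ... | no i≢j   = L-clique (L.holds i) (L.holds j) (i≢j ∘ L.injective)

      embed : Sparse → Vect
      embed []            = []
      embed ((m , i) ∷ v) = (m , point i) ∷ embed v

      embed-· : ∀ v j → embed v · point j ≡ value v j
      embed-· []            j = refl
      embed-· ((m , i) ∷ v) j = cong₂ (λ e t → m * g e + t) (distance i j) (embed-· v j)

      embed-● : ∀ v w → embed v ● embed w ≡ form v w
      embed-● v []            = refl
      embed-● v ((m , j) ∷ w) = cong₂ (λ s t → m * s + t) (embed-· v j) (embed-● v w)

      -- In the model `m` is 1 or 0 according to membership of one point. Only its integrality is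
      -- proved here, by propagation from x along parallelograms; the bounds come from `f-square`.
      Integral : Fin n → Set
      Integral u = ∃[ m ] embed E₀ · u ≡ + 3 * m + - 1ℤ

      additive : ∀ {a b c e} → Parallelogram a b c e → ∀ v → v · b ≡ v · c + v · e - v · a
      additive {a} {b} {c} {e} P [] = refl
      additive {a} {b} {c} {e} P ((m , p) ∷ v) = trans (cong₂ (λ s t → m * s + t) (point-image p) (additive {a} {b} {c} {e} P v))
          (shape m (g (d p c)) (g (d p e)) (g (d p a)) (v · c) (v · e) (v · a))
        where
        point-image : ∀ p → g (d p b) ≡ g (d p c) + g (d p e) - g (d p a)
        point-image p = trans (cong g (d-sym p b)) (trans (image {a} {b} {c} {e} P p)
          (cong₂ _-_ (cong₂ _+_ (cong g (d-sym c p)) (cong g (d-sym e p))) (cong g (d-sym a p))))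
        shape : ∀ m p q r s t u → m * (p + q - r) + (s + t - u) ≡ (m * p + s) + (m * q + t) - (m * r + u)
        shape = solve-∀

      integral-image : ∀ {a b c e} → Parallelogram a b c e → Integral a → Integral c → Integral e → Integral b
      integral-image {a} {b} {c} {e} P (p , ea) (q , ec) (r , ee) = q + r - p ,
        trans (additive {a} {b} {c} {e} P (embed E₀)) (trans (cong₂ _-_ (cong₂ _+_ ec ee) ea) (shape p q r))
        where
        shape : ∀ p q r → (+ 3 * q + - 1ℤ) + (+ 3 * r + - 1ℤ) - (+ 3 * p + - 1ℤ) ≡ + 3 * (q + r - p) + - 1ℤ
        shape = solve-∀

      integral-point : ∀ i → Integral (point i)
      integral-point centre     = 0ℤ , embed-· E₀ centre
      integral-point pivot      = 1ℤ , embed-· E₀ pivot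
      integral-point (short 0F) = 1ℤ , embed-· E₀ (short 0F)
      integral-point (short 1F) = 1ℤ , embed-· E₀ (short 1F)
      integral-point (long i)   = 0ℤ , embed-· E₀ (long i)

      swapped : ∀ {a b c e} → Parallelogram a b c e → Parallelogram c e a b
      swapped p z = sym (p z)

      twisted : ∀ {a b c e} → Parallelogram a b c e → Parallelogram e c a b
      twisted {a} {b} {c} {e} p z = trans (ℤ.+-comm (g (d e z)) (g (d c z))) (sym (p z))

      abstract
        -- A neighbour of x at distance 2 from the pivot is adjacent to exactly one short vertex.
        one-short : ∀ {v} → d x v ≡ 1F → d y v ≡ 2F → g (d (K.at 0F) v) + g (d (K.at 1F) v) ≡ 1ℤ
        one-short {v} xv yv = table (d (K.at 0F) v) (d (K.at 1F) v) (range 0F) (range 1F) not-both not-none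
          where
          range : ∀ i → d (K.at i) v ≢ 0F × d (K.at i) v ≢ 3F
          range i = (λ e → contradiction (trans (sym (proj₂ (K⊆Λ (K.holds i)))) (trans (cong (d y) (d-zero e)) yv)) λ ())
            , λ e → contradiction (subst₂ (λ i j → Triangle 1F i j) xv e (triangle-at (proj₁ (K⊆Λ (K.holds i))) v)) λ { (_ , _ , s≤s (s≤s ())) }
          -- The reflection y + v - t of a common neighbour t of x, y and v is another one, at
          -- distance 2 from t. As `K` and `L` are cliques, the two lie in different ones.
          mirror : ∀ {t} → Λ x y t → d t v ≡ 1F → ∃[ t* ] Parallelogram t t* y v × Λ x y t* × d t* t ≡ 2F × d t* v ≡ 1F
          mirror {t} (xt , yt) tv =
            let t* , T = reflect (flip yt) tv yv
            in t* , T , (flip (image-at T x (flip xy) (flip xv) (flip xt) 1F refl) , flip (image-at T y (d-refl y) (flip yv) (flip yt) 1F refl))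
              , image-at T t yt (flip tv) (d-refl t) 2F refl , image-at T v yv (d-refl v) tv 1F refl
          not-both : ¬ (d (K.at 0F) v ≡ 1F × d (K.at 1F) v ≡ 1F)
          not-both (e₀ , e₁) =
            let k* , T , l* , k*k₀ , k*v = mirror (K⊆Λ (K.holds 0F)) e₀
                k₀k₁ = K-clique (K.holds 0F) (K.holds 1F) (λ e → contradiction (K.injective e) λ ())
                k*k₁ = image-at T (K.at 1F) (proj₂ (K⊆Λ (K.holds 1F))) (flip e₁) k₀k₁ 1F refl
            in no-bridge xy (K⊆Λ (K.holds 0F)) l* (K⊆Λ (K.holds 1F)) (flip k*k₀) (flip k₀k₁) (flip k*k₁)
          short-near : ∀ {t} → K t → d t v ≡ 1F → ∃[ i ] d (K.at i) v ≡ 1F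
          short-near p e = let i , q = K.complete p in i , trans (cong (λ t → d t v) q) e
          not-none : ¬ (d (K.at 0F) v ≡ 2F × d (K.at 1F) v ≡ 2F)
          not-none (e₀ , e₁) =
            let t , xt , yt , vt = exists₃ 1F 1F 1F x y v (subst (0ℤ <_) (sym (trans (sum-cong-≗ (λ z →
                  trans (sym (ℤ.*-assoc (δ 1F (d x z)) (δ 1F (d y z)) (δ 1F (d v z)))) (cong (λ i → δ 1F (d x z) * δ 1F (d y z) * δ 1F i) (d-sym v z))))
                  (triple-common xy xv yv))) (+<+ (s≤s z≤n)))
                t* , _ , l* , t*t , t*v = mirror (xt , yt) (flip vt)
            in decide (cover (xt , yt)) (cover l*) (flip vt) t*v t*t
            where
            far-short : ∀ {t} → K t → d t v ≡ 1F → ⊥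
            far-short p e = go (short-near p e)
              where
              go : ∃[ i ] d (K.at i) v ≡ 1F → ⊥
              go (0F , q) = contradiction (trans (sym q) e₀) λ ()
              go (1F , q) = contradiction (trans (sym q) e₁) λ ()
            decide : ∀ {t t*} → K t ⊎ L t → K t* ⊎ L t* → d t v ≡ 1F → d t* v ≡ 1F → d t* t ≡ 2F → ⊥
            decide (inj₁ p) _ e _ _ = far-short p e
            decide _ (inj₁ p) _ e _ = far-short p e
            decide (inj₂ p) (inj₂ q) _ _ e = contradiction (trans (sym (L-clique q p (≢-at 1F e))) e) λ ()
          table : ∀ p q → p ≢ 0F × p ≢ 3F → q ≢ 0F × q ≢ 3F → ¬ (p ≡ 1F × q ≡ 1F) → ¬ (p ≡ 2F × q ≡ 2F) → g p + g q ≡ 1ℤ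
          table = finite₂ (λ p q → (¬? (p Fin.≟ 0F) ×-dec ¬? (p Fin.≟ 3F)) →-dec (¬? (q Fin.≟ 0F) ×-dec ¬? (q Fin.≟ 3F)) →-dec
            ¬? ((p Fin.≟ 1F) ×-dec (q Fin.≟ 1F)) →-dec ¬? ((p Fin.≟ 2F) ×-dec (q Fin.≟ 2F)) →-dec (g p + g q ℤ.≟ 1ℤ))

        integral-1 : ∀ {v} → d x v ≡ 1F → Integral v
        integral-1 {v} xv = go (d y v) refl
          where
          go : ∀ i → d y v ≡ i → Integral v
          go 0F e = subst Integral (d-zero e) (integral-point pivot)
          go 1F e = covered (cover (xv , e))
            where
            covered : K v ⊎ L v → Integral v
            covered (inj₁ p) = let i , q = K.complete p in subst Integral q (integral-point (short i))
            covered (inj₂ p) = let i , q = L.complete p in subst Integral q (integral-point (long i))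
          go 2F e = 0ℤ , trans (shape (g (d y v)) (g (d (K.at 0F) v)) (g (d (K.at 1F) v)) (g (d x v)))
              (combine (cong g e) (one-short xv e) (cong g xv))
            where
            shape : ∀ p q r s → 1ℤ * p + (1ℤ * q + (1ℤ * r + (- (+ 2) * s + 0ℤ))) ≡ p + (q + r) - + 2 * s
            shape = solve-∀
            combine : ∀ {p q s} → p ≡ 0ℤ → q ≡ 1ℤ → s ≡ 1ℤ → p + q - + 2 * s ≡ + 3 * 0ℤ + - 1ℤ
            combine refl refl refl = refl
          go 3F e = contradiction (subst₂ (λ i j → Triangle 1F i j) xv e (triangle-at xy v)) λ { (_ , _ , s≤s (s≤s ())) }

        -- u = v + v* - x, where v and its reflection v* are both adjacent to x.
        integral-2 : ∀ {u} → d x u ≡ 2F → Integral u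
        integral-2 {u} xu =
          let v , xv , uv = exists₂ 1F 1F x u (subst (0ℤ <_) (sym (common xu)) (+<+ (s≤s z≤n)))
              v* , V = reflect (flip xv) (flip uv) xu
              v*x = image-at V x (d-refl x) (flip xu) (flip xv) 1F refl
          in integral-image {x} {u} {v} {v*} (swapped {v} {v*} {x} {u} V) (integral-point centre) (integral-1 xv) (integral-1 (flip v*x))

        -- u = v + v* - w, where w is adjacent to x while v and v* are at distance 2 from x.
        integral-3 : ∀ {u} → d x u ≡ 3F → Integral u
        integral-3 {u} xu =
          let v , uv , xv = exists₂ 1F 2F u x (subst (0ℤ <_) (sym (intersection (δ 1F) (δ 2F) (+ 9) pos refl (flip xu))) (+<+ (s≤s z≤n)))
              w , xw , vw = exists₂ 1F 1F x v (subst (0ℤ <_) (sym (common xv)) (+<+ (s≤s z≤n)))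
              uw = between (d u w) (triangle-at (flip xu) w) xw
                     (subst (Triangle 1F (d u w)) vw (triangle-at uv w))
              v* , V = reflect (flip uv) vw uw
              v*x = image-at V x (flip xu) (flip xw) (flip xv) 2F refl
          in integral-image {w} {u} {v} {v*} (twisted {v} {v*} {u} {w} V) (integral-1 xw) (integral-2 xv) (integral-2 (flip v*x))
          where
          between : ∀ i {j} → Triangle 3F i j → j ≡ 1F → Triangle 1F i 1F → i ≡ 2F
          between i t refl t′ = table i t t′
            where
            table : ∀ i → Triangle 3F i 1F → Triangle 1F i 1F → i ≡ 2F
            table = toWitness {a? = Fin.all? λ i → Triangle? 3F i 1F →-dec Triangle? 1F i 1F →-dec (i Fin.≟ 2F)} _

        integral : ∀ u → Integral u
        integral u = go (d x u) refl
          where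
          go : ∀ i → d x u ≡ i → Integral u
          go 0F e = subst Integral (d-zero e) (integral-point centre)
          go 1F e = integral-1 e
          go 2F e = integral-2 e
          go 3F e = integral-3 e

      open Coordinates S g (+ 21) (+<+ (s≤s z≤n)) g-idem using (combination; combination-·; ●-combination; residue-norm; residue; distance-formula)

      f : Fin n → Fin 9 → ℤ
      f u 0F = proj₁ (integral u)
      f u 1F = g (d x u) - g (d y u) + proj₁ (integral u)
      f u 2F = g (d x u) - g (d (K.at 0F) u) + proj₁ (integral u)
      f u 3F = g (d x u) - g (d (K.at 1F) u) + proj₁ (integral u)
      f u (suc (suc (suc (suc l)))) = g (d (L.at l) u) - g (d y u) + proj₁ (integral u)

      f-value : ∀ i u → embed (E i) · u ≡ + 3 * f u i + - 1ℤ
      f-value i u = go i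
        where
        m = proj₁ (integral u)
        shift : ∀ a b {t} → t ≡ + 3 * m + - 1ℤ → + 3 * a + (- (+ 3) * b + t) ≡ + 3 * (a - b + m) + - 1ℤ
        shift a b refl = shape a b m
          where
          shape : ∀ a b m → + 3 * a + (- (+ 3) * b + (+ 3 * m + - 1ℤ)) ≡ + 3 * (a - b + m) + - 1ℤ
          shape = solve-∀
        go : ∀ i → embed (E i) · u ≡ + 3 * f u i + - 1ℤ
        go 0F = proj₂ (integral u)
        go 1F = shift (g (d x u)) (g (d y u)) (proj₂ (integral u))
        go 2F = shift (g (d x u)) (g (d (K.at 0F) u)) (proj₂ (integral u))
        go 3F = shift (g (d x u)) (g (d (K.at 1F) u)) (proj₂ (integral u))
        go (suc (suc (suc (suc l)))) = shift (g (d (L.at l) u)) (g (d y u)) (proj₂ (integral u))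

      F : Fin 9 → Vect
      F i = embed (E i)

      F-gram : ∀ i j → F i ● F j ≡ + 9 * δ i j + - 1ℤ
      F-gram i j = trans (embed-● (E i) (E j)) (E-gram i j)

      abstract
        -- The nine points sum to a null vector, because the rows of 9I - J sum to 0, and each takes
        -- the value 3f - 1.
        f-size : ∀ u → sum (f u) ≡ + 3
        f-size u = cancel-positive-≡ {+ 3} (+<+ (s≤s z≤n)) (trans (shape (sum (f u))) (cong (_+ + 9) (trans (sym total) (null C norm u))))
          where
          C : Vect
          C = combination (λ _ → 1ℤ) F
          total : C · u ≡ + 3 * sum (f u) + (- (+ 9) + 0ℤ)
          total = trans (combination-· (λ _ → 1ℤ) F u) (sum-combination ((+ 3 , f u) ∷ (- 1ℤ , λ _ → 1ℤ) ∷ [])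
            (λ i → trans (ℤ.*-identityˡ (F i · u)) (trans (f-value i u) (shape′ (f u i)))))
            where
            shape′ : ∀ p → + 3 * p + - 1ℤ ≡ + 3 * p + (- 1ℤ * 1ℤ + 0ℤ)
            shape′ = solve-∀
          shape : ∀ p → + 3 * p ≡ + 3 * p + (- (+ 9) + 0ℤ) + + 9
          shape = solve-∀
          norm : C ● C ≡ 0ℤ
          norm = trans (●-combination C (λ _ → 1ℤ) F) (sum-zero (λ i → 1ℤ * C ● F i) (λ i → trans (ℤ.*-identityˡ (C ● F i)) (trans (●-sym C (F i))
            (trans (●-combination (F i) (λ _ → 1ℤ) F) (trans (sum-cong-≗ (λ j → trans (ℤ.*-identityˡ (F i ● F j)) (F-gram i j))) (row i))))))
            where
            row : ∀ (i : Fin 9) → sum {9} (λ j → + 9 * δ i j + - 1ℤ) ≡ 0ℤ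
            row = toWitness {a? = Fin.all? λ i → sum {9} (λ j → + 9 * δ i j + - 1ℤ) ℤ.≟ 0ℤ} _

        -- Bessel's inequality for u against the nine points reads Σf² ≤ 3 = Σf, whereas f² ≥ f for
        -- integers, so equality holds termwise.
        f-square : ∀ u i → f u i * f u i - f u i ≡ 0ℤ
        f-square u = sum-nonneg-zero (λ i → f u i * f u i - f u i) (λ i → product-pred-nonneg (f u i))
          (ℤ.≤-antisym upper (sum-nonneg (λ i → f u i * f u i - f u i) (λ i → product-pred-nonneg (f u i))))
          where
          q : ℤ
          q = sum (λ i → f u i * f u i)
          total : sum (λ i → f u i * f u i - f u i) ≡ q - + 3
          total = trans (sum-combination ((1ℤ , λ i → f u i * f u i) ∷ (- 1ℤ , f u) ∷ []) (λ i → shape (f u i * f u i) (f u i)))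
            (trans (cong (λ t → 1ℤ * q + (- 1ℤ * t + 0ℤ)) (f-size u)) (shape′ q))
            where
            shape : ∀ a b → a - b ≡ 1ℤ * a + (- 1ℤ * b + 0ℤ)
            shape = solve-∀
            shape′ : ∀ q → 1ℤ * q + (- (+ 3) + 0ℤ) ≡ q - + 3
            shape′ = solve-∀
          bessel : 0ℤ ≤ + 9 * (0ℤ - (q - + 3))
          bessel = subst (0ℤ ≤_) (trans (residue-norm F (+ 3) (+ 3) (- 1ℤ) (+ 9) (- 1ℤ) (+ 3) F-gram (f u) u (f-size u) (λ i → f-value i u)) (shape q))
            (nonneg (residue F (+ 3) (+ 3) (- 1ℤ) (+ 9) (- 1ℤ) (+ 3) F-gram (f u) u))
            where
            shape : ∀ q → + 18 + - (+ 6 * (+ 3 * q + - (+ 3))) + (+ 9 * q + - (+ 9)) ≡ + 9 * (0ℤ - (q - + 3))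
            shape = solve-∀
          upper : sum (λ i → f u i * f u i - f u i) ≤ 0ℤ
          upper = subst (_≤ 0ℤ) (sym total) (0≤-⇒≤ (cancel-positive-≤ {+ 9} (+<+ (s≤s z≤n)) bessel))

      P : Fin n → Subset 9
      P u = tabulate (λ i → does (f u i ℤ.≟ 1ℤ))

      indicator-P : ∀ u i → indicator (P u) i ≡ f u i
      indicator-P u i = trans (indicator-tabulate (λ i → does (f u i ℤ.≟ 1ℤ)) i)
          (bit (f u i) (ℤ.i*j≡0⇒i≡0∨j≡0 (f u i) (trans (shape (f u i)) (f-square u i))))
        where
        shape : ∀ f → f * (f - 1ℤ) ≡ f * f - f
        shape = solve-∀
        bit : ∀ f → f ≡ 0ℤ ⊎ f - 1ℤ ≡ 0ℤ → (if does (f ℤ.≟ 1ℤ) then 1ℤ else 0ℤ) ≡ f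
        bit f (inj₁ refl) = refl
        bit f (inj₂ e) rewrite ℤ.i-j≡0⇒i≡j f 1ℤ e = refl

      size-P : ∀ u → sum (indicator (P u)) ≡ + 3
      size-P u = trans (sum-cong-≗ (indicator-P u)) (f-size u)

      formula : ∀ z w → g (d z w) ≡ + ∣ P z ∩ P w ∣ - 1ℤ
      formula z w = cancel-positive-≡ {+ 3} (+<+ (s≤s z≤n)) (trans
          (distance-formula F (+ 3) (+ 3) (- 1ℤ) (+ 9) (- 1ℤ) (+ 3) F-gram P size-P
            (λ i z → trans (f-value i z) (cong (λ t → + 3 * t + - 1ℤ) (sym (indicator-P z i)))) refl z w) (shape (+ ∣ P z ∩ P w ∣)))
        where
        shape : ∀ t → + 3 * t + - (+ 3) ≡ + 3 * (t - 1ℤ)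
        shape = solve-∀

      triple : Fin n → KSubset 9 3
      triple z = P z , ℤ.+-injective (trans (sym (sum-indicator (P z))) (size-P z))

      result : Γ ≅ johnsonGraph 9 3
      result = isomorphism order KSubset-rank (λ {v} {w} → KSubset-rank-injective {S = v} {w}) triple
        (λ {z} {w} e → d-zero (at {z} {w} (trans (formula z w) (trans (cong (λ Q → + ∣ P z ∩ Q ∣ - 1ℤ) (sym (cong proj₁ e)))
          (trans (sym (formula z z)) (cong g (d-refl z)))))))
        (λ z w → mk⇔ (λ e → ℤ.+-injective (cancel-+ (- 1ℤ) (trans (sym (formula z w)) (cong g (∼⇒1 e)))))
          (λ e → 1⇒∼ (at {z} {w} (trans (formula z w) (cong (λ t → + t - 1ℤ) e)))))

    result : Γ ≅ johnsonGraph 9 3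
    result = let _ , _ , xy = edge in Labelled.result xy (Edge.splitting xy)

-- The generalized hexagon of order (2,2)

module Hexagons where
  open IntegerSums
  open DistanceSchemes
  open BoseMesnerAlgebra
  open ParameterBounds
  open Reduction
  open Enumerations
  open NullTriangles
  import Data.Fin.Subset
  import Data.Fin.Subset.Properties as Subset
  import Data.Product.Properties as Product
  import Data.Sum.Properties as Sum
  open import Data.Bool using (not)
  open import Data.Fin.Subset using (Subset)
  open import Data.Vec using (tabulate; lookup; []; _∷_)
  open import Data.Vec.Properties using (lookup∘tabulate; []=⇒lookup; lookup⇒[]=)
  open import Defs
    using (Walk; []; _∷_; Distance; HasDiameter; Cycle; HasSize; IncidenceStructure; incidenceGraph;
      GeneralizedHexagon)
  open import Function.Bundles using (mk↔ₛ′)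
  open import Relation.Binary.Definitions using (Tri; tri<; tri≈; tri>)
  open import Relation.Nullary.Decidable using (map′)

  bit : ∀ {P : Set} → Dec P → ℤ
  bit P? = if does P? then 1ℤ else 0ℤ

  bit-yes : ∀ {P : Set} (P? : Dec P) → P → bit P? ≡ 1ℤ
  bit-yes (yes _) _ = refl
  bit-yes (no ¬p) p = contradiction p ¬p

  bit-no : ∀ {P : Set} (P? : Dec P) → ¬ P → bit P? ≡ 0ℤ
  bit-no (yes p) ¬p = contradiction p ¬p
  bit-no (no _) _ = refl

  sum⇒HasSize : ∀ {n m} {P : Fin n → Set} (P? : ∀ z → Dec (P z)) → sum (λ z → bit (P? z)) ≡ + m → HasSize P m
  sum⇒HasSize {n} {m} {P} P? e = S , ℤ.+-injective (trans (sym (sum-indicator S)) (trans (sum-cong-≗ agree) e)) , λ z → mk⇔ (to z) (from z)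
    where
    S : Subset n
    S = tabulate (λ z → does (P? z))
    member : ∀ z → lookup S z ≡ does (P? z)
    member z = lookup∘tabulate (λ z → does (P? z)) z
    to : ∀ z → z Data.Fin.Subset.∈ S → P z
    to z z∈S with P? z | trans (sym ([]=⇒lookup z∈S)) (member z)
    ... | yes p | _ = p
    ... | no _  | ()
    from : ∀ z → P z → z Data.Fin.Subset.∈ S
    from z p = lookup⇒[]= z S (trans (member z) (yes-does (P? z)))
      where
      yes-does : (P? : Dec (P z)) → does P? ≡ true
      yes-does (yes _) = refl
      yes-does (no ¬p) = contradiction p ¬p
    agree : ∀ z → indicator S z ≡ bit (P? z)
    agree z with z Subset.∈? S
    ... | yes z∈S = trans (indicator-∈ z∈S) (sym (bit-yes (P? z) (to z z∈S)))
    ... | no  z∉S = trans (indicator-∉ z∉S) (sym (bit-no (P? z) (z∉S ∘ from z)))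

  count : ∀ {n} {P : Fin n → Set} (P? : ∀ z → Dec (P z)) → ∃[ m ] sum (λ z → bit (P? z)) ≡ + m
  count {zero}  P? = 0 , refl
  count {suc n} P? with P? 0F | count (P? ∘ suc)
  ... | yes _ | m , e = suc m , cong (_+_ 1ℤ) e
  ... | no _  | m , e = m , trans (ℤ.+-identityˡ _) e

  least : ∀ {P : ℕ → Set} (P? : ∀ m → Dec (P m)) m → P m → ∃[ e ] e ℕ.≤ m × P e × (∀ i → i ℕ.< e → ¬ P i)
  least P? m p with P? 0
  least P? m p       | yes p₀ = 0 , z≤n , p₀ , λ _ ()
  least P? zero p    | no ¬p₀ = contradiction p ¬p₀
  least P? (suc m) p | no ¬p₀ = let e , e≤m , q , min = least (P? ∘ suc) m p in
    suc e , s≤s e≤m , q , λ { zero _ → ¬p₀ ; (suc i) (s≤s i<e) → min i i<e }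

  sort₃ : ∀ {n} (Q : Fin n → Fin n → Fin n → Set) → (∀ {a b c} → Q a b c → Q b a c) → (∀ {a b c} → Q a b c → Q a c b) →
    ∀ {a b c} → Q a b c → a ≢ b → a ≢ c → b ≢ c → ∃[ i ] ∃[ j ] ∃[ k ] i Fin.< j × j Fin.< k × Q i j k
  sort₃ Q s₁ s₂ {a} {b} {c} q a≢b a≢c b≢c = go (Fin.<-cmp a b) (Fin.<-cmp a c) (Fin.<-cmp b c)
    where
    go : Tri (a Fin.< b) (a ≡ b) (b Fin.< a) → Tri (a Fin.< c) (a ≡ c) (c Fin.< a) → Tri (b Fin.< c) (b ≡ c) (c Fin.< b) →
      ∃[ i ] ∃[ j ] ∃[ k ] i Fin.< j × j Fin.< k × Q i j k
    go (tri≈ _ e _) _ _ = contradiction e a≢b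
    go _ (tri≈ _ e _) _ = contradiction e a≢c
    go _ _ (tri≈ _ e _) = contradiction e b≢c
    go (tri< p _ _) _ (tri< r _ _) = a , b , c , p , r , q
    go (tri< _ _ _) (tri< p _ _) (tri> _ _ r) = a , c , b , p , r , s₂ q
    go (tri< p _ _) (tri> _ _ r) (tri> _ _ _) = c , a , b , r , p , s₁ (s₂ q)
    go (tri> _ _ p) (tri< r _ _) _ = b , a , c , p , r , s₁ q
    go (tri> _ _ _) (tri> _ _ p) (tri< r _ _) = b , c , a , r , p , s₂ (s₁ q)
    go (tri> _ _ p) (tri> _ _ _) (tri> _ _ r) = c , b , a , r , p , s₁ (s₂ (s₁ q))

  next : Fin 6 → Fin 6
  next 0F = 1F
  next 1F = 2F
  next 2F = 3F
  next 3F = 4F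
  next 4F = 5F
  next 5F = 0F

  -- The nine pairs of nonadjacent corners of a hexagon.
  pair : Fin 9 → Fin 6 × Fin 6
  pair 0F = 0F , 2F
  pair 1F = 0F , 3F
  pair 2F = 0F , 4F
  pair 3F = 1F , 3F
  pair 4F = 1F , 4F
  pair 5F = 1F , 5F
  pair 6F = 2F , 4F
  pair 7F = 2F , 5F
  pair 8F = 3F , 5F

  Far : Fin 6 → Fin 6 → Set
  Far i j = ∃[ k ] (pair k ≡ (i , j) ⊎ pair k ≡ (j , i))

  far? : ∀ i j → Dec (Far i j)
  far? i j = Fin.any? λ k → Product.≡-dec Fin._≟_ Fin._≟_ (pair k) (i , j) ⊎-dec Product.≡-dec Fin._≟_ Fin._≟_ (pair k) (j , i)

  near-or-far : ∀ i j → i ≡ j ⊎ j ≡ next i ⊎ i ≡ next j ⊎ Far i j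
  near-or-far = toWitness {a? = Fin.all? λ i → Fin.all? λ j → (i Fin.≟ j) ⊎-dec (j Fin.≟ next i) ⊎-dec (i Fin.≟ next j) ⊎-dec far? i j} _

  -- If two different sides had the same line, the far corners found here would be collinear.
  lines-separate : ∀ i j → i ≡ j ⊎ Far i j ⊎ Far i (next j) ⊎ Far (next i) j
  lines-separate = toWitness {a? = Fin.all? λ i → Fin.all? λ j → (i Fin.≟ j) ⊎-dec far? i j ⊎-dec far? i (next j) ⊎-dec far? (next i) j} _

  -- The 12 flags of a hexagon in cyclic order: (i , 0) is its i-th vertex and (i , 1) its i-th side.
  Next : Fin 6 × Fin 2 → Fin 6 × Fin 2 → Set
  Next (i , 0F) (j , 1F) = i ≡ j
  Next (i , 1F) (j , 0F) = j ≡ next i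
  Next _ _ = ⊥

  next? : ∀ s t → Dec (Next s t)
  next? (i , 0F) (j , 1F) = i Fin.≟ j
  next? (i , 1F) (j , 0F) = j Fin.≟ next i
  next? (i , 0F) (j , 0F) = no λ ()
  next? (i , 1F) (j , 1F) = no λ ()

  next-step : ∀ i j → suc (toℕ i) ≡ toℕ j → Next (Fin.remQuot {6} 2 i) (Fin.remQuot {6} 2 j)
  next-step = toWitness {a? = Fin.all? λ i → Fin.all? λ j → (suc (toℕ i) ℕ.≟ toℕ j) →-dec next? (Fin.remQuot {6} 2 i) (Fin.remQuot {6} 2 j)} _

  next-close : ∀ i j → suc (toℕ i) ≡ 12 → toℕ j ≡ 0 → Next (Fin.remQuot {6} 2 i) (Fin.remQuot {6} 2 j)
  next-close = toWitness {a? = Fin.all? λ i → Fin.all? λ j → (suc (toℕ i) ℕ.≟ 12) →-dec (toℕ j ℕ.≟ 0) →-dec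
    next? (Fin.remQuot {6} 2 i) (Fin.remQuot {6} 2 j)} _

  module Hexagon {n : ℕ} (Γ : Graph (Fin n)) (R : Realization Γ 3 4 1) where
    open Realization R renaming (metric to S)
    open Scheme S
    open Counting S
    open Metric S
    open Existence S

    pos : 0ℤ < + 3
    pos = +<+ (s≤s z≤n)

    flip : ∀ {x y i} → d x y ≡ i → d y x ≡ i
    flip {x} {y} e = trans (d-sym y x) e

    adjacent-≢ : ∀ {x y} → d x y ≡ 1F → x ≢ y
    adjacent-≢ {x} e refl = contradiction (trans (sym e) (d-refl x)) λ ()

    abstract
      w-idem : ∀ x y → sum (λ z → w (d x z) * w (d y z)) ≡ + 36 * w (d x y)
      w-idem x y = go (d x y) refl
        where
        go : ∀ i → d x y ≡ i → sum (λ z → w (d x z) * w (d y z)) ≡ + 36 * w i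
        go 0F e = intersection w w _ pos refl e
        go 1F e = intersection w w _ pos refl e
        go 2F e = intersection w w _ pos refl e
        go 3F e = intersection w w _ pos refl e

      common-1 : ∀ {x y z z′} → d x y ≡ 1F → Joint 1F 1F x y z → Joint 1F 1F x y z′ → z ≡ z′
      common-1 {x} {y} e = unique {1F} {1F} {x} {y} (intersection (δ 1F) (δ 1F) (+ 1) pos refl e)

      common-2 : ∀ {x y z z′} → d x y ≡ 2F → Joint 1F 1F x y z → Joint 1F 1F x y z′ → z ≡ z′
      common-2 {x} {y} e = unique {1F} {1F} {x} {y} (intersection (δ 1F) (δ 1F) (+ 1) pos refl e)

      third : ∀ {x y} → d x y ≡ 1F → ∃[ z ] d x z ≡ 1F × d y z ≡ 1F
      third {x} {y} e = exists₂ 1F 1F x y (subst (0ℤ <_) (sym (intersection (δ 1F) (δ 1F) (+ 1) pos refl e)) (+<+ (s≤s z≤n)))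

      valency-6 : ∀ x → sum (λ z → δ 1F (d x z)) ≡ + 6
      valency-6 x = trans (sum-cong-≗ (λ z → sym (ℤ.*-identityʳ (δ 1F (d x z)))))
        (intersection (δ 1F) (λ _ → 1ℤ) (+ 6) pos refl (d-refl x))

    open NullLines S (+ 36) (+<+ (s≤s z≤n)) w-idem

    Triple : Set
    Triple = Fin n × Fin n × Fin n

    code : Triple → Fin (n ℕ.* (n ℕ.* n))
    code (i , j , k) = Fin.combine i (Fin.combine j k)

    decode : Fin (n ℕ.* (n ℕ.* n)) → Triple
    decode c = let i , c′ = Fin.remQuot (n ℕ.* n) c ; j , k = Fin.remQuot {n} n c′ in i , j , k

    decode-code : ∀ t → decode (code t) ≡ t
    decode-code (i , j , k) = trans (cong (λ (a , b) → a , Fin.remQuot {n} n b) (Fin.remQuot-combine {n} {n ℕ.* n} i (Fin.combine j k)))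
      (cong (_,_ i) (Fin.remQuot-combine {n} {n} j k))

    code-decode : ∀ c → code (decode c) ≡ c
    code-decode c = trans (cong (Fin.combine (proj₁ (Fin.remQuot {n} (n ℕ.* n) c))) (Fin.combine-remQuot {n} n (proj₂ (Fin.remQuot {n} (n ℕ.* n) c))))
      (Fin.combine-remQuot {n} (n ℕ.* n) c)

    Clique : Fin n → Fin n → Fin n → Set
    Clique i j k = d i j ≡ 1F × d i k ≡ 1F × d j k ≡ 1F

    -- Lines are the triangles of Γ. Increasing triples represent each of them once, and `code`
    -- numbers the triples so that `enumerate` applies.
    Sorted : Triple → Set
    Sorted (i , j , k) = i Fin.< j × j Fin.< k × Clique i j k

    sorted? : ∀ t → Dec (Sorted t)
    sorted? (i , j , k) = (i Fin.<? j) ×-dec (j Fin.<? k) ×-dec (d i j Fin.≟ 1F) ×-dec (d i k Fin.≟ 1F) ×-dec (d j k Fin.≟ 1F)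

    abstract
      lines : ∃[ l ] Enumeration l (λ c → Sorted (decode c)) (λ c → bit (sorted? (decode c)))
      lines = let l , e = count (λ c → sorted? (decode c)) in
        l , enumerate (λ c → sorted? (decode c)) _ (λ {c} → bit-yes (sorted? (decode c))) (λ {c} → bit-no (sorted? (decode c))) e

    l : ℕ
    l = proj₁ lines

    module Line = Enumeration (proj₂ lines)

    triple : Fin l → Triple
    triple L = decode (Line.at L)

    On : Fin n → Fin n → Fin n → Fin n → Set
    On x i j k = x ≡ i ⊎ x ≡ j ⊎ x ≡ k

    _∈L_ : Fin n → Fin l → Set
    x ∈L L = let i , j , k = triple L in On x i j k

    _∈L?_ : ∀ x L → Dec (x ∈L L)
    x ∈L? L = let i , j , k = triple L in (x Fin.≟ i) ⊎-dec (x Fin.≟ j) ⊎-dec (x Fin.≟ k)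

    clique : ∀ L → let i , j , k = triple L in Clique i j k
    clique L = proj₂ (proj₂ (Line.holds L))

    on-adjacent : ∀ {i j k} → Clique i j k → ∀ {x y} → On x i j k → On y i j k → x ≢ y → d x y ≡ 1F
    on-adjacent _ (inj₁ refl) (inj₁ refl) ne = contradiction refl ne
    on-adjacent (a , b , c) (inj₁ refl) (inj₂ (inj₁ refl)) _ = a
    on-adjacent (a , b , c) (inj₁ refl) (inj₂ (inj₂ refl)) _ = b
    on-adjacent (a , b , c) (inj₂ (inj₁ refl)) (inj₁ refl) _ = flip a
    on-adjacent _ (inj₂ (inj₁ refl)) (inj₂ (inj₁ refl)) ne = contradiction refl ne
    on-adjacent (a , b , c) (inj₂ (inj₁ refl)) (inj₂ (inj₂ refl)) _ = c
    on-adjacent (a , b , c) (inj₂ (inj₂ refl)) (inj₁ refl) _ = flip b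
    on-adjacent (a , b , c) (inj₂ (inj₂ refl)) (inj₂ (inj₁ refl)) _ = flip c
    on-adjacent _ (inj₂ (inj₂ refl)) (inj₂ (inj₂ refl)) ne = contradiction refl ne

    adjacent : ∀ {x y} L → x ∈L L → y ∈L L → x ≢ y → d x y ≡ 1F
    adjacent L = on-adjacent (clique L)

    on-closed : ∀ {i j k} → Clique i j k → ∀ {x y z} → On x i j k → On y i j k → x ≢ y → d x z ≡ 1F → d y z ≡ 1F → On z i j k
    on-closed {i} {j} {k} q@(a , b , c) {x} {y} {z} px py ne xz yz = go (third-point px py)
      where
      third-point : On x i j k → On y i j k → ∃[ t ] On t i j k × d x t ≡ 1F × d y t ≡ 1F
      third-point (inj₁ refl) (inj₁ refl) = contradiction refl ne
      third-point (inj₁ refl) (inj₂ (inj₁ refl)) = k , inj₂ (inj₂ refl) , b , c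
      third-point (inj₁ refl) (inj₂ (inj₂ refl)) = j , inj₂ (inj₁ refl) , a , flip c
      third-point (inj₂ (inj₁ refl)) (inj₁ refl) = k , inj₂ (inj₂ refl) , c , b
      third-point (inj₂ (inj₁ refl)) (inj₂ (inj₁ refl)) = contradiction refl ne
      third-point (inj₂ (inj₁ refl)) (inj₂ (inj₂ refl)) = i , inj₁ refl , flip a , flip b
      third-point (inj₂ (inj₂ refl)) (inj₁ refl) = j , inj₂ (inj₁ refl) , flip c , a
      third-point (inj₂ (inj₂ refl)) (inj₂ (inj₁ refl)) = i , inj₁ refl , flip b , flip a
      third-point (inj₂ (inj₂ refl)) (inj₂ (inj₂ refl)) = contradiction refl ne
      go : ∃[ t ] On t i j k × d x t ≡ 1F × d y t ≡ 1F → On z i j k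
      go (t , p , xt , yt) = subst (λ z → On z i j k) (common-1 (on-adjacent q px py ne) (xt , yt) (xz , yz)) p

    same-set : ∀ {i j k i′ j′ k′} → Clique i j k → Clique i′ j′ k′ → ∀ {x y} → On x i j k → On y i j k → On x i′ j′ k′ → On y i′ j′ k′ →
      x ≢ y → ∀ {z} → On z i j k → On z i′ j′ k′
    same-set q q′ {x} {y} px py px′ py′ ne {z} pz with z Fin.≟ x | z Fin.≟ y
    ... | yes refl | _ = px′
    ... | no _ | yes refl = py′
    ... | no z≢x | no z≢y = on-closed q′ px′ py′ ne (on-adjacent q px pz (z≢x ∘ sym)) (on-adjacent q py pz (z≢y ∘ sym))

    sorted-unique : ∀ {t t′ : Triple} → Sorted t → Sorted t′ → let i , j , k = t ; i′ , j′ , k′ = t′ in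
      (∀ {z} → On z i j k → On z i′ j′ k′) → (∀ {z} → On z i′ j′ k′ → On z i j k) → t ≡ t′
    sorted-unique {i , j , k} {i′ , j′ , k′} (a , b , _) (a′ , b′ , _) to from = middle (to {j} (inj₂ (inj₁ refl)))
      where
      minimal : ∀ {i j k z : Fin n} → i Fin.< j → j Fin.< k → On z i j k → i Fin.≤ z
      minimal p q (inj₁ refl) = ℕ.≤-refl
      minimal p q (inj₂ (inj₁ refl)) = ℕ.<⇒≤ p
      minimal p q (inj₂ (inj₂ refl)) = ℕ.<⇒≤ (ℕ.<-trans p q)
      maximal : ∀ {i j k z : Fin n} → i Fin.< j → j Fin.< k → On z i j k → z Fin.≤ k
      maximal p q (inj₁ refl) = ℕ.<⇒≤ (ℕ.<-trans p q)
      maximal p q (inj₂ (inj₁ refl)) = ℕ.<⇒≤ q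
      maximal p q (inj₂ (inj₂ refl)) = ℕ.≤-refl
      first : i ≡ i′
      first = Fin.≤-antisym (minimal a b (from {i′} (inj₁ refl))) (minimal a′ b′ (to {i} (inj₁ refl)))
      last : k ≡ k′
      last = Fin.≤-antisym (maximal a′ b′ (to {k} (inj₂ (inj₂ refl)))) (maximal a b (from {k′} (inj₂ (inj₂ refl))))
      middle : On j i′ j′ k′ → (i , j , k) ≡ (i′ , j′ , k′)
      middle (inj₁ e) = contradiction (trans first (sym e)) (Fin.<⇒≢ a)
      middle (inj₂ (inj₁ e)) = cong₂ _,_ first (cong₂ _,_ e last)
      middle (inj₂ (inj₂ e)) = contradiction (trans e (sym last)) (Fin.<⇒≢ b)

    line-unique : ∀ {x y} L L′ → x ∈L L → y ∈L L → x ∈L L′ → y ∈L L′ → x ≢ y → L ≡ L′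
    line-unique {x} {y} L L′ px py px′ py′ ne = Line.injective (trans (sym (code-decode (Line.at L)))
      (trans (cong code (sorted-unique (Line.holds L) (Line.holds L′)
        (same-set (clique L) (clique L′) px py px′ py′ ne) (same-set (clique L′) (clique L) px′ py′ px py ne))) (code-decode (Line.at L′))))

    line-through : ∀ {x y} → d x y ≡ 1F → ∃[ L ] x ∈L L × y ∈L L
    line-through {x} {y} xy =
      let z , xz , yz = third xy
          i , j , k , i<j , j<k , q , px , py = sort₃ Q
            (λ { ((a , b , c) , p , q) → (flip a , c , b) , turn p , turn q })
            (λ { ((a , b , c) , p , q) → (b , a , flip c) , turn′ p , turn′ q })
            {x} {y} {z} ((xy , xz , yz) , inj₁ refl , inj₂ (inj₁ refl)) (adjacent-≢ xy) (adjacent-≢ xz) (adjacent-≢ yz)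
          L , e = Line.complete {code (i , j , k)} (subst Sorted (sym (decode-code (i , j , k))) (i<j , j<k , q))
      in L , transport L (trans (cong decode e) (decode-code (i , j , k))) px , transport L (trans (cong decode e) (decode-code (i , j , k))) py
      where
      Q : Fin n → Fin n → Fin n → Set
      Q i j k = Clique i j k × On x i j k × On y i j k
      turn : ∀ {x i j k} → On x i j k → On x j i k
      turn (inj₁ e) = inj₂ (inj₁ e)
      turn (inj₂ (inj₁ e)) = inj₁ e
      turn (inj₂ (inj₂ e)) = inj₂ (inj₂ e)
      turn′ : ∀ {x i j k} → On x i j k → On x i k j
      turn′ (inj₁ e) = inj₁ e
      turn′ (inj₂ (inj₁ e)) = inj₂ (inj₂ e)
      turn′ (inj₂ (inj₂ e)) = inj₂ (inj₁ e)
      transport : ∀ {x} L {t} → triple L ≡ t → (let i , j , k = t in On x i j k) → x ∈L L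
      transport L refl p = p

    structure : IncidenceStructure n l
    structure = record { _I_ = _∈L_ ; _I?_ = _∈L?_ }

    ι : Fin l → Fin n → ℤ
    ι L x = bit (x ∈L? L)

    line-sum : ∀ L → sum (ι L) ≡ + 3
    line-sum L = let i , j , k = triple L in trans (sum-combination ((1ℤ , λ x → δ i x * 1ℤ) ∷ (1ℤ , λ x → δ j x * 1ℤ) ∷ (1ℤ , λ x → δ k x * 1ℤ) ∷ [])
        (λ x → pointwise i j k (clique L) x))
      (cong₂ (λ a b → 1ℤ * a + b) (sum-δ i (λ _ → 1ℤ)) (cong₂ (λ a b → 1ℤ * a + (1ℤ * b + 0ℤ)) (sum-δ j (λ _ → 1ℤ)) (sum-δ k (λ _ → 1ℤ))))
      where
      pointwise : ∀ i j k → Clique i j k → ∀ x → bit ((x Fin.≟ i) ⊎-dec (x Fin.≟ j) ⊎-dec (x Fin.≟ k)) ≡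
        1ℤ * (δ i x * 1ℤ) + (1ℤ * (δ j x * 1ℤ) + (1ℤ * (δ k x * 1ℤ) + 0ℤ))
      pointwise i j k (ij , ik , jk) x with x Fin.≟ i | x Fin.≟ j | x Fin.≟ k
      ... | yes refl | _ | _ rewrite δ-refl x | δ-≢ {i = j} {x} (adjacent-≢ ij ∘ sym) | δ-≢ {i = k} {x} (adjacent-≢ ik ∘ sym) = refl
      ... | no x≢i | yes refl | _ rewrite δ-refl x | δ-≢ {i = i} {x} (x≢i ∘ sym) | δ-≢ {i = k} {x} (adjacent-≢ jk ∘ sym) = refl
      ... | no x≢i | no x≢j | yes refl rewrite δ-refl x | δ-≢ {i = i} {x} (x≢i ∘ sym) | δ-≢ {i = j} {x} (x≢j ∘ sym) = refl
      ... | no x≢i | no x≢j | no x≢k rewrite δ-≢ {i = i} {x} (x≢i ∘ sym) | δ-≢ {i = j} {x} (x≢j ∘ sym) | δ-≢ {i = k} {x} (x≢k ∘ sym) = refl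

    pencil : Fin n → ℤ
    pencil x = sum (λ L → ι L x)

    pair-sum : ∀ x y → sum (λ L → ι L x * ι L y) ≡ pencil x * (δ x y * 1ℤ) + (1ℤ * δ 1F (d x y) + 0ℤ)
    pair-sum x y = go (x Fin.≟ y) (d x y Fin.≟ 1F)
      where
      square : ∀ {P : Set} (P? : Dec P) → bit P? * bit P? ≡ bit P?
      square (yes _) = refl
      square (no _)  = refl
      shape₁ : ∀ p → p ≡ p * (1ℤ * 1ℤ) + (1ℤ * 0ℤ + 0ℤ)
      shape₁ = solve-∀
      shape₂ : ∀ p → p * (0ℤ * 1ℤ) + (1ℤ * 1ℤ + 0ℤ) ≡ 1ℤ
      shape₂ = solve-∀
      shape₃ : ∀ p → p * (0ℤ * 1ℤ) + (1ℤ * 0ℤ + 0ℤ) ≡ 0ℤ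
      shape₃ = solve-∀
      zero-product : ∀ {P Q : Set} (P? : Dec P) (Q? : Dec Q) → ¬ (P × Q) → bit P? * bit Q? ≡ 0ℤ
      zero-product (yes p) (yes q) ¬pq = contradiction (p , q) ¬pq
      zero-product (yes p) (no _) _ = refl
      zero-product (no _) Q? _ = ℤ.*-zeroˡ (bit Q?)
      go : Dec (x ≡ y) → Dec (d x y ≡ 1F) → sum (λ L → ι L x * ι L y) ≡ pencil x * (δ x y * 1ℤ) + (1ℤ * δ 1F (d x y) + 0ℤ)
      go (yes refl) _ = trans (sum-cong-≗ (λ L → square (x ∈L? L))) (trans (shape₁ (pencil x))
        (cong₂ (λ a b → pencil x * (a * 1ℤ) + (1ℤ * b + 0ℤ)) (sym (δ-refl x)) (sym (cong (δ 1F) (d-refl x)))))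
      go (no x≢y) (yes e) = let L₀ , p , q = line-through e in
        trans (sum-cong-≗ (λ L → single L₀ p q L (L₀ Fin.≟ L))) (trans (sum-δ L₀ (λ _ → 1ℤ))
          (trans (sym (shape₂ (pencil x))) (cong₂ (λ a b → pencil x * (a * 1ℤ) + (1ℤ * b + 0ℤ)) (sym (δ-≢ x≢y)) (sym (cong (δ 1F) e)))))
        where
        single : ∀ L₀ → x ∈L L₀ → y ∈L L₀ → ∀ L → Dec (L₀ ≡ L) → ι L x * ι L y ≡ δ L₀ L * 1ℤ
        single L₀ p q L (yes refl) = trans (cong₂ _*_ (bit-yes (x ∈L? L) p) (bit-yes (y ∈L? L) q)) (cong (_* 1ℤ) (sym (δ-refl L)))
        single L₀ p q L (no ne) = trans (zero-product (x ∈L? L) (y ∈L? L) (λ (p′ , q′) → ne (line-unique L₀ L p q p′ q′ x≢y)))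
          (cong (_* 1ℤ) (sym (δ-≢ ne)))
      go (no x≢y) (no ne) = trans (sum-zero (λ L → ι L x * ι L y) (λ L → zero-product (x ∈L? L) (y ∈L? L) (λ (p , q) → ne (adjacent L p q x≢y))))
        (trans (sym (shape₃ (pencil x))) (cong₂ (λ a b → pencil x * (a * 1ℤ) + (1ℤ * b + 0ℤ)) (sym (δ-≢ x≢y)) (sym (δ-≢ (ne ∘ sym)))))

    -- Count the pairs (L, y) with x and y on L: each of the r lines through x has 3 points, while y
    -- = x lies on all r of them and each of the 6 neighbours of x on one. So 3r = r + 6.
    pencil-3 : ∀ x → pencil x ≡ + 3
    pencil-3 x = cancel-positive-≡ {+ 2} (+<+ (s≤s z≤n)) (trans (shape (pencil x)) (trans (cong (_- pencil x) (sym by-lines))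
        (trans (cong (_- pencil x) by-points) (shape′ (pencil x)))))
      where
      total : ℤ
      total = sum (λ L → sum (λ y → ι L x * ι L y))
      by-lines : total ≡ + 3 * pencil x + 0ℤ
      by-lines = trans (sum-cong-≗ (λ L → trans (sym (*-distribˡ-sum (ι L x) (ι L))) (cong (ι L x *_) (line-sum L))))
        (sum-combination ((+ 3 , λ L → ι L x) ∷ []) (λ L → shape″ (ι L x)))
        where
        shape″ : ∀ t → t * + 3 ≡ + 3 * t + 0ℤ
        shape″ = solve-∀
      by-points : total ≡ pencil x * 1ℤ + (1ℤ * + 6 + 0ℤ)
      by-points = trans (∑-comm (λ L y → ι L x * ι L y)) (trans (sum-combination
        ((pencil x , λ y → δ x y * 1ℤ) ∷ (1ℤ , λ y → δ 1F (d x y)) ∷ []) (pair-sum x))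
        (cong₂ (λ a b → pencil x * a + (1ℤ * b + 0ℤ)) (sum-δ x (λ _ → 1ℤ)) (valency-6 x)))
      shape : ∀ t → + 2 * t ≡ (+ 3 * t + 0ℤ) - t
      shape = solve-∀
      shape′ : ∀ t → (t * 1ℤ + (1ℤ * + 6 + 0ℤ)) - t ≡ + 2 * + 3
      shape′ = solve-∀

    G : Graph (Fin n ⊎ Fin l)
    G = incidenceGraph structure
    open Graph G using (_∼_)

    -- With decidable walks, the least length can be searched for, so a walk of length at most 6
    -- yields an exact distance.
    Walk? : ∀ u v m → Dec (Walk G u v m)
    Walk? u v zero = map′ (λ { refl → [] }) (λ { [] → refl }) (Sum.≡-dec Fin._≟_ Fin._≟_ u v)
    Walk? u v (suc m) = map′ to from (Fin.any? (λ x → Graph._∼?_ G u (inj₁ x) ×-dec Walk? (inj₁ x) v m) ⊎-dec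
        Fin.any? (λ L → Graph._∼?_ G u (inj₂ L) ×-dec Walk? (inj₂ L) v m))
      where
      to : (∃[ x ] u ∼ inj₁ x × Walk G (inj₁ x) v m) ⊎ (∃[ L ] u ∼ inj₂ L × Walk G (inj₂ L) v m) → Walk G u v (suc m)
      to (inj₁ (x , e , p)) = e ∷ p
      to (inj₂ (L , e , p)) = e ∷ p
      from : Walk G u v (suc m) → (∃[ x ] u ∼ inj₁ x × Walk G (inj₁ x) v m) ⊎ (∃[ L ] u ∼ inj₂ L × Walk G (inj₂ L) v m)
      from (_∷_ {y = inj₁ x} e p) = inj₁ (x , e , p)
      from (_∷_ {y = inj₂ L} e p) = inj₂ (L , e , p)

    walk⇒distance : ∀ {u v m} → m ℕ.≤ 6 → Walk G u v m → ∃[ e ] e ℕ.≤ 6 × Distance G u v e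
    walk⇒distance {u} {v} {m} m≤6 p = let e , e≤m , q , min = least (Walk? u v) m p in e , ℕ.≤-trans e≤m m≤6 , q , min

    edge-walk : ∀ {x y} → d x y ≡ 1F → Walk G (inj₁ x) (inj₁ y) 2
    edge-walk e = let L , p , q = line-through e in _∷_ {y = inj₂ L} p (q ∷ [])

    abstract
      predecessor : ∀ {x y} (i : Fin 3) → d x y ≡ suc i → ∃[ z ] d z y ≡ 1F × d x z ≡ Fin.inject₁ i
      predecessor {x} {y} 0F e = x , e , d-refl x
      predecessor {x} {y} 1F e = let z , xz , yz = exists₂ 1F 1F x y (subst (0ℤ <_) (sym (intersection (δ 1F) (δ 1F) (+ 1) pos refl e)) (+<+ (s≤s z≤n)))
        in z , flip yz , xz
      predecessor {x} {y} 2F e = let z , xz , yz = exists₂ 2F 1F x y (subst (0ℤ <_) (sym (intersection (δ 2F) (δ 1F) (+ 3) pos refl e)) (+<+ (s≤s z≤n)))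
        in z , flip yz , xz

    point-walk : ∀ {x y} i → d x y ≡ i → Walk G (inj₁ x) (inj₁ y) (toℕ i ℕ.* 2)
    point-walk {x} {y} 0F e = subst (λ y → Walk G (inj₁ x) (inj₁ y) 0) (d-zero e) []
    point-walk 1F e = edge-walk e
    point-walk {x} {y} 2F e = let z , zy , xz = predecessor 1F e in append G (edge-walk xz) (edge-walk zy)
    point-walk {x} {y} 3F e = let z , zy , xz = predecessor 2F e in append G (point-walk 2F xz) (edge-walk zy)

    -- Three distances equal to 3 are not a null pattern. Hence a point and a line are at most 2·2 +
    -- 1 apart in the incidence graph.
    nearest : ∀ x L → ∃[ y ] y ∈L L × toℕ (d x y) ℕ.≤ 2
    nearest x L = let i , j , k = triple L ; ij , ik , jk = clique L in pick i j k (line-zero ij ik jk x)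
      where
      table : ∀ p q r → Zero p q r → toℕ p ℕ.≤ 2 ⊎ toℕ q ℕ.≤ 2 ⊎ toℕ r ℕ.≤ 2
      table = finite₃ (λ p q r → (w p + (w q + w r) ℤ.≟ 0ℤ) →-dec ((toℕ p ℕ.≤? 2) ⊎-dec (toℕ q ℕ.≤? 2) ⊎-dec (toℕ r ℕ.≤? 2)))
      at-most : ∀ {y} → toℕ (d y x) ℕ.≤ 2 → toℕ (d x y) ℕ.≤ 2
      at-most {y} = subst (λ i → toℕ i ℕ.≤ 2) (d-sym y x)
      pick : ∀ i j k → Zero (d i x) (d j x) (d k x) → ∃[ y ] On y i j k × toℕ (d x y) ℕ.≤ 2
      pick i j k z = go (table (d i x) (d j x) (d k x) z)
        where
        go : toℕ (d i x) ℕ.≤ 2 ⊎ toℕ (d j x) ℕ.≤ 2 ⊎ toℕ (d k x) ℕ.≤ 2 → ∃[ y ] On y i j k × toℕ (d x y) ℕ.≤ 2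
        go (inj₁ h) = i , inj₁ refl , at-most h
        go (inj₂ (inj₁ h)) = j , inj₂ (inj₁ refl) , at-most h
        go (inj₂ (inj₂ h)) = k , inj₂ (inj₂ refl) , at-most h

    -- Two incidence steps move a point by at most one step of Γ. This is the lower bound 6 for
    -- opposite points.
    walk-bound : ∀ {x y m} → Walk G (inj₁ x) (inj₁ y) m → toℕ (d x y) ℕ.* 2 ℕ.≤ m
    walk-bound {x} [] = subst (λ i → toℕ i ℕ.* 2 ℕ.≤ 0) (sym (d-refl x)) z≤n
    walk-bound {x} {y} (_∷_ {y = inj₂ L} p (_∷_ {y = inj₁ z} q rest)) =
      ℕ.≤-trans (ℕ.*-monoˡ-≤ 2 (ℕ.≤-trans (d-tri x z y) (ℕ.+-monoˡ-≤ (toℕ (d z y)) (short (x Fin.≟ z))))) (s≤s (s≤s (walk-bound rest)))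
      where
      short : Dec (x ≡ z) → toℕ (d x z) ℕ.≤ 1
      short (yes refl) = subst (λ i → toℕ i ℕ.≤ 1) (sym (d-refl x)) z≤n
      short (no ne) = subst (λ i → toℕ i ℕ.≤ 1) (sym (adjacent L p q ne)) ℕ.≤-refl
    walk-bound (_∷_ {y = inj₁ _} () _)
    walk-bound (_∷_ {y = inj₂ _} _ (_∷_ {y = inj₂ _} () _))

    diameter : HasDiameter G 6
    diameter = reach , inj₁ (proj₁ far) , inj₁ (proj₁ (proj₂ far)) , point-walk 3F (proj₂ (proj₂ far)) ,
        λ e e<6 p → ℕ.<-irrefl refl (ℕ.<-≤-trans e<6 (subst (λ i → toℕ i ℕ.* 2 ℕ.≤ e) (proj₂ (proj₂ far)) (walk-bound p)))
      where
      to-line : ∀ x L → ∃[ m ] m ℕ.≤ 5 × Walk G (inj₁ x) (inj₂ L) m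
      to-line x L = let y , p , h = nearest x L in _ , s≤s (ℕ.*-monoˡ-≤ 2 h) , snoc G (point-walk (d x y) refl) p
      reach : ∀ u v → ∃[ e ] e ℕ.≤ 6 × Distance G u v e
      reach (inj₁ x) (inj₁ y) = walk⇒distance (ℕ.*-monoˡ-≤ 2 (ℕ.≤-pred (Fin.toℕ<n (d x y)))) (point-walk (d x y) refl)
      reach (inj₁ x) (inj₂ L) = let m , h , p = to-line x L in walk⇒distance (ℕ.m≤n⇒m≤1+n h) p
      reach (inj₂ L) (inj₁ x) = let m , h , p = to-line x L in walk⇒distance (ℕ.m≤n⇒m≤1+n h) (reverse G p)
      reach (inj₂ L) (inj₂ M) = let i , _ = triple L ; m , h , p = to-line i M in
        walk⇒distance (s≤s h) (_∷_ {y = inj₁ i} (inj₁ refl) p)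

    transversal : ∀ {p₀ p₁ p₂ L₀ L₁} → p₀ ∈L L₀ → p₁ ∈L L₀ → p₁ ∈L L₁ → p₂ ∈L L₁ → p₀ ≢ p₁ → p₁ ≢ p₂ → L₀ ≢ L₁ → d p₀ p₂ ≡ 2F
    transversal {p₀} {p₁} {p₂} {L₀} {L₁} a b c e n₀ n₁ L₀≢L₁ = go (d p₀ p₂) refl
      where
      p₀p₁ = adjacent L₀ a b n₀
      p₁p₂ = adjacent L₁ c e n₁
      go : ∀ i → d p₀ p₂ ≡ i → d p₀ p₂ ≡ 2F
      go 0F h = contradiction (line-unique L₀ L₁ a b (subst (_∈L L₁) (sym (d-zero h)) e) c n₀) L₀≢L₁
      go 1F h = contradiction (line-unique L₀ L₁ b (on-closed (clique L₀) a b n₀ h p₁p₂) c e n₁) L₀≢L₁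
      go 2F h = h
      go 3F h = contradiction (subst₂ (λ i j → Triangle 1F i j) h p₁p₂ (triangle-at p₀p₁ p₂)) λ { (_ , s≤s (s≤s ()) , _) }

    private
      infix 4 _≢ᵥ_
      _≢ᵥ_ : Fin n ⊎ Fin l → Fin n ⊎ Fin l → Set
      u ≢ᵥ v = u ≢ v

    point-≢ : ∀ {x y} → inj₁ x ≢ᵥ inj₁ y → x ≢ y
    point-≢ ne refl = ne refl

    line-≢ : ∀ {L M} → inj₂ L ≢ᵥ inj₂ M → L ≢ M
    line-≢ ne refl = ne refl

    no-polygon-2 : ∀ {p0 p1 L0 L1} → p0 ∈L L0 → p1 ∈L L0 → p1 ∈L L1 → p0 ∈L L1 →
      inj₁ p0 ≢ᵥ inj₁ p1 → inj₂ L0 ≢ᵥ inj₂ L1 → inj₁ p1 ≢ᵥ inj₁ p0 → inj₂ L1 ≢ᵥ inj₂ L0 → ⊥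
    no-polygon-2 {p0} {p1} {L0} {L1} e0 e1 e2 e3 n0 n1 n2 n3 =
      line-≢ n1 (line-unique L0 L1 e0 e1 e3 e2 (point-≢ n0))

    no-polygon-3 : ∀ {p0 p1 p2 L0 L1 L2} → p0 ∈L L0 → p1 ∈L L0 → p1 ∈L L1 → p2 ∈L L1 → p2 ∈L L2 → p0 ∈L L2 →
      inj₁ p0 ≢ᵥ inj₁ p1 → inj₂ L0 ≢ᵥ inj₂ L1 → inj₁ p1 ≢ᵥ inj₁ p2 → inj₂ L1 ≢ᵥ inj₂ L2 → inj₁ p2 ≢ᵥ inj₁ p0 → inj₂ L2 ≢ᵥ inj₂ L0 → ⊥
    no-polygon-3 {p0} {p1} {p2} {L0} {L1} {L2} e0 e1 e2 e3 e4 e5 n0 n1 n2 n3 n4 n5 =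
      contradiction (trans (sym (transversal {L₀ = L0} {L1} e0 e1 e2 e3 (point-≢ n0) (point-≢ n2) (line-≢ n1)))
        (adjacent L2 e5 e4 (point-≢ n4 ∘ sym))) λ ()

    no-polygon-4 : ∀ {p0 p1 p2 p3 L0 L1 L2 L3} → p0 ∈L L0 → p1 ∈L L0 → p1 ∈L L1 → p2 ∈L L1 → p2 ∈L L2 → p3 ∈L L2 → p3 ∈L L3 → p0 ∈L L3 →
      inj₁ p0 ≢ᵥ inj₁ p1 → inj₂ L0 ≢ᵥ inj₂ L1 → inj₁ p1 ≢ᵥ inj₁ p2 → inj₂ L1 ≢ᵥ inj₂ L2 → inj₁ p2 ≢ᵥ inj₁ p3 → inj₂ L2 ≢ᵥ inj₂ L3 → inj₁ p3 ≢ᵥ inj₁ p0 → inj₂ L3 ≢ᵥ inj₂ L0 → ⊥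
    no-polygon-4 {p0} {p1} {p2} {p3} {L0} {L1} {L2} {L3} e0 e1 e2 e3 e4 e5 e6 e7 n0 n1 n2 n3 n4 n5 n6 n7 =
      line-≢ n7 (line-unique L3 L0 e7 e6 e0 (subst (_∈L L0) p1≡p3 e1) (point-≢ n6 ∘ sym))
      where
      p1≡p3 : p1 ≡ p3
      p1≡p3 = common-2 (transversal {L₀ = L0} {L1} e0 e1 e2 e3 (point-≢ n0) (point-≢ n2) (line-≢ n1))
        (adjacent L0 e0 e1 (point-≢ n0) , flip (adjacent L1 e2 e3 (point-≢ n2)))
        (flip (adjacent L3 e6 e7 (point-≢ n6)) , adjacent L2 e4 e5 (point-≢ n4))

    -- Both p₂ and p₃ are at distance 2 from p₀, so by the null pattern the third point of L₂ is
    -- adjacent to p₀. As c₂ = 1 it is p₁, and then L₁ = L₂.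
    no-polygon-5 : ∀ {p0 p1 p2 p3 p4 L0 L1 L2 L3 L4} → p0 ∈L L0 → p1 ∈L L0 → p1 ∈L L1 → p2 ∈L L1 → p2 ∈L L2 → p3 ∈L L2 → p3 ∈L L3 → p4 ∈L L3 → p4 ∈L L4 → p0 ∈L L4 →
      inj₁ p0 ≢ᵥ inj₁ p1 → inj₂ L0 ≢ᵥ inj₂ L1 → inj₁ p1 ≢ᵥ inj₁ p2 → inj₂ L1 ≢ᵥ inj₂ L2 → inj₁ p2 ≢ᵥ inj₁ p3 → inj₂ L2 ≢ᵥ inj₂ L3 → inj₁ p3 ≢ᵥ inj₁ p4 → inj₂ L3 ≢ᵥ inj₂ L4 → inj₁ p4 ≢ᵥ inj₁ p0 → inj₂ L4 ≢ᵥ inj₂ L0 → ⊥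
    no-polygon-5 {p0} {p1} {p2} {p3} {p4} {L0} {L1} {L2} {L3} {L4} e0 e1 e2 e3 e4 e5 e6 e7 e8 e9 n0 n1 n2 n3 n4 n5 n6 n7 n8 n9 =
      line-≢ n3 (line-unique L1 L2 e2 e3 (subst (_∈L L2) t≡p1 t∈L2) e4 (point-≢ n2))
      where
      p0p2 = transversal {L₀ = L0} {L1} e0 e1 e2 e3 (point-≢ n0) (point-≢ n2) (line-≢ n1)
      p0p3 = flip (transversal {L₀ = L3} {L4} e6 e7 e8 e9 (point-≢ n6) (point-≢ n8) (line-≢ n7))
      p2p3 = adjacent L2 e4 e5 (point-≢ n4)
      t = proj₁ (third p2p3)
      p2t = proj₁ (proj₂ (third p2p3))
      p3t = proj₂ (proj₂ (third p2p3))
      t∈L2 : t ∈L L2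
      t∈L2 = on-closed (clique L2) e4 e5 (point-≢ n4) p2t p3t
      last : ∀ i → Zero 2F 2F i → i ≡ 1F
      last 0F ()
      last 1F _ = refl
      last 2F ()
      last 3F ()
      p0t : d p0 t ≡ 1F
      p0t = trans (d-sym p0 t) (last (d t p0) (subst₂ (λ i j → Zero i j (d t p0)) (flip p0p2) (flip p0p3) (line-zero p2p3 p2t p3t p0)))
      t≡p1 : t ≡ p1
      t≡p1 = common-2 p0p2 (p0t , p2t) (adjacent L0 e0 e1 (point-≢ n0) , flip (adjacent L1 e2 e3 (point-≢ n2)))

    -- Cycles of the incidence graph alternate between points and lines, so after at most one
    -- rotation a short even cycle is one of the polygons excluded above.
    cycle-from-point-4 : ∀ p v1 v2 v3 → inj₁ p ∼ v1 → v1 ∼ v2 → v2 ∼ v3 → v3 ∼ inj₁ p →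
      inj₁ p ≢ᵥ v2 → v1 ≢ᵥ v3 → v2 ≢ᵥ inj₁ p → v3 ≢ᵥ v1 → ⊥
    cycle-from-point-4 _ (inj₁ _) _ _ ()
    cycle-from-point-4 _ (inj₂ _) (inj₂ _) _ _ ()
    cycle-from-point-4 _ (inj₂ _) (inj₁ _) (inj₁ _) _ _ ()
    cycle-from-point-4 _ (inj₂ _) (inj₁ _) (inj₂ _) e0 e1 e2 e3 n0 n1 n2 n3 =
      no-polygon-2 e0 e1 e2 e3 n0 n1 n2 n3

    cycle-4 : ∀ v0 v1 v2 v3 → v0 ∼ v1 → v1 ∼ v2 → v2 ∼ v3 → v3 ∼ v0 →
      v0 ≢ᵥ v2 → v1 ≢ᵥ v3 → v2 ≢ᵥ v0 → v3 ≢ᵥ v1 → ⊥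
    cycle-4 (inj₁ p) = cycle-from-point-4 p
    cycle-4 (inj₂ _) (inj₂ _) _ _ ()
    cycle-4 v0@(inj₂ _) (inj₁ p) v2 v3 e0 e1 e2 e3 n0 n1 n2 n3 =
      cycle-from-point-4 p v2 v3 v0 e1 e2 e3 e0 n1 n2 n3 n0

    cycle-from-point-6 : ∀ p v1 v2 v3 v4 v5 → inj₁ p ∼ v1 → v1 ∼ v2 → v2 ∼ v3 → v3 ∼ v4 → v4 ∼ v5 → v5 ∼ inj₁ p →
      inj₁ p ≢ᵥ v2 → v1 ≢ᵥ v3 → v2 ≢ᵥ v4 → v3 ≢ᵥ v5 → v4 ≢ᵥ inj₁ p → v5 ≢ᵥ v1 → ⊥
    cycle-from-point-6 _ (inj₁ _) _ _ _ _ ()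
    cycle-from-point-6 _ (inj₂ _) (inj₂ _) _ _ _ _ ()
    cycle-from-point-6 _ (inj₂ _) (inj₁ _) (inj₁ _) _ _ _ _ ()
    cycle-from-point-6 _ (inj₂ _) (inj₁ _) (inj₂ _) (inj₂ _) _ _ _ _ ()
    cycle-from-point-6 _ (inj₂ _) (inj₁ _) (inj₂ _) (inj₁ _) (inj₁ _) _ _ _ _ ()
    cycle-from-point-6 _ (inj₂ _) (inj₁ _) (inj₂ _) (inj₁ _) (inj₂ _) e0 e1 e2 e3 e4 e5 n0 n1 n2 n3 n4 n5 =
      no-polygon-3 e0 e1 e2 e3 e4 e5 n0 n1 n2 n3 n4 n5

    cycle-6 : ∀ v0 v1 v2 v3 v4 v5 → v0 ∼ v1 → v1 ∼ v2 → v2 ∼ v3 → v3 ∼ v4 → v4 ∼ v5 → v5 ∼ v0 →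
      v0 ≢ᵥ v2 → v1 ≢ᵥ v3 → v2 ≢ᵥ v4 → v3 ≢ᵥ v5 → v4 ≢ᵥ v0 → v5 ≢ᵥ v1 → ⊥
    cycle-6 (inj₁ p) = cycle-from-point-6 p
    cycle-6 (inj₂ _) (inj₂ _) _ _ _ _ ()
    cycle-6 v0@(inj₂ _) (inj₁ p) v2 v3 v4 v5 e0 e1 e2 e3 e4 e5 n0 n1 n2 n3 n4 n5 =
      cycle-from-point-6 p v2 v3 v4 v5 v0 e1 e2 e3 e4 e5 e0 n1 n2 n3 n4 n5 n0

    cycle-from-point-8 : ∀ p v1 v2 v3 v4 v5 v6 v7 → inj₁ p ∼ v1 → v1 ∼ v2 → v2 ∼ v3 → v3 ∼ v4 → v4 ∼ v5 → v5 ∼ v6 → v6 ∼ v7 → v7 ∼ inj₁ p →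
      inj₁ p ≢ᵥ v2 → v1 ≢ᵥ v3 → v2 ≢ᵥ v4 → v3 ≢ᵥ v5 → v4 ≢ᵥ v6 → v5 ≢ᵥ v7 → v6 ≢ᵥ inj₁ p → v7 ≢ᵥ v1 → ⊥
    cycle-from-point-8 _ (inj₁ _) _ _ _ _ _ _ ()
    cycle-from-point-8 _ (inj₂ _) (inj₂ _) _ _ _ _ _ _ ()
    cycle-from-point-8 _ (inj₂ _) (inj₁ _) (inj₁ _) _ _ _ _ _ _ ()
    cycle-from-point-8 _ (inj₂ _) (inj₁ _) (inj₂ _) (inj₂ _) _ _ _ _ _ _ ()
    cycle-from-point-8 _ (inj₂ _) (inj₁ _) (inj₂ _) (inj₁ _) (inj₁ _) _ _ _ _ _ _ ()
    cycle-from-point-8 _ (inj₂ _) (inj₁ _) (inj₂ _) (inj₁ _) (inj₂ _) (inj₂ _) _ _ _ _ _ _ ()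
    cycle-from-point-8 _ (inj₂ _) (inj₁ _) (inj₂ _) (inj₁ _) (inj₂ _) (inj₁ _) (inj₁ _) _ _ _ _ _ _ ()
    cycle-from-point-8 _ (inj₂ _) (inj₁ _) (inj₂ _) (inj₁ _) (inj₂ _) (inj₁ _) (inj₂ _) e0 e1 e2 e3 e4 e5 e6 e7 n0 n1 n2 n3 n4 n5 n6 n7 =
      no-polygon-4 e0 e1 e2 e3 e4 e5 e6 e7 n0 n1 n2 n3 n4 n5 n6 n7

    cycle-8 : ∀ v0 v1 v2 v3 v4 v5 v6 v7 → v0 ∼ v1 → v1 ∼ v2 → v2 ∼ v3 → v3 ∼ v4 → v4 ∼ v5 → v5 ∼ v6 → v6 ∼ v7 → v7 ∼ v0 →
      v0 ≢ᵥ v2 → v1 ≢ᵥ v3 → v2 ≢ᵥ v4 → v3 ≢ᵥ v5 → v4 ≢ᵥ v6 → v5 ≢ᵥ v7 → v6 ≢ᵥ v0 → v7 ≢ᵥ v1 → ⊥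
    cycle-8 (inj₁ p) = cycle-from-point-8 p
    cycle-8 (inj₂ _) (inj₂ _) _ _ _ _ _ _ ()
    cycle-8 v0@(inj₂ _) (inj₁ p) v2 v3 v4 v5 v6 v7 e0 e1 e2 e3 e4 e5 e6 e7 n0 n1 n2 n3 n4 n5 n6 n7 =
      cycle-from-point-8 p v2 v3 v4 v5 v6 v7 v0 e1 e2 e3 e4 e5 e6 e7 e0 n1 n2 n3 n4 n5 n6 n7 n0

    cycle-from-point-10 : ∀ p v1 v2 v3 v4 v5 v6 v7 v8 v9 → inj₁ p ∼ v1 → v1 ∼ v2 → v2 ∼ v3 → v3 ∼ v4 → v4 ∼ v5 → v5 ∼ v6 → v6 ∼ v7 → v7 ∼ v8 → v8 ∼ v9 → v9 ∼ inj₁ p →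
      inj₁ p ≢ᵥ v2 → v1 ≢ᵥ v3 → v2 ≢ᵥ v4 → v3 ≢ᵥ v5 → v4 ≢ᵥ v6 → v5 ≢ᵥ v7 → v6 ≢ᵥ v8 → v7 ≢ᵥ v9 → v8 ≢ᵥ inj₁ p → v9 ≢ᵥ v1 → ⊥
    cycle-from-point-10 _ (inj₁ _) _ _ _ _ _ _ _ _ ()
    cycle-from-point-10 _ (inj₂ _) (inj₂ _) _ _ _ _ _ _ _ _ ()
    cycle-from-point-10 _ (inj₂ _) (inj₁ _) (inj₁ _) _ _ _ _ _ _ _ _ ()
    cycle-from-point-10 _ (inj₂ _) (inj₁ _) (inj₂ _) (inj₂ _) _ _ _ _ _ _ _ _ ()
    cycle-from-point-10 _ (inj₂ _) (inj₁ _) (inj₂ _) (inj₁ _) (inj₁ _) _ _ _ _ _ _ _ _ ()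
    cycle-from-point-10 _ (inj₂ _) (inj₁ _) (inj₂ _) (inj₁ _) (inj₂ _) (inj₂ _) _ _ _ _ _ _ _ _ ()
    cycle-from-point-10 _ (inj₂ _) (inj₁ _) (inj₂ _) (inj₁ _) (inj₂ _) (inj₁ _) (inj₁ _) _ _ _ _ _ _ _ _ ()
    cycle-from-point-10 _ (inj₂ _) (inj₁ _) (inj₂ _) (inj₁ _) (inj₂ _) (inj₁ _) (inj₂ _) (inj₂ _) _ _ _ _ _ _ _ _ ()
    cycle-from-point-10 _ (inj₂ _) (inj₁ _) (inj₂ _) (inj₁ _) (inj₂ _) (inj₁ _) (inj₂ _) (inj₁ _) (inj₁ _) _ _ _ _ _ _ _ _ ()
    cycle-from-point-10 _ (inj₂ _) (inj₁ _) (inj₂ _) (inj₁ _) (inj₂ _) (inj₁ _) (inj₂ _) (inj₁ _) (inj₂ _) e0 e1 e2 e3 e4 e5 e6 e7 e8 e9 n0 n1 n2 n3 n4 n5 n6 n7 n8 n9 =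
      no-polygon-5 e0 e1 e2 e3 e4 e5 e6 e7 e8 e9 n0 n1 n2 n3 n4 n5 n6 n7 n8 n9

    cycle-10 : ∀ v0 v1 v2 v3 v4 v5 v6 v7 v8 v9 → v0 ∼ v1 → v1 ∼ v2 → v2 ∼ v3 → v3 ∼ v4 → v4 ∼ v5 → v5 ∼ v6 → v6 ∼ v7 → v7 ∼ v8 → v8 ∼ v9 → v9 ∼ v0 →
      v0 ≢ᵥ v2 → v1 ≢ᵥ v3 → v2 ≢ᵥ v4 → v3 ≢ᵥ v5 → v4 ≢ᵥ v6 → v5 ≢ᵥ v7 → v6 ≢ᵥ v8 → v7 ≢ᵥ v9 → v8 ≢ᵥ v0 → v9 ≢ᵥ v1 → ⊥
    cycle-10 (inj₁ p) = cycle-from-point-10 p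
    cycle-10 (inj₂ _) (inj₂ _) _ _ _ _ _ _ _ _ ()
    cycle-10 v0@(inj₂ _) (inj₁ p) v2 v3 v4 v5 v6 v7 v8 v9 e0 e1 e2 e3 e4 e5 e6 e7 e8 e9 n0 n1 n2 n3 n4 n5 n6 n7 n8 n9 =
      cycle-from-point-10 p v2 v3 v4 v5 v6 v7 v8 v9 v0 e1 e2 e3 e4 e5 e6 e7 e8 e9 e0 n1 n2 n3 n4 n5 n6 n7 n8 n9 n0

    side : Fin n ⊎ Fin l → Bool
    side (inj₁ _) = true
    side (inj₂ _) = false

    side-flip : ∀ {u v} → u ∼ v → side v ≡ not (side u)
    side-flip {inj₁ _} {inj₂ _} _ = refl
    side-flip {inj₂ _} {inj₁ _} _ = refl
    side-flip {inj₁ _} {inj₁ _} ()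
    side-flip {inj₂ _} {inj₂ _} ()

    alternating : ∀ {m} → ℕ → (f : Fin (suc m) → Fin n ⊎ Fin l) → Bool
    alternating zero    f = side (f 0F)
    alternating (suc k) f = not (alternating k f)

    alternate : ∀ {m} (C : Cycle G (suc m)) (i : Fin (suc m)) → side (Cycle.vertex C i) ≡ alternating (toℕ i) (Cycle.vertex C)
    alternate {m} C i = go i (toℕ i) refl
      where
      go : ∀ i k → toℕ i ≡ k → side (Cycle.vertex C i) ≡ alternating k (Cycle.vertex C)
      go i zero e = cong (side ∘ Cycle.vertex C) (Fin.toℕ-injective e)
      go i (suc k) e = trans (side-flip (Cycle.step C j i (trans (cong suc (Fin.toℕ-fromℕ< k<)) (sym e))))
          (cong not (go j k (Fin.toℕ-fromℕ< k<)))
        where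
        k< : k ℕ.< suc m
        k< = ℕ.<⇒≤ (subst (ℕ._< suc m) e (Fin.toℕ<n i))
        j = fromℕ< k<

    -- The incidence graph is bipartite, and a cycle of length m + 1 changes sides m + 1 times. On a
    -- constant function `alternating` performs m of these flips, so for a concrete odd length the
    -- hypothesis is checked by evaluation.
    odd-cycle : ∀ {m} (C : Cycle G (suc m)) → (∀ b → not (alternating {0} m (λ _ → b)) ≢ side b) → ⊥
    odd-cycle {m} C ne = ne (Cycle.vertex C 0F) (trans (cong not (trans (constant m)
        (trans (cong (λ k → alternating k (Cycle.vertex C)) (sym (Fin.toℕ-fromℕ m))) (sym (alternate C (Fin.fromℕ m))))))
        (sym (side-flip (Cycle.close C (Fin.fromℕ m) 0F (cong suc (Fin.toℕ-fromℕ m)) refl))))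
      where
      constant : ∀ k → alternating {0} k (λ _ → Cycle.vertex C 0F) ≡ alternating k (Cycle.vertex C)
      constant zero    = refl
      constant (suc k) = cong not (constant k)

    no-short-cycle : ∀ m → m ℕ.< 12 → ¬ Cycle G m
    no-short-cycle 0 _ C = contradiction (Cycle.3≤m C) λ ()
    no-short-cycle 1 _ C = contradiction (Cycle.3≤m C) λ { (s≤s ()) }
    no-short-cycle 2 _ C = contradiction (Cycle.3≤m C) λ { (s≤s (s≤s ())) }
    no-short-cycle 3 _ C = odd-cycle C λ { (inj₁ _) () ; (inj₂ _) () }
    no-short-cycle 4 _ C = let open Cycle C in cycle-4 (vertex 0F) (vertex 1F) (vertex 2F) (vertex 3F)
      (step 0F 1F refl) (step 1F 2F refl) (step 2F 3F refl) (close 3F 0F refl refl)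
      (apart 0F 2F λ ()) (apart 1F 3F λ ()) (apart 2F 0F λ ()) (apart 3F 1F λ ())
      where
      apart : ∀ i j → i ≢ j → Cycle.vertex C i ≢ᵥ Cycle.vertex C j
      apart i j ne e = ne (Cycle.injective C e)
    no-short-cycle 5 _ C = odd-cycle C λ { (inj₁ _) () ; (inj₂ _) () }
    no-short-cycle 6 _ C = let open Cycle C in cycle-6 (vertex 0F) (vertex 1F) (vertex 2F) (vertex 3F) (vertex 4F) (vertex 5F)
      (step 0F 1F refl) (step 1F 2F refl) (step 2F 3F refl) (step 3F 4F refl) (step 4F 5F refl) (close 5F 0F refl refl)
      (apart 0F 2F λ ()) (apart 1F 3F λ ()) (apart 2F 4F λ ()) (apart 3F 5F λ ()) (apart 4F 0F λ ()) (apart 5F 1F λ ())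
      where
      apart : ∀ i j → i ≢ j → Cycle.vertex C i ≢ᵥ Cycle.vertex C j
      apart i j ne e = ne (Cycle.injective C e)
    no-short-cycle 7 _ C = odd-cycle C λ { (inj₁ _) () ; (inj₂ _) () }
    no-short-cycle 8 _ C = let open Cycle C in cycle-8 (vertex 0F) (vertex 1F) (vertex 2F) (vertex 3F) (vertex 4F) (vertex 5F) (vertex 6F) (vertex 7F)
      (step 0F 1F refl) (step 1F 2F refl) (step 2F 3F refl) (step 3F 4F refl) (step 4F 5F refl) (step 5F 6F refl) (step 6F 7F refl) (close 7F 0F refl refl)
      (apart 0F 2F λ ()) (apart 1F 3F λ ()) (apart 2F 4F λ ()) (apart 3F 5F λ ()) (apart 4F 6F λ ()) (apart 5F 7F λ ()) (apart 6F 0F λ ()) (apart 7F 1F λ ())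
      where
      apart : ∀ i j → i ≢ j → Cycle.vertex C i ≢ᵥ Cycle.vertex C j
      apart i j ne e = ne (Cycle.injective C e)
    no-short-cycle 9 _ C = odd-cycle C λ { (inj₁ _) () ; (inj₂ _) () }
    no-short-cycle 10 _ C = let open Cycle C in cycle-10 (vertex 0F) (vertex 1F) (vertex 2F) (vertex 3F) (vertex 4F) (vertex 5F) (vertex 6F) (vertex 7F) (vertex 8F) (vertex 9F)
      (step 0F 1F refl) (step 1F 2F refl) (step 2F 3F refl) (step 3F 4F refl) (step 4F 5F refl) (step 5F 6F refl) (step 6F 7F refl) (step 7F 8F refl) (step 8F 9F refl) (close 9F 0F refl refl)
      (apart 0F 2F λ ()) (apart 1F 3F λ ()) (apart 2F 4F λ ()) (apart 3F 5F λ ()) (apart 4F 6F λ ()) (apart 5F 7F λ ()) (apart 6F 8F λ ()) (apart 7F 9F λ ()) (apart 8F 0F λ ()) (apart 9F 1F λ ())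
      where
      apart : ∀ i j → i ≢ j → Cycle.vertex C i ≢ᵥ Cycle.vertex C j
      apart i j ne e = ne (Cycle.injective C e)
    no-short-cycle 11 _ C = odd-cycle C λ { (inj₁ _) () ; (inj₂ _) () }
    no-short-cycle (suc (suc (suc (suc (suc (suc (suc (suc (suc (suc (suc (suc m)))))))))))) (s≤s (s≤s (s≤s (s≤s (s≤s (s≤s (s≤s (s≤s (s≤s (s≤s (s≤s (s≤s ()))))))))))))

    abstract
      opposite : ∃[ x ] ∃[ y ] d x y ≡ 3F
      opposite = far

      gates : ∀ {x y} → d x y ≡ 3F → Enumeration 3 (Joint 1F 2F y x) (λ z → δ 1F (d y z) * δ 2F (d x z))
      gates {x} {y} e = joint {3} 1F 2F y x (intersection (δ 1F) (δ 2F) (+ 3) pos refl (flip e))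

    record Ring : Set where
      field
        vertex : Fin 6 → Fin n
        edge   : ∀ i → d (vertex i) (vertex (next i)) ≡ 1F
        apart  : ∀ k → let i , j = pair k in 2 ℕ.≤ toℕ (d (vertex i) (vertex j))

    -- Two geodesics join opposite vertices x and y, through different gates among the c₃ = 3
    -- neighbours of y at distance 2 from x. By c₂ = 1 there are no diagonals r q′ and q r′, and
    -- chords r r′ or q q′ are impossible because distances 3, 2, 2 are not a null pattern.
    ring : Ring
    ring = go (proj₂ (proj₂ opposite)) (gates (proj₂ (proj₂ opposite)))
      where
      go : ∀ {x y} → d x y ≡ 3F → Enumeration 3 (Joint 1F 2F y x) (λ z → δ 1F (d y z) * δ 2F (d x z)) → Ring
      go {x} {y} xy N = record
        { vertex = λ { 0F → x ; 1F → r ; 2F → q ; 3F → y ; 4F → q′ ; 5F → r′ }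
        ; edge   = λ { 0F → xr ; 1F → rq ; 2F → flip yq ; 3F → yq′ ; 4F → flip r′q′ ; 5F → flip xr′ }
        ; apart  = λ { 0F → exactly xq ; 1F → subst (λ i → 2 ℕ.≤ toℕ i) (sym xy) (s≤s (s≤s z≤n)) ; 2F → exactly xq′
                     ; 3F → exactly ry ; 4F → at-least r≢q′ r≁q′ ; 5F → at-least r≢r′ r≁r′
                     ; 6F → at-least q≢q′ q≁q′ ; 7F → at-least q≢r′ q≁r′ ; 8F → exactly (flip r′y) } }
        where
        module N = Enumeration N
        q = N.at 0F
        q′ = N.at 1F
        yq = proj₁ (N.holds 0F)
        yq′ = proj₁ (N.holds 1F)
        xq = proj₂ (N.holds 0F)
        xq′ = proj₂ (N.holds 1F)
        q≢q′ : q ≢ q′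
        q≢q′ e = contradiction (N.injective {0F} {1F} e) λ ()
        gate : ∀ {q} → d x q ≡ 2F → ∃[ r ] d r q ≡ 1F × d x r ≡ 1F
        gate e = predecessor 1F e
        r = proj₁ (gate xq)
        rq = proj₁ (proj₂ (gate xq))
        xr = proj₂ (proj₂ (gate xq))
        r′ = proj₁ (gate xq′)
        r′q′ = proj₁ (proj₂ (gate xq′))
        xr′ = proj₂ (proj₂ (gate xq′))
        far-gate : ∀ {r q} → d x r ≡ 1F → d r q ≡ 1F → d y q ≡ 1F → d r y ≡ 2F
        far-gate {r} {q} xr rq yq = table (d r y) (subst (λ i → Triangle 1F i (d r y)) xy (triangle-at xr y))
            (subst (λ i → Triangle 1F (d r y) i) (flip yq) (triangle-at rq y))
          where
          table : ∀ i → Triangle 1F 3F i → Triangle 1F i 1F → i ≡ 2F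
          table 0F (_ , s≤s () , _) _
          table 1F (_ , s≤s (s≤s ()) , _) _
          table 2F _ _ = refl
          table 3F _ (_ , s≤s (s≤s ()) , _)
        ry : d r y ≡ 2F
        ry = far-gate xr rq yq
        r′y : d r′ y ≡ 2F
        r′y = far-gate xr′ r′q′ yq′
        r≁q′ : d r q′ ≢ 1F
        r≁q′ e = q≢q′ (common-2 ry (rq , yq) (e , yq′))
        q≁r′ : d q r′ ≢ 1F
        q≁r′ e = q≢q′ (common-2 r′y (flip e , yq) (r′q′ , yq′))
        r≢q′ : r ≢ q′
        r≢q′ e = contradiction (trans (sym xr) (trans (cong (d x) e) xq′)) λ ()
        q≢r′ : q ≢ r′
        q≢r′ e = contradiction (trans (sym xq) (trans (cong (d x) e) xr′)) λ ()
        r≢r′ : r ≢ r′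
        r≢r′ e = r≁q′ (trans (cong (λ r → d r q′) e) r′q′)
        r≁r′ : d r r′ ≢ 1F
        r≁r′ e = not-null (subst₂ (λ i j → Zero 3F i j) ry r′y (subst (λ i → Zero i (d r y) (d r′ y)) xy (line-zero xr xr′ e y)))
          where
          not-null : ¬ Zero 3F 2F 2F
          not-null ()
        q≁q′ : d q q′ ≢ 1F
        q≁q′ e = not-null (subst₂ (λ i j → Zero 3F i j) (flip xq) (flip xq′) (subst (λ i → Zero i (d q x) (d q′ x)) (flip xy) (line-zero yq yq′ e x)))
          where
          not-null : ¬ Zero 3F 2F 2F
          not-null ()
        exactly : ∀ {u v} → d u v ≡ 2F → 2 ℕ.≤ toℕ (d u v)
        exactly e = subst (λ i → 2 ℕ.≤ toℕ i) (sym e) ℕ.≤-refl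
        at-least : ∀ {u v} → u ≢ v → d u v ≢ 1F → 2 ℕ.≤ toℕ (d u v)
        at-least {u} {v} ne ¬adj = table (d u v) (ne ∘ d-zero) ¬adj
          where
          table : ∀ i → i ≢ 0F → i ≢ 1F → 2 ℕ.≤ toℕ i
          table 0F p _ = contradiction refl p
          table 1F _ p = contradiction refl p
          table (suc (suc i)) _ _ = s≤s (s≤s z≤n)

    module R = Ring ring

    not-apart : ∀ {u v} L → u ∈L L → v ∈L L → ¬ 2 ℕ.≤ toℕ (d u v)
    not-apart {u} {v} L p q h = go (u Fin.≟ v)
      where
      go : Dec (u ≡ v) → ⊥
      go (yes refl) = contradiction (subst (λ i → 2 ℕ.≤ toℕ i) (d-refl u) h) λ ()
      go (no ne) = contradiction (subst (λ i → 2 ℕ.≤ toℕ i) (adjacent L p q ne) h) λ { (s≤s ()) }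

    side-line : ∀ i → ∃[ L ] R.vertex i ∈L L × R.vertex (next i) ∈L L
    side-line i = line-through (R.edge i)

    far-apart : ∀ {i j} → Far i j → 2 ℕ.≤ toℕ (d (R.vertex i) (R.vertex j))
    far-apart (k , inj₁ refl) = R.apart k
    far-apart (k , inj₂ refl) = subst (λ e → 2 ℕ.≤ toℕ e) (d-sym _ _) (R.apart k)

    ring-injective : ∀ i j → R.vertex i ≡ R.vertex j → i ≡ j
    ring-injective i j e = go (near-or-far i j)
      where
      go : i ≡ j ⊎ j ≡ next i ⊎ i ≡ next j ⊎ Far i j → i ≡ j
      go (inj₁ p) = p
      go (inj₂ (inj₁ p)) = contradiction (trans e (cong R.vertex p)) (adjacent-≢ (R.edge i))
      go (inj₂ (inj₂ (inj₁ p))) = contradiction (trans (sym e) (cong R.vertex p)) (adjacent-≢ (R.edge j))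
      go (inj₂ (inj₂ (inj₂ p))) = contradiction (subst (λ i → 2 ℕ.≤ toℕ i) (trans (cong (d (R.vertex i)) (sym e)) (d-refl (R.vertex i))) (far-apart p)) λ ()

    line-injective : ∀ i j → proj₁ (side-line i) ≡ proj₁ (side-line j) → i ≡ j
    line-injective i j e = go (lines-separate i j)
      where
      L = proj₁ (side-line i)
      pj : R.vertex j ∈L L
      pj = subst (R.vertex j ∈L_) (sym e) (proj₁ (proj₂ (side-line j)))
      pj′ : R.vertex (next j) ∈L L
      pj′ = subst (R.vertex (next j) ∈L_) (sym e) (proj₂ (proj₂ (side-line j)))
      go : i ≡ j ⊎ Far i j ⊎ Far i (next j) ⊎ Far (next i) j → i ≡ j
      go (inj₁ p) = p
      go (inj₂ (inj₁ p)) = ⊥-elim (not-apart L (proj₁ (proj₂ (side-line i))) pj (far-apart p))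
      go (inj₂ (inj₂ (inj₁ p))) = ⊥-elim (not-apart L (proj₁ (proj₂ (side-line i))) pj′ (far-apart p))
      go (inj₂ (inj₂ (inj₂ p))) = ⊥-elim (not-apart L (proj₂ (proj₂ (side-line i))) pj (far-apart p))

    flag : Fin 6 × Fin 2 → Fin n ⊎ Fin l
    flag (i , 0F) = inj₁ (R.vertex i)
    flag (i , 1F) = inj₂ (proj₁ (side-line i))

    flag-injective : ∀ s t → flag s ≡ flag t → s ≡ t
    flag-injective (i , 0F) (j , 0F) e = cong (_, 0F) (ring-injective i j (Sum.inj₁-injective e))
    flag-injective (i , 1F) (j , 1F) e = cong (_, 1F) (line-injective i j (Sum.inj₂-injective e))
    flag-injective (i , 0F) (j , 1F) ()
    flag-injective (i , 1F) (j , 0F) ()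

    flag-step : ∀ s t → Next s t → flag s ∼ flag t
    flag-step (i , 0F) (j , 1F) refl = proj₁ (proj₂ (side-line i))
    flag-step (i , 1F) (j , 0F) refl = proj₂ (proj₂ (side-line i))
    flag-step (i , 0F) (j , 0F) ()
    flag-step (i , 1F) (j , 1F) ()

    dodecagon : Cycle G 12
    dodecagon = record
      { 3≤m = s≤s (s≤s (s≤s z≤n)) ; vertex = flag ∘ Fin.remQuot {6} 2
      ; injective = λ {i} {j} e → trans (sym (Fin.combine-remQuot {6} 2 i)) (trans (cong (λ (q , r) → Fin.combine {6} {2} q r)
          (flag-injective (Fin.remQuot {6} 2 i) (Fin.remQuot {6} 2 j) e)) (Fin.combine-remQuot {6} 2 j))
      ; step = λ i j e → flag-step (Fin.remQuot {6} 2 i) (Fin.remQuot {6} 2 j) (next-step i j e)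
      ; close = λ i j e e′ → flag-step (Fin.remQuot {6} 2 i) (Fin.remQuot {6} 2 j) (next-close i j e e′) }

    hexagon : GeneralizedHexagon structure 2 2
    hexagon = record
      { diameter = diameter ; girth = dodecagon , no-short-cycle
      ; line-size = λ L → sum⇒HasSize (λ x → x ∈L? L) (line-sum L) ; point-size = λ x → sum⇒HasSize (λ L → x ∈L? L) (pencil-3 x) }

    result : IsGeneralizedHexagon Γ 2 2
    result = n , l , structure , hexagon , record { vertices = mk↔ₛ′ (λ x → x) (λ x → x) (λ _ → refl) (λ _ → refl)
      ; adjacency = λ x y → mk⇔ (λ a → adjacent-≢ (∼⇒1 a) , line-through (∼⇒1 a)) (λ (ne , L , p , q) → 1⇒∼ (adjacent L p q ne)) }

-- A search that forces the distances between base vertices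

module Searching where
  open IntegerSums
  open DistanceSchemes
  open BoseMesnerAlgebra
  open ParameterBounds
  open Reduction
  open Enumerations
  import Data.List.Relation.Unary.Any.Properties as Any
  open import Data.Bool using (_∧_)
  open import Data.List using (map; concatMap; filter; length; zip; drop)
  open import Data.List.Properties using (≡-dec)
  open import Data.List.Relation.Unary.All as All using (All; []; _∷_)
  open import Data.List.Relation.Unary.Any as Any using (Any)
  open import Relation.Nullary.Decidable using (map′)

  -- The distances from a vertex to a list of base vertices, latest first.
  Row : Set
  Row = List (Fin 4)

  nth : ∀ {A : Set} → A → ℕ → List A → A
  nth x _       []       = x
  nth x zero    (y ∷ ys) = y
  nth x (suc i) (y ∷ ys) = nth x i ys

  restrict : ∀ {A : Set} → Row → List A → List A
  restrict (1F ∷ p) (x ∷ xs) = x ∷ restrict p xs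
  restrict (_ ∷ p)  (x ∷ xs) = restrict p xs
  restrict _        _        = []

  select : ∀ {A : Set} → Fin 4 → Row → Fin 4 → Row → List A → List A
  select a (i ∷ p) b (j ∷ q) (x ∷ xs) =
    if does ((i Fin.≟ a) ×-dec (j Fin.≟ b)) then x ∷ select a p b q xs else select a p b q xs
  select _ _       _ _       _        = []

  -- `near` is the matrix of distances among the base vertices adjacent to the candidate; an
  -- adjacent triple in it completes a 4-clique.
  Clique : Row → List Row → Set
  Clique p rows = Any (λ r → Any (λ s → Any (_≡ 1F) (restrict r s)) (restrict r near)) near
    where
    near : List Row
    near = map (restrict p) (restrict p rows)

  clique? : ∀ p rows → Dec (Clique p rows)
  clique? p rows = Any.any? (λ r → Any.any? (λ s → Any.any? (Fin._≟ 1F) (restrict r s)) (restrict r _)) _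

  triangular : Fin 4 → Fin 4 → Fin 4 → Bool
  triangular 0F 0F 0F = true
  triangular 0F 1F 1F = true
  triangular 0F 2F 2F = true
  triangular 0F 3F 3F = true
  triangular 1F 0F 1F = true
  triangular 1F 1F 0F = true
  triangular 1F 1F 1F = true
  triangular 1F 1F 2F = true
  triangular 1F 2F 1F = true
  triangular 1F 2F 2F = true
  triangular 1F 2F 3F = true
  triangular 1F 3F 2F = true
  triangular 1F 3F 3F = true
  triangular 2F 0F 2F = true
  triangular 2F 1F 1F = true
  triangular 2F 1F 2F = true
  triangular 2F 1F 3F = true
  triangular 2F 2F _  = true
  triangular 2F 3F 1F = true
  triangular 2F 3F 2F = true
  triangular 2F 3F 3F = true
  triangular 3F 0F 3F = true
  triangular 3F 1F 2F = true
  triangular 3F 1F 3F = true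
  triangular 3F 2F 1F = true
  triangular 3F 2F 2F = true
  triangular 3F 2F 3F = true
  triangular 3F 3F _  = true
  triangular _  _  _  = false

  triangles : Fin 4 → Row → Row → Bool
  triangles v (i ∷ c) (j ∷ p) = triangular i j v ∧ triangles v c p
  triangles v _       _       = true

  -- A vertex of distance a from the i-th and b from the j-th base vertex, and different from all base vertices, is added;
  -- its distances to them must be forced.  The vector with the given coefficients is orthogonal to the earlier base
  -- vertices, and its norm times its weight is W, or both are zero.
  record Instruction : Set where
    constructor instruction
    field
      i      : ℕ
      a      : Fin 4
      j      : ℕ
      b      : Fin 4
      forced : Row
      weight : ℤ
      vector : List ℤ

  Basis : Set
  Basis = List (ℤ × List ℤ)

  -- The pool contains the distances that a vertex can have to the base vertices, together with the defect in
  -- Bessel's inequality.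
  record State : Set where
    constructor state
    field
      rows  : List Row
      basis : Basis
      pool  : List (Row × ℤ)

  module Search (u : Fin 4 → ℤ) (W : ℤ) (p : Fin 4 → Fin 4 → Fin 4 → ℕ)
    (Excluded : Row → List Row → Set) (excluded? : ∀ q rows → Dec (Excluded q rows)) where

    dot : List ℤ → Row → ℤ
    dot (+ 0 ∷ ms) (i ∷ is) = dot ms is
    dot (m ∷ ms)   (i ∷ is) = m * u i + dot ms is
    dot _          _        = 0ℤ

    -- W times the squared distance of t from the span of the base. As w‖v‖² = W, the term w⟨v, t⟩²
    -- is W times the squared length of the projection to v; vectors of weight 0 are null and
    -- contribute nothing.
    defect : Basis → Row → ℤ
    defect ((w , ms) ∷ B) (i ∷ is) = defect B is - w * (dot ms (i ∷ is) * dot ms (i ∷ is))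
    defect _              _        = W * u 0F

    skip : ∀ {w} → Dec (w ≡ 0ℤ) → ℤ → List ℤ → List ℤ
    skip (yes _) _ xs = xs
    skip (no _)  x xs = x ∷ xs

    coordinates : Basis → Row → List ℤ
    coordinates ((w , ms) ∷ B) (i ∷ is) = skip (w ℤ.≟ 0ℤ) (dot ms (i ∷ is)) (coordinates B is)
    coordinates _              _        = []

    inner : List ℤ → List ℤ → ℤ
    inner (x ∷ xs) (y ∷ ys) = x * y + inner xs ys
    inner _        _        = 0ℤ

    -- Paired with the coordinates of a second vertex, the result is W times the inner product of
    -- the projections to the span. Coordinates are stored for nonzero weights only, so weight 0
    -- consumes no entry.
    weigh : Basis → List ℤ → List ℤ
    weigh []            _  = []
    weigh ((w , _) ∷ B) xs = go (w ℤ.≟ 0ℤ) xs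
      where
      go : Dec (w ≡ 0ℤ) → List ℤ → List ℤ
      go (yes _) xs       = weigh B xs
      go (no _)  []       = []
      go (no _)  (x ∷ xs) = w * x ∷ weigh B xs

    rank : Basis → ℤ
    rank []            = 0ℤ
    rank ((w , _) ∷ B) = (if does (w ℤ.≟ 0ℤ) then 0ℤ else 1ℤ) + rank B

    lead : List ℤ → ℤ
    lead []      = 0ℤ
    lead (m ∷ _) = m

    -- A vector of weight 0 is a linear relation between vertices, so it must vanish on every row;
    -- the second condition is Bessel's inequality.
    Small : ℤ → ℤ → ℤ → Set
    Small w s r = (w ≡ 0ℤ → s ≡ 0ℤ) × 0ℤ ≤ r

    small? : ∀ w s r → Dec (Small w s r)
    small? w s r = ((w ℤ.≟ 0ℤ) →-dec (s ℤ.≟ 0ℤ)) ×-dec (0ℤ ℤ.≤? r)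

    extend₁ : Row → Row → Fin 4 → ℤ → ℤ → ℤ → List (Row × ℤ)
    extend₁ c q v w s r = if does (small? w s r) ∧ triangles v c q then (v ∷ q , r) ∷ [] else []

    extend₂ : Row → ℤ → ℤ → Row × ℤ → ℤ → Fin 4 → List (Row × ℤ)
    extend₂ c w m (q , r) t v = extend₁ c q v w (m * u v + t) (r - w * ((m * u v + t) * (m * u v + t)))

    extend₃ : Row → ℤ → ℤ → Row × ℤ → ℤ → List (Row × ℤ)
    extend₃ c w m e t = concatMap (extend₂ c w m e t) (0F ∷ 1F ∷ 2F ∷ 3F ∷ [])

    extend : Row → ℤ → List ℤ → List (Row × ℤ) → List (Row × ℤ)
    extend c w ms E = concatMap (λ e → extend₃ c w (lead ms) e (dot (drop 1 ms) (proj₁ e))) E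

    border : Row → List Row → List Row
    border (i ∷ c) (r ∷ rows) = (i ∷ r) ∷ border c rows
    border _       _          = []

    next : State → Instruction → State
    next (state rows basis pool) (instruction _ _ _ _ c w ms) =
      state ((0F ∷ c) ∷ border c rows) ((w , ms) ∷ basis) (extend c w ms pool)

    Matches : List Row → Instruction → Row → Set
    Matches rows (instruction i a j b _ _ _) q = nth 0F i q ≡ a × nth 0F j q ≡ b × All (_≢ 0F) q × ¬ Excluded q rows

    matches? : ∀ rows I q → Dec (Matches rows I q)
    matches? rows (instruction i a j b _ _ _) q =
      (nth 0F i q Fin.≟ a) ×-dec (nth 0F j q Fin.≟ b) ×-dec All.all? (λ k → ¬? (k Fin.≟ 0F)) q ×-dec ¬? (excluded? q rows)

    norm : List ℤ → Row → ℤ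
    norm []       c = 0ℤ
    norm (m ∷ ms) c = m * dot (m ∷ ms) (0F ∷ c)

    Normal : ℤ → ℤ → Set
    Normal w N = w * N ≡ W ⊎ (w ≡ 0ℤ × N ≡ 0ℤ)

    -- An intersection number larger than the number of base vertices in the prescribed position
    -- guarantees a new vertex there, and the pool leaves only one row for it.
    Admissible : State → Instruction → Set
    Admissible (state rows basis pool) I@(instruction i a j b c w ms) =
      i ℕ.< length rows × j ℕ.< length rows ×
      length (select a (nth [] i rows) b (nth [] j rows) rows) ℕ.< p (nth 0F j (nth [] i rows)) a b ×
      All (λ (q , _) → Matches rows I q → q ≡ c) pool ×
      All (λ r → dot ms r ≡ 0ℤ) (border c rows) × 
      Normal w (norm ms c)

    admissible? : ∀ s I → Dec (Admissible s I)
    admissible? (state rows basis pool) I@(instruction i a j b c w ms) =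
      (i ℕ.<? length rows) ×-dec (j ℕ.<? length rows) ×-dec
      (length (select a (nth [] i rows) b (nth [] j rows) rows) ℕ.<? p (nth 0F j (nth [] i rows)) a b) ×-dec
      All.all? (λ (q , _) → matches? rows I q →-dec ≡-dec Fin._≟_ q c) pool ×-dec
      All.all? (λ r → dot ms r ℤ.≟ 0ℤ) (border c rows) ×-dec
      ((w * norm ms c ℤ.≟ W) ⊎-dec ((w ℤ.≟ 0ℤ) ×-dec (norm ms c ℤ.≟ 0ℤ)))

    data Run (K : State → Set) : State → List Instruction → Set where
      stop : ∀ {s} → K s → Run K s []
      step : ∀ {s I Is} → Admissible s I → Run K (next s I) Is → Run K s (I ∷ Is)

    run? : ∀ {K} → (∀ s → Dec (K s)) → ∀ s Is → Dec (Run K s Is)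
    run? K? s []       = map′ stop (λ { (stop k) → k }) (K? s)
    run? K? s (I ∷ Is) = map′ (λ (a , r) → step a r) (λ { (step a r) → a , r }) (admissible? s I ×-dec run? K? (next s I) Is)

    start : ℤ → State
    start w = next (state [] [] (([] , W * u 0F) ∷ [])) (instruction 0 0F 0 0F [] w (1ℤ ∷ []))

    module Recognition {V : Set} (_≟_ : (v v′ : V) → Dec (v ≡ v′)) (_∼_ : V → V → Set) (_∼?_ : ∀ v v′ → Dec (v ∼ v′)) (N : ℕ) (table : List V) where

      Compatible : List ℤ → List ℤ → Set
      Compatible x y = Any (λ i → W * u i ≡ inner x y) (0F ∷ 1F ∷ 2F ∷ 3F ∷ [])

      compatible? : ∀ x y → Dec (Compatible x y)
      compatible? x y = go (inner x y)
        where
        go : ∀ e → Dec (Any (λ i → W * u i ≡ e) (0F ∷ 1F ∷ 2F ∷ 3F ∷ []))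
        go e = Any.any? (λ i → W * u i ℤ.≟ e) _

      degree : List (List ℤ) → List ℤ → ℕ
      degree S x = length (filter (compatible? x) S)

      tight : State → List (List ℤ)
      tight (state _ B pool) = map (coordinates B ∘ proj₁) (filter (λ e → proj₂ e ℤ.≟ 0ℤ) pool)

      -- Tight rows may belong to no vertex. A row of a vertex has admissible inner products with
      -- the rows of all N vertices, so this filter discards none of those.
      ample : Basis → List (List ℤ) → List (List ℤ)
      ample B S = filter (λ x → N ℕ.≤? degree S (weigh B x)) S

      Agree : ℤ → V → V → Set
      Agree e v v′ = (e ≡ W * u 1F → v ∼ v′) × (v ∼ v′ → e ≡ W * u 1F) × (v ≡ v′ → e ≡ W * u 0F)

      agree? : ∀ e v v′ → Dec (Agree e v v′)
      agree? e v v′ = ((e ℤ.≟ W * u 1F) →-dec (v ∼? v′)) ×-dec ((v ∼? v′) →-dec (e ℤ.≟ W * u 1F)) ×-dec ((v ≟ v′) →-dec (e ℤ.≟ W * u 0F))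

      AgreeAll : List (List ℤ × V) → List ℤ → V → Set
      AgreeAll Q x v = All (λ (y , v′) → Agree (inner x y) v v′) Q

      agreeAll? : ∀ Q x v → Dec (AgreeAll Q x v)
      agreeAll? Q x v = All.all? (λ (y , v′) → agree? (inner x y) v v′) Q

      -- The survivors are paired by position with an explicit list of vertices, which assigns a
      -- name to each of them because the lengths agree.
      Matched : Basis → List (List ℤ) → Set
      Matched B R = length R ≡ length table × All (λ (x , v) → AgreeAll (zip R table) (weigh B x) v) (zip R table)

      matched? : ∀ B R → Dec (Matched B R)
      matched? B R = (length R ℕ.≟ length table) ×-dec All.all? (λ (x , v) → agreeAll? (zip R table) (weigh B x) v) (zip R table)

      Recognised : ℤ → State → Set
      Recognised ρ s = rank (State.basis s) ≡ ρ × Matched (State.basis s) (ample (State.basis s) (tight s))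

      recognised? : ∀ ρ s → Dec (Recognised ρ s)
      recognised? ρ s = (rank (State.basis s) ℤ.≟ ρ) ×-dec matched? (State.basis s) (ample (State.basis s) (tight s))

-- Soundness of the search

module SearchSoundness where
  open IntegerSums
  open DistanceSchemes
  open BoseMesnerAlgebra
  open ParameterBounds
  open Reduction
  open Enumerations
  open Searching
  import Data.Bool.Properties as Bool
  import Data.List.Membership.DecPropositional as DecMembership
  import Data.List.Relation.Unary.All.Properties as All
  import Data.List.Relation.Unary.Any.Properties as Any
  open import Data.Bool using (_∧_)
  open import Data.List using (map; concatMap; filter; length; zip; drop; lookup)
  open import Data.List.Membership.Propositional using (_∈_; _∉_; lose; find)
  open import Data.List.Membership.Propositional.Properties using (∈-map⁺; ∈-concatMap⁺; ∈-filter⁺)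
  open import Data.List.Properties using (map-∘; length-map; map-cong)
  open import Data.List.Relation.Unary.All as All using (All; []; _∷_)
  open import Data.List.Relation.Unary.Any as Any using (Any; here; there)
  open import Relation.Nullary.Decidable using (dec-true)

  ∈-concatMap : ∀ {A B : Set} (f : A → List B) {xs x y} → x ∈ xs → y ∈ f x → y ∈ concatMap f xs
  ∈-concatMap f x∈xs y∈ = ∈-concatMap⁺ f (lose x∈xs y∈)

  distances : List (Fin 4)
  distances = 0F ∷ 1F ∷ 2F ∷ 3F ∷ []

  ∈-distances : ∀ i → i ∈ distances
  ∈-distances 0F = here refl
  ∈-distances 1F = there (here refl)
  ∈-distances 2F = there (there (here refl))
  ∈-distances 3F = there (there (there (here refl)))

  nth-map : ∀ {A B : Set} (f : A → B) x y i xs → i ℕ.< length xs → nth x i (map f xs) ≡ f (nth y i xs)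
  nth-map f x y zero    (z ∷ xs) _       = refl
  nth-map f x y (suc i) (z ∷ xs) (s≤s p) = nth-map f x y i xs p
  nth-map f x y i       []       ()

  length-select : ∀ {A B : Set} (f : A → B) a p b q xs → length (select a p b q (map f xs)) ≡ length (select a p b q xs)
  length-select f a []      b _       _        = refl
  length-select f a (i ∷ p) b []      _        = refl
  length-select f a (i ∷ p) b (j ∷ q) []       = refl
  length-select f a (i ∷ p) b (j ∷ q) (x ∷ xs) with does ((i Fin.≟ a) ×-dec (j Fin.≟ b))
  ... | true  = cong suc (length-select f a p b q xs)
  ... | false = length-select f a p b q xs

  zip-∈ : ∀ {A B : Set} {x : A} {xs : List A} {ys : List B} → length xs ≡ length ys → x ∈ xs → ∃[ y ] (x , y) ∈ zip xs ys
  zip-∈ {xs = x ∷ xs} {y ∷ ys} e (here refl) = y , here refl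
  zip-∈ {xs = x ∷ xs} {y ∷ ys} e (there p)   = let y′ , q = zip-∈ (ℕ.suc-injective e) p in y′ , there q

  restrict-map : ∀ {A B : Set} (f : A → B) p xs → restrict p (map f xs) ≡ map f (restrict p xs)
  restrict-map f []       xs       = refl
  restrict-map f (0F ∷ p) (x ∷ xs) = restrict-map f p xs
  restrict-map f (1F ∷ p) (x ∷ xs) = cong (f x ∷_) (restrict-map f p xs)
  restrict-map f (2F ∷ p) (x ∷ xs) = restrict-map f p xs
  restrict-map f (3F ∷ p) (x ∷ xs) = restrict-map f p xs
  restrict-map f (0F ∷ p) []       = refl
  restrict-map f (1F ∷ p) []       = refl
  restrict-map f (2F ∷ p) []       = refl
  restrict-map f (3F ∷ p) []       = refl

  module Profiles {n : ℕ} {π : Parameters} (S : Scheme n π) where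
    open Scheme S

    profile : List (Fin n) → Fin n → Row
    profile bs t = map (λ b → d b t) bs

    restrict-adjacent : ∀ t bs → All (λ b → d b t ≡ 1F) (restrict (profile bs t) bs)
    restrict-adjacent t []       = []
    restrict-adjacent t (b ∷ bs) = go (d b t) refl
      where
      go : ∀ i → d b t ≡ i → All (λ b → d b t ≡ 1F) (restrict (i ∷ profile bs t) (b ∷ bs))
      go 0F _ = restrict-adjacent t bs
      go 1F e = e ∷ restrict-adjacent t bs
      go 2F _ = restrict-adjacent t bs
      go 3F _ = restrict-adjacent t bs

    restrict-profiles : ∀ p bs cs → restrict p (map (profile bs) cs) ≡ map (profile bs) (restrict p cs)
    restrict-profiles p bs cs = restrict-map (profile bs) p cs

    ∈-restrict⁻ : ∀ {A : Set} {x : A} p xs → x ∈ restrict p xs → x ∈ xs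
    ∈-restrict⁻ (0F ∷ p) (x ∷ xs) q           = there (∈-restrict⁻ p xs q)
    ∈-restrict⁻ (1F ∷ p) (x ∷ xs) (here e)    = here e
    ∈-restrict⁻ (1F ∷ p) (x ∷ xs) (there q)   = there (∈-restrict⁻ p xs q)
    ∈-restrict⁻ (2F ∷ p) (x ∷ xs) q           = there (∈-restrict⁻ p xs q)
    ∈-restrict⁻ (3F ∷ p) (x ∷ xs) q           = there (∈-restrict⁻ p xs q)
    ∈-restrict⁻ []       xs       ()
    ∈-restrict⁻ (0F ∷ p) []       ()
    ∈-restrict⁻ (1F ∷ p) []       ()
    ∈-restrict⁻ (2F ∷ p) []       ()
    ∈-restrict⁻ (3F ∷ p) []       ()

    module _ (no-clique : ∀ {x y z t} → d x y ≡ 1F → d x z ≡ 1F → d x t ≡ 1F → d y z ≡ 1F → d y t ≡ 1F → d z t ≡ 1F → ⊥) where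

      clique-free : ∀ bs t → ¬ Clique (profile bs t) (map (profile bs) bs)
      clique-free bs t c = first (subst (λ M → Any (Step M) M) near-eq c)
        where
        Step : List Row → Row → Set
        Step M r = Any (λ s → Any (_≡ 1F) (restrict r s)) (restrict r M)
        nb : List (Fin n)
        nb = restrict (profile bs t) bs
        near-eq : map (restrict (profile bs t)) (restrict (profile bs t) (map (profile bs) bs)) ≡ map (profile nb) nb
        near-eq = trans (cong (map (restrict (profile bs t))) (restrict-profiles (profile bs t) bs bs))
          (trans (sym (map-∘ nb)) (map-cong (λ b → restrict-map (λ x → d x b) (profile bs t) bs) nb))
        first : Any (Step (map (profile nb) nb)) (map (profile nb) nb) → ⊥
        first any = let b , b∈nb , q = find (Any.map⁻ any) in second b b∈nb (subst (Any _) (restrict-profiles (profile nb b) nb nb) q)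
          where

          second : ∀ b → b ∈ nb → Any (λ s → Any (_≡ 1F) (restrict (profile nb b) s)) (map (profile nb) (restrict (profile nb b) nb)) → ⊥
          second b b∈nb any′ = let b′ , b′∈ , q = find (Any.map⁻ any′) in
              third b′ b′∈ (subst (Any (_≡ 1F)) (restrict-map (λ x → d x b′) (profile nb b) nb) q)
            where
            third : ∀ b′ → b′ ∈ restrict (profile nb b) nb → Any (_≡ 1F) (map (λ x → d x b′) (restrict (profile nb b) nb)) → ⊥
            third b′ b′∈ any″ =
              let b″ , b″∈ , b″b′ = find (Any.map⁻ any″)
                  to-t : ∀ {x} → x ∈ nb → d x t ≡ 1F
                  to-t = All.lookup (restrict-adjacent t bs)
                  to-b : ∀ {x} → x ∈ restrict (profile nb b) nb → d x b ≡ 1F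
                  to-b = All.lookup (restrict-adjacent b nb)
                  in-nb : ∀ {x} → x ∈ restrict (profile nb b) nb → x ∈ nb
                  in-nb = ∈-restrict⁻ (profile nb b) nb
              in no-clique b″b′ (to-b b″∈) (to-t (in-nb b″∈)) (to-b b′∈) (to-t (in-nb b′∈)) (to-t b∈nb)

  module Soundness {n : ℕ} {π : Parameters} (S : Scheme n π) (u : Fin 4 → ℤ) (κ : ℤ) (κ>0 : 0ℤ < κ)
    (idem : ∀ x y → sum (λ z → u (Scheme.d S x z) * u (Scheme.d S y z)) ≡ κ * u (Scheme.d S x y))
    (W : ℤ) (W>0 : 0ℤ < W) (p : Fin 4 → Fin 4 → Fin 4 → ℕ)
    (supply : ∀ h a b → 0 ℕ.< p h a b → ∀ {x y} → Scheme.d S x y ≡ h →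
      sum (λ z → δ a (Scheme.d S x z) * δ b (Scheme.d S y z)) ≡ + p h a b)
    (Excluded : Row → List Row → Set) (excluded? : ∀ q rows → Dec (Excluded q rows))
    (excluded : ∀ bs t → ¬ Excluded (Profiles.profile S bs t) (map (Profiles.profile S bs) bs)) where
    open Scheme S
    open Metric S
    open Counting S
    open Profiles S
    open Form S u
    open Positive κ κ>0 idem renaming (pairing to ●-pairing)
    open Search u W p Excluded excluded?

    dot-∷ : ∀ m ms i is → dot (m ∷ ms) (i ∷ is) ≡ m * u i + dot ms is
    dot-∷ (+ 0)      ms i is = sym (trans (cong (_+ dot ms is) (ℤ.*-zeroˡ (u i))) (ℤ.+-identityˡ (dot ms is)))
    dot-∷ (+ suc m)  ms i is = refl
    dot-∷ -[1+ m ]   ms i is = refl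

    dot-lead : ∀ ms i is → dot ms (i ∷ is) ≡ lead ms * u i + dot (drop 1 ms) is
    dot-lead []       i is = sym (trans (cong (_+ 0ℤ) (ℤ.*-zeroˡ (u i))) refl)
    dot-lead (m ∷ ms) i is = dot-∷ m ms i is

    vect : List ℤ → List (Fin n) → Vect
    vect (m ∷ ms) (b ∷ bs) = (m , b) ∷ vect ms bs
    vect _        _        = []

    dot-· : ∀ ms bs t → dot ms (profile bs t) ≡ vect ms bs · t
    dot-· []       bs       t = refl
    dot-· (+ 0 ∷ ms) []     t = refl
    dot-· (+ suc _ ∷ ms) [] t = refl
    dot-· (-[1+ _ ] ∷ ms) [] t = refl
    dot-· (m ∷ ms) (b ∷ bs) t = trans (dot-∷ m ms (d b t) (profile bs t)) (cong (_+_ (m * u (d b t))) (dot-· ms bs t))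

    Perpendicular : Vect → List (Fin n) → Set
    Perpendicular v = All (λ b → v · b ≡ 0ℤ)

    data Orthogonal : Basis → List (Fin n) → Set where
      []  : Orthogonal [] []
      cons : ∀ {B bs w ms b} → Perpendicular (vect ms (b ∷ bs)) bs → Normal w (vect ms (b ∷ bs) ● vect ms (b ∷ bs)) →
        Orthogonal B bs → Orthogonal ((w , ms) ∷ B) (b ∷ bs)

    -- W times the component of t orthogonal to the base, whose norm is W times `defect`.
    residual : Basis → List (Fin n) → Fin n → Vect
    residual ((w , ms) ∷ B) (b ∷ bs) t = scale (- (w * dot ms (profile (b ∷ bs) t))) (vect ms (b ∷ bs)) ++ residual B bs t
    residual _              _        t = (W , t) ∷ []

    perpendicular-● : ∀ {v bs} ms → Perpendicular v bs → v ● vect ms bs ≡ 0ℤ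
    perpendicular-● []       _ = refl
    perpendicular-● (m ∷ ms) [] = refl
    perpendicular-● {v} (m ∷ ms) (e ∷ es) = trans (cong₂ _+_ (trans (cong (m *_) e) (ℤ.*-zeroʳ m)) (perpendicular-● {v} ms es)) refl

    residual-perpendicular : ∀ {B bs} v t → Orthogonal B bs → Perpendicular v bs → v ● residual B bs t ≡ W * v · t
    residual-perpendicular v t [] [] = ℤ.+-identityʳ (W * v · t)
    residual-perpendicular {(w , ms) ∷ B} {b ∷ bs} v t (cons _ _ o) (e ∷ es) = trans (●-++ v (scale c (vect ms (b ∷ bs))) (residual B bs t))
        (trans (cong₂ _+_ (trans (●-scale v c (vect ms (b ∷ bs))) (trans (cong (c *_) (perpendicular-● {v} {b ∷ bs} ms (e ∷ es))) (ℤ.*-zeroʳ c)))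
          (residual-perpendicular v t o es)) (ℤ.+-identityˡ (W * v · t)))
      where
      c : ℤ
      c = - (w * dot ms (profile (b ∷ bs) t))

    -- The common consequence of both alternatives in `Normal`; it treats independent and null
    -- vectors uniformly in the norm.
    normal-square : ∀ {w N} → Normal w N → w * (w * N) ≡ w * W
    normal-square {w} (inj₁ e) = cong (w *_) e
    normal-square (inj₂ (refl , refl)) = refl

    residual-norm : ∀ {B bs} t → Orthogonal B bs → residual B bs t ● residual B bs t ≡ W * defect B (profile bs t)
    residual-norm t [] = trans (shape W (u (d t t))) (cong (λ i → W * (W * u i)) (d-refl t))
      where
      shape : ∀ w a → w * (w * a + 0ℤ) + 0ℤ ≡ w * (w * a)
      shape = solve-∀
    residual-norm {(w , ms) ∷ B} {b ∷ bs} t (cons perp norm o) =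
        final {s} {v · t} {D = defect B (profile bs t)} (dot-· ms (b ∷ bs) t) (●-++ X (scale c v) r) (●-scale X c v) (●-sym X v) (●-++ v (scale c v) r) (●-scale v c v)
          (residual-perpendicular v t o perp) (●-sym X r) (●-++ r (scale c v) r) (●-scale r c v) (●-sym r v) (residual-norm t o) (normal-square norm)
      where
      s : ℤ
      s = dot ms (profile (b ∷ bs) t)
      c : ℤ
      c = - (w * s)
      v r X : Vect
      v = vect ms (b ∷ bs)
      r = residual B bs t
      X = scale c v ++ r
      final : ∀ {s vt XX Xcv Xr Xv vX vcv vr vv rX rcv rr rv D} → s ≡ vt → XX ≡ Xcv + Xr → Xcv ≡ (- (w * s)) * Xv → Xv ≡ vX → vX ≡ vcv + vr →
        vcv ≡ (- (w * s)) * vv → vr ≡ W * vt → Xr ≡ rX → rX ≡ rcv + rr → rcv ≡ (- (w * s)) * rv → rv ≡ vr → rr ≡ W * D →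
        w * (w * vv) ≡ w * W → XX ≡ W * (D - w * (s * s))
      final {s} {vv = vv} {D = D} refl refl refl refl refl refl refl refl refl refl refl refl e =
        trans (shape w s vv W D) (trans (cong (λ x → s * s * x + (- (+ 2 * (w * (s * (W * s)))) + W * D)) e) (shape′ w s W D))
        where
        shape : ∀ w s N W D → (- (w * s)) * ((- (w * s)) * N + W * s) + ((- (w * s)) * (W * s) + W * D) ≡
          s * s * (w * (w * N)) + (- (+ 2 * (w * (s * (W * s)))) + W * D)
        shape = solve-∀
        shape′ : ∀ w s W D → s * s * (w * W) + (- (+ 2 * (w * (s * (W * s)))) + W * D) ≡ W * (D - w * (s * s))
        shape′ = solve-∀

    defect-nonneg : ∀ {B bs} t → Orthogonal B bs → 0ℤ ≤ defect B (profile bs t)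
    defect-nonneg {B} {bs} t o = cancel-positive-≤ W>0 (subst (0ℤ ≤_) (residual-norm t o) (nonneg (residual B bs t)))

    residual-· : ∀ {B bs} t z → Orthogonal B bs →
      residual B bs t · z ≡ W * u (d t z) - inner (weigh B (coordinates B (profile bs t))) (coordinates B (profile bs z))
    residual-· t z [] = shape (W * u (d t z))
      where
      shape : ∀ a → a + 0ℤ ≡ a - 0ℤ
      shape = solve-∀
    residual-· {(w , ms) ∷ B} {b ∷ bs} t z (cons perp norm o) = final {D = W * u (d t z)}
        (++-· (scale c v) r z) (scale-· c v z) (dot-· ms (b ∷ bs) z) (residual-· t z o)
      where
      s s′ : ℤ
      s  = dot ms (profile (b ∷ bs) t)
      s′ = dot ms (profile (b ∷ bs) z)
      c : ℤ
      c = - (w * s)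
      v r : Vect
      v = vect ms (b ∷ bs)
      r = residual B bs t
      x y : List ℤ
      x = coordinates B (profile bs t)
      y = coordinates B (profile bs z)
      weigh-skip : List ℤ → List ℤ
      weigh-skip = weigh ((w , ms) ∷ B)
      unskip : inner (weigh-skip (skip (w ℤ.≟ 0ℤ) s x)) (skip (w ℤ.≟ 0ℤ) s′ y) ≡ w * s * s′ + inner (weigh B x) y
      unskip = go (w ℤ.≟ 0ℤ) refl
        where
        go : ∀ q → q ≡ (w ℤ.≟ 0ℤ) → inner (weigh-skip (skip q s x)) (skip q s′ y) ≡ w * s * s′ + inner (weigh B x) y
        go q e with w ℤ.≟ 0ℤ
        go (yes refl) _ | yes _ = sym (ℤ.+-identityˡ (inner (weigh B x) y))
        go (no ne) _ | no _ = refl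
        go (yes e) _ | no ne = contradiction e ne
        go (no ne) _ | yes e = contradiction e ne
      final : ∀ {Xz cvz rz vz D} → Xz ≡ cvz + rz → cvz ≡ c * vz → s′ ≡ vz → rz ≡ D - inner (weigh B x) y →
        Xz ≡ D - inner (weigh-skip (skip (w ℤ.≟ 0ℤ) s x)) (skip (w ℤ.≟ 0ℤ) s′ y)
      final {D = D} refl refl refl refl = trans (shape w s s′ D (inner (weigh B x) y)) (cong (_-_ D) (sym unskip))
        where
        shape : ∀ w s t D i → (- (w * s)) * t + (D - i) ≡ D - (w * s * t + i)
        shape = solve-∀

    -- With defect 0 the residual is null, so t lies in the span of the base and its distance to
    -- every z is read off from coordinates.
    inner-formula : ∀ {B bs} t z → Orthogonal B bs → defect B (profile bs t) ≡ 0ℤ →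
      W * u (d t z) ≡ inner (weigh B (coordinates B (profile bs t))) (coordinates B (profile bs z))
    inner-formula {B} {bs} t z o e = ℤ.i-j≡0⇒i≡j (W * u (d t z)) (inner (weigh B (coordinates B (profile bs t))) (coordinates B (profile bs z))) (trans (sym (residual-· t z o))
      (null (residual B bs t) (trans (residual-norm t o) (trans (cong (W *_) e) (ℤ.*-zeroʳ W))) z))

    weight-unit : ∀ {w N} → Normal w N → w * N ≡ (if does (w ℤ.≟ 0ℤ) then 0ℤ else 1ℤ) * W
    weight-unit {w} {N} (inj₁ e) = go (w ℤ.≟ 0ℤ)
      where
      go : (w? : Dec (w ≡ 0ℤ)) → w * N ≡ (if does w? then 0ℤ else 1ℤ) * W
      go (yes refl) = ℤ.*-zeroˡ N
      go (no _)     = trans e (sym (ℤ.*-identityˡ W))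
    weight-unit (inj₂ (refl , refl)) = refl

    -- Summing ⟨v, t⟩² over all t gives κ‖v‖², so each nonzero weight lowers the total by κW.
    defect-sum : ∀ {B bs} → Orthogonal B bs → sum (λ t → defect B (profile bs t)) ≡ + n * (W * u 0F) - κ * (rank B * W)
    defect-sum [] = trans (sum-const n (W * u 0F)) (shape (+ n * (W * u 0F)) κ W)
      where
      shape : ∀ a k w → a ≡ a - k * (0ℤ * w)
      shape = solve-∀
    defect-sum {(w , ms) ∷ B} {b ∷ bs} (cons perp norm o) = trans (sum-combination
        ((1ℤ , λ t → defect B (profile bs t)) ∷ (- w , λ t → vect ms (b ∷ bs) · t * vect ms (b ∷ bs) · t) ∷ [])
        (λ t → trans (cong (λ s → defect B (profile bs t) - w * (s * s)) (dot-· ms (b ∷ bs) t)) (shape (defect B (profile bs t)) w (vect ms (b ∷ bs) · t))))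
      (final {ε = if does (w ℤ.≟ 0ℤ) then 0ℤ else 1ℤ} (defect-sum o) (●-pairing (vect ms (b ∷ bs)) (vect ms (b ∷ bs))) (weight-unit norm))
      where
      shape : ∀ D w s → D - w * (s * s) ≡ 1ℤ * D + (- w * (s * s) + 0ℤ)
      shape = solve-∀
      final : ∀ {P Q N ε} → P ≡ + n * (W * u 0F) - κ * (rank B * W) → Q ≡ κ * N → w * N ≡ ε * W →
        1ℤ * P + (- w * Q + 0ℤ) ≡ + n * (W * u 0F) - κ * ((ε + rank B) * W)
      final {N = N} {ε} refl refl e = trans (shape′ (+ n * (W * u 0F)) κ (rank B) W w N)
        (trans (cong (λ x → + n * (W * u 0F) - κ * (rank B * W) - κ * x) e) (shape″ (+ n * (W * u 0F)) κ (rank B) W ε))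
        where
        shape′ : ∀ A κ r W w N → 1ℤ * (A - κ * (r * W)) + (- w * (κ * N) + 0ℤ) ≡ A - κ * (r * W) - κ * (w * N)
        shape′ = solve-∀
        shape″ : ∀ A κ r W ε → A - κ * (r * W) - κ * (ε * W) ≡ A - κ * ((ε + r) * W)
        shape″ = solve-∀

    -- Links the computation to Γ: the base consists of actual vertices, and pruning the pool has
    -- not lost the row of any vertex.
    record Valid (bs : List (Fin n)) (s : State) : Set where
      open State s
      field
        rows-eq    : rows ≡ map (profile bs) bs
        orthogonal : Orthogonal basis bs
        complete   : ∀ t → (profile bs t , defect basis (profile bs t)) ∈ pool

    triangles-hold : ∀ t v bs → triangles (d t v) (profile bs t) (profile bs v) ≡ true
    triangles-hold t v []       = refl
    triangles-hold t v (b ∷ bs) = cong₂ _∧_ (table (d b t) (d b v) (d t v) (triangle b t v)) (triangles-hold t v bs)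
      where
      table : ∀ i j k → Triangle i j k → triangular i j k ≡ true
      table = finite₃ (λ i j k → Triangle? i j k →-dec (triangular i j k Bool.≟ true))

    border-profile : ∀ t bs xs → border (map (λ x → d x t) xs) (map (profile bs) xs) ≡ map (profile (t ∷ bs)) xs
    border-profile t bs []       = refl
    border-profile t bs (x ∷ xs) = cong₂ _∷_ (cong (_∷ profile bs x) (d-sym x t)) (border-profile t bs xs)

    self-norm : ∀ ms t bs → Perpendicular (vect ms (t ∷ bs)) bs → vect ms (t ∷ bs) ● vect ms (t ∷ bs) ≡ norm ms (profile bs t)
    self-norm []       t bs _ = refl
    self-norm (m ∷ ms) t bs perp = trans (cong₂ _+_ (cong (m *_) (trans (sym (dot-· (m ∷ ms) (t ∷ bs) t))
        (cong (λ i → dot (m ∷ ms) (i ∷ profile bs t)) (d-refl t)))) (perpendicular-● {vect (m ∷ ms) (t ∷ bs)} ms perp))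
      (ℤ.+-identityʳ (m * dot (m ∷ ms) (0F ∷ profile bs t)))

    extended : ∀ {bs s} t (I : Instruction) → Valid bs s → let open Instruction I in profile bs t ≡ forced →
      All (λ r → dot vector r ≡ 0ℤ) (border forced (State.rows s)) → Normal weight (norm vector forced) → Valid (t ∷ bs) (next s I)
    extended {bs} {state rows B pool} t (instruction i a j b .(profile bs t) w ms) valid refl zeros normal = record
      { rows-eq = cong₂ _∷_ (cong (_∷ profile bs t) (sym (d-refl t))) border-eq
      ; orthogonal = cons perp (subst (Normal w) (sym (self-norm ms t bs perp)) normal) orthogonal
      ; complete = complete′ }
      where
      open Valid valid
      border-eq : border (profile bs t) rows ≡ map (profile (t ∷ bs)) bs
      border-eq = trans (cong (border (profile bs t)) rows-eq) (border-profile t bs bs)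
      perp : Perpendicular (vect ms (t ∷ bs)) bs
      perp = All.map (λ {x} e → trans (sym (dot-· ms (t ∷ bs) x)) e)
        (All.map⁻ (subst (All (λ r → dot ms r ≡ 0ℤ)) border-eq zeros))
      orthogonal′ : Orthogonal ((w , ms) ∷ B) (t ∷ bs)
      orthogonal′ = cons perp (subst (Normal w) (sym (self-norm ms t bs perp)) normal) orthogonal
      complete′ : ∀ z → (profile (t ∷ bs) z , defect ((w , ms) ∷ B) (profile (t ∷ bs) z)) ∈ extend (profile bs t) w ms pool
      complete′ z = ∈-concatMap (λ e → extend₃ (profile bs t) w (lead ms) e (dot (drop 1 ms) (proj₁ e))) (complete z)
          (∈-concatMap (extend₂ (profile bs t) w (lead ms) (profile bs z , defect B (profile bs z)) (dot (drop 1 ms) (profile bs z)))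
            (∈-distances (d t z))
            (survive (lead ms * u (d t z) + dot (drop 1 ms) (profile bs z)) (dot-lead ms (d t z) (profile bs z))))
        where
        D : ℤ
        D = defect B (profile bs z)
        s : ℤ
        s = dot ms (d t z ∷ profile bs z)
        small : Small w s (D - w * (s * s))
        small = null-case normal , defect-nonneg z orthogonal′
          where
          null-case : Normal w (norm ms (profile bs t)) → w ≡ 0ℤ → s ≡ 0ℤ
          null-case (inj₁ e) w≡0 = contradiction (subst (0ℤ <_) (trans (sym e) (trans (cong (_* norm ms (profile bs t)) w≡0) (ℤ.*-zeroˡ (norm ms (profile bs t))))) W>0) (ℤ.<-irrefl refl)
          null-case (inj₂ (_ , e)) _ = trans (dot-· ms (t ∷ bs) z) (null (vect ms (t ∷ bs)) (trans (self-norm ms t bs perp) e) z)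
        entry : ℤ → Row × ℤ
        entry s = d t z ∷ profile bs z , D - w * (s * s)
        survive : ∀ s′ → s ≡ s′ → entry s ∈ extend₁ (profile bs t) (profile bs z) (d t z) w s′ (D - w * (s′ * s′))
        survive _ refl = subst (λ c → entry s ∈ (if c then entry s ∷ [] else []))
          (sym (cong₂ _∧_ (dec-true (small? w s (D - w * (s * s))) small) (triangles-hold t z bs))) (here refl)

    select-∈ : ∀ {a b x y bs z} → z ∈ bs → d z x ≡ a → d z y ≡ b → z ∈ select a (profile bs x) b (profile bs y) bs
    select-∈ {a} {b} {x} {y} {c ∷ bs} {z} z∈ p q = go z∈ ((d c x Fin.≟ a) ×-dec (d c y Fin.≟ b))
      where
      go : z ∈ c ∷ bs → (P? : Dec (d c x ≡ a × d c y ≡ b)) →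
        z ∈ (if does P? then c ∷ select a (profile bs x) b (profile bs y) bs else select a (profile bs x) b (profile bs y) bs)
      go (here refl) (yes _) = here refl
      go (here refl) (no ¬P) = contradiction (p , q) ¬P
      go (there z∈) (yes _) = there (select-∈ z∈ p q)
      go (there z∈) (no _)  = select-∈ z∈ p q

    fresh : ∀ {m P χ} (N : Enumeration {n} m P χ) (known bs : List (Fin n)) → length known ℕ.< m → (∀ {z} → z ∈ bs → P z → z ∈ known) →
      ∃[ z ] P z × z ∉ bs
    fresh {m} {P} N known bs few covers = go (Fin.any? (λ i → ¬? (Enumeration.at N i ∈? bs)))
      where
      open DecMembership (Fin._≟_ {n}) using (_∈?_)
      open Enumeration N
      go : Dec (∃[ i ] ¬ at i ∈ bs) → ∃[ z ] P z × z ∉ bs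
      go (yes (i , at∉)) = at i , holds i , at∉
      go (no none) = contradiction (Fin.injective⇒≤ {f = λ i → Any.index (found i)} inj) (ℕ.<⇒≱ few)
        where
        found : ∀ i → at i ∈ known
        found i = covers (member (at i ∈? bs)) (holds i)
          where
          member : Dec (at i ∈ bs) → at i ∈ bs
          member (yes q) = q
          member (no q)  = contradiction (i , q) none
        inj : ∀ {i j} → Any.index (found i) ≡ Any.index (found j) → i ≡ j
        inj {i} {j} e = injective (trans (Any.lookup-index (found i)) (trans (cong (lookup known) e) (sym (Any.lookup-index (found j)))))

    nonzero : ∀ {bs t} → t ∉ bs → All (_≢ 0F) (profile bs t)
    nonzero {[]}     _   = []
    nonzero {b ∷ bs} t∉ = (λ e → t∉ (here (sym (d-zero e)))) ∷ nonzero (t∉ ∘ there)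

    -- A new vertex exists by pigeonhole, since more vertices have the two prescribed distances than
    -- the base contains. Its row is in the pool and matches the instruction, so it is the forced
    -- one.
    advance : ∀ {bs s} I → Valid bs s → Admissible s I → ∃[ t ] Valid (t ∷ bs) (next s I)
    advance {bs} {state rows B pool} I@(instruction i a j b c w ms) valid (i< , j< , few , forced , zeros , normal) =
        let t , (xt , yt) , t∉ = new in t , extended t I valid (is-forced t xt yt t∉) zeros normal
      where
      open Valid valid
      x y : Fin n
      x = nth (proj₁ far) i bs
      y = nth (proj₁ far) j bs
      length-rows : length rows ≡ length bs
      length-rows = trans (cong length rows-eq) (length-map (profile bs) bs)
      row-x : nth [] i rows ≡ profile bs x
      row-x = trans (cong (nth [] i) rows-eq) (nth-map (profile bs) [] _ i bs (subst (i ℕ.<_) length-rows i<))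
      row-y : nth [] j rows ≡ profile bs y
      row-y = trans (cong (nth [] j) rows-eq) (nth-map (profile bs) [] _ j bs (subst (j ℕ.<_) length-rows j<))
      h : Fin 4
      h = nth 0F j (nth [] i rows)
      h-eq : d x y ≡ h
      h-eq = trans (d-sym x y) (sym (trans (cong (nth 0F j) row-x) (nth-map (λ b → d b x) 0F _ j bs (subst (j ℕ.<_) length-rows j<))))
      known : List (Fin n)
      known = select a (profile bs x) b (profile bs y) bs
      few′ : length known ℕ.< p h a b
      few′ = subst (ℕ._< p h a b) (trans (cong length (trans (cong₂ (λ q r → select a q b r rows) row-x row-y)
        (cong (select a (profile bs x) b (profile bs y)) rows-eq))) (length-select (profile bs) a (profile bs x) b (profile bs y) bs)) few
      new : ∃[ t ] Joint a b x y t × t ∉ bs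
      new = fresh (joint a b x y (supply h a b (ℕ.≤-<-trans z≤n few′) h-eq)) known bs few′
        (λ {z} z∈ (xz , yz) → select-∈ z∈ (trans (d-sym z x) xz) (trans (d-sym z y) yz))
      is-forced : ∀ t → d x t ≡ a → d y t ≡ b → t ∉ bs → profile bs t ≡ c
      is-forced t xt yt t∉ = All.lookup {P = λ (q , _) → Matches rows I q → q ≡ c} forced (complete t)
        ( trans (nth-map (λ b → d b t) 0F _ i bs (subst (i ℕ.<_) length-rows i<)) xt
        , trans (nth-map (λ b → d b t) 0F _ j bs (subst (j ℕ.<_) length-rows j<)) yt
        , nonzero t∉ , λ ex → excluded bs t (subst (Excluded (profile bs t)) rows-eq ex))

    run : ∀ {K bs s Is} → Valid bs s → Run K s Is → ∃[ bs′ ] ∃[ s′ ] Valid bs′ s′ × K s′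
    run valid (stop k)                = _ , _ , valid , k
    run valid (step {I = I} ok rest) = let t , valid′ = advance I valid ok in run valid′ rest

    started : ∀ {w} → w * u 0F ≡ W → Valid (proj₁ far ∷ []) (start w)
    started {w} e = extended {[]} {state [] [] (([] , W * u 0F) ∷ [])} (proj₁ far) (instruction 0 0F 0 0F [] w (1ℤ ∷ [])) record
      { rows-eq = refl ; orthogonal = [] ; complete = λ _ → here refl } refl [] (inj₁ (trans (shape w (u 0F)) e))
      where
      shape : ∀ w a → w * (1ℤ * (1ℤ * a + 0ℤ)) ≡ w * a
      shape = solve-∀

    module _ {V : Set} (_≟_ : (v v′ : V) → Dec (v ≡ v′)) (_∼_ : V → V → Set) (_∼?_ : ∀ v v′ → Dec (v ∼ v′)) (N : ℕ) (table : List V)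
      (order : n ≡ N) (peak : ∀ i → u i ≡ u 0F → i ≡ 0F) (unit : ∀ i → u i ≡ u 1F → i ≡ 1F) where
      open Recognition _≟_ _∼_ _∼?_ N table

      W-cancel : ∀ {a b} → W * a ≡ W * b → a ≡ b
      W-cancel = cancel-positive-≡ W>0

      -- By the trace of the projection, Bessel's inequality is tight once the rank is full.
      recognise : ∀ {ρ bs s} → + N * u 0F ≡ κ * ρ → Valid bs s → Recognised ρ s →
        ∃[ f ] (∀ {x y} → f x ≡ f y → x ≡ y) × (∀ x y → d x y ≡ 1F ⇔ f x ∼ f y)
      recognise {ρ} {bs} {state rows B pool} dimension valid (rank-eq , lengths , agree) = f , f-injective , λ x y → mk⇔
          (λ e → proj₁ (agrees x y) (trans (sym (formula x y)) (cong (λ i → W * u i) e)))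
          (λ e → unit (d x y) (W-cancel (trans (formula x y) (proj₁ (proj₂ (agrees x y)) e))))
        where
        open Valid valid
        c : Fin n → List ℤ
        c t = coordinates B (profile bs t)
        defect-zero : ∀ t → defect B (profile bs t) ≡ 0ℤ
        defect-zero = sum-nonneg-zero (λ t → defect B (profile bs t)) (λ t → defect-nonneg t orthogonal)
          (trans (defect-sum orthogonal) (final rank-eq (trans (cong (λ m → + m * u 0F) order) dimension)))
          where
          final : ∀ {r} → r ≡ ρ → + n * u 0F ≡ κ * ρ → + n * (W * u 0F) - κ * (r * W) ≡ 0ℤ
          final refl e = trans (shape (+ n) W (u 0F) κ ρ) (trans (cong (λ x → W * (x - κ * ρ)) e) (shape′ W (κ * ρ)))
            where
            shape : ∀ n W u κ ρ → n * (W * u) - κ * (ρ * W) ≡ W * (n * u - κ * ρ)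
            shape = solve-∀
            shape′ : ∀ W x → W * (x - x) ≡ 0ℤ
            shape′ = solve-∀
        formula : ∀ x y → W * u (d x y) ≡ inner (weigh B (c x)) (c y)
        formula x y = inner-formula x y orthogonal (defect-zero x)
        c-injective : ∀ {x y} → c x ≡ c y → x ≡ y
        c-injective {x} {y} e = d-zero (peak (d x y) (W-cancel (trans (formula x y)
          (trans (cong (inner (weigh B (c x))) (sym e)) (trans (sym (formula x x)) (cong (λ i → W * u i) (d-refl x)))))))
        S′ : List (List ℤ)
        S′ = tight (state rows B pool)
        in-tight : ∀ t → c t ∈ S′
        in-tight t = ∈-map⁺ (coordinates B ∘ proj₁) (∈-filter⁺ (λ e → proj₂ e ℤ.≟ 0ℤ) (complete t) (defect-zero t))
        neighbours-of : ∀ t z → c z ∈ filter (compatible? (weigh B (c t))) S′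
        neighbours-of t z = ∈-filter⁺ (compatible? (weigh B (c t))) (in-tight z) (lose (∈-distances (d t z)) (formula t z))
        R : List (List ℤ)
        R = ample B S′
        -- The n different coordinate vectors of vertices are all compatible with the one of t, so
        -- its degree is at least n.
        in-ample : ∀ t → c t ∈ R
        in-ample t = ∈-filter⁺ (λ x → N ℕ.≤? degree S′ (weigh B x)) (in-tight t)
          (subst (ℕ._≤ degree S′ (weigh B (c t))) order (Fin.injective⇒≤ {f = λ z → Any.index (neighbours-of t z)} inj))
          where
          inj : ∀ {y z} → Any.index (neighbours-of t y) ≡ Any.index (neighbours-of t z) → y ≡ z
          inj {y} {z} e = c-injective (trans (Any.lookup-index (neighbours-of t y))
            (trans (cong (lookup (filter (compatible? (weigh B (c t))) S′)) e) (sym (Any.lookup-index (neighbours-of t z)))))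
        named : ∀ t → ∃[ v ] (c t , v) ∈ zip R table
        named t = zip-∈ lengths (in-ample t)
        f : Fin n → V
        f t = proj₁ (named t)
        agrees : ∀ x y → Agree (inner (weigh B (c x)) (c y)) (f x) (f y)
        agrees x y = All.lookup {P = λ (y , v′) → Agree (inner (weigh B (c x)) y) (f x) v′}
          (All.lookup {P = λ (x , v) → AgreeAll (zip R table) (weigh B x) v} agree (proj₂ (named x))) (proj₂ (named y))
        f-injective : ∀ {x y} → f x ≡ f y → x ≡ y
        f-injective {x} {y} e = d-zero (peak (d x y) (W-cancel (trans (formula x y) (proj₂ (proj₂ (agrees x y)) e))))

-- Data of the search for the Doro graph

module DoroSearch where
  open IntegerSums
  open DistanceSchemes
  open BoseMesnerAlgebra
  open ParameterBounds
  open Reduction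
  open Enumerations
  open Searching
  open SearchSoundness
  import Data.List
  import Data.List.Relation.Unary.Any.Properties as Any
  import Data.Vec.Properties as Vec
  open import Data.List using (map; concatMap)
  open import Data.List.Membership.Propositional using (_∈_)
  open import Data.List.Relation.Unary.Any as Any using (Any)
  open import Data.Nat using (_%_)
  open import Data.Nat.DivMod using (_mod_)
  open import Data.Vec using (Vec; []; _∷_)
  open import Defs using (B; leading; DoroVertex)
  open import Relation.Nullary.Decidable using (map′)

  module DoroData where

    -- Eigenfunction of θ₁ = 5 with κ = 20. The dimension 65·4/20 = 13 is the rank that the search
    -- must reach.
    u : Fin 4 → ℤ
    u 0F = + 4
    u 1F = + 2
    u 2F = 0ℤ
    u 3F = - (+ 1)

    -- The numbers of vertices at distances a and b from two vertices at distance h, for the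
    -- positions used by the instructions. The default 0 supplies no vertex, so it asserts nothing.
    p : Fin 4 → Fin 4 → Fin 4 → ℕ
    p 0F 1F 1F = 10
    p 1F 1F 1F = 3
    p 1F 1F 2F = 6
    p 2F 1F 1F = 2
    p 2F 2F 1F = 4
    p 2F 3F 1F = 4
    p _  _  _  = 0

    -- Twenty vertices after the initial one. The norms of the 13 vectors of nonzero weight,
    -- counting the initial one, divide W = 54600. A vertex of weight 0 lies in the span of the
    -- earlier ones: it does not raise the rank, but rows that violate its linear relation leave the
    -- pool.
    instructions : List Instruction
    instructions =
      instruction 0 1F 0 1F (1F ∷ []) (+ 4550)
        (+ 2 ∷ - (+ 1) ∷ []) ∷
      instruction 1 1F 0 2F (2F ∷ 1F ∷ []) (+ 2275)
        (+ 3 ∷ + 1 ∷ - (+ 2) ∷ []) ∷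
      instruction 1 3F 0 1F (1F ∷ 3F ∷ 2F ∷ []) (+ 325)
        (+ 8 ∷ - (+ 5) ∷ + 1 ∷ + 2 ∷ []) ∷
      instruction 2 1F 1 1F (2F ∷ 1F ∷ 1F ∷ 1F ∷ []) (+ 65)
        (+ 21 ∷ + 4 ∷ - (+ 13) ∷ - (+ 10) ∷ + 1 ∷ []) ∷
      instruction 4 1F 1 1F (2F ∷ 1F ∷ 1F ∷ 2F ∷ 1F ∷ []) (+ 1365)
        (+ 5 ∷ + 2 ∷ - (+ 2) ∷ - (+ 1) ∷ + 0 ∷ - (+ 3) ∷ []) ∷
      instruction 2 1F 1 1F (2F ∷ 1F ∷ 1F ∷ 1F ∷ 2F ∷ 2F ∷ []) (+ 2275)
        (+ 4 ∷ + 1 ∷ - (+ 2) ∷ - (+ 2) ∷ - (+ 1) ∷ + 0 ∷ + 1 ∷ []) ∷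
      instruction 4 1F 0 1F (1F ∷ 2F ∷ 2F ∷ 2F ∷ 1F ∷ 3F ∷ 2F ∷ []) (+ 0)
        (+ 1 ∷ - (+ 1) ∷ + 0 ∷ + 1 ∷ + 1 ∷ - (+ 1) ∷ + 0 ∷ + 0 ∷ []) ∷
      instruction 5 1F 4 1F (2F ∷ 2F ∷ 2F ∷ 2F ∷ 1F ∷ 1F ∷ 3F ∷ 2F ∷ []) (+ 0)
        (+ 1 ∷ + 0 ∷ + 1 ∷ + 1 ∷ + 0 ∷ - (+ 1) ∷ - (+ 1) ∷ + 0 ∷ + 0 ∷ []) ∷
      instruction 7 1F 3 1F (3F ∷ 3F ∷ 3F ∷ 1F ∷ 2F ∷ 2F ∷ 2F ∷ 1F ∷ 1F ∷ []) (+ 2275)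
        (+ 4 ∷ + 0 ∷ + 0 ∷ + 0 ∷ - (+ 2) ∷ + 1 ∷ + 0 ∷ + 1 ∷ - (+ 2) ∷ - (+ 1) ∷ []) ∷
      instruction 6 1F 0 1F (1F ∷ 2F ∷ 3F ∷ 2F ∷ 1F ∷ 3F ∷ 1F ∷ 2F ∷ 2F ∷ 2F ∷ []) (+ 2275)
        (+ 4 ∷ - (+ 2) ∷ + 0 ∷ + 0 ∷ + 0 ∷ - (+ 1) ∷ + 0 ∷ - (+ 2) ∷ + 1 ∷ + 0 ∷ + 1 ∷ []) ∷
      instruction 10 1F 6 1F (3F ∷ 2F ∷ 3F ∷ 3F ∷ 2F ∷ 2F ∷ 1F ∷ 3F ∷ 2F ∷ 2F ∷ 1F ∷ []) (+ 0)
        (+ 1 ∷ + 0 ∷ + 0 ∷ + 0 ∷ + 0 ∷ + 0 ∷ + 0 ∷ - (+ 1) ∷ + 0 ∷ + 1 ∷ + 1 ∷ - (+ 1) ∷ []) ∷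
      instruction 10 1F 1 1F (3F ∷ 1F ∷ 1F ∷ 3F ∷ 3F ∷ 2F ∷ 2F ∷ 2F ∷ 2F ∷ 3F ∷ 1F ∷ 2F ∷ []) (+ 65)
        (+ 24 ∷ + 0 ∷ - (+ 12) ∷ - (+ 6) ∷ + 0 ∷ + 0 ∷ - (+ 4) ∷ + 5 ∷ + 2 ∷ + 2 ∷ + 1 ∷ - (+ 12) ∷ + 5 ∷ []) ∷
      instruction 7 1F 3 1F (2F ∷ 3F ∷ 2F ∷ 1F ∷ 3F ∷ 2F ∷ 3F ∷ 1F ∷ 3F ∷ 2F ∷ 2F ∷ 2F ∷ 2F ∷ []) (+ 0)
        (+ 1 ∷ + 0 ∷ + 0 ∷ + 1 ∷ - (+ 1) ∷ + 0 ∷ + 0 ∷ + 0 ∷ - (+ 1) ∷ + 0 ∷ + 0 ∷ + 0 ∷ + 0 ∷ + 1 ∷ []) ∷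
      instruction 10 1F 1 1F (3F ∷ 1F ∷ 3F ∷ 1F ∷ 2F ∷ 2F ∷ 2F ∷ 1F ∷ 2F ∷ 2F ∷ 1F ∷ 2F ∷ 2F ∷ 3F ∷ []) (+ 26)
        (+ 42 ∷ + 0 ∷ - (+ 18) ∷ + 0 ∷ - (+ 12) ∷ + 8 ∷ + 0 ∷ + 0 ∷ - (+ 18) ∷ + 5 ∷ + 2 ∷ - (+ 12) ∷ + 8 ∷ + 2 ∷ - (+ 2) ∷ []) ∷
      instruction 10 1F 0 1F (1F ∷ 3F ∷ 1F ∷ 2F ∷ 2F ∷ 2F ∷ 3F ∷ 2F ∷ 1F ∷ 3F ∷ 1F ∷ 2F ∷ 2F ∷ 1F ∷ 2F ∷ []) (+ 14)
        (+ 60 ∷ - (+ 18) ∷ + 0 ∷ - (+ 18) ∷ + 0 ∷ + 8 ∷ + 8 ∷ + 0 ∷ + 0 ∷ - (+ 18) ∷ - (+ 5) ∷ - (+ 18) ∷ + 8 ∷ + 8 ∷ - (+ 18) ∷ + 8 ∷ []) ∷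
      instruction 3 1F 1 1F (2F ∷ 1F ∷ 2F ∷ 1F ∷ 3F ∷ 2F ∷ 2F ∷ 2F ∷ 2F ∷ 2F ∷ 3F ∷ 3F ∷ 2F ∷ 3F ∷ 2F ∷ 3F ∷ []) (+ 0)
        (+ 1 ∷ + 1 ∷ - (+ 1) ∷ + 0 ∷ - (+ 1) ∷ + 0 ∷ + 1 ∷ + 0 ∷ + 0 ∷ + 0 ∷ + 0 ∷ + 0 ∷ + 0 ∷ + 0 ∷ + 0 ∷ + 0 ∷ + 0 ∷ []) ∷
      instruction 7 1F 4 1F (1F ∷ 2F ∷ 2F ∷ 1F ∷ 1F ∷ 2F ∷ 2F ∷ 1F ∷ 3F ∷ 2F ∷ 3F ∷ 2F ∷ 3F ∷ 3F ∷ 3F ∷ 2F ∷ 2F ∷ []) (+ 0)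
        (+ 1 ∷ + 0 ∷ + 0 ∷ + 0 ∷ + 0 ∷ - (+ 1) ∷ + 0 ∷ + 1 ∷ - (+ 1) ∷ + 0 ∷ + 0 ∷ + 0 ∷ + 0 ∷ + 0 ∷ + 0 ∷ + 0 ∷ + 1 ∷ + 0 ∷ []) ∷
      instruction 14 1F 3 1F (2F ∷ 1F ∷ 2F ∷ 1F ∷ 2F ∷ 2F ∷ 3F ∷ 2F ∷ 3F ∷ 1F ∷ 3F ∷ 2F ∷ 2F ∷ 3F ∷ 1F ∷ 2F ∷ 3F ∷ 3F ∷ []) (+ 0)
        (+ 1 ∷ + 0 ∷ + 0 ∷ + 0 ∷ - (+ 1) ∷ + 0 ∷ + 0 ∷ + 0 ∷ + 1 ∷ + 0 ∷ + 0 ∷ + 0 ∷ + 1 ∷ + 0 ∷ + 0 ∷ - (+ 1) ∷ + 0 ∷ + 0 ∷ + 0 ∷ []) ∷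
      instruction 16 2F 4 1F (2F ∷ 2F ∷ 1F ∷ 2F ∷ 1F ∷ 3F ∷ 2F ∷ 2F ∷ 2F ∷ 3F ∷ 3F ∷ 1F ∷ 1F ∷ 3F ∷ 2F ∷ 2F ∷ 2F ∷ 3F ∷ 3F ∷ []) (+ 0)
        (+ 1 ∷ + 0 ∷ + 0 ∷ + 0 ∷ + 1 ∷ - (+ 1) ∷ + 0 ∷ + 0 ∷ + 0 ∷ + 0 ∷ + 0 ∷ + 0 ∷ + 0 ∷ - (+ 1) ∷ + 0 ∷ + 0 ∷ + 1 ∷ + 0 ∷ + 0 ∷ + 0 ∷ []) ∷
      instruction 6 1F 3 1F (2F ∷ 1F ∷ 1F ∷ 1F ∷ 3F ∷ 2F ∷ 1F ∷ 2F ∷ 2F ∷ 3F ∷ 2F ∷ 2F ∷ 3F ∷ 3F ∷ 2F ∷ 3F ∷ 2F ∷ 3F ∷ 3F ∷ 3F ∷ []) (+ 420)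
        (+ 13 ∷ + 0 ∷ + 0 ∷ + 0 ∷ + 0 ∷ + 6 ∷ - (+ 7) ∷ + 0 ∷ - (+ 7) ∷ + 0 ∷ + 19 ∷ - (+ 7) ∷ + 0 ∷ + 0 ∷ + 6 ∷ - (+ 7) ∷ - (+ 7) ∷ - (+ 7) ∷ + 6 ∷ + 6 ∷ + 6 ∷ []) ∷ []

    -- The 65 vertices in base 5, in the order of the survivors of the search, with which `Matched`
    -- compares them by position.
    vectors : List (Vec (Fin 5) 4)
    vectors = map (λ m → m ℕ./ 125 mod 5 ∷ m ℕ./ 25 mod 5 ∷ m ℕ./ 5 mod 5 ∷ m mod 5 ∷ []) (
      5 ∷ 25 ∷ 125 ∷ 128 ∷ 127 ∷ 27 ∷ 229 ∷ 151 ∷ 226 ∷ 28 ∷ 154 ∷ 8 ∷ 7 ∷ 134 ∷ 149 ∷ 146 ∷ 131 ∷ 46 ∷ 31 ∷ 214 ∷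
      49 ∷ 219 ∷ 186 ∷ 34 ∷ 191 ∷ 194 ∷ 216 ∷ 189 ∷ 211 ∷ 182 ∷ 208 ∷ 197 ∷ 223 ∷ 160 ∷ 165 ∷ 235 ∷ 240 ∷ 183 ∷ 198 ∷ 222 ∷
      207 ∷ 242 ∷ 163 ∷ 168 ∷ 237 ∷ 162 ∷ 238 ∷ 180 ∷ 195 ∷ 220 ∷ 167 ∷ 243 ∷ 205 ∷ 215 ∷ 248 ∷ 172 ∷ 185 ∷ 190 ∷ 210 ∷ 233 ∷
      157 ∷ 158 ∷ 173 ∷ 247 ∷ 232 ∷ []
      )

    _≟ⱽ_ : (v w : Vec (Fin 5) 4) → Dec (v ≡ w)
    _≟ⱽ_ = Vec.≡-dec Fin._≟_

    vertex-≡ : {v w : DoroVertex} → proj₁ v ≡ proj₁ w → v ≡ w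
    vertex-≡ {v , p , q} {.v , p′ , q′} refl = cong₂ (λ p q → v , p , q) (ℕ.≡-irrelevant p p′) (ℕ.≡-irrelevant q q′)

    _≟_ : (v w : DoroVertex) → Dec (v ≡ w)
    v ≟ w = map′ vertex-≡ (cong proj₁) (proj₁ v ≟ⱽ proj₁ w)

    vertices : List DoroVertex
    vertices = concatMap (λ v → vertex v ((leading v ℕ.≟ 1) ×-dec ((B v v ℕ.* B v v) % 5 ℕ.≟ 1))) vectors
      where
      vertex : ∀ v → Dec (leading v ≡ 1 × (B v v ℕ.* B v v) % 5 ≡ 1) → List DoroVertex
      vertex v (yes p) = (v , p) ∷ []
      vertex v (no _)  = []

    listed : ∀ a b c d → let v = a ∷ b ∷ c ∷ d ∷ [] in leading v ≡ 1 → (B v v ℕ.* B v v) % 5 ≡ 1 → v ∈ vectors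
    listed = toWitness {a? = Fin.all? λ a → Fin.all? λ b → Fin.all? λ c → Fin.all? λ d → let v = a ∷ b ∷ c ∷ d ∷ [] in
      (leading v ℕ.≟ 1) →-dec ((B v v ℕ.* B v v) % 5 ℕ.≟ 1) →-dec Any.any? (v ≟ⱽ_) vectors} _

    position : (v : DoroVertex) → proj₁ v ∈ vectors
    position (a ∷ b ∷ c ∷ d ∷ [] , p , q) = listed a b c d p q

    rank : DoroVertex → Fin 65
    rank v = Any.index (position v)

    rank-injective : ∀ {v w} → rank v ≡ rank w → v ≡ w
    rank-injective {v} {w} e = vertex-≡ (trans (Any.lookup-index (position v))
      (trans (cong (Data.List.lookup vectors) e) (sym (Any.lookup-index (position w)))))

    open Search u (+ 54600) p Clique clique? using (Run; stop; step; run?; start; module Recognition)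
    open Graph doroGraph using (_∼_; _∼?_)
    open Recognition _≟_ _∼_ _∼?_ 65 vertices using (Recognised; recognised?)

    Found : State → Set
    Found = Recognised (+ 13)

    found? : ∀ s → Dec (Found s)
    found? = recognised? (+ 13)

    abstract
      search : Run Found (start (+ 13650)) instructions
      search = toWitness {a? = run? found? (start (+ 13650)) instructions} _

-- Identification of the Doro graph

module DoroGraphs where
  open IntegerSums
  open DistanceSchemes
  open BoseMesnerAlgebra
  open ParameterBounds
  open Reduction
  open Enumerations
  open Searching
  open SearchSoundness
  open DoroSearch
  open import Data.Vec using ([]; _∷_)

  module Doro {n : ℕ} (Γ : Graph (Fin n)) (R : Realization Γ 5 4 2) where
    open Realization R renaming (metric to S)
    open Scheme S
    open Counting S
    open Metric S
    open BoseMesner S using (convolution)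
    open DoroData
    open Graph doroGraph using (_∼_; _∼?_)

    pos : 0ℤ < + 10
    pos = +<+ (s≤s z≤n)

    single : Fin 4 → ℤ
    single i = - (+ 6 * δ 0F i + + 6 * δ 1F i + + 4 * δ 3F i)

    double : Fin 4 → Fin 4 → ℤ
    double i j = + 6 * (δ 1F i * δ 1F j) + + 2 * (δ 3F i * δ 3F j)

    -- Quadratic in the indicators of the distances, so that its sum over all vertices involves only
    -- intersection numbers: 6·65 - 4·162 + 6·42.
    excess : Fin 4 → Fin 4 → Fin 4 → Fin 4 → ℤ
    excess i j k l = + 6 + (single i + single j + single k + single l) +
      (double i j + double i k + double i l + double j k + double j l + double k l)

    abstract
      u-idem : ∀ x y → sum (λ z → u (d x z) * u (d y z)) ≡ + 20 * u (d x y)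
      u-idem x y = go (d x y) refl
        where
        go : ∀ i → d x y ≡ i → sum (λ z → u (d x z) * u (d y z)) ≡ + 20 * u i
        go 0F e = intersection u u _ pos refl e
        go 1F e = intersection u u _ pos refl e
        go 2F e = intersection u u _ pos refl e
        go 3F e = intersection u u _ pos refl e

      order : n ≡ 65
      order = ℤ.+-injective (trans (sym (sum-1 n)) (intersection (λ _ → 1ℤ) (λ _ → 1ℤ) (+ 65) pos refl (d-refl (proj₁ far))))

      supply : ∀ h a b → 0 ℕ.< p h a b → ∀ {x y} → d x y ≡ h → sum (λ z → δ a (d x z) * δ b (d y z)) ≡ + p h a b
      supply h a b q e = intersection (δ a) (δ b) (+ p h a b) pos (table h a b q) e
        where
        table : ∀ h a b → 0 ℕ.< p h a b → + 10 * + p h a b ≡ convolution (δ a) (δ b) h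
        table = finite₃ (λ h a b → (0 ℕ.<? p h a b) →-dec (+ 10 * + p h a b ℤ.≟ convolution (δ a) (δ b) h))

      single-sum : ∀ x → sum (λ z → single (d x z)) ≡ - (+ 162)
      single-sum x = trans (sum-cong-≗ (λ z → sym (ℤ.*-identityʳ (single (d x z)))))
        (intersection single (λ _ → 1ℤ) (- (+ 162)) pos refl (d-refl x))

      double-sum : ∀ {x y} → d x y ≡ 1F → sum (λ z → double (d x z) (d y z)) ≡ + 42
      double-sum {x} {y} e = trans (sum-combination ((+ 6 , λ z → δ 1F (d x z) * δ 1F (d y z)) ∷ (+ 2 , λ z → δ 3F (d x z) * δ 3F (d y z)) ∷ [])
          (λ z → shape (+ 6 * (δ 1F (d x z) * δ 1F (d y z))) (+ 2 * (δ 3F (d x z) * δ 3F (d y z)))))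
        (cong₂ (λ a b → + 6 * a + (+ 2 * b + 0ℤ)) (intersection (δ 1F) (δ 1F) (+ 3) pos refl e) (intersection (δ 3F) (δ 3F) (+ 12) pos refl e))
        where
        shape : ∀ a b → a + b ≡ a + (b + 0ℤ)
        shape = solve-∀

    -- If n₃ members of a 4-clique are at distance 3 from z, and none is adjacent to z, the excess is (n₃ - 2)(n₃ - 3);
    -- otherwise it is nonnegative as well.  But it sums to -6.
    no-clique : ∀ {x y z t} → d x y ≡ 1F → d x z ≡ 1F → d x t ≡ 1F → d y z ≡ 1F → d y t ≡ 1F → d z t ≡ 1F → ⊥
    no-clique {x} {y} {z} {t} xy xz xt yz yt zt = negative (subst (0ℤ ≤_) total
        (sum-nonneg (λ v → excess (d x v) (d y v) (d z v) (d t v)) (λ v → nonneg (d x v) (d y v) (d z v) (d t v)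
          (triangle-at xy v) (triangle-at xz v) (triangle-at xt v) (triangle-at yz v) (triangle-at yt v) (triangle-at zt v))))
      where
      negative : ¬ 0ℤ ≤ -[1+ 5 ]
      negative ()
      nonneg : ∀ i j k l → Triangle 1F i j → Triangle 1F i k → Triangle 1F i l → Triangle 1F j k → Triangle 1F j l → Triangle 1F k l →
        0ℤ ≤ excess i j k l
      nonneg = finite₄ (λ i j k l → Triangle? 1F i j →-dec Triangle? 1F i k →-dec Triangle? 1F i l →-dec Triangle? 1F j k →-dec
        Triangle? 1F j l →-dec Triangle? 1F k l →-dec (0ℤ ℤ.≤? excess i j k l))
      total : sum (λ v → excess (d x v) (d y v) (d z v) (d t v)) ≡ -[1+ 5 ]
      total = trans (sum-combination
          ((+ 6 , λ _ → 1ℤ) ∷ (1ℤ , λ v → single (d x v)) ∷ (1ℤ , λ v → single (d y v)) ∷ (1ℤ , λ v → single (d z v)) ∷ (1ℤ , λ v → single (d t v)) ∷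
           (1ℤ , λ v → double (d x v) (d y v)) ∷ (1ℤ , λ v → double (d x v) (d z v)) ∷ (1ℤ , λ v → double (d x v) (d t v)) ∷
           (1ℤ , λ v → double (d y v) (d z v)) ∷ (1ℤ , λ v → double (d y v) (d t v)) ∷ (1ℤ , λ v → double (d z v) (d t v)) ∷ [])
          (λ v → shape (single (d x v)) (single (d y v)) (single (d z v)) (single (d t v)) (double (d x v) (d y v)) (double (d x v) (d z v))
            (double (d x v) (d t v)) (double (d y v) (d z v)) (double (d y v) (d t v)) (double (d z v) (d t v))))
        (final (trans (sum-1 n) (cong +_ order)) (single-sum x) (single-sum y) (single-sum z) (single-sum t)
          (double-sum xy) (double-sum xz) (double-sum xt) (double-sum yz) (double-sum yt) (double-sum zt))
        where
        shape : ∀ a b c e f g h i j k → + 6 + (a + b + c + e) + (f + g + h + i + j + k) ≡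
          + 6 * 1ℤ + (1ℤ * a + (1ℤ * b + (1ℤ * c + (1ℤ * e + (1ℤ * f + (1ℤ * g + (1ℤ * h + (1ℤ * i + (1ℤ * j + (1ℤ * k + 0ℤ))))))))))
        shape = solve-∀
        final : ∀ {o a b c e f g h i j k} → o ≡ + 65 → a ≡ - (+ 162) → b ≡ - (+ 162) → c ≡ - (+ 162) → e ≡ - (+ 162) →
          f ≡ + 42 → g ≡ + 42 → h ≡ + 42 → i ≡ + 42 → j ≡ + 42 → k ≡ + 42 →
          + 6 * o + (1ℤ * a + (1ℤ * b + (1ℤ * c + (1ℤ * e + (1ℤ * f + (1ℤ * g + (1ℤ * h + (1ℤ * i + (1ℤ * j + (1ℤ * k + 0ℤ)))))))))) ≡ -[1+ 5 ]
        final refl refl refl refl refl refl refl refl refl refl refl = refl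

    open Soundness S u (+ 20) (+<+ (s≤s z≤n)) u-idem (+ 54600) (+<+ (s≤s z≤n)) p supply Clique clique?
      (Profiles.clique-free S no-clique)

    result : Γ ≅ doroGraph
    result =
      let _ , _ , valid , recognised = run (started {+ 13650} refl) search
          f , f-injective , adjacency = recognise _≟_ _∼_ _∼?_ 65 vertices order peak unit {ρ = + 13} refl valid recognised
      in isomorphism order rank rank-injective f f-injective
        (λ x y → mk⇔ (Equivalence.to (adjacency x y) ∘ ∼⇒1) (1⇒∼ ∘ Equivalence.from (adjacency x y)))
      where
      open import Function.Bundles using (module Equivalence)
      peak : ∀ i → u i ≡ u 0F → i ≡ 0F
      peak 0F _ = refl
      peak 1F ()
      peak 2F ()
      peak 3F ()
      unit : ∀ i → u i ≡ u 1F → i ≡ 1F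
      unit 0F ()
      unit 1F _ = refl
      unit 2F ()
      unit 3F ()

theorem12 : ∀ (n : ℕ) (Γ : Graph (Fin n)) (Γ-shilla : Shilla Γ) →
    Shilla.bΓ Γ-shilla ≡ + 2 →
    Γ ≅ oddGraph 4 ⊎
    IsGeneralizedHexagon Γ 2 2 ⊎
    Γ ≅ hammingGraph 3 3 ⊎
    Γ ≅ doroGraph ⊎
    Γ ≅ johnsonGraph 9 3
theorem12 n Γ Γ-shilla bΓ≡2 = identify (cases Γ Γ-shilla bΓ≡2)
  where
  open Arrays
  open Reduction
  identify : (∃[ a ] ∃[ c ] ∃[ t ] Case a c t × Realization Γ a (c ℕ.* t) c) →
    Γ ≅ oddGraph 4 ⊎ IsGeneralizedHexagon Γ 2 2 ⊎ Γ ≅ hammingGraph 3 3 ⊎ Γ ≅ doroGraph ⊎ Γ ≅ johnsonGraph 9 3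
  identify (_ , _ , _ , odd , R)      = inj₁ (OddGraphO₄.OddGraph.result Γ R)
  identify (_ , _ , _ , hexagon , R)  = inj₂ (inj₁ (Hexagons.Hexagon.result Γ R))
  identify (_ , _ , _ , hamming , R)  = inj₂ (inj₂ (inj₁ (HammingGraphH33.Hamming.result Γ R)))
  identify (_ , _ , _ , doro , R)     = inj₂ (inj₂ (inj₂ (inj₁ (DoroGraphs.Doro.result Γ R))))
  identify (_ , _ , _ , johnson , R)  = inj₂ (inj₂ (inj₂ (inj₂ (JohnsonGraphJ93.Johnson.result Γ R))))
  identify (_ , _ , _ , no-graph , R) = ⊥-elim (Enumerations.NoGraph.absurd (Realization.metric R))
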